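{- For every integer $k \geq 1$, the problem Max Partial $k$-Coloring on instances $(G,\mathsf{rev})$, where $G$ is a (bull, chair)-free graph with $n$ vertices and clique number $\omega$, can be solved in time $n^{\mathcal{O}(k\omega)}$.
   Context: All graphs are finite, simple and undirected. Write $[k]=\{1,\ldots,k\}$. For graphs $F_1,\ldots,F_m$, a graph $G$ is $(F_1,\ldots,F_m)$-free if no $F_i$ is isomorphic to an induced subgraph of $G$. The bull is the 5-vertex graph consisting of a triangle together with two pendant vertices attached to two distinct vertices of the triangle. The chair is the 5-vertex graph obtained from the star $K_{1,3}$ by subdividing one edge exactly once. Problem Max Partial $k$-Coloring. Input: a graph $G$ and a revenue function $\mathsf{rev}: V(G)\times [k]\to \mathbb{Q}_{\geq 0}$. Task: find a set $X\subseteq V(G)$ and a proper $k$-coloring $c: X\to [k]$ of the induced subgraph $G[X]$ (adjacent vertices get distinct colors) such that $\sum_{v\in X}\mathsf{rev}(v,c(v))$ is maximum possible. Arithmetic operations on values of the revenue function are assumed to take constant time. -}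

module Defs where

open import Data.Bool.Base using (Bool; true; false; if_then_else_; not; _∧_; _∨_)
open import Data.Bool.Properties using (∨-comm)
open import Data.Fin using (Fin; zero; suc; toℕ; #_)
open import Data.Fin.Properties using () renaming (_≟_ to _≟ᶠ_)
open import Data.Fin.Subset using (Subset; _∈_; _∉_; ∣_∣)
open import Data.Fin.Subset.Properties using (_∈?_)
open import Data.Bool.ListAction using (any)
open import Data.List.Base using (List; []; _∷_)
open import Data.Nat.Base as ℕ using (ℕ; zero; suc)
open import Data.Nat.Properties as ℕ using ()
open import Data.Product.Base using (Σ; ∃; ∃-syntax; _×_; _,_; proj₁)
open import Data.Rational.Base as ℚ using (ℚ; 0ℚ)
open import Data.Rational.Properties as ℚ using ()
open import Function.Base using (_∘_)
open import Function.Bundles using (_↔_; Inverse)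
open import Relation.Binary.PropositionalEquality using (_≡_; _≢_; refl)
open import Relation.Nullary using (yes; no; does)
open import Algebra.Properties.Monoid.Sum ℚ.+-0-monoid using (sum)

------------------------------------------------------------------------
-- Graphs

-- Finiteness is imposed by taking V = Fin n.
record Graph (V : Set) : Set where
  field
    adj        : V → V → Bool
    adj-sym    : ∀ u v → adj u v ≡ adj v u
    adj-irrefl : ∀ v → adj v v ≡ false

open Graph public

infix 10 _[_]

_[_] : ∀ {n} → Graph (Fin n) → (X : Subset n) → Graph (∃ (_∈ X))
G [ X ] = record
  { adj        = λ u v → adj G (proj₁ u) (proj₁ v)
  ; adj-sym    = λ u v → adj-sym G (proj₁ u) (proj₁ v)
  ; adj-irrefl = λ v → adj-irrefl G (proj₁ v)
  }

infix 4 _≅_ _≅InducedSubgraphOf_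

_≅_ : ∀ {V W} → Graph V → Graph W → Set
_≅_ {V} {W} F H =
  Σ (V ↔ W) λ f → ∀ u v → adj F u v ≡ adj H (Inverse.to f u) (Inverse.to f v)

_≅InducedSubgraphOf_ : ∀ {m n} → Graph (Fin m) → Graph (Fin n) → Set
F ≅InducedSubgraphOf G = ∃[ X ] F ≅ G [ X ]

IsClique : ∀ {n} → Graph (Fin n) → Subset n → Set
IsClique G K = ∀ u v → u ∈ K → v ∈ K → u ≢ v → adj G u v ≡ true

IsCliqueNumber : ∀ {n} → Graph (Fin n) → ℕ → Set
IsCliqueNumber G ω =
  (∃[ K ] IsClique G K × ∣ K ∣ ≡ ω) × (∀ K → IsClique G K → ∣ K ∣ ℕ.≤ ω)

joins : ∀ {n} → List (Fin n × Fin n) → Fin n → Fin n → Bool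
joins es u v = any (λ (x , y) → does (u ≟ᶠ x) ∧ does (v ≟ᶠ y)) es

fromEdges : ∀ {n} (es : List (Fin n × Fin n)) →
            (∀ v → joins es v v ∨ joins es v v ≡ false) → Graph (Fin n)
fromEdges es loopless = record
  { adj        = λ u v → joins es u v ∨ joins es v u
  ; adj-sym    = λ u v → ∨-comm (joins es u v) (joins es v u)
  ; adj-irrefl = loopless
  }

-- Triangle 0 1 2, with 3 pendant at 0 and 4 pendant at 1.
bull : Graph (Fin 5)
bull = fromEdges
  ((# 0 , # 1) ∷ (# 0 , # 2) ∷ (# 1 , # 2) ∷ (# 0 , # 3) ∷ (# 1 , # 4) ∷ [])
  λ { zero → refl ; (suc zero) → refl ; (suc (suc zero)) → refl
    ; (suc (suc (suc zero))) → refl ; (suc (suc (suc (suc zero)))) → refl }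

-- Star with centre 0 and leaves 1, 2, 4, the edge from 0 to 4 subdivided by 3.
chair : Graph (Fin 5)
chair = fromEdges
  ((# 0 , # 1) ∷ (# 0 , # 2) ∷ (# 0 , # 3) ∷ (# 3 , # 4) ∷ [])
  λ { zero → refl ; (suc zero) → refl ; (suc (suc zero)) → refl
    ; (suc (suc (suc zero))) → refl ; (suc (suc (suc (suc zero)))) → refl }

------------------------------------------------------------------------
-- Max Partial k-Coloring; the colours 1, …, k are the elements of Fin k.

Revenue : ℕ → ℕ → Set
Revenue n k = Fin n → Fin k → ℚ

record PartialColoring {n} (k : ℕ) (G : Graph (Fin n)) : Set where
  field
    X      : Subset n
    color  : ∃ (_∈ X) → Fin k
    proper : ∀ u v → adj (G [ X ]) u v ≡ true → color u ≢ color v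

open PartialColoring public

revenueAt : ∀ {n k} {G : Graph (Fin n)} →
            Revenue n k → PartialColoring k G → Fin n → ℚ
revenueAt rev c v with v ∈? X c
... | yes v∈X = rev v (color c (v , v∈X))
... | no  _   = 0ℚ

revenue : ∀ {n k} {G : Graph (Fin n)} → Revenue n k → PartialColoring k G → ℚ
revenue rev c = sum (revenueAt rev c)

IsOptimal : ∀ {n k} {G : Graph (Fin n)} → Revenue n k → PartialColoring k G → Set
IsOptimal {k = k} {G} rev c =
  ∀ (c′ : PartialColoring k G) → revenue rev c′ ℚ.≤ revenue rev c

------------------------------------------------------------------------
-- Machine model: a structured random access machine with two sorts of
-- memory, naturals and rationals, both organised as arrays, named by
-- numerals, of unbounded length.
--
-- Naturals (control, addresses) have addition, truncated subtraction and
-- comparison at unit cost.  Unit-cost multiplication is left out on purpose: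
-- without it, t steps only produce numbers of O(t + log n) bits and this part
-- of the machine is polynomially equivalent to a Turing machine; with it, that
-- is not known.
--
-- Rationals (revenues and values computed from them) have the four arithmetic
-- operations and comparison at unit cost.  They influence control only through
-- comparison; there is no rounding or conversion to naturals.
--
-- The instance is read-only.  A program has access to n = |V(G)|, the adjacency
-- matrix of G and the revenue matrix, but not to the clique number.

infixl 6 _⊕_ _⊖_ _⊕ᵠ_ _⊖ᵠ_
infixl 7 _⊗ᵠ_ _⊘ᵠ_
infix  4 _≤ᵗ_ _≤ᵠ_
infixr 3 _andᵗ_
infix  2 ifᵗ_then_else_ while_loop_
infix  2 _⟦_⟧≔_ _⟦_⟧≔ᵠ_
infixr 1 _⨾_

data ℕExp : Set where
  lit     : ℕ → ℕExp
  order   : ℕExp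
  _⟦_⟧    : ℕ → ℕExp → ℕExp
  _⊕_ _⊖_ : ℕExp → ℕExp → ℕExp

data ℚExp : Set where
  litᵠ                : ℚ → ℚExp
  revᵠ                : ℕExp → ℕExp → ℚExp
  _⟦_⟧ᵠ               : ℕ → ℕExp → ℚExp
  _⊕ᵠ_ _⊖ᵠ_ _⊗ᵠ_ _⊘ᵠ_ : ℚExp → ℚExp → ℚExp

data Test : Set where
  adjᵗ   : ℕExp → ℕExp → Test
  _≤ᵗ_   : ℕExp → ℕExp → Test
  _≤ᵠ_   : ℚExp → ℚExp → Test
  notᵗ   : Test → Test
  _andᵗ_ : Test → Test → Test

data Program : Set where
  skip            : Program
  _⟦_⟧≔_          : ℕ → ℕExp → ℕExp → Program
  _⟦_⟧≔ᵠ_         : ℕ → ℕExp → ℚExp → Program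
  _⨾_             : Program → Program → Program
  ifᵗ_then_else_  : Test → Program → Program → Program
  while_loop_     : Test → Program → Program

costℕ : ℕExp → ℕ
costℕ (lit _)   = 1
costℕ order     = 1
costℕ (_ ⟦ e ⟧) = suc (costℕ e)
costℕ (e ⊕ f)   = suc (costℕ e ℕ.+ costℕ f)
costℕ (e ⊖ f)   = suc (costℕ e ℕ.+ costℕ f)

costℚ : ℚExp → ℕ
costℚ (litᵠ _)   = 1
costℚ (revᵠ e f) = suc (costℕ e ℕ.+ costℕ f)
costℚ (_ ⟦ e ⟧ᵠ) = suc (costℕ e)
costℚ (p ⊕ᵠ q)   = suc (costℚ p ℕ.+ costℚ q)
costℚ (p ⊖ᵠ q)   = suc (costℚ p ℕ.+ costℚ q)
costℚ (p ⊗ᵠ q)   = suc (costℚ p ℕ.+ costℚ q)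
costℚ (p ⊘ᵠ q)   = suc (costℚ p ℕ.+ costℚ q)

costᵗ : Test → ℕ
costᵗ (adjᵗ e f) = suc (costℕ e ℕ.+ costℕ f)
costᵗ (e ≤ᵗ f)   = suc (costℕ e ℕ.+ costℕ f)
costᵗ (p ≤ᵠ q)   = suc (costℚ p ℕ.+ costℚ q)
costᵗ (notᵗ b)   = suc (costᵗ b)
costᵗ (b andᵗ d) = suc (costᵗ b ℕ.+ costᵗ d)

record Memory : Set where
  constructor memory
  field
    nat : ℕ → ℕ → ℕ
    rat : ℕ → ℕ → ℚ

open Memory public

blank : Memory
blank = memory (λ _ _ → 0) (λ _ _ → 0ℚ)

update : {A : Set} → (ℕ → ℕ → A) → ℕ → ℕ → A → ℕ → ℕ → A
update m a i x b j = if does (a ℕ.≟ b) ∧ does (i ℕ.≟ j) then x else m b j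

-- Out-of-range reads return the default value.
readAt : {A : Set} → A → ∀ {n} → (Fin n → A) → ℕ → A
readAt d {zero}  f i       = d
readAt d {suc n} f zero    = f zero
readAt d {suc n} f (suc i) = readAt d (f ∘ suc) i

-- Division by zero yields zero.
_÷₀_ : ℚ → ℚ → ℚ
p ÷₀ q with q ℚ.≟ 0ℚ
... | yes _  = 0ℚ
... | no q≢0 = ℚ._÷_ p q {{ℚ.≢-nonZero q≢0}}

module Execution {n k : ℕ} (G : Graph (Fin n)) (rev : Revenue n k) where

  evalℕ : ℕExp → Memory → ℕ
  evalℕ (lit x)   σ = x
  evalℕ order     σ = n
  evalℕ (a ⟦ e ⟧) σ = nat σ a (evalℕ e σ)
  evalℕ (e ⊕ f)   σ = evalℕ e σ ℕ.+ evalℕ f σ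
  evalℕ (e ⊖ f)   σ = evalℕ e σ ℕ.∸ evalℕ f σ

  evalℚ : ℚExp → Memory → ℚ
  evalℚ (litᵠ x)   σ = x
  evalℚ (revᵠ e f) σ =
    readAt 0ℚ (λ v → readAt 0ℚ (rev v) (evalℕ f σ)) (evalℕ e σ)
  evalℚ (a ⟦ e ⟧ᵠ) σ = rat σ a (evalℕ e σ)
  evalℚ (p ⊕ᵠ q)   σ = evalℚ p σ ℚ.+ evalℚ q σ
  evalℚ (p ⊖ᵠ q)   σ = evalℚ p σ ℚ.- evalℚ q σ
  evalℚ (p ⊗ᵠ q)   σ = evalℚ p σ ℚ.* evalℚ q σ
  evalℚ (p ⊘ᵠ q)   σ = evalℚ p σ ÷₀ evalℚ q σ

  evalᵗ : Test → Memory → Bool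
  evalᵗ (adjᵗ e f) σ =
    readAt false (λ u → readAt false (adj G u) (evalℕ f σ)) (evalℕ e σ)
  evalᵗ (e ≤ᵗ f)   σ = does (evalℕ e σ ℕ.≤? evalℕ f σ)
  evalᵗ (p ≤ᵠ q)   σ = does (evalℚ p σ ℚ.≤? evalℚ q σ)
  evalᵗ (notᵗ b)   σ = not (evalᵗ b σ)
  evalᵗ (b andᵗ d) σ = evalᵗ b σ ∧ evalᵗ d σ

  infix 0 ⟨_,_⟩⇓⟨_,_⟩

  -- ⟨ P , σ ⟩⇓⟨ τ , t ⟩ : started in memory σ, the program P halts with
  -- memory τ after exactly t steps.
  data ⟨_,_⟩⇓⟨_,_⟩ : Program → Memory → Memory → ℕ → Set where

    ⇓skip : ∀ {σ} → ⟨ skip , σ ⟩⇓⟨ σ , 1 ⟩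

    ⇓assign : ∀ {σ a e f} →
      ⟨ a ⟦ e ⟧≔ f , σ ⟩⇓⟨ memory (update (nat σ) a (evalℕ e σ) (evalℕ f σ)) (rat σ)
                         , suc (costℕ e ℕ.+ costℕ f) ⟩

    ⇓assignᵠ : ∀ {σ a e q} →
      ⟨ a ⟦ e ⟧≔ᵠ q , σ ⟩⇓⟨ memory (nat σ) (update (rat σ) a (evalℕ e σ) (evalℚ q σ))
                          , suc (costℕ e ℕ.+ costℚ q) ⟩

    ⇓seq : ∀ {P Q ρ σ τ s t} →
      ⟨ P , ρ ⟩⇓⟨ σ , s ⟩ → ⟨ Q , σ ⟩⇓⟨ τ , t ⟩ →
      ⟨ P ⨾ Q , ρ ⟩⇓⟨ τ , s ℕ.+ t ⟩

    ⇓then : ∀ {b P Q σ τ t} → evalᵗ b σ ≡ true → ⟨ P , σ ⟩⇓⟨ τ , t ⟩ →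
      ⟨ ifᵗ b then P else Q , σ ⟩⇓⟨ τ , suc (costᵗ b ℕ.+ t) ⟩

    ⇓else : ∀ {b P Q σ τ t} → evalᵗ b σ ≡ false → ⟨ Q , σ ⟩⇓⟨ τ , t ⟩ →
      ⟨ ifᵗ b then P else Q , σ ⟩⇓⟨ τ , suc (costᵗ b ℕ.+ t) ⟩

    ⇓stop : ∀ {b P σ} → evalᵗ b σ ≡ false →
      ⟨ while b loop P , σ ⟩⇓⟨ σ , suc (costᵗ b) ⟩

    ⇓loop : ∀ {b P ρ σ τ s t} → evalᵗ b ρ ≡ true →
      ⟨ P , ρ ⟩⇓⟨ σ , s ⟩ → ⟨ while b loop P , σ ⟩⇓⟨ τ , t ⟩ →
      ⟨ while b loop P , ρ ⟩⇓⟨ τ , suc (costᵗ b ℕ.+ s) ℕ.+ t ⟩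

-- The output is natural array 0: cell v holds 0 if v ∉ X, and otherwise the
-- colour of v as a number in {1, …, k}.
Outputs : ∀ {n k} {G : Graph (Fin n)} → Memory → PartialColoring k G → Set
Outputs τ c =
  (∀ v (v∈X : v ∈ X c) → nat τ 0 (toℕ v) ≡ suc (toℕ (color c (v , v∈X)))) ×
  (∀ v → v ∉ X c → nat τ 0 (toℕ v) ≡ 0)

SolvesWithin : ∀ {n k} → Program → Graph (Fin n) → Revenue n k → ℕ → Set
SolvesWithin {n} {k} P G rev bound =
  ∃[ τ ] ∃[ t ] ⟨ P , blank ⟩⇓⟨ τ , t ⟩ × t ℕ.≤ bound ×
  Σ (PartialColoring k G) λ c → Outputs τ c × IsOptimal rev c
  where open Execution G rev

-- The bound n^(a·k·ω).  The truncations matter only for n ≤ 1, where the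
-- literal power n^(…) would leave no time at all to write an output.
timeBound : (a k n ω : ℕ) → ℕ
timeBound a k n ω = (2 ℕ.⊔ n) ℕ.^ (a ℕ.* (k ℕ.* (1 ℕ.⊔ ω)))

-- Every vertex v carries a table wt giving, for each set D of colours, the best revenue obtainable from
-- the part of the graph that v stands for when only colours in D may be used.  A minimal module M with at
-- least two vertices induces a prime graph, or a graph on two vertices; once its own table has been
-- computed, M can be replaced by a single vertex, and at most n such contractions leave one vertex.
--
-- A prime graph of maximum degree at most two is a path or a cycle and is solved by dynamic programming.
-- In a prime (bull, chair)-free graph with a vertex of degree at least three, every maximal independent set
-- I contains three vertices without a common non-neighbour outside I, so that I is the set of common
-- non-neighbours of three vertices.  Guessing k triples, in n^(3k) ways, therefore fixes maximal independent
-- sets containing the colour classes, and each vertex then contributes independently of the others.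
--
-- The optimum value yields an optimal colouring by self-reduction: the options (v, i) are forbidden one by
-- one, and each prohibition that lowers the optimum is withdrawn.
module Submission where

open import Defs
open import Data.Bool.Base using (Bool; true; false; if_then_else_; not; _∧_; _∨_) renaming (T to IsTrue)
import Data.Bool.Properties as 𝔹ₚ
open import Data.Empty using (⊥; ⊥-elim)
open import Data.Fin.Base using (Fin; zero; suc; toℕ; fromℕ<; combine; _↑ˡ_; remQuot)
import Data.Fin.Properties as Fₚ
open import Data.Fin.Properties using (toℕ<n; toℕ-injective; toℕ-fromℕ<; any?) renaming (_≟_ to _≟ᶠ_)
import Data.Fin.Subset as Sub
open import Data.Fin.Subset using (Subset; _∈_; _∉_; _⊆_; _∩_; _─_; ⁅_⁆)
open import Data.Fin.Subset.Properties
  using (_∈?_; p∩q⊆p; p∩q⊆q; x∈p∩q⁺; p─q⊆p; x∈p∧x∉q⇒x∈p─q; ∉⊥; ⊥⊆; ⊆-antisym; ⊆⊤; x∈⁅x⁆; x∈⁅y⁆⇒x≡y)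
open import Data.List.Base using (List; []; _∷_; map; _++_; allFin; length)
open import Data.List.Membership.Propositional using () renaming (_∈_ to _∈ᴸ_)
open import Data.List.Membership.Propositional.Properties using (∈-map⁺; ∈-++⁺ˡ; ∈-++⁺ʳ; ∈-allFin)
open import Data.List.Properties using (∷-injective; length-++; length-map; length-tabulate)
open import Data.List.Relation.Unary.Any using (here; there)
open import Data.Maybe.Base using (Maybe; just; nothing)
open import Data.Maybe.Properties using (just-injective)
open import Data.Nat.Base
  using (ℕ; zero; suc; _+_; _*_; _≤_; _<_; z≤n; s≤s; _≡ᵇ_; _^_; _⊔_; _≤ᵇ_; NonZero; >-nonZero)
import Data.Nat.Properties as ℕₚ
open import Data.Nat.Solver using (module +-*-Solver)
open import Data.Product.Base using (Σ; ∃; ∃-syntax; _×_; _,_; proj₁; proj₂)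
open import Data.Rational.Base using (ℚ; 0ℚ) renaming (_≤_ to _≤ℚ_; _+_ to _+ℚ_)
import Data.Rational.Properties as ℚₚ
open import Data.Sum.Base using (_⊎_; inj₁; inj₂)
open import Data.Unit.Base using (⊤; tt)
open import Data.Vec.Base using (Vec; []; _∷_; lookup; tabulate; toList) renaming (_++_ to _++ᵛ_)
import Data.Vec.Properties as Vecₚ
open import Data.Vec.Properties using (lookup∘tabulate; []=⇒lookup; lookup⇒[]=; lookup-++ˡ)
open import Data.Vec.Properties.WithK using ([]=-irrelevant)
open import Function.Base using (_∘_; id; case_of_)
open import Function.Bundles using (mk↔ₛ′)
open import Relation.Binary.PropositionalEquality
  using (_≡_; _≢_; refl; sym; trans; cong; subst; cong₂; subst₂; module ≡-Reasoning)
open import Relation.Nullary using (¬_; Dec; yes; no; does)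
open import Relation.Nullary.Decidable
  using (dec-true; dec-false; _×-dec_; map′; proof; ¬?; decidable-stable; _→-dec_)
open import Relation.Nullary.Reflects using (Reflects; ofʸ; ofⁿ)
open import Algebra.Properties.CommutativeMonoid.Sum ℚₚ.+-0-commutativeMonoid
  using (sum; sum-cong-≗; ∑-distrib-+)
open import Algebra.Properties.CommutativeSemigroup ℕₚ.+-commutativeSemigroup using (x∙yz≈y∙xz)

-- The structural claim is proved by contradiction, and its cases keep ending in the same way: a set
-- is exhibited that no outside vertex distinguishes, with two members and a vertex missing, against
-- primality. The cases follow the traces on I, the trace of a vertex being the set of its
-- neighbours in I. If some trace has three elements, an inclusion-maximal one is contradictory; if
-- all traces have at most two, goodness spreads along edges and the maximum degree is two. If I has
-- at most three elements, they dominate by maximality. Sets are predicates and existence is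
-- double-negated, because only contradictions are needed until the triple is found by a decidable
-- finite search.
--
-- A vertex standing for a module may carry several colours at once, so the optimisation is over
-- assignments of colour sets, disjoint on adjacent vertices. Vertex loops all run exactly n times
-- and loops over colour sets are unrolled; hence the running time is read off the syntax as a power
-- of n with exponent linear in k.

-- Maximal independent sets in prime (bull, chair)-free graphs

record BullChairFree {V : Set} (adj : V → V → Bool) : Set where
  field
    ~-sym    : ∀ u v → adj u v ≡ adj v u
    ~-irrefl : ∀ v → adj v v ≡ false
    bull-free : ∀ {a b c d e} →
      adj a b ≡ true → adj a c ≡ true → adj b c ≡ true → adj a d ≡ true → adj b e ≡ true →
      adj a e ≡ false → adj b d ≡ false → adj c d ≡ false → adj c e ≡ false → adj d e ≡ false → ⊥
    -- Centre `c`, leaves `x` and `y`, subdivided edge `c`-`p`-`q`. Only `x ≢ y` is demanded: any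
    -- other two vertices are adjacent or differ in their adjacency to a third one.
    chair-free : ∀ {c x y p q} →
      adj c x ≡ true → adj c y ≡ true → adj c p ≡ true → adj p q ≡ true →
      adj x y ≡ false → adj x p ≡ false → adj y p ≡ false →
      adj q c ≡ false → adj q x ≡ false → adj q y ≡ false → x ≢ y → ⊥

-- Primality in double-negated form, which spares deciding membership in S.
IsPrime : {V : Set} → (V → V → Bool) → Set₁
IsPrime {V} adj = (S : V → Set) →
  (∀ {x s s′} → ¬ S x → S s → S s′ → adj x s ≡ true → adj x s′ ≡ false → ⊥) →
  ∀ {a b} → S a → S b → a ≢ b → ∀ x → ¬ S x → ⊥

MaxDegree≤2 : {V : Set} → (V → V → Bool) → Set
MaxDegree≤2 {V} adj = ∀ {v p q r : V} → adj v p ≡ true → adj v q ≡ true → adj v r ≡ true →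
  p ≢ q → p ≢ r → q ≢ r → ⊥

module MaximalIndependent
  {V : Set} (adj : V → V → Bool) (free : BullChairFree adj) (prime : IsPrime adj)
  (I : V → Set) (I? : ∀ v → Dec (I v))
  (independent : ∀ {a b} → I a → I b → adj a b ≡ false)
  (maximal : ∀ {y} → ¬ I y → ∃[ i ] I i × adj y i ≡ true) where

  open BullChairFree free

  infix 4 _~_ _≁_ _◁_

  -- `x ◁ a` says that `a` lies in the trace of `x`, the set of its neighbours in `I`. The argument
  -- compares traces throughout.
  _~_ _≁_ _◁_ : V → V → Set
  u ~ v = adj u v ≡ true
  u ≁ v = adj u v ≡ false
  x ◁ a = I a × x ~ a

  sy : ∀ {u v} → u ~ v → v ~ u
  sy {u} {v} p = trans (~-sym v u) p

  sn : ∀ {u v} → u ≁ v → v ≁ u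
  sn {u} {v} p = trans (~-sym v u) p

  clash : ∀ {u v} → u ~ v → u ≁ v → ⊥
  clash p q with trans (sym p) q
  ... | ()

  dec : ∀ u v → u ~ v ⊎ u ≁ v
  dec u v with adj u v
  ... | true  = inj₁ refl
  ... | false = inj₂ refl

  non : ∀ {u v} → (u ~ v → ⊥) → u ≁ v
  non {u} {v} f with dec u v
  ... | inj₁ p = ⊥-elim (f p)
  ... | inj₂ q = q

  yea : ∀ {u v} → (u ≁ v → ⊥) → u ~ v
  yea {u} {v} f with dec u v
  ... | inj₁ p = p
  ... | inj₂ q = ⊥-elim (f q)

  apart : ∀ {w a b} → w ~ a → w ≁ b → a ≢ b
  apart p q refl = clash p q

  ≢-sym′ : ∀ {a b : V} → a ≢ b → b ≢ a
  ≢-sym′ f e = f (sym e)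

  outside : ∀ {y i} → y ◁ i → ¬ I y
  outside (Ii , y~i) Iy = clash y~i (independent Iy Ii)

  -- Bull with triangle `x`, `y`, `a` and pendants `b` and `d`. So adjacent vertices whose traces
  -- meet have nested traces.
  crossing : ∀ {x y a b d} → x ~ y → x ◁ a → y ~ a → x ◁ b → y ≁ b → y ◁ d → x ≁ d → ⊥
  crossing x~y (Ia , x~a) y~a (Ib , x~b) y≁b (Id , y~d) x≁d =
    bull-free x~y x~a y~a x~b y~d x≁d y≁b (independent Ia Ib) (independent Ia Id) (independent Ib Id)

  -- Chair with centre `x`, leaves `b` and `c`, and the path `x`-`y`-`d`.
  private-pair : ∀ {x y b c d} → x ~ y → x ◁ b → y ≁ b → x ◁ c → y ≁ c → b ≢ c → y ◁ d → x ≁ d → ⊥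
  private-pair x~y (Ib , x~b) y≁b (Ic , x~c) y≁c b≢c (Id , y~d) x≁d =
    chair-free x~b x~c x~y y~d (independent Ib Ic) (sn y≁b) (sn y≁c) (sn x≁d)
      (independent Id Ib) (independent Id Ic) b≢c

  -- Chair with centre `x`, leaves `b` and `c`, and the path `x`-`a`-`y`. So of two non-adjacent
  -- vertices with meeting traces, each misses at most one element of the other's trace.
  private-pair′ : ∀ {x y a b c} → x ≁ y → x ◁ a → y ~ a → x ◁ b → y ≁ b → x ◁ c → y ≁ c → b ≢ c → ⊥
  private-pair′ x≁y (Ia , x~a) y~a (Ib , x~b) y≁b (Ic , x~c) y≁c b≢c =
    chair-free x~b x~c x~a (sy y~a) (independent Ib Ic) (independent Ib Ia) (independent Ic Ia)
      (sn x≁y) y≁b y≁c b≢c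

  -- An element `e` missed by `y` yields a bull as soon as `y` sees `b` or `c`, and a chair
  -- otherwise.
  nested : ∀ {x y b c d e} → x ~ y → x ◁ b → x ◁ c → b ≢ c → y ◁ d → x ≁ d → x ◁ e → y ~ e
  nested {x} {y} {b} {c} {d} {e} x~y xb xc b≢c yd x≁d xe = yea λ y≁e → case-b y≁e (dec y b)
    where
    case-b : y ≁ e → y ~ b ⊎ y ≁ b → ⊥
    case-b y≁e (inj₁ y~b) = crossing x~y xb y~b xe y≁e yd x≁d
    case-b y≁e (inj₂ y≁b) with dec y c
    ... | inj₁ y~c = crossing x~y xc y~c xe y≁e yd x≁d
    ... | inj₂ y≁c = private-pair x~y xb y≁b xc y≁c b≢c yd x≁d

  two-of-three : ∀ {e₁ e₂ e₃} (P : V → Set) → P e₁ → P e₂ → P e₃ → e₁ ≢ e₂ → e₁ ≢ e₃ → e₂ ≢ e₃ →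
    ∀ b → (∀ {x y} → P x → P y → x ≢ y → x ≢ b → y ≢ b → ⊥) → ⊥
  two-of-three {e₁} {e₂} {e₃} P p₁ p₂ p₃ n₁₂ n₁₃ n₂₃ b k = k p₁ p₂ n₁₂ is₁ is₂
    where
    is₁ : e₁ ≢ b
    is₁ refl = k p₂ p₃ n₂₃ (≢-sym′ n₁₂) (≢-sym′ n₁₃)
    is₂ : e₂ ≢ b
    is₂ refl = k p₁ p₃ n₁₃ n₁₂ (≢-sym′ n₂₃)

  record Three (w : V) : Set where
    constructor three
    field
      {e₁ e₂ e₃} : V
      w₁ : w ◁ e₁
      w₂ : w ◁ e₂
      w₃ : w ◁ e₃
      n₁₂ : e₁ ≢ e₂
      n₁₃ : e₁ ≢ e₃
      n₂₃ : e₂ ≢ e₃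

  -- The trace of `v` is `b` alone, or else two of its elements and the path through `x` to `s` form
  -- a chair around `v`. Two further trace elements of `w` give a chair around `w` with the path
  -- through `b` to `v` if `w ≁ v`; otherwise one of them and `x` are the pendants of a bull with
  -- triangle `w`, `v`, `b`.
  separate : ∀ {w v x b s} → Three w → v ~ x → v ◁ b → w ~ b → x ◁ s →
    (∀ {i} → v ◁ i → x ≁ i) → (∀ {i} → w ◁ i → x ≁ i) → ⊥
  separate {w} {v} {x} {b} {s} (three w₁ w₂ w₃ n₁₂ n₁₃ n₂₃) v~x vb@(Ib , v~b) w~b xs disj disj′ =
    two-of-three (w ◁_) w₁ w₂ w₃ n₁₂ n₁₃ n₂₃ b go
    where
    w≁s : w ≁ s
    w≁s = non λ w~s → clash (proj₂ xs) (disj′ (proj₁ xs , w~s))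
    v≁s : v ≁ s
    v≁s = non λ v~s → clash (proj₂ xs) (disj (proj₁ xs , v~s))
    only : ∀ {i} → I i → i ≢ b → v ≁ i
    only Ii i≢b = non λ v~i → private-pair v~x (Ii , v~i) (disj (Ii , v~i)) vb (disj vb) i≢b xs v≁s
    x≁w : w ≁ x
    x≁w = non λ w~x → clash (nested w~x w₁ w₂ n₁₂ xs w≁s w₁) (disj′ w₁)
    go : ∀ {i j} → w ◁ i → w ◁ j → i ≢ j → i ≢ b → j ≢ b → ⊥
    go wi@(Ii , w~i) wj@(Ij , _) i≢j i≢b j≢b with dec w v
    ... | inj₂ w≁v = private-pair′ w≁v (Ib , w~b) v~b wi (only Ii i≢b) wj (only Ij j≢b) i≢j
    ... | inj₁ w~v = bull-free w~v w~b v~b w~i v~x x≁w (only Ii i≢b) (independent Ib Ii)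
                       (sn (disj vb)) (sn (disj′ wi))

  -- Two non-adjacent vertices whose traces on I differ by one exchange

  record Exchange (w q : V) : Set where
    field
      {s t c₁ c₂} : V
      w≁q : w ≁ q
      ws  : w ≁ s
      qs  : q ◁ s
      wt  : w ◁ t
      qt  : q ≁ t
      wc₁ : w ◁ c₁
      qc₁ : q ~ c₁
      wc₂ : w ◁ c₂
      qc₂ : q ~ c₂
      c₁≢c₂ : c₁ ≢ c₂

  -- The vertex that completes `w` and `q` to a `Triple`. Without one, `Common` below is a module.
  record Third (w q s t : V) : Set where
    constructor third
    field
      {x c} : V
      w≁x : w ≁ x
      q≁x : q ≁ x
      xs : x ~ s
      xt : x ~ t
      wc : w ◁ c
      qc : q ~ c
      xc : x ≁ c

  module _ {w q : V} (E : Exchange w q) where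
    open Exchange E

    -- Elements of `I` have an empty trace, so inside `I` this is the intersection of the traces of
    -- `w` and `q`.
    Common : V → Set
    Common v = w ~ v × q ~ v × (∀ {i} → v ◁ i → w ~ i × q ~ i)

    module _ (no-third : ¬ Third w q s t) where

      -- For `v` outside `I`, an element `c` of its trace gives the bull with triangle `q`, `v`, `c`
      -- and pendants `s` at `q` and `x` at `v`.
      anti : ∀ {q s x v} → q ≁ x → q ◁ s → (∀ {i} → x ◁ i → q ≁ i) →
        q ~ v → (∀ {i} → v ◁ i → q ~ i) → v ≁ s → x ≁ v
      anti {q} {s} {x} {v} q≁x (Is , q~s) nc q~v vi v≁s = non go
        where
        go : x ~ v → ⊥
        go x~v with I? v
        ... | yes Iv = clash q~v (nc (Iv , x~v))
        ... | no ¬Iv with maximal ¬Iv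
        ... | c , Ic , v~c = bull-free q~v (vi (Ic , v~c)) v~c q~s (sy x~v) q≁x v≁s (independent Ic Is)
          (sn (non λ x~c → clash (vi (Ic , v~c)) (nc (Ic , x~c))))
          (sn (non λ x~s → clash q~s (nc (Is , x~s))))

      -- By `private-pair′`, `x` sees the whole trace of `q` except `s`. For `v` outside `I` with
      -- `c` in its trace, `x ≁ v` would give the bull with triangle `q`, `c`, `v` and pendants `s`
      -- at `q` and `x` at `c`.
      full : ∀ {q s x v i} → q ≁ x → q ◁ s → x ◁ i → q ~ i → x ≁ s →
        q ~ v → (∀ {i} → v ◁ i → q ~ i × s ≢ i) → v ≁ s → s ≢ v → x ~ v
      full {q} {s} {x} {v} {i} q≁x qs@(Is , q~s) (Ii , x~i) q~i x≁s q~v vi v≁s s≢v = yea go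
        where
        covers : ∀ {c} → q ◁ c → s ≢ c → x ~ c
        covers qc s≢c = yea λ x≁c → private-pair′ q≁x (Ii , q~i) x~i qs x≁s qc x≁c s≢c
        go : x ≁ v → ⊥
        go x≁v with I? v
        ... | yes Iv = clash (covers (Iv , q~v) s≢v) x≁v
        ... | no ¬Iv with maximal ¬Iv
        ... | c , Ic , v~c with vi (Ic , v~c)
        ... | q~c , s≢c = bull-free q~c q~v (sy v~c) q~s (sy (covers (Ic , q~c) s≢c)) q≁x
                            (independent Ic Is) v≁s (sn x≁v) (sn x≁s)

      -- Otherwise `v` is outside `I` and shares a trace element with `x`, but misses both `s` and
      -- `t`: the chair of `private-pair′`.
      covering : ∀ {x v} → x ~ s → x ~ t → (∀ {c} → w ◁ c → q ~ c → x ~ c) → Common v → x ~ v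
      covering {x} {v} x~s x~t cov (w~v , q~v , vi) = yea go
        where
        go : x ≁ v → ⊥
        go x≁v with I? v
        ... | yes Iv = clash (cov (Iv , w~v) q~v) x≁v
        ... | no ¬Iv with maximal ¬Iv
        ... | c , vc@(Ic , v~c) with vi vc
        ... | w~c , q~c = private-pair′ x≁v (Ic , cov (Ic , w~c) q~c) v~c
                (proj₁ qs , x~s) (non λ v~s → clash (proj₁ (vi (proj₁ qs , v~s))) ws)
                (proj₁ wt , x~t) (non λ v~t → clash (proj₂ (vi (proj₁ wt , v~t))) qt)
                (apart (proj₂ qs) qt)

      -- The cases follow the adjacency of `x` to `w` and `q`. A trace of `x` that reaches beyond an
      -- adjacent `w` or `q` contains theirs by `nested`, and a non-adjacent one is handled by
      -- `anti` and `full`; what is left leads to `covering`. The hypothesis `no-third` enters only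
      -- when `x` is adjacent to neither.
      common-uniform : ∀ {x v v′} → ¬ Common x → Common v → Common v′ → x ~ v → x ≁ v′ → ⊥
      common-uniform {x} {v} {v′} ¬Zx Zv@(w~v , q~v , vi) Zv′@(w~v′ , q~v′ , vi′) x~v x≁v′ =
        by-I (I? x)
        where
        v≁s : ∀ {v} → Common v → v ≁ s
        v≁s (_ , _ , vi) = non λ v~s → clash (proj₁ (vi (proj₁ qs , v~s))) ws
        v≁t : ∀ {v} → Common v → v ≁ t
        v≁t (_ , _ , vi) = non λ v~t → clash (proj₂ (vi (proj₁ wt , v~t))) qt
        s≢ : ∀ {v} → w ~ v → s ≢ v
        s≢ w~v = ≢-sym′ (apart w~v ws)
        t≢ : ∀ {v} → q ~ v → t ≢ v
        t≢ q~v = ≢-sym′ (apart q~v qt)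
        q-anti : q ≁ x → (∀ {i} → x ◁ i → q ≁ i) → ⊥
        q-anti q≁x nc = clash x~v (anti q≁x qs nc q~v (λ a → proj₂ (vi a)) (v≁s Zv))
        w-anti : w ≁ x → (∀ {i} → x ◁ i → w ≁ i) → ⊥
        w-anti w≁x nc = clash x~v (anti w≁x wt nc w~v (λ a → proj₁ (vi a)) (v≁t Zv))
        q-full : ∀ {i} → q ≁ x → x ◁ i → q ~ i → x ≁ s → ⊥
        q-full q≁x xi q~i x≁s = clash
          (full q≁x qs xi q~i x≁s q~v′ (λ a → proj₂ (vi′ a) , s≢ (proj₁ (vi′ a))) (v≁s Zv′) (s≢ w~v′)) x≁v′
        w-full : ∀ {i} → w ≁ x → x ◁ i → w ~ i → x ≁ t → ⊥
        w-full w≁x xi w~i x≁t = clash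
          (full w≁x wt xi w~i x≁t w~v′ (λ a → proj₁ (vi′ a) , t≢ (proj₂ (vi′ a))) (v≁t Zv′) (t≢ q~v′)) x≁v′
        w-nested : ∀ {i} → w ~ x → x ◁ i → w ≁ i → ∀ {j} → w ◁ j → x ~ j
        w-nested w~x xi w≁i = nested w~x wc₁ wc₂ c₁≢c₂ xi w≁i
        q-nested : ∀ {i} → q ~ x → x ◁ i → q ≁ i → ∀ {j} → q ◁ j → x ~ j
        q-nested q~x xi q≁i = nested q~x (proj₁ wc₁ , qc₁) (proj₁ wc₂ , qc₂) c₁≢c₂ xi q≁i
        cover! : x ~ s → x ~ t → (∀ {c} → w ◁ c → q ~ c → x ~ c) → ⊥
        cover! xs xt cov = clash (covering xs xt cov Zv′) x≁v′
        w-exceeds : ∀ {i} → w ~ x → q ~ x → x ◁ i → w ≁ i → ⊥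
        w-exceeds w~x q~x xi w≁i = cover!
            (q-nested q~x (proj₁ wt , x~t) qt qs) x~t (λ wc _ → w-nested w~x xi w≁i wc)
          where x~t = w-nested w~x xi w≁i wt
        q-exceeds : ∀ {i} → w ~ x → q ~ x → x ◁ i → q ≁ i → ⊥
        q-exceeds w~x q~x xi q≁i = cover!
            x~s (w-nested w~x (proj₁ qs , x~s) ws wt) (λ wc q~c → q-nested q~x xi q≁i (proj₁ wc , q~c))
          where x~s = q-nested q~x xi q≁i qs
        q-side : q ≁ x → (∀ {i} → x ◁ i → q ~ i → x ~ s → ⊥) → ⊥
        q-side q≁x k = q-anti q≁x λ {i} xi → non λ q~i → k xi q~i (yea λ x≁s → q-full q≁x xi q~i x≁s)
        w-side : w ≁ x → (∀ {i} → x ◁ i → w ~ i → x ~ t → ⊥) → ⊥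
        w-side w≁x k = w-anti w≁x λ {i} xi → non λ w~i → k xi w~i (yea λ x≁t → w-full w≁x xi w~i x≁t)
        by-I : Dec (I x) → ⊥
        by-I (yes Ix) = ¬Zx (proj₁ (vi (Ix , sy x~v)) , proj₂ (vi (Ix , sy x~v)) ,
                             λ { (Ii , x~i) → ⊥-elim (clash x~i (independent Ix Ii)) })
        by-I (no ¬Ix) with dec w x | dec q x
        ... | inj₁ w~x | inj₁ q~x = ¬Zx (w~x , q~x , λ xi →
                yea (λ w≁i → w-exceeds w~x q~x xi w≁i) , yea (λ q≁i → q-exceeds w~x q~x xi q≁i))
        ... | inj₁ w~x | inj₂ q≁x = q-side q≁x λ xi q~i x~s →
                let cov = λ {j} → w-nested w~x (proj₁ qs , x~s) ws {j} in
                cover! x~s (cov wt) (λ wc _ → cov wc)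
        ... | inj₂ w≁x | inj₁ q~x = w-side w≁x λ xi w~i x~t →
                let cov = λ {j} → q-nested q~x (proj₁ wt , x~t) qt {j} in
                cover! (cov qs) x~t (λ wc q~c → cov (proj₁ wc , q~c))
        ... | inj₂ w≁x | inj₂ q≁x = q-side q≁x λ _ _ x~s → w-side w≁x λ _ _ x~t →
                cover! x~s x~t λ wc q~c → yea λ x≁c →
                  no-third (third w≁x q≁x x~s x~t wc q~c x≁c)

      ∉Common : ¬ Common w
      ∉Common (w~w , _) = clash w~w (~-irrefl w)

      common : ∀ {c} → w ◁ c → q ~ c → Common c
      common (Ic , w~c) q~c = w~c , q~c , λ { (Ii , c~i) → ⊥-elim (clash c~i (independent Ic Ii)) }

      no-third-absurd : ⊥
      no-third-absurd = prime Common common-uniform (common wc₁ qc₁) (common wc₂ qc₂) c₁≢c₂ w ∉Common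

  -- Three pairwise non-adjacent vertices, each missing one element of I

  NoDominatingTriple : Set
  NoDominatingTriple = ∀ {x y z} → I x → I y → I z →
    (∀ {w} → ¬ I w → w ≁ x → w ≁ y → w ≁ z → ⊥) → ⊥

  bool-stable : ∀ {a b : Bool} → (a ≢ b → ⊥) → a ≡ b
  bool-stable {true}  {true}  f = refl
  bool-stable {false} {false} f = refl
  bool-stable {true}  {false} f = ⊥-elim (f λ ())
  bool-stable {false} {true}  f = ⊥-elim (f λ ())

  record Triple : Set where
    field
      {w₁ w₂ w₃ j₁ j₂ j₃ d} : V
      w₁≁w₂ : w₁ ≁ w₂
      w₁≁w₃ : w₁ ≁ w₃
      w₂≁w₃ : w₂ ≁ w₃
      w₁j₁ : w₁ ≁ j₁
      w₂j₂ : w₂ ≁ j₂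
      w₃j₃ : w₃ ≁ j₃
      w₁j₂ : w₁ ◁ j₂
      w₁j₃ : w₁ ◁ j₃
      w₂j₁ : w₂ ◁ j₁
      w₂j₃ : w₂ ◁ j₃
      w₃j₁ : w₃ ◁ j₁
      w₃j₂ : w₃ ◁ j₂
      w₁d  : w₁ ◁ d
      w₂d  : w₂ ~ d
      w₃d  : w₃ ~ d
      -- No trace properly contains the union of the traces of `w₁` and `w₂`.
      covered : ∀ {y r} → (∀ {i} → w₁ ◁ i → y ~ i) → (∀ {i} → w₂ ◁ i → y ~ i) →
        y ◁ r → w₁ ≁ r → w₂ ≁ r → ⊥

  module _ (T : Triple) where
    open Triple T

    j₁≢j₂ : j₁ ≢ j₂
    j₁≢j₂ = ≢-sym′ (apart (proj₂ w₁j₂) w₁j₁)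
    j₁≢j₃ : j₁ ≢ j₃
    j₁≢j₃ = ≢-sym′ (apart (proj₂ w₁j₃) w₁j₁)
    j₂≢j₃ : j₂ ≢ j₃
    j₂≢j₃ = ≢-sym′ (apart (proj₂ w₂j₃) w₂j₂)
    d≢j₁ : d ≢ j₁
    d≢j₁ = apart (proj₂ w₁d) w₁j₁
    d≢j₂ : d ≢ j₂
    d≢j₂ = apart w₂d w₂j₂
    d≢j₃ : d ≢ j₃
    d≢j₃ = apart w₃d w₃j₃
    Id : I d
    Id = proj₁ w₁d
    three₁ : Three w₁
    three₁ = three w₁j₂ w₁j₃ w₁d j₂≢j₃ (≢-sym′ d≢j₂) (≢-sym′ d≢j₃)
    three₂ : Three w₂
    three₂ = three w₂j₁ w₂j₃ (Id , w₂d) j₁≢j₃ (≢-sym′ d≢j₁) (≢-sym′ d≢j₃)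
    three₃ : Three w₃
    three₃ = three w₃j₁ w₃j₂ (Id , w₃d) j₁≢j₂ (≢-sym′ d≢j₁) (≢-sym′ d≢j₂)

    Span : V → Set
    Span i = w₁ ≁ i → w₂ ≁ i → ⊥

    -- The element `r` is missed by `w₃` as well. The vertex `y` is adjacent to none of the three:
    -- by `nested` it would contain one trace, then be adjacent to another of them, and finally
    -- contradict `covered`. Nor does it see `d`. Its element `u` in the span now forces it to see
    -- two of `j₁`, `j₂`, `j₃`, among them `j₃`, which `w₃` misses along with `r`; this is a chair
    -- around `y`.
    no-straddle : ∀ {y u r} → y ◁ u → Span u → y ◁ r → w₁ ≁ r → w₂ ≁ r → ⊥
    no-straddle {y} {u} {r} yu@(Iu , y~u) Uu yr@(Ir , y~r) w₁≁r w₂≁r =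
      Uu (non on-w₁) (non on-w₂)
      where
      w₃≁r : w₃ ≁ r
      w₃≁r = non λ w₃~r → private-pair′ (sn w₁≁w₃) (Id , w₃d) (proj₂ w₁d) w₃j₁ w₁j₁ (Ir , w₃~r) w₁≁r
        (apart (proj₂ w₂j₁) w₂≁r)
      forced : ∀ {w j} → y ~ d → w ~ d → y ◁ j → w ≁ j → w ≁ r → j ≢ r → y ~ w
      forced y~d w~d yj w≁j w≁r j≢r = yea λ y≁w →
        private-pair′ y≁w (Id , y~d) w~d yj w≁j yr w≁r j≢r
      nest₁ : y ~ w₁ → ∀ {i} → w₁ ◁ i → y ~ i
      nest₁ y~w = nested (sy y~w) w₁j₂ w₁j₃ j₂≢j₃ yr w₁≁r
      nest₂ : y ~ w₂ → ∀ {i} → w₂ ◁ i → y ~ i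
      nest₂ y~w = nested (sy y~w) w₂j₁ w₂j₃ j₁≢j₃ yr w₂≁r
      nest₃ : y ~ w₃ → ∀ {i} → w₃ ◁ i → y ~ i
      nest₃ y~w = nested (sy y~w) w₃j₁ w₃j₂ j₁≢j₂ yr w₃≁r
      y≁w₁ : y ≁ w₁
      y≁w₁ = non λ p → covered (nest₁ p)
        (nest₂ (forced (nest₁ p w₁d) w₂d (proj₁ w₁j₂ , nest₁ p w₁j₂) w₂j₂ w₂≁r (apart (proj₂ w₁j₂) w₁≁r)))
        yr w₁≁r w₂≁r
      y≁w₂ : y ≁ w₂
      y≁w₂ = non λ p → clash (forced (nest₂ p (Id , w₂d)) (proj₂ w₁d) (proj₁ w₂j₁ , nest₂ p w₂j₁) w₁j₁ w₁≁r
        (apart (proj₂ w₂j₁) w₂≁r)) y≁w₁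
      y≁w₃ : y ≁ w₃
      y≁w₃ = non λ p → clash (forced (nest₃ p (Id , w₃d)) (proj₂ w₁d) (proj₁ w₃j₁ , nest₃ p w₃j₁) w₁j₁ w₁≁r
        (apart (proj₂ w₂j₁) w₂≁r)) y≁w₁
      y≁d : y ≁ d
      y≁d = non λ y~d → private-pair′ (sn y≁w₁) w₁d y~d
        w₁j₂ (non λ y~j → clash (forced y~d w₂d (proj₁ w₁j₂ , y~j) w₂j₂ w₂≁r (apart (proj₂ w₁j₂) w₁≁r)) y≁w₂)
        w₁j₃ (non λ y~j → clash (forced y~d w₃d (proj₁ w₁j₃ , y~j) w₃j₃ w₃≁r (apart (proj₂ w₁j₃) w₁≁r)) y≁w₃)
        j₂≢j₃
      on-w₁ : w₁ ~ u → ⊥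
      on-w₁ w₁~u = private-pair′ y≁w₃ (proj₁ w₁j₂ , y~j₂) (proj₂ w₃j₂) (proj₁ w₁j₃ , y~j₃) w₃j₃ yr w₃≁r
          (apart (proj₂ w₁j₃) w₁≁r)
        where
        y~j₂ : y ~ j₂
        y~j₂ = yea λ n → private-pair′ (sn y≁w₁) (Iu , w₁~u) y~u w₁j₂ n w₁d y≁d (≢-sym′ d≢j₂)
        y~j₃ : y ~ j₃
        y~j₃ = yea λ n → private-pair′ (sn y≁w₁) (Iu , w₁~u) y~u w₁j₃ n w₁d y≁d (≢-sym′ d≢j₃)
      on-w₂ : w₂ ~ u → ⊥
      on-w₂ w₂~u = private-pair′ y≁w₃ (proj₁ w₂j₁ , y~j₁) (proj₂ w₃j₁) (proj₁ w₂j₃ , y~j₃) w₃j₃ yr w₃≁r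
          (apart (proj₂ w₁j₃) w₁≁r)
        where
        y~j₁ : y ~ j₁
        y~j₁ = yea λ n → private-pair′ (sn y≁w₂) (Iu , w₂~u) y~u w₂j₁ n (Id , w₂d) y≁d (≢-sym′ d≢j₁)
        y~j₃ : y ~ j₃
        y~j₃ = yea λ n → private-pair′ (sn y≁w₂) (Iu , w₂~u) y~u w₂j₃ n (Id , w₂d) y≁d (≢-sym′ d≢j₃)

    Within : V → Set
    Within v = (I v → Span v) × (∀ {i} → v ◁ i → Span i)

    -- No edge leaves `Within`, by `no-straddle` if `v` is in `I` and by `separate` otherwise.
    -- Primality will then make it the whole graph, so that the traces of `w₁` and `w₂` cover `I`.
    within-isolated : ∀ {x v} → ¬ Within x → Within v → x ~ v → ⊥
    within-isolated {x} {v} ¬Zx (Uv , vU) x~v with I? x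
    ... | yes Ix = ¬Zx ((λ _ → vU (Ix , sy x~v)) , λ { (Ii , x~i) → ⊥-elim (clash x~i (independent Ix Ii)) })
    ... | no ¬Ix = ¬Zx ((λ Ix → ⊥-elim (¬Ix Ix)) , λ {r} xr w₁≁r w₂≁r → escape xr w₁≁r w₂≁r)
      where
      escape : ∀ {r} → x ◁ r → w₁ ≁ r → w₂ ≁ r → ⊥
      escape {r} xr w₁≁r w₂≁r with I? v
      ... | yes Iv = no-straddle (Iv , x~v) (Uv Iv) xr w₁≁r w₂≁r
      ... | no ¬Iv with maximal ¬Iv
      ... | b , vb = vU vb (non λ w₁~b → sep three₁ w₁~b λ {i} wi n _ → clash (proj₂ wi) n)
                           (non λ w₂~b → sep three₂ w₂~b λ {i} wi _ n → clash (proj₂ wi) n)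
        where
        avoids : ∀ {i} → I i → Span i → x ≁ i
        avoids Ii Ui = non λ x~i → no-straddle (Ii , x~i) Ui xr w₁≁r w₂≁r
        sep : ∀ {w} → Three w → w ~ b → (∀ {i} → w ◁ i → Span i) → ⊥
        sep t w~b wU = separate t (sy x~v) vb w~b xr (λ vi → avoids (proj₁ vi) (vU vi))
                         (λ wi → avoids (proj₁ wi) (wU wi))

    spanning : ∀ {i} → I i → Span i
    spanning {i} Ii w₁≁i w₂≁i = prime Within (λ ¬Zx Zv _ x~v _ → within-isolated ¬Zx Zv x~v)
      (z w₁j₂ λ n _ → clash (proj₂ w₁j₂) n) (z w₁j₃ λ n _ → clash (proj₂ w₁j₃) n) j₂≢j₃ i
      λ Zi → proj₁ Zi Ii w₁≁i w₂≁i
      where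
      z : ∀ {j} → w₁ ◁ j → Span j → Within j
      z (Ij , _) Uj = (λ _ → Uj) , λ { (Ik , j~k) → ⊥-elim (clash j~k (independent Ij Ik)) }

    -- Misses at most one element of `I`. By `missing-three` the alternative is to miss at least
    -- three.
    Big : V → Set
    Big y = ∀ {a b} → I a → y ≁ a → I b → y ≁ b → a ≢ b → ⊥

    record Missing (y : V) : Set where
      constructor missing
      field
        {e₁ e₂ e₃} : V
        i₁ : I e₁
        i₂ : I e₂
        i₃ : I e₃
        y₁ : y ≁ e₁
        y₂ : y ≁ e₂
        y₃ : y ≁ e₃
        n₁₂ : e₁ ≢ e₂
        n₁₃ : e₁ ≢ e₃
        n₂₃ : e₂ ≢ e₃

    only→big : ∀ {w j} → (∀ {a} → I a → w ≁ a → a ≢ j → ⊥) → Big w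
    only→big only Ia w≁a Ib w≁b a≢b = only Ia w≁a λ { refl → only Ib w≁b λ { refl → a≢b refl } }

    only₁ : ∀ {a} → I a → w₁ ≁ a → a ≢ j₁ → ⊥
    only₁ Ia n a≢j = spanning Ia n (non λ w₂~a →
      private-pair′ (sn w₁≁w₂) (Id , w₂d) (proj₂ w₁d) (Ia , w₂~a) n w₂j₁ w₁j₁ a≢j)
    only₂ : ∀ {a} → I a → w₂ ≁ a → a ≢ j₂ → ⊥
    only₂ Ia n a≢j = spanning Ia (non λ w₁~a →
      private-pair′ w₁≁w₂ w₁d w₂d (Ia , w₁~a) n w₁j₂ w₂j₂ a≢j) n
    only₃ : ∀ {a} → I a → w₃ ≁ a → a ≢ j₃ → ⊥
    only₃ Ia n a≢j = spanning Ia
      (non λ w₁~a → private-pair′ w₁≁w₃ w₁d w₃d (Ia , w₁~a) n w₁j₃ w₃j₃ a≢j)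
      (non λ w₂~a → private-pair′ w₂≁w₃ (Id , w₂d) w₃d (Ia , w₂~a) n w₂j₃ w₃j₃ a≢j)

    -- A vertex `y` that sees `j` and misses two elements `a` and `b` sees nothing of the trace of
    -- `w`. A shared element would give a chair around `w` if `w ≁ y`; if `w ~ y`, then `nested`
    -- would make `y` see `a`.
    lone : ∀ {w j y} → Three w → w ≁ j → I j → (∀ {a} → I a → w ≁ a → a ≢ j → ⊥) →
      ¬ Big y → y ~ j → (Missing y → ⊥) → ⊥
    lone {w} {j} {y} (three w₁ w₂ w₃ n₁₂ n₁₃ n₂₃) w≁j Ij only ¬big y~j k = ¬big go
      where
      go : Big y
      go {a} {b} Ia y≁a Ib y≁b a≢b = k (missing (proj₁ w₁) (proj₁ w₂) (proj₁ w₃)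
          (none w₁) (none w₂) (none w₃) n₁₂ n₁₃ n₂₃)
        where
        w~ : ∀ {a} → I a → y ≁ a → w ~ a
        w~ Ia y≁a = yea λ w≁a → only Ia w≁a (≢-sym′ (apart y~j y≁a))
        none : ∀ {e} → w ◁ e → y ≁ e
        none {e} (Ie , w~e) = non λ y~e → by y~e (dec w y)
          where
          by : y ~ e → w ~ y ⊎ w ≁ y → ⊥
          by y~e (inj₁ w~y) = clash (nested w~y w₁ w₂ n₁₂ (Ij , y~j) w≁j (Ia , w~ Ia y≁a)) y≁a
          by y~e (inj₂ w≁y) = private-pair′ w≁y (Ie , w~e) y~e (Ia , w~ Ia y≁a) y≁a (Ib , w~ Ib y≁b) y≁b a≢b

    missing-three : ∀ {y} → ¬ Big y → (Missing y → ⊥) → ⊥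
    missing-three {y} ¬big k with dec y j₁ | dec y j₂ | dec y j₃
    ... | inj₁ p | _ | _ = lone three₁ w₁j₁ (proj₁ w₂j₁) only₁ ¬big p k
    ... | inj₂ _ | inj₁ p | _ = lone three₂ w₂j₂ (proj₁ w₁j₂) only₂ ¬big p k
    ... | inj₂ _ | inj₂ _ | inj₁ p = lone three₃ w₃j₃ (proj₁ w₁j₃) only₃ ¬big p k
    ... | inj₂ p | inj₂ q | inj₂ r =
      k (missing (proj₁ w₂j₁) (proj₁ w₁j₂) (proj₁ w₁j₃) p q r j₁≢j₂ j₁≢j₃ j₂≢j₃)

    two-hits : ∀ {w y} → Big w → Missing y →
      (∀ {i j} → w ◁ i → w ◁ j → i ≢ j → y ≁ i → y ≁ j → ⊥) → ⊥
    two-hits {w} big (missing {e₁} {e₂} {e₃} i₁ i₂ i₃ y₁ y₂ y₃ n₁₂ n₁₃ n₂₃) k with dec w e₁ | dec w e₂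
    ... | inj₁ p | inj₁ q = k (i₁ , p) (i₂ , q) n₁₂ y₁ y₂
    ... | inj₁ p | inj₂ q = k (i₁ , p) (i₃ , yea λ r → big i₂ q i₃ r n₂₃) n₁₃ y₁ y₃
    ... | inj₂ p | _ = k (i₂ , yea λ r → big i₁ p i₂ r n₁₂) (i₃ , yea λ r → big i₁ p i₃ r n₁₃) n₂₃ y₂ y₃

    big-adjacent : ∀ {w y a} → Big w → Missing y → w ◁ a → y ~ a → w ~ y
    big-adjacent big m wa y~a = yea λ w≁y → two-hits big m λ wi wj i≢j y≁i y≁j →
      private-pair′ w≁y wa y~a wi y≁i wj y≁j i≢j

    big-apart : ∀ {w y a} → Big w → Missing y → y ◁ a → w ≁ a → w ≁ y
    big-apart big m ya w≁a = non λ w~y → two-hits big m λ wi wj i≢j y≁i y≁j →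
      clash (nested w~y wi wj i≢j ya w≁a wi) y≁i

    -- A shared element forces `w ~ y`, an element of `y` missed by `w` forces `w ≁ y`.
    big-uniform : ∀ {w y a b} → Big w → Missing y → y ◁ a → y ◁ b → adj w a ≡ adj w b
    big-uniform {w} {y} {a} {b} big m ya yb = bool-stable go
      where
      go : adj w a ≢ adj w b → ⊥
      go ne with dec w a | dec w b
      ... | inj₁ p | inj₁ q = ne (trans p (sym q))
      ... | inj₂ p | inj₂ q = ne (trans p (sym q))
      ... | inj₁ p | inj₂ q = clash (big-adjacent big m (proj₁ ya , p) (proj₂ ya)) (big-apart big m yb q)
      ... | inj₂ p | inj₁ q = clash (big-adjacent big m (proj₁ yb , q) (proj₂ yb)) (big-apart big m ya p)

    -- Bull with triangle `w`, `v`, `c`. Its pendants are `x` at `v` and, at `w`, an element other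
    -- than `c` that `w` sees and `x` misses.
    cross : ∀ {w v x c i} → Big w → Missing x → v ~ x → v ◁ c → x ≁ c → x ◁ i → v ≁ i →
      w ~ c → w ~ v → w ≁ x → ⊥
    cross {w} {v} {x} {c} {i} big m v~x vc@(Ic , v~c) x≁c xi v≁i w~c w~v w≁x =
      two-hits big m λ we wf e≢f x≁e x≁f →
        by we x≁e λ { refl → by wf x≁f λ { refl → e≢f refl } }
      where
      by : ∀ {e} → w ◁ e → x ≁ e → (e ≢ c → ⊥)
      by (Ie , w~e) x≁e e≢c = bull-free w~v w~c v~c w~e v~x w≁x
        (non λ v~e → private-pair v~x (Ie , v~e) x≁e vc x≁c e≢c xi v≁i)
        (independent Ic Ie) (sn x≁c) (sn x≁e)

    module _ {y₀ b₀ : V} (¬Iy₀ : ¬ I y₀) (m₀ : Missing y₀) (¬big₀ : ¬ Big y₀) (y₀b₀ : y₀ ◁ b₀) where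

      Twin : V → Set
      Twin b = ∀ {w} → ¬ I w → Big w → adj w b ≡ adj w b₀

      -- The module that refutes a non-big vertex outside `I`: elements of `I` that no big vertex
      -- separates from `b₀`, and the non-big vertices attached only to such elements. The big
      -- vertex `w₁` is not in it.
      Block : V → Set
      Block v = (I v → Twin v) × (¬ I v → ¬ Big v × (∀ {i} → v ◁ i → Twin i))

      -- A big `x` sees all of `Block` or none of it, according to whether it sees `b₀`. A non-big
      -- `x` adjacent to the member `v` is itself a member: a big vertex that separates an element
      -- of its trace from one of the trace of `v` is excluded by `cross`.
      block-uniform : ∀ {x v v′} → ¬ Block x → Block v → Block v′ → x ~ v → x ≁ v′ → ⊥
      block-uniform {x} {v} {v′} ¬Zx (vI , vW) (v′I , v′W) x~v x≁v′ with I? x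
      ... | yes Ix = by (I? v)
        where
        by : Dec (I v) → ⊥
        by (yes Iv) = clash x~v (independent Ix Iv)
        by (no ¬Iv) = ¬Zx ((λ _ → proj₂ (vW ¬Iv) (Ix , sy x~v)) , λ ¬Ix → ⊥-elim (¬Ix Ix))
      ... | no ¬Ix = ¬Zx ((λ Ix → ⊥-elim (¬Ix Ix)) , λ _ → small , twins)
        where
        small : ¬ Big x
        small big with dec x b₀
        ... | inj₁ p = in-v′ (I? v′)
          where
          in-v′ : Dec (I v′) → ⊥
          in-v′ (yes Iv′) = clash (trans (v′I Iv′ ¬Ix big) p) x≁v′
          in-v′ (no ¬Iv′) with maximal ¬Iv′ | v′W ¬Iv′
          ... | c , Ic , v′~c | ¬bigv′ , tw = missing-three ¬bigv′ λ m →
            clash (big-adjacent big m (Ic , trans (tw (Ic , v′~c) ¬Ix big) p) v′~c) x≁v′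
        ... | inj₂ p = in-v (I? v)
          where
          in-v : Dec (I v) → ⊥
          in-v (yes Iv) = clash x~v (trans (vI Iv ¬Ix big) p)
          in-v (no ¬Iv) with maximal ¬Iv | vW ¬Iv
          ... | c , vc | ¬bigv , tw = missing-three ¬bigv λ m →
            clash x~v (big-apart big m vc (trans (tw vc ¬Ix big) p))
        twins : ∀ {i} → x ◁ i → Twin i
        twins {i} xi {w} ¬Iw big = bool-stable λ ne → missing-three small λ m → by ne m (I? v)
          where
          by : adj w i ≢ adj w b₀ → Missing x → Dec (I v) → ⊥
          by ne m (yes Iv) = ne (trans (big-uniform big m xi (Iv , x~v)) (vI Iv ¬Iw big))
          by ne m (no ¬Iv) with maximal ¬Iv | vW ¬Iv
          ... | c , vc@(Ic , v~c) | ¬bigv , tw = missing-three ¬bigv λ mv → split mv (dec w c) (dec w i)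
            where
            x≁c : x ≁ c
            x≁c = non λ x~c → ne (trans (big-uniform big m xi (Ic , x~c)) (tw vc ¬Iw big))
            v≁i : v ≁ i
            v≁i = non λ v~i → ne (tw (proj₁ xi , v~i) ¬Iw big)
            ne′ : adj w i ≢ adj w c
            ne′ e = ne (trans e (tw vc ¬Iw big))
            split : Missing v → w ~ c ⊎ w ≁ c → w ~ i ⊎ w ≁ i → ⊥
            split mv (inj₁ p) (inj₁ q) = ne′ (trans q (sym p))
            split mv (inj₂ p) (inj₂ q) = ne′ (trans q (sym p))
            split mv (inj₁ p) (inj₂ q) = cross big m (sy x~v) vc x≁c xi v≁i p
              (big-adjacent big mv (Ic , p) v~c) (big-apart big m xi q)
            split mv (inj₂ p) (inj₁ q) = cross big mv x~v xi v≁i vc x≁c q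
              (big-adjacent big m (proj₁ xi , q) (proj₂ xi)) (big-apart big mv vc p)

      bad-absurd : ⊥
      bad-absurd = prime Block block-uniform {y₀} {b₀}
        ((λ Iy → ⊥-elim (¬Iy₀ Iy)) , λ _ → ¬big₀ , λ y₀i _ big → big-uniform big m₀ y₀i y₀b₀)
        ((λ _ _ _ → refl) , λ ¬Ib → ⊥-elim (¬Ib (proj₁ y₀b₀)))
        (λ { refl → ¬Iy₀ (proj₁ y₀b₀) }) w₁
        λ Z → proj₁ (proj₂ Z (outside w₁j₂)) (only→big only₁)

    -- A vertex outside `I` that misses `j₁`, `j₂` and `j₃` would not be `Big`, which `bad-absurd`
    -- excludes. These three are therefore a dominating triple.
    triple-dominates : ¬ NoDominatingTriple
    triple-dominates nd = nd (proj₁ w₂j₁) (proj₁ w₁j₂) (proj₁ w₁j₃) λ ¬Iw n₁ n₂ n₃ →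
      bad-absurd ¬Iw (missing (proj₁ w₂j₁) (proj₁ w₁j₂) (proj₁ w₁j₃) n₁ n₂ n₃ j₁≢j₂ j₁≢j₃ j₂≢j₃)
        (λ big → big (proj₁ w₂j₁) n₁ (proj₁ w₁j₂) n₂ j₁≢j₂) (proj₂ (maximal ¬Iw))

  -- A third vertex `x` missing a common element `c` turns `w`, `q`, `x` with `s`, `t`, `c` into a
  -- `Triple`, and without one `no-third-absurd` applies. The element `d` seen by all three is
  -- whichever of `c₁`, `c₂` differs from `c`.
  exchange-absurd : ∀ {w q} → NoDominatingTriple → (E : Exchange w q) →
    (∀ {y r} → (∀ {i} → w ◁ i → y ~ i) → (∀ {i} → q ◁ i → y ~ i) → y ◁ r → w ≁ r → q ≁ r → ⊥) → ⊥
  exchange-absurd {w} {q} nd E covered = no-third-absurd E with-third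
    where
    open Exchange E
    with-third : ¬ Third w q s t
    with-third (third {x} {c} w≁x q≁x x~s x~t wc q~c x≁c) =
      by wc₁ qc₁ λ { refl → by wc₂ qc₂ λ { refl → c₁≢c₂ refl } }
      where
      by : ∀ {d} → w ◁ d → q ~ d → (d ≢ c → ⊥)
      by {d} wd q~d d≢c = triple-dominates (record
        { w₁≁w₂ = w≁q ; w₁≁w₃ = w≁x ; w₂≁w₃ = q≁x
        ; w₁j₁ = ws ; w₂j₂ = qt ; w₃j₃ = x≁c
        ; w₁j₂ = wt ; w₁j₃ = wc ; w₂j₁ = qs ; w₂j₃ = proj₁ wc , q~c
        ; w₃j₁ = proj₁ qs , x~s ; w₃j₂ = proj₁ wt , x~t
        ; w₁d = wd ; w₂d = q~d
        ; w₃d = yea λ x≁d → private-pair′ q≁x qs x~s (proj₁ wd , q~d) x≁d (proj₁ wc , q~c) x≁c d≢c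
        ; covered = covered }) nd

  record Four : Set where
    constructor four
    field
      {a₁ a₂ a₃ a₄} : V
      i₁ : I a₁
      i₂ : I a₂
      i₃ : I a₃
      i₄ : I a₄
      n₁₂ : a₁ ≢ a₂
      n₁₃ : a₁ ≢ a₃
      n₁₄ : a₁ ≢ a₄
      n₂₃ : a₂ ≢ a₃
      n₂₄ : a₂ ≢ a₄
      n₃₄ : a₃ ≢ a₄

  two-of-four : Four → ∀ s t → (∀ {x y} → I x → I y → x ≢ y → x ≢ s → x ≢ t → y ≢ s → y ≢ t → ⊥) → ⊥
  two-of-four (four {a₁} {a₂} {a₃} i₁ i₂ i₃ i₄ n₁₂ n₁₃ n₁₄ n₂₃ n₂₄ n₃₄) s t k =
    two-of-three Q (i₁ , not₁) (i₂ , not₂) (i₃ , not₃) n₁₂ n₁₃ n₂₃ t k′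
    where
    Q : V → Set
    Q v = I v × v ≢ s
    k′ : ∀ {x y} → Q x → Q y → x ≢ y → x ≢ t → y ≢ t → ⊥
    k′ (Ix , x≢s) (Iy , y≢s) x≢y x≢t y≢t = k Ix Iy x≢y x≢s x≢t y≢s y≢t
    not₁ : a₁ ≢ s
    not₁ refl = two-of-three Q (i₂ , ≢-sym′ n₁₂) (i₃ , ≢-sym′ n₁₃) (i₄ , ≢-sym′ n₁₄) n₂₃ n₂₄ n₃₄ t k′
    not₂ : a₂ ≢ s
    not₂ refl = two-of-three Q (i₁ , n₁₂) (i₃ , ≢-sym′ n₂₃) (i₄ , ≢-sym′ n₂₄) n₁₃ n₁₄ n₃₄ t k′
    not₃ : a₃ ≢ s
    not₃ refl = two-of-three Q (i₁ , n₁₃) (i₂ , n₂₃) (i₄ , ≢-sym′ n₃₄) n₁₂ n₁₄ n₂₄ t k′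

  Full : V → Set
  Full y = ∀ {i} → I i → y ~ i

  -- A vertex outside I with an inclusion-maximal trace of size at least three

  module _ (nd : NoDominatingTriple) {w r : V} (W : Three w) (Ir : I r) (w≁r : w ≁ r)
    (w-max : ∀ {x} → (∀ {i} → w ◁ i → x ~ i) → ∀ {i} → x ◁ i → w ~ i) where

    open Three W

    -- If `w ~ x`, then `x` contains the trace of `w` by `nested`, against `w-max`. If not, a missed
    -- element `t` would make the two an `Exchange`, for which `w-max` gives the covering condition;
    -- so `x` contains the trace again.
    no-overlap : ∀ {x u s} → x ◁ u → w ~ u → x ◁ s → w ≁ s → ⊥
    no-overlap {x} {u} {s} (Iu , x~u) w~u xs w≁s = clash (w-max (λ {t} wt → yea (lacks wt)) xs) w≁s
      where
      w≁x : w ≁ x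
      w≁x = non λ w~x → clash (w-max (nested w~x w₁ w₂ n₁₂ xs w≁s) xs) w≁s
      lacks : ∀ {t} → w ◁ t → x ≁ t → ⊥
      lacks {t} wt x≁t = two-of-three (w ◁_) w₁ w₂ w₃ n₁₂ n₁₃ n₂₃ t λ wc₁ wc₂ c₁≢c₂ c₁≢t c₂≢t →
        exchange-absurd nd (record { w≁q = w≁x ; ws = w≁s ; qs = xs ; wt = wt ; qt = x≁t
          ; wc₁ = wc₁ ; qc₁ = hit wc₁ c₁≢t ; wc₂ = wc₂ ; qc₂ = hit wc₂ c₂≢t ; c₁≢c₂ = c₁≢c₂ })
          λ wy _ yr n _ → clash (w-max wy yr) n
        where
        hit : ∀ {c} → w ◁ c → c ≢ t → x ~ c
        hit wc c≢t = yea λ x≁c → private-pair′ w≁x (Iu , w~u) x~u wc x≁c wt x≁t c≢t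

    Below : V → Set
    Below v = (I v → w ~ v) × (∀ {i} → v ◁ i → w ~ i)

    below-isolated : ∀ {x v} → ¬ Below x → Below v → x ~ v → ⊥
    below-isolated {x} {v} ¬Zx (vI , vW) x~v with I? x
    ... | yes Ix = ¬Zx ((λ _ → vW (Ix , sy x~v)) , λ { (Ii , x~i) → ⊥-elim (clash x~i (independent Ix Ii)) })
    ... | no ¬Ix = ¬Zx ((λ Ix → ⊥-elim (¬Ix Ix)) , λ xs → yea λ w≁s → escape xs w≁s)
      where
      escape : ∀ {s} → x ◁ s → w ≁ s → ⊥
      escape xs w≁s with I? v
      ... | yes Iv = no-overlap (Iv , x~v) (vI Iv) xs w≁s
      ... | no ¬Iv with maximal ¬Iv
      ... | b , vb = separate W (sy x~v) vb (vW vb) xs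
        (λ vi → non λ x~i → no-overlap (proj₁ vi , x~i) (vW vi) xs w≁s)
        (λ wi → non λ x~i → no-overlap (proj₁ wi , x~i) (proj₂ wi) xs w≁s)

    -- No edge leaves `Below`, which would thus be a proper module. Hence an inclusion-maximal trace
    -- with three elements is all of `I`.
    partial-absurd : ⊥
    partial-absurd = prime Below (λ ¬Zx Zv _ x~v _ → below-isolated ¬Zx Zv x~v)
      (z w₁) (z w₂) n₁₂ r λ Zr → clash (proj₁ Zr Ir) w≁r
      where
      z : ∀ {e} → w ◁ e → Below e
      z (Ie , w~e) = (λ _ → w~e) , λ { (Ii , e~i) → ⊥-elim (clash e~i (independent Ie Ii)) }

  module _ (nd : NoDominatingTriple) (F : Four) where

    module _ {w q t : V} (w-full : Full w) (w≁q : w ≁ q) (It : I t) (q≁t : q ≁ t) where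

      ¬Iq : ¬ I q
      ¬Iq Iq = clash (w-full Iq) w≁q

      q-misses-one : ∀ {i} → I i → i ≢ t → q ~ i
      q-misses-one Ii i≢t with maximal ¬Iq
      ... | c , Ic , q~c = yea λ q≁i → private-pair′ w≁q (Ic , w-full Ic) q~c (Ii , w-full Ii) q≁i
                             (It , w-full It) q≁t i≢t

      -- Two vertices missing one element each, and different ones, form an `Exchange` whose two
      -- traces cover `I`. Four elements of `I` leave the two common ones that are required.
      misses-t-only : ∀ {q′ s} → I s → q′ ≁ s → s ≢ t → (∀ {i} → I i → i ≢ s → q′ ~ i) → ⊥
      misses-t-only {q′} {s} Is q′≁s s≢t others =
        two-of-four F s t λ Ic Id c≢d c≢s c≢t d≢s d≢t →
        exchange-absurd nd (record
          { w≁q = non λ q′~q → crossing (sy q′~q) (Ic , q-misses-one Ic c≢t) (others Ic c≢s)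
                    (Is , q-misses-one Is s≢t) q′≁s (It , others It (≢-sym′ s≢t)) q≁t
          ; ws = q′≁s ; qs = Is , q-misses-one Is s≢t
          ; wt = It , others It (≢-sym′ s≢t) ; qt = q≁t
          ; wc₁ = Ic , others Ic c≢s ; qc₁ = q-misses-one Ic c≢t
          ; wc₂ = Id , others Id d≢s ; qc₂ = q-misses-one Id d≢t ; c₁≢c₂ = c≢d })
          λ _ _ yr q′≁r q≁r → clash (q-misses-one (proj₁ yr) λ { refl →
            clash (others It (≢-sym′ s≢t)) q′≁r }) q≁r

      -- The candidate module: it contains every element of `I` except `t`.
      Under : V → Set
      Under v = v ≢ t × v ≁ t × (∀ {y} → Full y → y ~ v)

      -- If `x` misses `t` and some full vertex is not adjacent to `x`, then `x` sees `I` without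
      -- `t`, and `x ≁ v′` gives a bull. If `x` sees `t`, it misses two elements of `I` by
      -- `misses-t-only`; comparison with `q` shrinks its trace to `t` alone, and the edge to `v`
      -- gives a bull.
      under-uniform : ∀ {x v v′} → ¬ Under x → Under v → Under v′ → x ~ v → x ≁ v′ → ⊥
      under-uniform {x} {v} {v′} ¬Zx (v≢t , v≁t , Fv) (v′≢t , v′≁t , Fv′) x~v x≁v′ with I? x
      ... | yes Ix = ¬Zx ((λ { refl → clash (sy x~v) v≁t }) , independent Ix It , λ f → f Ix)
      ... | no ¬Ix = by (dec x t)
        where
        not-full : ¬ Full x
        not-full f = clash (Fv′ f) x≁v′
        by : x ~ t ⊎ x ≁ t → ⊥
        by (inj₂ x≁t) = ¬Zx ((λ { refl → ¬Ix It }) , x≁t , λ {y} Fy → yea λ y≁x → below Fy y≁x)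
          where
          below : ∀ {y} → Full y → y ≁ x → ⊥
          below {y} Fy y≁x with maximal ¬Ix
          ... | c₀ , Ic₀ , x~c₀ = in-v′ (I? v′)
            where
            has : ∀ {i} → I i → i ≢ t → x ~ i
            has Ii i≢t = yea λ x≁i → private-pair′ y≁x (Ic₀ , Fy Ic₀) x~c₀ (Ii , Fy Ii) x≁i (It , Fy It) x≁t i≢t
            in-v′ : Dec (I v′) → ⊥
            in-v′ (yes Iv′) = clash (has Iv′ v′≢t) x≁v′
            in-v′ (no ¬Iv′) with maximal ¬Iv′
            ... | c , Ic , v′~c = bull-free (Fy Ic) (Fv′ Fy) (sy v′~c) (Fy It) (sy (has Ic (apart v′~c v′≁t)))
                    y≁x (independent Ic It) v′≁t (sn x≁v′) (sn x≁t)
        by (inj₁ x~t) = not-full λ {a} Ia → yea λ x≁a →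
          misses-t-only Ia x≁a (≢-sym′ (apart x~t x≁a)) λ {b} Ib b≢a → yea λ x≁b →
          two-missing Ia x≁a Ib x≁b (≢-sym′ b≢a)
          where
          two-missing : ∀ {a b} → I a → x ≁ a → I b → x ≁ b → a ≢ b → ⊥
          two-missing {a} {b} Ia x≁a Ib x≁b a≢b = in-v (I? v)
            where
            qh : ∀ {i} → I i → x ≁ i → q ◁ i
            qh Ii x≁i = Ii , q-misses-one Ii (≢-sym′ (apart x~t x≁i))
            q≁x : q ≁ x
            q≁x = non λ q~x → clash (nested q~x (qh Ia x≁a) (qh Ib x≁b) a≢b (It , x~t) q≁t (qh Ia x≁a)) x≁a
            nc : ∀ {i} → I i → i ≢ t → x ≁ i
            nc Ii i≢t = non λ x~i →
              private-pair′ q≁x (Ii , q-misses-one Ii i≢t) x~i (qh Ia x≁a) x≁a (qh Ib x≁b) x≁b a≢b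
            in-v : Dec (I v) → ⊥
            in-v (yes Iv) = clash x~v (nc Iv v≢t)
            in-v (no ¬Iv) with maximal ¬Iv
            ... | c , Ic , v~c = pend Ia x≁a λ { refl → pend Ib x≁b λ { refl → a≢b refl } }
              where
              q~c : q ~ c
              q~c = q-misses-one Ic (apart v~c v≁t)
              x≁c : x ≁ c
              x≁c = nc Ic (apart v~c v≁t)
              v~q : v ~ q
              v~q = yea λ v≁q → bull-free (w-full Ic) (Fv w-full) (sy v~c) (w-full It) (sy q~c) w≁q
                      (independent Ic It) v≁t v≁q (sn q≁t)
              pend : ∀ {e} → I e → x ≁ e → (e ≢ c → ⊥)
              pend Ie x≁e e≢c = bull-free (sy v~q) q~c v~c (proj₂ (qh Ie x≁e)) (sy x~v) q≁x
                (non λ v~e → private-pair (sy x~v) (Ie , v~e) x≁e (Ic , v~c) x≁c e≢c (It , x~t) v≁t)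
                (independent Ic Ie) (sn x≁c) (sn x≁e)

      non-full-absurd : ⊥
      non-full-absurd = two-of-four F t t λ Ia Ib a≢b a≢t _ b≢t _ →
        prime Under under-uniform (z Ia a≢t) (z Ib b≢t) a≢b t λ Z → proj₁ Z refl
        where
        z : ∀ {a} → I a → a ≢ t → Under a
        z Ia a≢t = a≢t , independent Ia It , λ f → f Ia

    -- By `non-full-absurd` full vertices are adjacent to all vertices that are not full. The latter
    -- thus form a module, which contains `I` but not `w`.
    full-absurd : ∀ {w} → Full w → ⊥
    full-absurd {w} w-full = prime (λ v → ¬ Full v)
      (λ {x} {s} {s′} ¬¬Fx _ ¬Fs′ _ x≁s′ → ¬Fs′ λ {t} It → yea λ s′≁t →
        non-full-absurd (λ {i} Ii → yea λ x≁i → ¬¬Fx λ Fx → clash (Fx Ii) x≁i) x≁s′ It s′≁t)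
      (z (Four.i₁ F)) (z (Four.i₂ F)) (Four.n₁₂ F) w (λ ¬Fw → ¬Fw w-full)
      where
      z : ∀ {a} → I a → ¬ Full a
      z Ia f = clash (f Ia) (~-irrefl _)

  -- Traces of size at most two

  module AtMostTwo
    (few : ∀ {x a b c} → x ◁ a → x ◁ b → x ◁ c → a ≢ b → a ≢ c → b ≢ c → ⊥) where

    -- A path leading from a through x and e towards b, either a–x–b (with e = b) or a–x–e–b.
    data Arm (a b x e : V) : Set where
      pair   : I a → I b → a ≢ b → x ~ a → x ~ b → e ≡ b → Arm a b x e
      single : I a → I b → a ≢ b → x ~ a → e ~ b → x ~ e →
               (∀ {i} → x ◁ i → i ≢ a → ⊥) → (∀ {i} → e ◁ i → i ≢ b → ⊥) → Arm a b x e

    near : ∀ {a b x e} → Arm a b x e → x ~ a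
    near (pair _ _ _ p _ _) = p
    near (single _ _ _ p _ _ _ _) = p

    edge : ∀ {a b x e} → Arm a b x e → x ~ e
    edge (pair _ _ _ _ p refl) = p
    edge (single _ _ _ _ _ p _ _) = p

    base : ∀ {a b x e} → Arm a b x e → I a
    base (pair p _ _ _ _ _) = p
    base (single p _ _ _ _ _ _ _) = p

    far : ∀ {a b x e} → Arm a b x e → e ≁ a
    far (pair Ia Ib _ _ _ refl) = independent Ib Ia
    far (single Ia _ a≢b _ _ _ _ u) = non λ e~a → u (Ia , e~a) a≢b

    far≢ : ∀ {a b x e} → Arm a b x e → e ≢ a
    far≢ (pair _ _ a≢b _ _ refl) refl = a≢b refl
    far≢ (single Ia Ib _ _ e~b _ _ _) refl = clash e~b (independent Ia Ib)

    flip : ∀ {a b x e} → Arm a b x e → (∀ {x e} → Arm b a x e → ⊥) → ⊥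
    flip (pair Ia Ib a≢b x~a x~b _) k = k (pair Ib Ia (≢-sym′ a≢b) x~b x~a refl)
    flip (single Ia Ib a≢b x~a e~b x~e u v) k = k (single Ib Ia (≢-sym′ a≢b) e~b x~a (sy x~e) v u)

    record Apart (x e y f : V) : Set where
      constructor separated
      field
        x≁y : x ≁ y
        x≁f : x ≁ f
        y≁e : y ≁ e
        e≁f : e ≁ f

    Apart-swap : ∀ {x e y f} → Apart x e y f → Apart y f x e
    Apart-swap (separated p q r s) = separated (sn p) r q (sn s)

    -- An edge `x`-`f` gives a bull with triangle `x`, `e`, `f` and pendants `b` and `c` if `e ~ f`,
    -- and otherwise a chair around `x` with leaves `a` and `e`.
    no-branch : ∀ {x e f a b c} → x ◁ a → e ◁ b → f ◁ c → x ~ e → x ≁ b → x ≁ c →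
      e ≁ a → e ≁ c → f ≁ a → f ≁ b → x ≁ f
    no-branch {x} {e} {f} (Ia , x~a) (Ib , e~b) (Ic , f~c) x~e x≁b x≁c e≁a e≁c f≁a f≁b = non go
      where
      go : x ~ f → ⊥
      go x~f with dec e f
      ... | inj₁ e~f = bull-free e~f (sy x~e) (sy x~f) e~b f~c e≁c f≁b x≁b x≁c (independent Ib Ic)
      ... | inj₂ e≁f = chair-free x~a x~e x~f f~c (sn e≁a) (sn f≁a) e≁f (sn x≁c) (independent Ic Ia)
                         (sn e≁c) λ { refl → outside (Ib , e~b) Ia }

    pair-single : ∀ {a b c x y f} → I a → I b → I c → a ≢ b → a ≢ c → b ≢ c →
      x ~ a → x ~ b → y ~ a → f ~ c → y ~ f →
      (∀ {i} → y ◁ i → i ≢ a → ⊥) → (∀ {i} → f ◁ i → i ≢ c → ⊥) → Apart x b y f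
    pair-single Ia Ib Ic a≢b a≢c b≢c x~a x~b y~a f~c y~f uy uf =
      separated (non λ x~y → bull-free x~y x~a y~a x~b y~f x≁f y≁b (independent Ia Ib) (sn f≁a) (sn f≁b))
        x≁f y≁b (sn f≁b)
      where
      f≁a = non λ f~a → uf (Ia , f~a) a≢c
      f≁b = non λ f~b → uf (Ib , f~b) b≢c
      y≁b = non λ y~b → uy (Ib , y~b) (≢-sym′ a≢b)
      x≁f = non λ x~f → private-pair x~f (Ia , x~a) f≁a (Ib , x~b) f≁b a≢b (Ic , f~c)
              (non λ x~c → few (Ia , x~a) (Ib , x~b) (Ic , x~c) a≢b a≢c b≢c)

    -- Two arms with different ends thus form an induced path `e`-`x`-`a`-`y`-`f`, the germ of the
    -- path or cycle that the whole graph turns out to be.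
    apart-arms : ∀ {a b c x e y f} → Arm a b x e → Arm a c y f → b ≢ c → Apart x e y f
    apart-arms (pair Ia Ib a≢b x~a x~b refl) (pair _ Ic a≢c y~a y~c refl) b≢c =
      separated (non λ x~y → crossing x~y (Ia , x~a) y~a (Ib , x~b) y≁b (Ic , y~c) x≁c) x≁c y≁b
        (independent Ib Ic)
      where
      y≁b = non λ y~b → few (Ia , y~a) (Ib , y~b) (Ic , y~c) a≢b a≢c b≢c
      x≁c = non λ x~c → few (Ia , x~a) (Ib , x~b) (Ic , x~c) a≢b a≢c b≢c
    apart-arms (pair Ia Ib a≢b x~a x~b refl) (single _ Ic a≢c y~a f~c y~f uy uf) b≢c =
      pair-single Ia Ib Ic a≢b a≢c b≢c x~a x~b y~a f~c y~f uy uf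
    apart-arms (single Ia Ib a≢b x~a e~b x~e ux ue) (pair _ Ic a≢c y~a y~c refl) b≢c =
      Apart-swap (pair-single Ia Ic Ib a≢c a≢b (≢-sym′ b≢c) y~a y~c x~a e~b x~e ux ue)
    apart-arms (single Ia Ib a≢b x~a e~b x~e ux ue) (single _ Ic a≢c y~a f~c y~f uy uf) b≢c =
      separated (non λ x~y → bull-free x~y x~a y~a x~e y~f x≁f y≁e (sn e≁a) (sn f≁a) e≁f) x≁f y≁e e≁f
      where
      e≁a = non λ p → ue (Ia , p) a≢b
      e≁c = non λ p → ue (Ic , p) (≢-sym′ b≢c)
      f≁a = non λ p → uf (Ia , p) a≢c
      f≁b = non λ p → uf (Ib , p) b≢c
      x≁b = non λ p → ux (Ib , p) (≢-sym′ a≢b)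
      x≁c = non λ p → ux (Ic , p) (≢-sym′ a≢c)
      y≁b = non λ p → uy (Ib , p) (≢-sym′ a≢b)
      y≁c = non λ p → uy (Ic , p) (≢-sym′ a≢c)
      x≁f = no-branch (Ia , x~a) (Ib , e~b) (Ic , f~c) x~e x≁b x≁c e≁a e≁c f≁a f≁b
      y≁e = no-branch (Ia , y~a) (Ic , f~c) (Ib , e~b) y~f y≁c y≁b f≁a f≁b e≁a e≁c
      e≁f = no-branch (Ib , e~b) (Ia , x~a) (Ic , f~c) (sy x~e) e≁a e≁c x≁b x≁c f≁b f≁a

    -- The neighbours of x away from a serve as far ends for other neighbours of a as well.
    extend : ∀ {a b x e u y} → Arm a b x e → x ~ u → u ≁ a → u ≢ a → y ~ a → y ~ u →
      (∀ {e} → Arm a b y e → ⊥) → ⊥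
    extend {a} {b} {x} {e} {u} {y} A x~u u≁a u≢a y~a y~u k with I? u
    ... | yes Iu = in-I A
      where
      in-I : Arm a b x e → ⊥
      in-I (pair Ia Ib a≢b x~a x~b _) =
        few (Ia , x~a) (Ib , x~b) (Iu , x~u) a≢b (≢-sym′ u≢a) λ { refl → k (pair Ia Ib a≢b y~a y~u refl) }
      in-I (single _ _ _ _ _ _ ux _) = ux (Iu , x~u) u≢a
    ... | no ¬Iu with maximal ¬Iu
    ... | i , ui@(Ii , u~i) = by A
      where
      finish : I a → I b → a ≢ b → (∀ {j} → u ◁ j → j ≢ b → ⊥) → ⊥
      finish Ia Ib a≢b uu with dec y b
      ... | inj₁ y~b = k (pair Ia Ib a≢b y~a y~b refl)
      ... | inj₂ y≁b = k (single Ia Ib a≢b y~a u~b y~u uy uu)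
        where
        u~b : u ~ b
        u~b = yea λ u≁b → uu ui (apart u~i u≁b)
        uy : ∀ {j} → y ◁ j → j ≢ a → ⊥
        uy yj j≢a = private-pair y~u (Ia , y~a) u≁a yj (non λ u~j → uu (proj₁ yj , u~j) (apart (proj₂ yj) y≁b))
          (≢-sym′ j≢a) (Ib , u~b) y≁b
      by : Arm a b x e → ⊥
      by (pair Ia Ib a≢b x~a x~b _) = finish Ia Ib a≢b λ {j} uj j≢b →
        clash (nested x~u (Ia , x~a) (Ib , x~b) a≢b uj
          (non λ x~j → few (Ia , x~a) (Ib , x~b) (proj₁ uj , x~j) a≢b
            (≢-sym′ (apart (proj₂ uj) u≁a)) (≢-sym′ j≢b)) (Ia , x~a)) u≁a
      by S@(single Ia Ib a≢b x~a e~b x~e ux ue) = finish Ia Ib a≢b λ {j} uj j≢b →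
        clash x~u (Apart.x≁f (apart-arms S (single Ia (proj₁ uj) (≢-sym′ (apart (proj₂ uj) u≁a)) x~a (proj₂ uj)
          x~u ux (λ ui′ i≢j → private-pair (sy x~u) ui′ (x≁ ui′) uj (x≁ uj) i≢j (Ia , x~a) u≁a)) (≢-sym′ j≢b)))
        where
        x≁ : ∀ {j} → u ◁ j → x ≁ j
        x≁ uj = non λ x~j → ux (proj₁ uj , x~j) (apart (proj₂ uj) u≁a)

    module Side {a b c x e y f} (ax : Arm a b x e) (ay : Arm a c y f) (b≢c : b ≢ c) where

      open Apart (apart-arms ax ay b≢c) public

      x≢y : x ≢ y
      x≢y = ≢-sym′ (apart (sy (edge ay)) (sn x≁f))

      not-both : ∀ {v e f} → Arm a b v e → Arm a c v f → ⊥
      not-both p q = clash (edge q) (Apart.x≁f (apart-arms p q b≢c))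

      -- To avoid chairs centred at `a`, the vertex `v` must see both `e` and `f`. By `extend` it
      -- would then start arms towards `b` and towards `c`, which `not-both` forbids.
      no-stranger : ∀ {v} → v ~ a → v ≢ x → v ≢ y → v ≁ x → v ≁ y → ⊥
      no-stranger {v} v~a v≢x v≢y v≁x v≁y =
        extend ax (edge ax) (far ax) (far≢ ax) v~a v~e λ ab →
        extend ay (edge ay) (far ay) (far≢ ay) v~a v~f λ ac → not-both ab ac
        where
        v~f : v ~ f
        v~f = yea λ v≁f → chair-free (sy v~a) (sy (near ax)) (sy (near ay)) (edge ay)
                v≁x v≁y x≁y (far ay) (sn v≁f) (sn x≁f) v≢x
        v~e : v ~ e
        v~e = yea λ v≁e → chair-free (sy v~a) (sy (near ay)) (sy (near ax)) (edge ax)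
                v≁y v≁x (sn x≁y) (far ax) (sn v≁e) (sn y≁e) v≢y

      same-side : ∀ {v} → v ~ a → v ~ x → v ≁ y → (∀ {e} → Arm a b v e → ⊥) → ⊥
      same-side {v} v~a v~x v≁y k with dec v e
      ... | inj₁ v~e = extend ax (edge ax) (far ax) (far≢ ax) v~a v~e k
      ... | inj₂ v≁e = bull-free (sy (near ax)) (sy v~a) (sy v~x) (sy (near ay)) (edge ax) (sn (far ax))
                         x≁y v≁y v≁e y≁e

    module Centre {a b c x e y f} (ax : Arm a b x e) (ay : Arm a c y f) (b≢c : b ≢ c) where

      open Side ax ay b≢c

      Near : V → Set
      Near v = v ~ a × v ≁ y × v ≢ y

      near-arm : ∀ {v} → Near v → (∀ {e} → Arm a b v e → ⊥) → ⊥
      near-arm {v} (v~a , v≁y , v≢y) k = by (dec v x)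
        where
        v≢x : v ≢ x
        v≢x refl = k ax
        by : v ~ x ⊎ v ≁ x → ⊥
        by (inj₁ v~x) = same-side v~a v~x v≁y k
        by (inj₂ v≁x) = no-stranger v~a v≢x v≢y v≁x v≁y

      near-uniform : ∀ {u v v′} → ¬ Near u → Near v → Near v′ → u ~ v → u ≁ v′ → ⊥
      near-uniform {u} {v} {v′} ¬Nu Nv@(v~a , v≁y , v≢y) Nv′@(v′~a , v′≁y , v′≢y) u~v u≁v′ =
        near-arm Nv λ av → near-arm Nv′ λ av′ → by av av′ (dec u a)
        where
        u≢a : u ≢ a
        u≢a refl = clash (sy v′~a) u≁v′
        u≢y : u ≢ y
        u≢y refl = clash u~v (sn v≁y)
        by : ∀ {e e′} → Arm a b v e → Arm a b v′ e′ → u ~ a ⊎ u ≁ a → ⊥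
        by av av′ (inj₁ u~a) = Side.same-side ay av′ (≢-sym′ b≢c) u~a
          (yea λ u≁y → ¬Nu (u~a , u≁y , u≢y)) u≁v′
          λ ac → clash u~v (sn (Apart.x≁y (apart-arms av ac b≢c)))
        by av av′ (inj₂ u≁a) = bull-free (sy v~a) (sy v′~a) v~v′ (sy (near ay)) (sy u~v) (sn u≁a)
            v≁y v′≁y (sn u≁v′) y≁u
          where
          v~v′ : v ~ v′
          v~v′ = yea λ v≁v′ → Side.no-stranger av ay b≢c v′~a (≢-sym′ (apart u~v u≁v′)) v′≢y (sn v≁v′) v′≁y
          y≁u : y ≁ u
          y≁u = non λ y~u → extend av (sy u~v) u≁a u≢a (near ay) y~u λ ab → not-both ab ay

      -- `Near`, the neighbours of `a` off `y`, is a module that omits `a`, so it has no second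
      -- member.
      near-unique : ∀ {v} → Near v → v ≢ x → ⊥
      near-unique {v} Nv v≢x = prime Near near-uniform Nv (near ax , x≁y , x≢y) v≢x a
        λ { (a~a , _) → clash a~a (~-irrefl a) }

    module TwoArms {a b c x e y f} (ax : Arm a b x e) (ay : Arm a c y f) (b≢c : b ≢ c) where

      open Side ax ay b≢c
      open Centre ax ay b≢c using (near-unique)

      near-unique′ : ∀ {v} → v ~ a → v ≁ x → v ≢ x → v ≢ y → ⊥
      near-unique′ v~a v≁x v≢x = Centre.near-unique ay ax (≢-sym′ b≢c) (v~a , v≁x , v≢x)

      Hub : V → Set
      Hub v = v ~ a × v ~ x × v ~ y

      hub-armless : ∀ {v g h} → Hub v → Arm a g v h → ⊥
      hub-armless {v} {g} (_ , v~x , v~y) A = not-b λ { refl → clash v~y (Apart.x≁y (apart-arms A ay b≢c)) }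
        where
        not-b : g ≢ b → ⊥
        not-b g≢b = clash v~x (Apart.x≁y (apart-arms A ax g≢b))

      hub-closed : ∀ {u v} → Hub v → u ~ v → u ≁ a → u ≢ a → ⊥
      hub-closed {u} {v} Hv@(v~a , v~x , v~y) u~v u≁a u≢a with I? u
      ... | yes Iu = hub-armless Hv (pair (base ax) Iu (≢-sym′ u≢a) v~a (sy u~v) refl)
      ... | no ¬Iu with maximal ¬Iu
      ... | i , ui@(Ii , u~i) = hub-armless Hv (single (base ax) Ii (≢-sym′ (apart u~i u≁a)) v~a u~i (sy u~v)
              alone λ uj j≢i → private-pair u~v uj (v≁ uj) ui (v≁ ui) j≢i (base ax , v~a) u≁a)
        where
        alone : ∀ {j} → v ◁ j → j ≢ a → ⊥
        alone (Ij , v~j) j≢a = hub-armless Hv (pair (base ax) Ij (≢-sym′ j≢a) v~a v~j refl)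
        v≁ : ∀ {j} → u ◁ j → v ≁ j
        v≁ uj = non λ v~j → alone (proj₁ uj , v~j) (apart (proj₂ uj) u≁a)

      -- A further neighbour of `a` is adjacent to both `x` and `y`. Such hubs start no arm, so
      -- their neighbours are `a` or neighbours of `a`; together with `a` they form a module that
      -- omits `x`.
      nbrs : ∀ {v} → v ~ a → v ≢ x → v ≢ y → ⊥
      nbrs {v} v~a v≢x v≢y = classify v~a v≢x v≢y λ Hv →
        prime Z uniform (inj₁ refl) (inj₂ Hv) (λ { refl → clash v~a (~-irrefl _) }) x
          λ { (inj₁ refl) → clash (near ax) (~-irrefl _) ; (inj₂ (_ , x~x , _)) → clash x~x (~-irrefl x) }
        where
        Z : V → Set
        Z v = v ≡ a ⊎ Hub v
        classify : ∀ {u} → u ~ a → u ≢ x → u ≢ y → ¬ ¬ Hub u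
        classify {u} u~a u≢x u≢y k with dec u x | dec u y
        ... | inj₁ p | inj₁ q = k (u~a , p , q)
        ... | inj₁ p | inj₂ q = near-unique (u~a , q , u≢y) u≢x
        ... | inj₂ p | inj₁ q = near-unique′ u~a p u≢x u≢y
        ... | inj₂ p | inj₂ q = no-stranger u~a u≢x u≢y p q
        uniform : ∀ {u v v′} → ¬ Z u → Z v → Z v′ → u ~ v → u ≁ v′ → ⊥
        uniform {u} {v} {v′} ¬Zu Zv Zv′ u~v u≁v′ = by (dec u a) Zv
          where
          u≢x : Z v′ → u ≢ x
          u≢x (inj₁ refl) refl = clash (near ax) u≁v′
          u≢x (inj₂ (_ , p , _)) refl = clash p (sn u≁v′)
          u≢y : Z v′ → u ≢ y
          u≢y (inj₁ refl) refl = clash (near ay) u≁v′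
          u≢y (inj₂ (_ , _ , p)) refl = clash p (sn u≁v′)
          by : u ~ a ⊎ u ≁ a → Z v → ⊥
          by (inj₁ u~a) _ = classify u~a (u≢x Zv′) (u≢y Zv′) λ Hu → ¬Zu (inj₂ Hu)
          by (inj₂ u≁a) (inj₁ refl) = clash u~v u≁a
          by (inj₂ u≁a) (inj₂ Hv) = hub-closed Hv u~v u≁a λ { refl → ¬Zu (inj₁ refl) }

      nbrs-are : ∀ {p q} → p ~ a → q ~ a → p ≢ q → (p ≡ x → q ≡ y → ⊥) → (p ≡ y → q ≡ x → ⊥) → ⊥
      nbrs-are {p} {q} p~a q~a p≢q k₁ k₂ = nbrs p~a p≢x λ p≡y →
        nbrs q~a (λ q≡x → k₂ p≡y q≡x) (λ q≡y → p≢q (trans p≡y (sym q≡y)))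
        where
        p≢x : p ≢ x
        p≢x p≡x = nbrs q~a (λ q≡x → p≢q (trans p≡x (sym q≡x))) (λ q≡y → k₁ p≡x q≡y)

      square : ∀ {r} → r ~ x → r ~ y → r ≢ a → ⊥
      square {r} r~x r~y r≢a with dec r a
      ... | inj₁ r~a = nbrs r~a (λ { refl → clash r~x (~-irrefl _) }) (λ { refl → clash r~y (~-irrefl _) })
      ... | inj₂ r≁a = extend ax (sy r~x) r≁a r≢a (near ay) (sy r~y) λ ab → not-both ab ay

    -- The invariant carried along edges. Excluding triangles and squares besides bounding the
    -- degree is what lets the next vertex satisfy it again.
    record Good (v : V) : Set where
      field
        degree : ∀ {p q r} → v ~ p → v ~ q → v ~ r → p ≢ q → p ≢ r → q ≢ r → ⊥
        no-triangle : ∀ {p q} → v ~ p → v ~ q → p ≢ q → p ~ q → ⊥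
        no-square : ∀ {p q r} → v ~ p → v ~ q → p ≢ q → r ~ p → r ~ q → r ≢ v → ⊥

    good-centre : ∀ {a b c x e y f} → Arm a b x e → Arm a c y f → b ≢ c → Good a
    good-centre {a} {x = x} {y = y} ax ay b≢c = record
      { degree = λ p q r p≢q p≢r q≢r → two-of-three (a ~_) p q r p≢q p≢r q≢r x
          λ u v u≢v u≢x v≢x → nbrs (sy u) u≢x λ { refl → nbrs (sy v) v≢x λ { refl → u≢v refl } }
      ; no-triangle = λ p q p≢q p~q → nbrs-are (sy p) (sy q) p≢q
          (λ { refl refl → clash p~q x≁y }) (λ { refl refl → clash p~q (sn x≁y) })
      ; no-square = λ p q p≢q r~p r~q r≢a → nbrs-are (sy p) (sy q) p≢q
          (λ { refl refl → square r~p r~q r≢a }) (λ { refl refl → square r~q r~p r≢a })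
      }
      where
      open TwoArms ax ay b≢c
      open Side ax ay b≢c using (x≁y)

    module Step {o p q : V} (good : Good p) (p~o : p ~ o) (p~q : p ~ q) (o≢q : o ≢ q) where
      open Good good

      o≁q : o ≁ q
      o≁q = non (no-triangle p~o p~q o≢q)

      Onward : V → Set
      Onward v = q ~ v × v ≢ p

      o≁ : ∀ {v} → Onward v → o ≁ v
      o≁ (q~v , v≢p) = non λ o~v → no-square p~o p~q o≢q (sy o~v) (sy q~v) v≢p

      p≁ : ∀ {v} → Onward v → p ≁ v
      p≁ (q~v , v≢p) = non λ p~v → degree p~o p~q p~v o≢q (λ { refl → clash q~v (sn o≁q) })
        λ { refl → clash q~v (~-irrefl _) }

      -- A vertex `u` separating `v` from `v′` gives a chair around `q` ending in `o` if `v ≁ v′`,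
      -- and otherwise a bull with triangle `q`, `v`, `v′` and pendants `p` and `u`. So `q` has at
      -- most one neighbour besides `p`.
      onward-uniform : ∀ {u v v′} → ¬ Onward u → Onward v → Onward v′ → u ~ v → u ≁ v′ → ⊥
      onward-uniform {u} {v} {v′} ¬Eu Ev@(q~v , v≢p) Ev′@(q~v′ , v′≢p) u~v u≁v′ =
        bull-free q~v q~v′ v~v′ (sy p~q) (sy u~v) q≁u (sn (p≁ Ev)) (sn (p≁ Ev′)) (sn u≁v′) p≁u
        where
        u≢p : u ≢ p
        u≢p refl = clash u~v (p≁ Ev)
        q≁u : q ≁ u
        q≁u = non λ q~u → ¬Eu (q~u , u≢p)
        v~v′ : v ~ v′
        v~v′ = yea λ v≁v′ → chair-free q~v q~v′ (sy p~q) p~o v≁v′ (sn (p≁ Ev)) (sn (p≁ Ev′))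
                 o≁q (o≁ Ev) (o≁ Ev′) (apart u~v u≁v′)
        p≁u : p ≁ u
        p≁u = non λ p~u → degree p~o p~q p~u o≢q (λ { refl → clash u~v (o≁ Ev) })
                λ { refl → clash q~v′ u≁v′ }

      onward-unique : ∀ {v v′} → Onward v → Onward v′ → v ≢ v′ → ⊥
      onward-unique Ev Ev′ v≢v′ = prime Onward onward-uniform Ev Ev′ v≢v′ p λ { (_ , p≢p) → p≢p refl }

      split : ∀ {v v′} → q ~ v → q ~ v′ → v ≢ v′ →
        (v ≡ p → Onward v′ → ⊥) → (v′ ≡ p → Onward v → ⊥) → ⊥
      split {v} {v′} q~v q~v′ v≢v′ k₁ k₂ = onward-unique (q~v , v≢p)
          (q~v′ , λ v′≡p → k₂ v′≡p (q~v , v≢p)) v≢v′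
        where
        v≢p : v ≢ p
        v≢p v≡p = k₁ v≡p (q~v′ , λ v′≡p → v≢v′ (trans v≡p (sym v′≡p)))

      wing : ∀ {v r} → Onward v → r ~ p → r ~ v → r ≢ q → ⊥
      wing Ev r~p r~v r≢q = degree p~o p~q (sy r~p) o≢q (λ { refl → clash r~v (o≁ Ev) }) (≢-sym′ r≢q)

      next : Good q
      next = record
        { degree = λ a b c a≢b a≢c b≢c → two-of-three (q ~_) a b c a≢b a≢c b≢c p
            λ u v u≢v u≢p v≢p → onward-unique (u , u≢p) (v , v≢p) u≢v
        ; no-triangle = λ a b a≢b a~b → split a b a≢b
            (λ { refl E → clash a~b (p≁ E) }) (λ { refl E → clash (sy a~b) (p≁ E) })
        ; no-square = λ a b a≢b r~a r~b r≢q → split a b a≢b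
            (λ { refl E → wing E r~a r~b r≢q }) (λ { refl E → wing E r~b r~a r≢q })
        }

    -- A good vertex with a good neighbour passes goodness on to its other neighbours by
    -- `Step.next`. The set reached is closed under adjacency, hence everything.
    spread : ∀ {a b c x e y f} → Arm a b x e → Arm a c y f → b ≢ c → MaxDegree≤2 adj
    spread {a} {x = x} {y = y} ax ay b≢c {v} p q r p≢q p≢r q≢r =
      prime Reached closed reached-a reached-x (λ { refl → clash (near ax) (~-irrefl _) }) v
        λ { (g , _) → Good.degree g p q r p≢q p≢r q≢r }
      where
      Reached : V → Set
      Reached v = Good v × ∃[ u ] v ~ u × Good u
      good-a : Good a
      good-a = good-centre ax ay b≢c
      good-x : Good x
      good-x = Step.next good-a (sy (near ay)) (sy (near ax)) (≢-sym′ (Side.x≢y ax ay b≢c))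
      reached-a : Reached a
      reached-a = good-a , x , sy (near ax) , good-x
      reached-x : Reached x
      reached-x = good-x , a , near ax , good-a
      closed : ∀ {u v v′} → ¬ Reached u → Reached v → Reached v′ → u ~ v → u ≁ v′ → ⊥
      closed {u} {v} ¬Ru (gv , g , v~g , gg) _ u~v _ =
        ¬Ru (Step.next gv v~g (sy u~v) g≢u , v , u~v , gv)
        where
        g≢u : g ≢ u
        g≢u refl = ¬Ru (gg , v , u~v , gv)

    module _ (F : Four) where
      open Four F

      disjoint-single : ∀ {u v i} → u ~ v → u ◁ i → (∀ {j} → u ◁ j → v ≁ j) →
        ∀ {k} → v ◁ k → u ≁ k → ∀ {j} → u ◁ j → j ≢ i → ⊥
      disjoint-single u~v ui d vk u≁k uj j≢i = private-pair u~v uj (d uj) ui (d ui) j≢i vk u≁k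

      -- Without an arm no edge leaves the set consisting of `a₁` and the vertices whose trace is
      -- `a₁` alone. Its complement is then a module containing two further elements of `I`.
      some-arm : (∀ {b x e} → Arm a₁ b x e → ⊥) → ⊥
      some-arm none = prime (λ v → ¬ S v)
        (λ ¬¬Sx ¬Ss _ x~s _ → ¬¬Sx λ Sx → closed ¬Ss Sx (sy x~s))
        (z i₂ n₁₂) (z i₃ n₁₃) n₂₃ a₁ λ ¬S → ¬S (inj₁ refl)
        where
        S : V → Set
        S v = v ≡ a₁ ⊎ (v ~ a₁ × (∀ {i} → v ◁ i → i ≢ a₁ → ⊥))
        z : ∀ {a} → I a → a₁ ≢ a → ¬ S a
        z _ n (inj₁ e) = n (sym e)
        z Ia _ (inj₂ (p , _)) = clash p (independent Ia i₁)
        closed : ∀ {u v} → ¬ S u → S v → u ~ v → ⊥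
        closed {u} {v} ¬Su Sv u~v = by Sv (dec u a₁)
          where
          on : u ~ a₁ → ⊥
          on u~a = ¬Su (inj₂ (u~a , λ ui i≢a → none (pair i₁ (proj₁ ui) (≢-sym′ i≢a) u~a (proj₂ ui) refl)))
          by : S v → u ~ a₁ ⊎ u ≁ a₁ → ⊥
          by (inj₁ refl) _ = on u~v
          by (inj₂ _) (inj₁ u~a) = on u~a
          by (inj₂ (v~a , alone)) (inj₂ u≁a) with I? u
          ... | yes Iu = alone (Iu , sy u~v) λ { refl → ¬Su (inj₁ refl) }
          ... | no ¬Iu with maximal ¬Iu
          ... | i , ui = none (single i₁ (proj₁ ui) (≢-sym′ (apart (proj₂ ui) u≁a)) v~a (proj₂ ui) (sy u~v) alone
                  (disjoint-single u~v ui (λ uj → non λ v~j → alone (proj₁ uj , v~j) (apart (proj₂ uj) u≁a))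
                    (i₁ , v~a) u≁a))

      -- If all arms at `a` and `b` run between these two, no edge leaves the set of `a`, `b` and
      -- the vertices whose trace lies in this pair. Its complement is a module with two further
      -- elements of `I`.
      other-arm : ∀ {a b x e} → Arm a b x e → I b → (∀ {c x e} → Arm a c x e → c ≢ b → ⊥) →
        (∀ {c x e} → Arm b c x e → c ≢ a → ⊥) → ⊥
      other-arm {a} {b} A Ib none-a none-b = two-of-four F a b λ Ic Id c≢d c≢a c≢b d≢a d≢b →
        prime (λ v → ¬ S v) (λ ¬¬Sx ¬Ss _ x~s _ → ¬¬Sx λ Sx → closed ¬Ss Sx (sy x~s))
          (λ Sc → proj₁ Sc Ic c≢a c≢b) (λ Sd → proj₁ Sd Id d≢a d≢b) c≢d a
          λ ¬Sa → ¬Sa ((λ _ a≢a _ → a≢a refl) , λ { (Ii , a~i) → ⊥-elim (clash a~i (independent (base A) Ii)) })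
        where
        S : V → Set
        S v = (I v → v ≢ a → v ≢ b → ⊥) × (∀ {i} → v ◁ i → i ≢ a → i ≢ b → ⊥)
        closed : ∀ {u v} → ¬ S u → S v → u ~ v → ⊥
        closed {u} {v} ¬Su (vI , vW) u~v with I? u
        ... | yes Iu = ¬Su ((λ _ → vW (Iu , sy u~v)) , λ { (Ii , u~i) → ⊥-elim (clash u~i (independent Iu Ii)) })
        ... | no ¬Iu = ¬Su ((λ Iu → ⊥-elim (¬Iu Iu)) , λ ui i≢a i≢b → beyond ui i≢a i≢b (I? v))
          where
          beyond : ∀ {i} → u ◁ i → i ≢ a → i ≢ b → Dec (I v) → ⊥
          beyond {i} ui@(Ii , u~i) i≢a i≢b = λ where
              (yes Iv) → vI Iv (λ { refl → clash u~v u≁a }) (λ { refl → clash u~v u≁b })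
              (no ¬Iv) → off (maximal ¬Iv)
            where
            u≁a : u ≁ a
            u≁a = non λ u~a → none-a (pair (base A) Ii (≢-sym′ i≢a) u~a u~i refl) i≢b
            u≁b : u ≁ b
            u≁b = non λ u~b → none-b (pair Ib Ii (≢-sym′ i≢b) u~b u~i refl) i≢a
            d : ∀ {j} → u ◁ j → v ≁ j
            d (Ij , u~j) = non λ v~j → vW (Ij , v~j) (apart u~j u≁a) (apart u~j u≁b)
            d′ : ∀ {j} → v ◁ j → u ≁ j
            d′ (Ij , v~j) = non λ u~j → vW (Ij , v~j) (apart u~j u≁a) (apart u~j u≁b)
            off : ∃[ j ] I j × v ~ j → ⊥
            off (j , vj@(Ij , v~j)) = vW vj
              (λ { refl → none-a (single Ij Ii (≢-sym′ i≢a) v~j u~i (sy u~v)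
                     (disjoint-single (sy u~v) vj d′ ui (d ui))
                     (disjoint-single u~v ui d vj (d′ vj))) i≢b })
              (λ { refl → none-b (single Ij Ii (≢-sym′ i≢b) v~j u~i (sy u~v)
                     (disjoint-single (sy u~v) vj d′ ui (d ui))
                     (disjoint-single u~v ui d vj (d′ vj))) i≢a })

      tip : ∀ {a b x e} → Arm a b x e → I b
      tip (pair _ p _ _ _ _) = p
      tip (single _ p _ _ _ _ _ _) = p

      degree≤2 : MaxDegree≤2 adj
      degree≤2 p q r p≢q p≢r q≢r = some-arm λ A → other-arm A (tip A)
        (λ A′ c≢b → spread A A′ (≢-sym′ c≢b) p q r p≢q p≢r q≢r)
        (λ B c≢a → flip A λ A′ → spread A′ B (≢-sym′ c≢a) p q r p≢q p≢r q≢r)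

  -- From traces to a dominating triple

  module _ (elems : List V) (complete : ∀ v → v ∈ᴸ elems) where

    infix 4 _⊑_
    _⊑_ : V → V → Set
    w ⊑ x = ∀ {i} → w ◁ i → x ~ i

    ⊑-trans : ∀ {u v w} → u ⊑ v → v ⊑ w → u ⊑ w
    ⊑-trans p q ui = q (proj₁ ui , p ui)

    -- Moves up along the list whenever the trace grows. The continuation form works under a double
    -- negation, so `⊑` is never decided.
    climb : ∀ (xs : List V) w →
      (∀ {m} → w ⊑ m → (∀ {x} → x ∈ᴸ xs → m ⊑ x → x ⊑ m) → ⊥) → ⊥
    climb [] w k = k proj₂ λ ()
    climb (x ∷ xs) w k = stay λ w⊑x → climb xs x λ x⊑m top → k (⊑-trans w⊑x x⊑m)
        λ { (here refl) _ → x⊑m ; (there p) → top p }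
      where
      stay : ¬ (w ⊑ x) → ⊥
      stay w⋢x = climb xs w λ w⊑m top → k w⊑m
        λ { (here refl) m⊑x → ⊥-elim (w⋢x (⊑-trans w⊑m m⊑x)) ; (there p) → top p }

    dominating-triple : Four → ¬ MaxDegree≤2 adj → ¬ NoDominatingTriple
    dominating-triple F ¬deg nd = ¬deg (AtMostTwo.degree≤2
      (λ p q r a≢b a≢c b≢c → large (three p q r a≢b a≢c b≢c)) F)
      where
      large : ∀ {w} → Three w → ⊥
      large {w} (three p q r a≢b a≢c b≢c) = climb elems w λ {m} w⊑m top →
        full-absurd nd F {m} λ {i} Ii → yea λ m≁i →
        partial-absurd nd (three (up w⊑m p) (up w⊑m q) (up w⊑m r) a≢b a≢c b≢c) Ii m≁i
          (λ {x} → top (complete x))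
        where
        up : ∀ {m i} → w ⊑ m → w ◁ i → m ◁ i
        up w⊑m wi = proj₁ wi , w⊑m wi

    -- While the chosen elements of `I` fail to dominate, a vertex missing them all has a new
    -- neighbour in `I`. Three failures produce the four elements that `dominating-triple` requires.
    dominating : V → ¬ MaxDegree≤2 adj → ¬ NoDominatingTriple
    dominating v₀ ¬deg nd = start (I? v₀)
      where
      fourth : ∀ {a b c d} → I a → I b → I c → I d → a ≢ b → a ≢ c → b ≢ c → a ≢ d → b ≢ d → c ≢ d → ⊥
      fourth Ia Ib Ic Id ab ac bc ad bd cd = dominating-triple (four Ia Ib Ic Id ab ac ad bc bd cd) ¬deg nd
      from : ∀ {a} → I a → ⊥
      from Ia = nd Ia Ia Ia λ ¬Iw wa _ _ → let (b , Ib , wb) = maximal ¬Iw ; b≢a = apart wb wa in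
        nd Ia Ib Ib λ ¬Iw wa wb _ → let (c , Ic , wc) = maximal ¬Iw ; c≢a = apart wc wa ; c≢b = apart wc wb in
        nd Ia Ib Ic λ ¬Iw wa wb wc → let (d , Id , wd) = maximal ¬Iw in
        fourth Ia Ib Ic Id (≢-sym′ b≢a) (≢-sym′ c≢a) (≢-sym′ c≢b)
          (≢-sym′ (apart wd wa)) (≢-sym′ (apart wd wb)) (≢-sym′ (apart wd wc))
      start : Dec (I v₀) → ⊥
      start (yes Iv)  = from Iv
      start (no ¬Iv) = from (proj₁ (proj₂ (maximal ¬Iv)))

-- A language of bounded vertex loops and its compilation

data Ty : Set where
  bool num rational : Ty

⟦_⟧ᵀ : Ty → Set
⟦ bool ⟧ᵀ     = Bool
⟦ num ⟧ᵀ      = ℕ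
⟦ rational ⟧ᵀ = ℚ

data Op : Ty → Set where
  or       : Op bool
  plus max : Op rational

infixl 6 _⊔ᵠ_
_⊔ᵠ_ : ℚ → ℚ → ℚ
p ⊔ᵠ q = if does (p ℚₚ.≤? q) then q else p

apply : ∀ {τ} → Op τ → ⟦ τ ⟧ᵀ → ⟦ τ ⟧ᵀ → ⟦ τ ⟧ᵀ
apply or   = _∨_
apply plus = _+ℚ_
apply max  = _⊔ᵠ_

unit : ∀ {τ} → Op τ → ⟦ τ ⟧ᵀ
unit or   = false
unit plus = 0ℚ
unit max  = 0ℚ

iter : {A : Set} {n : ℕ} → (Fin n → A → A) → A → A
iter {n = zero}  f a = a
iter {n = suc n} f a = iter (f ∘ suc) (f zero a)

-- A program works on families of arrays; an array of the family f is named by an index in Ix f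
-- and has one cell per vertex.
record Signature : Set₁ where
  field
    Fam  : Set
    ty   : Fam → Ty
    Ix   : Fam → Set
    enum : ∀ f → List (Ix f)
    enum-complete : ∀ f (i : Ix f) → i ∈ᴸ enum f
    _≟ᵃ_ : (f g : Fam) → Dec (f ≡ g)
    -- The flag tells the two copies of an array apart: the array itself and its shadow.
    name : Bool → ∀ f → Ix f → ℕ
    name-injective : ∀ {b c f g} {i : Ix f} {j : Ix g} → name b f i ≡ name c g j →
                     _≡_ {A = Bool × Σ Fam Ix} (b , f , i) (c , g , j)

module Language (𝕊 : Signature) (k : ℕ) where
  open Signature 𝕊

  data Exp : Ty → ℕ → Set where
    const  : ∀ {τ d} → ⟦ τ ⟧ᵀ → Exp τ d
    cell   : ∀ {d} f → Ix f → Fin d → Exp (ty f) d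
    adjᵉ   : ∀ {d} → Fin d → Fin d → Exp bool d
    leᵉ    : ∀ {d} → Fin d → Fin d → Exp bool d
    revᵉ   : ∀ {d} → Fin d → Fin k → Exp rational d
    _≤ᵉ_   : ∀ {d} → Exp rational d → Exp rational d → Exp bool d
    ifᵉ    : ∀ {τ d} → Exp bool d → Exp τ d → Exp τ d → Exp τ d
    bin    : ∀ {τ d} → Op τ → Exp τ d → Exp τ d → Exp τ d
    big    : ∀ {τ d} → Op τ → Exp τ (suc d) → Exp τ d

  infixr 4 _▸_
  data Cmd : ℕ → Set where
    nop    : ∀ {d} → Cmd d
    -- A simultaneous update of every cell of every array of `f`: right-hand sides read the old
    -- store. Their extra variable is the cell being written.
    assign : ∀ {d} f → (Ix f → Exp (ty f) (suc d)) → Cmd d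
    _▸_    : ∀ {d} → Cmd d → Cmd d → Cmd d
    for    : ∀ {d} → Cmd (suc d) → Cmd d

  -- Unrolled before the run; the length of the list may depend on `k` but not on the graph.
  each : ∀ {A : Set} {d} → List A → (A → Cmd d) → Cmd d
  each []       c = nop
  each (x ∷ xs) c = c x ▸ each xs c

  -- Natural array 1 holds the loop variables, the innermost one last; the arrays 2
  -- hold temporaries.

  level : ∀ {d} → Fin d → ℕ
  level {suc d} zero    = d
  level {suc d} (suc x) = level x

  var : ∀ {d} → Fin d → ℕExp
  var x = 1 ⟦ lit (level x) ⟧

  user shadow : ∀ f → Ix f → ℕ
  user   f i = 3 + name true f i
  shadow f i = 3 + name false f i

  move : Ty → ℕ → ℕExp → ℕ → ℕExp → Program
  move rational a e b e′ = a ⟦ e ⟧≔ᵠ b ⟦ e′ ⟧ᵠ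
  move bool     a e b e′ = a ⟦ e ⟧≔ b ⟦ e′ ⟧
  move num      a e b e′ = a ⟦ e ⟧≔ b ⟦ e′ ⟧

  bit : Bool → ℕ
  bit true  = 1
  bit false = 0

  put : ∀ τ → ⟦ τ ⟧ᵀ → ℕ → Program
  put rational x t = 2 ⟦ lit t ⟧≔ᵠ litᵠ x
  put bool     x t = 2 ⟦ lit t ⟧≔ lit (bit x)
  put num      x t = 2 ⟦ lit t ⟧≔ lit x

  merge : ∀ {τ} → Op τ → ℕ → Program
  merge or   t = ifᵗ lit 1 ≤ᵗ 2 ⟦ lit t ⟧ then skip else move bool 2 (lit t) 2 (lit (suc t))
  merge plus t = 2 ⟦ lit t ⟧≔ᵠ (2 ⟦ lit t ⟧ᵠ ⊕ᵠ 2 ⟦ lit (suc t) ⟧ᵠ)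
  merge max  t = ifᵗ 2 ⟦ lit t ⟧ᵠ ≤ᵠ 2 ⟦ lit (suc t) ⟧ᵠ
                   then move rational 2 (lit t) 2 (lit (suc t)) else skip

  loopᵖ : ℕ → Program → Program
  loopᵖ d P = 1 ⟦ lit d ⟧≔ lit 0 ⨾
    while (1 ⟦ lit d ⟧ ⊕ lit 1) ≤ᵗ order loop (P ⨾ 1 ⟦ lit d ⟧≔ (1 ⟦ lit d ⟧ ⊕ lit 1))

  test : Test → ℕ → Program
  test b t = ifᵗ b then put bool true t else put bool false t

  -- The value is left in temporary `t`, and only later temporaries are used on the way, so `t` is
  -- the top of a stack.
  comp : ∀ {τ d} → Exp τ d → ℕ → Program
  comp {τ} (const x) t     = put τ x t
  comp (cell f i x) t      = move (ty f) 2 (lit t) (user f i) (var x)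
  comp (adjᵉ x y) t        = test (adjᵗ (var x) (var y)) t
  comp (leᵉ x y) t         = test (var x ≤ᵗ var y) t
  comp (revᵉ x i) t        = 2 ⟦ lit t ⟧≔ᵠ revᵠ (var x) (lit (toℕ i))
  comp (p ≤ᵉ q) t          = comp p t ⨾ comp q (suc t) ⨾ test (2 ⟦ lit t ⟧ᵠ ≤ᵠ 2 ⟦ lit (suc t) ⟧ᵠ) t
  comp (ifᵉ b p q) t       = comp b t ⨾ ifᵗ lit 1 ≤ᵗ 2 ⟦ lit t ⟧ then comp p t else comp q t
  comp (bin o p q) t       = comp p t ⨾ comp q (suc t) ⨾ merge o t
  comp {τ} {d} (big o e) t = put τ (unit o) t ⨾ loopᵖ d (comp e (suc t) ⨾ merge o t)

  sequence : ∀ {A : Set} → List A → (A → Program) → Program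
  sequence []       P = skip
  sequence (x ∷ xs) P = P x ⨾ sequence xs P

  fill : ∀ {d} f → (Ix f → Exp (ty f) (suc d)) → Ix f → Program
  fill {d} f e i = loopᵖ d (comp (e i) 0 ⨾ move (ty f) (shadow f i) (var {suc d} zero) 2 (lit 0))

  copy : ℕ → ∀ f → Ix f → Program
  copy d f i = loopᵖ d (move (ty f) (user f i) (var {suc d} zero) (shadow f i) (var {suc d} zero))

  compile : ∀ {d} → Cmd d → Program
  compile nop              = skip
  -- All shadows are filled before any is copied back, which makes the update simultaneous.
  compile {d} (assign f e) = sequence (enum f) (fill f e) ⨾ sequence (enum f) (copy d f)
  compile (c ▸ c′)         = compile c ⨾ compile c′
  compile {d} (for c)      = loopᵖ d (compile c)

  -- Semantics, cost and correctness of compiled programs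

  module Semantics {n : ℕ} (G : Graph (Fin n)) (rev : Revenue n k) where
    open Execution G rev

    Store : Set
    Store = (f : Fam) → Ix f → Fin n → ⟦ ty f ⟧ᵀ

    set : Store → (f : Fam) → (Ix f → Fin n → ⟦ ty f ⟧ᵀ) → Store
    set s f x g with f ≟ᵃ g
    ... | yes refl = x
    ... | no _     = s g

    eval : ∀ {τ d} → Exp τ d → Vec (Fin n) d → Store → ⟦ τ ⟧ᵀ
    eval (const x) ρ s    = x
    eval (cell f i x) ρ s = s f i (lookup ρ x)
    eval (adjᵉ x y) ρ s   = adj G (lookup ρ x) (lookup ρ y)
    eval (leᵉ x y) ρ s    = does (toℕ (lookup ρ x) ℕₚ.≤? toℕ (lookup ρ y))
    eval (revᵉ x i) ρ s   = rev (lookup ρ x) i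
    eval (p ≤ᵉ q) ρ s     = does (eval p ρ s ℚₚ.≤? eval q ρ s)
    eval (ifᵉ b p q) ρ s  = if eval b ρ s then eval p ρ s else eval q ρ s
    eval (bin o p q) ρ s  = apply o (eval p ρ s) (eval q ρ s)
    eval (big o e) ρ s    = iter (λ v a → apply o a (eval e (v ∷ ρ) s)) (unit o)

    exec : ∀ {d} → Cmd d → Vec (Fin n) d → Store → Store
    exec nop ρ s          = s
    exec (assign f e) ρ s = set s f (λ i v → eval (e i) (v ∷ ρ) s)
    exec (c ▸ c′) ρ s     = exec c′ ρ (exec c ρ s)
    exec (for c) ρ s      = iter (λ v → exec c (v ∷ ρ)) s

    -- Upper bounds: a conditional is charged for both branches, and every merge for the dearest
    -- one, the 10 steps of `max`.
    costᴱ : ∀ {τ d} → Exp τ d → ℕ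
    costᴱ (const x)    = 3
    costᴱ (cell f i x) = 5
    costᴱ (adjᵉ x y)   = 9
    costᴱ (leᵉ x y)    = 9
    costᴱ (revᵉ x i)   = 6
    costᴱ (p ≤ᵉ q)     = costᴱ p + (costᴱ q + 9)
    costᴱ (ifᵉ b p q)  = costᴱ b + (5 + (costᴱ p + costᴱ q))
    costᴱ (bin o p q)  = costᴱ p + (costᴱ q + 10)
    -- The first 3 sets the accumulator. A loop takes 3 steps to reset its variable and 7 for the
    -- last guard, and each round adds 7 for the guard and 6 for the increment.
    costᴱ (big o e)    = 3 + (10 + n * (13 + (costᴱ e + 10)))

    total : ∀ {A : Set} → List A → (A → ℕ) → ℕ
    total []       c = 1
    total (x ∷ xs) c = c x + total xs c

    costᶜ : ∀ {d} → Cmd d → ℕ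
    costᶜ nop          = 1
    costᶜ (assign f e) = total (enum f) (λ i → 10 + n * (13 + (costᴱ (e i) + 5))) +
                         total (enum f) (λ i → 10 + n * (13 + 6))
    costᶜ (c ▸ c′)     = costᶜ c + costᶜ c′
    costᶜ (for c)      = 10 + n * (13 + costᶜ c)

    -- A Hoare triple for total correctness with a time bound, whose precondition is the concrete
    -- memory `σ`.
    record Runs (P : Program) (σ : Memory) (c : ℕ) (Q : Memory → Set) : Set where
      constructor runs
      field
        {final} : Memory
        {steps} : ℕ
        steps≤  : steps ≤ c
        halts   : ⟨ P , σ ⟩⇓⟨ final , steps ⟩
        post    : Q final

    runs-seq : ∀ {P P′ σ c c′} {Q R : Memory → Set} → Runs P σ c Q →
      (∀ {τ} → Q τ → Runs P′ τ c′ R) → Runs (P ⨾ P′) σ (c + c′) R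
    runs-seq (runs l h q) f with f q
    ... | runs l′ h′ r = runs (ℕₚ.+-mono-≤ l l′) (⇓seq h h′) r

    runs-mono : ∀ {P σ c c′} {Q R : Memory → Set} → c ≤ c′ → (∀ {τ} → Q τ → R τ) → Runs P σ c Q → Runs P σ c′ R
    runs-mono c≤c′ f (runs l h q) = runs (ℕₚ.≤-trans l c≤c′) h (f q)

    runs-then : ∀ {b P P′ σ c c′} {Q : Memory → Set} → evalᵗ b σ ≡ true → Runs P σ c Q →
      Runs (ifᵗ b then P else P′) σ (suc (costᵗ b + (c + c′))) Q
    runs-then {b} e (runs l h q) =
      runs (s≤s (ℕₚ.+-monoʳ-≤ (costᵗ b) (ℕₚ.≤-trans l (ℕₚ.m≤m+n _ _)))) (⇓then e h) q

    runs-else : ∀ {b P P′ σ c c′} {Q : Memory → Set} → evalᵗ b σ ≡ false → Runs P′ σ c′ Q →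
      Runs (ifᵗ b then P else P′) σ (suc (costᵗ b + (c + c′))) Q
    runs-else {b} e (runs l h q) =
      runs (s≤s (ℕₚ.+-monoʳ-≤ (costᵗ b) (ℕₚ.≤-trans l (ℕₚ.m≤n+m _ _)))) (⇓else e h) q

    update-same : ∀ {A : Set} (m : ℕ → ℕ → A) a i x → update m a i x a i ≡ x
    update-same m a i x rewrite dec-true (a ℕₚ.≟ a) refl | dec-true (i ℕₚ.≟ i) refl = refl

    update-array : ∀ {A : Set} (m : ℕ → ℕ → A) a b i x j → a ≢ b → update m a i x b j ≡ m b j
    update-array m a b i x j a≢b rewrite dec-false (a ℕₚ.≟ b) a≢b = refl

    update-cell : ∀ {A : Set} (m : ℕ → ℕ → A) a b {i j} x → i ≢ j → update m a i x b j ≡ m b j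
    update-cell m a b {i} {j} x i≢j rewrite dec-false (i ℕₚ.≟ j) i≢j with does (a ℕₚ.≟ b)
    ... | true  = refl
    ... | false = refl

    module _ (d : ℕ) (P : Program) (c : ℕ) (Inv : ℕ → Memory → Set)
      (reset : ∀ {i σ} x → Inv i σ → Inv i (memory (update (nat σ) 1 d x) (rat σ)))
      (step : ∀ (v : Fin n) {σ} → Inv (toℕ v) σ → nat σ 1 d ≡ toℕ v →
              Runs P σ c (λ τ → nat τ 1 d ≡ toℕ v × Inv (suc (toℕ v)) τ))
      where

      private
        guard : Test
        guard = (1 ⟦ lit d ⟧ ⊕ lit 1) ≤ᵗ order
        body : Program
        body = P ⨾ 1 ⟦ lit d ⟧≔ (1 ⟦ lit d ⟧ ⊕ lit 1)

      rounds : ∀ m i → i + m ≡ n → ∀ {σ} → Inv i σ → nat σ 1 d ≡ i →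
        Runs (while guard loop body) σ (7 + m * (13 + c)) (Inv n)
      rounds zero i e {σ} inv at = runs ℕₚ.≤-refl (⇓stop stop) (subst (λ j → Inv j σ) i≡n inv)
        where
        i≡n : i ≡ n
        i≡n = trans (sym (ℕₚ.+-identityʳ i)) e
        stop : evalᵗ guard σ ≡ false
        stop rewrite at | i≡n | ℕₚ.+-comm n 1 = dec-false (suc n ℕₚ.≤? n) (ℕₚ.<-irrefl refl)
      rounds (suc m) i e {σ} inv at with step v (subst (λ j → Inv j σ) (sym v≡i) inv) (trans at (sym v≡i))
        where
        i<n : i < n
        i<n = subst (suc i ≤_) (trans (sym (ℕₚ.+-suc i m)) e) (ℕₚ.m≤m+n (suc i) m)
        v : Fin n
        v = fromℕ< i<n
        v≡i : toℕ v ≡ i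
        v≡i = toℕ-fromℕ< i<n
      ... | runs {τ} {t} l h (at′ , inv′) with rounds m (suc i) (trans (sym (ℕₚ.+-suc i m)) e) inv″ at″
        where
        i<n : i < n
        i<n = subst (suc i ≤_) (trans (sym (ℕₚ.+-suc i m)) e) (ℕₚ.m≤m+n (suc i) m)
        v≡i : toℕ (fromℕ< i<n) ≡ i
        v≡i = toℕ-fromℕ< i<n
        τ′ : Memory
        τ′ = memory (update (nat τ) 1 d (nat τ 1 d + 1)) (rat τ)
        inv″ : Inv (suc i) τ′
        inv″ = reset _ (subst (λ j → Inv (suc j) τ) v≡i inv′)
        at″ : nat τ′ 1 d ≡ suc i
        at″ = trans (update-same (nat τ) 1 d _) (trans (ℕₚ.+-comm _ 1) (cong suc (trans at′ v≡i)))
      ... | runs l′ h′ q = runs time (⇓loop go (⇓seq h ⇓assign) h′) q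
        where
        go : evalᵗ guard σ ≡ true
        go rewrite at = dec-true (i + 1 ℕₚ.≤? n) (subst₂ _≤_ (ℕₚ.+-comm 1 i) (trans (sym (ℕₚ.+-suc i m)) e)
          (ℕₚ.m≤m+n (suc i) m))
        time : suc (costᵗ guard + (t + 6)) + _ ≤ 7 + suc m * (13 + c)
        time = ℕₚ.≤-trans (ℕₚ.+-mono-≤ (ℕₚ.+-monoʳ-≤ 7 (ℕₚ.+-monoˡ-≤ 6 l)) l′)
          (ℕₚ.≤-reflexive (trans (cong (λ z → 7 + z + (7 + m * (13 + c))) (ℕₚ.+-comm c 6))
            (x∙yz≈y∙xz (13 + c) 7 (m * (13 + c)))))

      runs-loop : ∀ {σ} → Inv 0 σ → Runs (loopᵖ d P) σ (10 + n * (13 + c)) (Inv n)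
      runs-loop {σ} inv with rounds n 0 refl {memory (update (nat σ) 1 d 0) (rat σ)} (reset 0 inv)
                               (update-same (nat σ) 1 d 0)
      ... | runs l h q = runs (s≤s (s≤s (s≤s l))) (⇓seq ⇓assign h) q

    Holds : ∀ τ → Memory → ℕ → ℕ → ⟦ τ ⟧ᵀ → Set
    Holds bool     σ a j x = nat σ a j ≡ bit x
    Holds num      σ a j x = nat σ a j ≡ x
    Holds rational σ a j x = rat σ a j ≡ x

    -- What code at loop depth `d` with stack top `t` leaves alone: the variables of enclosing
    -- loops, the temporaries below `t` and the arrays of the store.
    record Frame (d t : ℕ) (σ τ : Memory) : Set where
      field
        loops : ∀ {j} → j < d → nat τ 1 j ≡ nat σ 1 j
        tempN : ∀ {j} → j < t → nat τ 2 j ≡ nat σ 2 j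
        tempQ : ∀ {j} → j < t → rat τ 2 j ≡ rat σ 2 j
        restN : ∀ a j → nat τ (3 + a) j ≡ nat σ (3 + a) j
        restQ : ∀ a j → rat τ (3 + a) j ≡ rat σ (3 + a) j
    open Frame

    frame-refl : ∀ {d t σ} → Frame d t σ σ
    frame-refl = record { loops = λ _ → refl ; tempN = λ _ → refl ; tempQ = λ _ → refl
                        ; restN = λ _ _ → refl ; restQ = λ _ _ → refl }

    frame-trans : ∀ {d t ρ σ τ} → Frame d t ρ σ → Frame d t σ τ → Frame d t ρ τ
    frame-trans F F′ = record
      { loops = λ l → trans (loops F′ l) (loops F l)
      ; tempN = λ l → trans (tempN F′ l) (tempN F l)
      ; tempQ = λ l → trans (tempQ F′ l) (tempQ F l)
      ; restN = λ a j → trans (restN F′ a j) (restN F a j)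
      ; restQ = λ a j → trans (restQ F′ a j) (restQ F a j) }

    frame-weaken : ∀ {d d′ t t′ σ τ} → d ≤ d′ → t ≤ t′ → Frame d′ t′ σ τ → Frame d t σ τ
    frame-weaken d≤ t≤ F = record
      { loops = λ l → loops F (ℕₚ.≤-trans l d≤)
      ; tempN = λ l → tempN F (ℕₚ.≤-trans l t≤)
      ; tempQ = λ l → tempQ F (ℕₚ.≤-trans l t≤)
      ; restN = restN F ; restQ = restQ F }

    frame-tempN : ∀ {d t σ} x → Frame d t σ (memory (update (nat σ) 2 t x) (rat σ))
    frame-tempN {d} {t} {σ} x = record
      { loops = λ _ → refl
      ; tempN = λ l → update-cell (nat σ) 2 2 x (ℕₚ.>⇒≢ l)
      ; tempQ = λ _ → refl
      ; restN = λ _ _ → refl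
      ; restQ = λ _ _ → refl }

    frame-tempQ : ∀ {d t σ} x → Frame d t σ (memory (nat σ) (update (rat σ) 2 t x))
    frame-tempQ {d} {t} {σ} x = record
      { loops = λ _ → refl
      ; tempN = λ _ → refl
      ; tempQ = λ l → update-cell (rat σ) 2 2 x (ℕₚ.>⇒≢ l)
      ; restN = λ _ _ → refl
      ; restQ = λ _ _ → refl }

    frame-loop : ∀ {d t σ} x → Frame d t σ (memory (update (nat σ) 1 d x) (rat σ))
    frame-loop {d} {t} {σ} x = record
      { loops = λ l → update-cell (nat σ) 1 1 x (ℕₚ.>⇒≢ l)
      ; tempN = λ _ → refl
      ; tempQ = λ _ → refl
      ; restN = λ _ _ → refl
      ; restQ = λ _ _ → refl }

    temp-kept : ∀ τ {d t j σ σ′ x} → Frame d t σ σ′ → j < t → Holds τ σ 2 j x → Holds τ σ′ 2 j x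
    temp-kept bool     F l h = trans (tempN F l) h
    temp-kept num      F l h = trans (tempN F l) h
    temp-kept rational F l h = trans (tempQ F l) h

    rest-kept : ∀ τ {d t a j σ σ′ x} → Frame d t σ σ′ → Holds τ σ (3 + a) j x → Holds τ σ′ (3 + a) j x
    rest-kept bool     {a = a} {j} F h = trans (restN F a j) h
    rest-kept num      {a = a} {j} F h = trans (restN F a j) h
    rest-kept rational {a = a} {j} F h = trans (restQ F a j) h

    level< : ∀ {d} (x : Fin d) → level x < d
    level< {suc d} zero    = ℕₚ.n<1+n d
    level< {suc d} (suc x) = ℕₚ.m<n⇒m<1+n (level< x)

    Vars : ∀ {d} → Vec (Fin n) d → Memory → Set
    Vars {d} ρ σ = ∀ x → nat σ 1 (level x) ≡ toℕ (lookup ρ x)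

    record Models {d} (ρ : Vec (Fin n) d) (s : Store) (σ : Memory) : Set where
      field
        vars  : Vars ρ σ
        holds : ∀ f i v → Holds (ty f) σ (user f i) (toℕ v) (s f i v)
    open Models

    models-kept : ∀ {d t} {ρ : Vec (Fin n) d} {s σ τ} → Frame d t σ τ → Models ρ s σ → Models ρ s τ
    models-kept F M = record
      { vars  = λ x → trans (loops F (level< x)) (vars M x)
      ; holds = λ f i v → rest-kept (ty f) F (holds M f i v) }

    vars-push : ∀ {d} {ρ : Vec (Fin n) d} σ v → Vars ρ σ → nat σ 1 d ≡ toℕ v → Vars (v ∷ ρ) σ
    vars-push σ v V at zero    = at
    vars-push σ v V at (suc x) = V x

    models-push : ∀ {d} {ρ : Vec (Fin n) d} {s σ} v → Models ρ s σ → nat σ 1 d ≡ toℕ v → Models (v ∷ ρ) s σ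
    models-push {σ = σ} v M at = record { vars = vars-push σ v (vars M) at ; holds = holds M }

    models-pop : ∀ {d} {ρ : Vec (Fin n) d} {s σ} {v : Fin n} → Models (v ∷ ρ) s σ → Models ρ s σ
    models-pop M = record { vars = λ x → vars M (suc x) ; holds = holds M }

    put-ok : ∀ τ x {d t σ} → Runs (put τ x t) σ 3 (λ σ′ → Frame d t σ σ′ × Holds τ σ′ 2 t x)
    put-ok bool     x {σ = σ} = runs ℕₚ.≤-refl ⇓assign (frame-tempN (bit x) , update-same (nat σ) 2 _ _)
    put-ok num      x {σ = σ} = runs ℕₚ.≤-refl ⇓assign (frame-tempN x , update-same (nat σ) 2 _ _)
    put-ok rational x {σ = σ} = runs ℕₚ.≤-refl ⇓assignᵠ (frame-tempQ x , update-same (rat σ) 2 _ _)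

    Frame′ : ∀ τ (d t : ℕ) (σ σ′ : Memory) (x : ⟦ τ ⟧ᵀ) → Set
    Frame′ τ d t σ σ′ x = Frame d t σ σ′ × Holds τ σ′ 2 t x

    fetch : ∀ τ {d t a j σ x} e → evalℕ e σ ≡ j → Holds τ σ a j x →
      Runs (move τ 2 (lit t) a e) σ (suc (1 + suc (costℕ e))) (λ σ′ → Frame′ τ d t σ σ′ x)
    fetch bool {t = t} {σ = σ} e refl h = runs ℕₚ.≤-refl ⇓assign
      (frame-tempN _ , trans (update-same (nat σ) 2 _ _) h)
    fetch num {t = t} {σ = σ} e refl h = runs ℕₚ.≤-refl ⇓assign
      (frame-tempN _ , trans (update-same (nat σ) 2 _ _) h)
    fetch rational {t = t} {σ = σ} e refl h = runs ℕₚ.≤-refl ⇓assignᵠ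
      (frame-tempQ _ , trans (update-same (rat σ) 2 _ _) h)

    readAt-toℕ : ∀ {A : Set} (x : A) {m} (f : Fin m → A) v → readAt x f (toℕ v) ≡ f v
    readAt-toℕ x f zero    = refl
    readAt-toℕ x f (suc v) = readAt-toℕ x (f ∘ suc) v

    test-ok : ∀ b x {d t σ} → evalᵗ b σ ≡ x → Runs (test b t) σ (suc (costᵗ b + (3 + 0)))
      (λ σ′ → Frame d t σ σ′ × Holds bool σ′ 2 t x)
    test-ok b true  e = runs-then e (put-ok bool true)
    test-ok b false e = runs-mono (s≤s (ℕₚ.+-monoʳ-≤ (costᵗ b) (ℕₚ.≤-reflexive refl))) id
                          (runs-else {c = 0} e (put-ok bool false))

    merge-ok : ∀ {τ} (o : Op τ) x y {d t σ} → Holds τ σ 2 t x → Holds τ σ 2 (suc t) y →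
      Runs (merge o t) σ 10 (λ σ′ → Frame′ τ d t σ σ′ (apply o x y))
    merge-ok or true y {σ = σ} h h′ = runs-mono (ℕₚ.m≤m+n 6 4) id
      (runs-then {c′ = 0} (trans (cong (λ z → does (1 ℕₚ.≤? z)) h) refl)
        (runs (ℕₚ.≤-refl {1}) ⇓skip (frame-refl , h)))
    merge-ok or false y {σ = σ} h h′ = runs-mono (ℕₚ.m≤m+n 9 1) id
      (runs-else {c = 0} (trans (cong (λ z → does (1 ℕₚ.≤? z)) h) refl) (fetch bool (lit _) refl h′))
    merge-ok plus x y {σ = σ} h h′ = runs-mono (ℕₚ.m≤m+n 7 3) id
      (runs ℕₚ.≤-refl ⇓assignᵠ (frame-tempQ _ , trans (update-same (rat σ) 2 _ _) (cong₂ _+ℚ_ h h′)))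
    merge-ok max x y {d} {t} {σ} h h′ = by (does (x ℚₚ.≤? y)) refl
      where
      E : evalᵗ (2 ⟦ lit t ⟧ᵠ ≤ᵠ 2 ⟦ lit (suc t) ⟧ᵠ) σ ≡ does (x ℚₚ.≤? y)
      E = cong₂ (λ p q → does (p ℚₚ.≤? q)) h h′
      by : ∀ b → does (x ℚₚ.≤? y) ≡ b →
        Runs (merge max t) σ 10 (λ σ′ → Frame′ rational d t σ σ′ (x ⊔ᵠ y))
      by true  e rewrite e = runs-mono ℕₚ.≤-refl id
        (runs-then {c′ = 0} (trans E e) (fetch rational (lit _) refl h′))
      by false e rewrite e = runs-mono (ℕₚ.m≤m+n 7 3) id
        (runs-else {c = 0} (trans E e) (runs (ℕₚ.≤-refl {1}) ⇓skip (frame-refl , h)))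

    module _ {A : Set} (d : ℕ) (P : Program) (c : ℕ) (f : Fin n → A → A) (R : A → Memory → Set)
      (reset : ∀ {a σ} x → R a σ → R a (memory (update (nat σ) 1 d x) (rat σ)))
      (step : ∀ v {a σ} → R a σ → nat σ 1 d ≡ toℕ v →
              Runs P σ c (λ τ → nat τ 1 d ≡ toℕ v × R (f v a) τ))
      where

      private
        -- The state after `i` rounds, indexed by a number because the invariant of `runs-loop` is.
        -- Past the last round the default `id` leaves it unchanged.
        stage : ∀ {m} → (Fin m → A → A) → A → ℕ → A
        stage g a zero    = a
        stage g a (suc i) = readAt id g i (stage g a i)

        stage-suc : ∀ {m} (g : Fin (suc m) → A → A) a i →
          stage g a (suc i) ≡ stage (g ∘ suc) (g zero a) i
        stage-suc g a zero    = refl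
        stage-suc g a (suc i) = cong (readAt id (g ∘ suc) i) (stage-suc g a i)

        stage-iter : ∀ {m} (g : Fin m → A → A) a → stage g a m ≡ iter g a
        stage-iter {zero}  g a = refl
        stage-iter {suc m} g a = trans (stage-suc g a m) (stage-iter (g ∘ suc) (g zero a))

      runs-iter : ∀ {a σ} → R a σ → Runs (loopᵖ d P) σ (10 + n * (13 + c)) (R (iter f a))
      runs-iter {a} {σ} r = runs-mono ℕₚ.≤-refl (λ {τ} → subst (λ x → R x τ) (stage-iter f a))
        (runs-loop d P c (λ i → R (stage f a i)) reset
          (λ v {σ} r at → runs-mono ℕₚ.≤-refl
            (λ {τ} (at′ , r′) → at′ , subst (λ g → R (g (stage f a (toℕ v))) τ) (sym (readAt-toℕ id f v)) r′)
            (step v r at))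
          r)

    comp-ok : ∀ {τ d} (e : Exp τ d) t {ρ s σ} → Models ρ s σ →
      Runs (comp e t) σ (costᴱ e) (λ σ′ → Frame′ τ d t σ σ′ (eval e ρ s))
    comp-ok {τ} (const x) t M = put-ok τ x
    comp-ok (cell f i x) t {ρ} M = runs-mono ℕₚ.≤-refl id
      (fetch (ty f) (var x) (vars M x) (holds M f i (lookup ρ x)))
    comp-ok (adjᵉ x y) t {ρ} {s} {σ} M = test-ok (adjᵗ (var x) (var y)) _ E
      where
      E : evalᵗ (adjᵗ (var x) (var y)) σ ≡ adj G (lookup ρ x) (lookup ρ y)
      E rewrite vars M x | vars M y =
        trans (readAt-toℕ false (λ u → readAt false (adj G u) (toℕ (lookup ρ y))) (lookup ρ x))
              (readAt-toℕ false (adj G (lookup ρ x)) (lookup ρ y))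
    comp-ok (leᵉ x y) t M = test-ok (var x ≤ᵗ var y) _
      (cong₂ (λ p q → does (p ℕₚ.≤? q)) (vars M x) (vars M y))
    comp-ok (revᵉ x i) t {ρ} {s} {σ} M = runs ℕₚ.≤-refl ⇓assignᵠ
      (frame-tempQ _ , trans (update-same (rat σ) 2 _ _) E)
      where
      E : evalℚ (revᵠ (var x) (lit (toℕ i))) σ ≡ rev (lookup ρ x) i
      E rewrite vars M x = trans (readAt-toℕ 0ℚ (λ v → readAt 0ℚ (rev v) (toℕ i)) (lookup ρ x))
                                 (readAt-toℕ 0ℚ (rev (lookup ρ x)) i)
    comp-ok {d = d} (p ≤ᵉ q) t M =
      runs-seq (comp-ok p t M) λ {τ} (F , h) →
      runs-seq (comp-ok q (suc t) (models-kept F M)) λ {τ′} (F′ , h′) →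
      runs-mono ℕₚ.≤-refl (λ (F″ , h″) → frame-trans F (frame-trans (frame-weaken ℕₚ.≤-refl (ℕₚ.n≤1+n t) F′) F″) , h″)
        (test-ok _ _ (cong₂ (λ p q → does (p ℚₚ.≤? q)) (temp-kept rational F′ (ℕₚ.n<1+n t) h) h′))
    comp-ok {τ} {d} (ifᵉ b p q) t {ρ} {s} M =
      runs-seq (comp-ok b t M) λ {τ′} (F , h) → branch M F h (eval b ρ s) refl
      where
      Q : Memory → Bool → Memory → Set
      Q σ x σ′ = Frame′ τ d t σ σ′ (if x then eval p ρ s else eval q ρ s)
      branch : ∀ {σ τ′} → Models ρ s σ → Frame d t σ τ′ → nat τ′ 2 t ≡ bit (eval b ρ s) → ∀ x → eval b ρ s ≡ x →
        Runs (ifᵗ lit 1 ≤ᵗ 2 ⟦ lit t ⟧ then comp p t else comp q t) τ′ _ (Q σ (eval b ρ s))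
      branch M F h true  e rewrite e = runs-then (cong (λ z → does (1 ℕₚ.≤? z)) h)
        (runs-mono ℕₚ.≤-refl (λ (F′ , h′) → frame-trans F F′ , h′) (comp-ok p t (models-kept F M)))
      branch M F h false e rewrite e = runs-else (cong (λ z → does (1 ℕₚ.≤? z)) h)
        (runs-mono ℕₚ.≤-refl (λ (F′ , h′) → frame-trans F F′ , h′) (comp-ok q t (models-kept F M)))
    comp-ok (bin o p q) t {ρ} {s} M =
      runs-seq (comp-ok p t M) λ (F , h) →
      runs-seq (comp-ok q (suc t) (models-kept F M)) λ (F′ , h′) →
      runs-mono ℕₚ.≤-refl (λ (F″ , h″) → frame-trans F (frame-trans (frame-weaken ℕₚ.≤-refl (ℕₚ.n≤1+n t) F′) F″) , h″)
        (merge-ok o (eval p ρ s) (eval q ρ s) (temp-kept _ F′ (ℕₚ.n<1+n t) h) h′)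
    comp-ok {τ} {d} (big o e) t {ρ} {s} {σ} M =
      runs-seq (put-ok τ (unit o)) λ (F , h) →
      runs-iter d _ _ (λ v a → apply o a (eval e (v ∷ ρ) s))
        (λ a σ′ → Frame′ τ d t σ σ′ a)
        (λ x (F , h) → frame-trans F (frame-loop x) , temp-kept τ (frame-loop {d} {suc t} x) (ℕₚ.n<1+n t) h)
        (λ v {a} (F , h) at →
          runs-seq (comp-ok e (suc t) (models-push v (models-kept F M) at)) λ (F′ , h′) →
          runs-mono ℕₚ.≤-refl (λ (F″ , h″) →
              trans (loops F″ (ℕₚ.n<1+n d)) (trans (loops F′ (ℕₚ.n<1+n d)) at) ,
              frame-trans F (frame-trans (frame-weaken (ℕₚ.n≤1+n d) (ℕₚ.n≤1+n t) F′)
                                         (frame-weaken (ℕₚ.n≤1+n d) ℕₚ.≤-refl F″)) , h″)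
            (merge-ok o a (eval e (v ∷ ρ) s) (temp-kept τ F′ (ℕₚ.n<1+n t) h) h′))
        (F , h)

    record Stored (τ : Ty) (a j : ℕ) (x : ⟦ τ ⟧ᵀ) (σ σ′ : Memory) : Set where
      field
        new   : Holds τ σ′ a j x
        other : ∀ τ′ b l y → (b ≢ a ⊎ l ≢ j) → Holds τ′ σ b l y → Holds τ′ σ′ b l y
    open Stored

    update-elsewhere : ∀ {A : Set} (m : ℕ → ℕ → A) a j x b l → (b ≢ a ⊎ l ≢ j) → update m a j x b l ≡ m b l
    update-elsewhere m a j x b l (inj₁ ne) = update-array m a b j x l (ne ∘ sym)
    update-elsewhere m a j x b l (inj₂ ne) = update-cell m a b x (ne ∘ sym)

    store-ok : ∀ τ {a b j x σ} e e′ → evalℕ e σ ≡ j → Holds τ σ b (evalℕ e′ σ) x →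
      Runs (move τ a e b e′) σ (suc (costℕ e + suc (costℕ e′))) (Stored τ a j x σ)
    store-ok bool {a} {σ = σ} e e′ refl h = runs ℕₚ.≤-refl ⇓assign record
      { new = trans (update-same (nat σ) a _ _) h
      ; other = λ { bool b l y ne h → trans (update-elsewhere (nat σ) a _ _ b l ne) h
                  ; num b l y ne h → trans (update-elsewhere (nat σ) a _ _ b l ne) h
                  ; rational b l y ne h → h } }
    store-ok num {a} {σ = σ} e e′ refl h = runs ℕₚ.≤-refl ⇓assign record
      { new = trans (update-same (nat σ) a _ _) h
      ; other = λ { bool b l y ne h → trans (update-elsewhere (nat σ) a _ _ b l ne) h
                  ; num b l y ne h → trans (update-elsewhere (nat σ) a _ _ b l ne) h
                  ; rational b l y ne h → h } }
    store-ok rational {a} {σ = σ} e e′ refl h = runs ℕₚ.≤-refl ⇓assignᵠ record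
      { new = trans (update-same (rat σ) a _ _) h
      ; other = λ { bool b l y ne h → h
                  ; num b l y ne h → h
                  ; rational b l y ne h → trans (update-elsewhere (rat σ) a _ _ b l ne) h } }

    -- Used twice, for computing the shadows and for copying them back; `Keep` is whatever must
    -- survive meanwhile.
    module Filling {d f} (P : Ix f → Program) (c : Ix f → ℕ) (arr : Ix f → ℕ)
      (arr-injective : ∀ {i j} → arr i ≡ arr j → i ≡ j)
      (val : Ix f → Fin n → ⟦ ty f ⟧ᵀ) (Keep : Memory → Set)
      (keep-reset : ∀ {σ} x → Keep σ → Keep (memory (update (nat σ) 1 d x) (rat σ)))
      (step : ∀ i v {σ} → Keep σ → nat σ 1 d ≡ toℕ v → Runs (P i) σ (c i) (λ τ →
        nat τ 1 d ≡ toℕ v × Keep τ × Holds (ty f) τ (3 + arr i) (toℕ v) (val i v) ×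
        (∀ j l y → (j ≢ i ⊎ l ≢ toℕ v) → Holds (ty f) σ (3 + arr j) l y → Holds (ty f) τ (3 + arr j) l y)))
      (_≟_ : ∀ (i j : Ix f) → Dec (i ≡ j)) where

      Done : (Ix f → Set) → Memory → Set
      Done D σ = Keep σ × (∀ {i} → D i → ∀ v → Holds (ty f) σ (3 + arr i) (toℕ v) (val i v))

      one : ∀ {D : Ix f → Set} i {σ} → Done D σ →
        Runs (loopᵖ d (P i)) σ (10 + n * (13 + c i)) (Done (λ j → j ≡ i ⊎ D j))
      one {D} i {σ} done = runs-mono ℕₚ.≤-refl
          (λ { (K , h , g) → K , λ { (inj₁ refl) v → g v (toℕ<n v) ; (inj₂ p) v → h p v } })
          (runs-loop d (P i) (c i) Inv
            (λ x (K , h , g) → keep-reset x K , (λ p v → rest-kept (ty f) (frame-loop {d} {0} x) (h p v)) ,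
                               λ v l → rest-kept (ty f) (frame-loop {d} {0} x) (g v l))
            advance
            (proj₁ done , proj₂ done , λ v ()))
        where
        Inv : ℕ → Memory → Set
        Inv m σ = Keep σ × (∀ {j} → D j → ∀ v → Holds (ty f) σ (3 + arr j) (toℕ v) (val j v)) ×
                  (∀ v → toℕ v < m → Holds (ty f) σ (3 + arr i) (toℕ v) (val i v))
        advance : ∀ v {σ} → Inv (toℕ v) σ → nat σ 1 d ≡ toℕ v →
          Runs (P i) σ (c i) (λ τ → nat τ 1 d ≡ toℕ v × Inv (suc (toℕ v)) τ)
        advance v (K , h , g) at = runs-mono ℕₚ.≤-refl (λ {τ} (at′ , K′ , new , old) →
            at′ , K′ , (λ {j} p u → keep-old new old j u (h p u)) ,
            λ u l → keep-new {τ} new old u (ℕₚ.m<1+n⇒m<n∨m≡n l)) (step i v K at)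
          where
          keep-old : ∀ {σ τ} → Holds (ty f) τ (3 + arr i) (toℕ v) (val i v) →
            (∀ j l y → (j ≢ i ⊎ l ≢ toℕ v) → Holds (ty f) σ (3 + arr j) l y → Holds (ty f) τ (3 + arr j) l y) →
            ∀ j u → Holds (ty f) σ (3 + arr j) (toℕ u) (val j u) → Holds (ty f) τ (3 + arr j) (toℕ u) (val j u)
          keep-old {σ} {τ} new old j u hold with j ≟ i | toℕ u ℕₚ.≟ toℕ v
          ... | no ne | _ = old j _ _ (inj₁ ne) hold
          ... | yes _ | no ne = old j _ _ (inj₂ ne) hold
          ... | yes refl | yes e = subst (λ w → Holds (ty f) τ (3 + arr i) (toℕ w) (val i w))
                                    (sym (toℕ-injective e)) new
          keep-new : ∀ {τ} → Holds (ty f) τ (3 + arr i) (toℕ v) (val i v) →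
            (∀ j l y → (j ≢ i ⊎ l ≢ toℕ v) → Holds (ty f) _ (3 + arr j) l y → Holds (ty f) τ (3 + arr j) l y) →
            ∀ u → (toℕ u < toℕ v ⊎ toℕ u ≡ toℕ v) → Holds (ty f) τ (3 + arr i) (toℕ u) (val i u)
          keep-new new old u (inj₁ l) = old i _ _ (inj₂ (ℕₚ.<⇒≢ l)) (g u l)
          keep-new {τ} new old u (inj₂ e) = subst (λ w → Holds (ty f) τ (3 + arr i) (toℕ w) (val i w))
                                             (sym (toℕ-injective e)) new

      many : ∀ {D : Ix f → Set} (is : List (Ix f)) {σ} → Done D σ →
        Runs (sequence is (λ i → loopᵖ d (P i))) σ (total is (λ i → 10 + n * (13 + c i)))
          (Done (λ j → D j ⊎ j ∈ᴸ is))
      many [] (K , h) = runs (ℕₚ.≤-refl {1}) ⇓skip (K , λ { (inj₁ p) → h p })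
      many (i ∷ is) done = runs-seq (one i done) λ done′ → runs-mono ℕₚ.≤-refl
        (λ { (K , h) → K , λ { (inj₁ p) → h (inj₁ (inj₂ p)) ; (inj₂ (here e)) → h (inj₁ (inj₁ e))
                             ; (inj₂ (there p)) → h (inj₂ p) } }) (many is done′)

      all : ∀ {σ} → Keep σ → Runs (sequence (enum f) (λ i → loopᵖ d (P i))) σ
        (total (enum f) (λ i → 10 + n * (13 + c i)))
        (λ τ → Keep τ × (∀ i v → Holds (ty f) τ (3 + arr i) (toℕ v) (val i v)))
      all K = runs-mono ℕₚ.≤-refl (λ { (K , h) → K , λ i → h (inj₂ (enum-complete f i)) })
        (many {λ _ → ⊥} (enum f) (K , λ ()))

    same-index : ∀ {b c f} {i j : Ix f} → name b f i ≡ name c f j → b ≡ c × i ≡ j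
    same-index e = split (name-injective e)
      where
      split : ∀ {b c f} {i j : Ix f} → _≡_ {A = Bool × Σ Fam Ix} (b , f , i) (c , f , j) → b ≡ c × i ≡ j
      split refl = refl , refl

    index-≟ : ∀ {f} (i j : Ix f) → Dec (i ≡ j)
    index-≟ {f} i j with name true f i ℕₚ.≟ name true f j
    ... | yes e = yes (proj₂ (same-index e))
    ... | no ne = no λ { refl → ne refl }

    compile-ok : ∀ {d} (c : Cmd d) {ρ s σ} → Models ρ s σ →
      Runs (compile c) σ (costᶜ c) (Models ρ (exec c ρ s))
    compile-ok nop M = runs (ℕₚ.≤-refl {1}) ⇓skip M
    compile-ok (c ▸ c′) M = runs-seq (compile-ok c M) λ M′ → compile-ok c′ M′
    compile-ok {d} (for c) {ρ} {s} M = runs-iter d (compile c) (costᶜ c) (λ v → exec c (v ∷ ρ)) (Models ρ)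
      (λ x → models-kept (frame-loop {d} {0} x))
      (λ v M at → runs-mono ℕₚ.≤-refl (λ M′ → vars M′ zero , models-pop M′) (compile-ok c (models-push v M at)))
      M
    compile-ok {d} (assign f e) {ρ} {s} M = runs-seq (Fill.all M) λ (M , h) →
        runs-mono ℕₚ.≤-refl done (Copy.all (vars M , (λ g i v _ → holds M g i v) , h))
      where
      val : Ix f → Fin n → ⟦ ty f ⟧ᵀ
      val i v = eval (e i) (v ∷ ρ) s

      -- During the copying the family `f` itself is in transition, so only the other families and
      -- the finished shadows are promised.
      Shadowed : Memory → Set
      Shadowed σ = Vars ρ σ × (∀ g i v → g ≢ f → Holds (ty g) σ (user g i) (toℕ v) (s g i v)) ×
                   (∀ i v → Holds (ty f) σ (shadow f i) (toℕ v) (val i v))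

      3+≢ : ∀ {a b} → a ≢ b → 3 + a ≢ 3 + b
      3+≢ ne refl = ne refl

      fam≢ : ∀ {b c g h} {i : Ix g} {j : Ix h} → g ≢ h → name b g i ≢ name c h j
      fam≢ ne e = ne (cong (λ p → proj₁ (proj₂ p)) (name-injective e))

      kept : ∀ {σ τ} → Frame (suc d) 0 σ τ → Models ρ s σ → Models ρ s τ
      kept F = models-kept (frame-weaken (ℕₚ.n≤1+n d) ℕₚ.≤-refl F)
      tags : ∀ {g} {j : Ix g} {i : Ix f} → name true g j ≡ name false f i → ⊥
      tags p with cong proj₁ (name-injective p)
      ... | ()
      differs : ∀ b {i j} {l m : ℕ} → (j ≢ i ⊎ l ≢ m) → (3 + name b f j ≢ 3 + name b f i ⊎ l ≢ m)
      differs b (inj₁ ne) = inj₁ (3+≢ λ p → ne (proj₂ (same-index p)))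
      differs b (inj₂ ne) = inj₂ ne

      models-stored : ∀ {i l x σ τ} → Stored (ty f) (shadow f i) l x σ τ → Models ρ s σ → Models ρ s τ
      models-stored S M = record
        { vars  = λ x → other S num 1 _ _ (inj₁ λ ()) (vars M x)
        ; holds = λ g j u → other S (ty g) _ _ _ (inj₁ (3+≢ λ p → tags p)) (holds M g j u) }

      module Fill = Filling {d} {f} (λ i → comp (e i) 0 ⨾ move (ty f) (shadow f i) (var {suc d} zero) 2 (lit 0))
        (λ i → costᴱ (e i) + 5) (name false f) (λ e → proj₂ (same-index e)) val (Models ρ s)
        (λ x → models-kept (frame-loop {d} {0} x))
        (λ i v {σ} M at → runs-seq (comp-ok (e i) 0 (models-push v M at)) λ {τ} (F , h) →
          runs-mono ℕₚ.≤-refl (λ S →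
            other S num 1 d _ (inj₁ λ ()) (trans (loops F (ℕₚ.n<1+n d)) at) ,
            models-stored S (kept F M) ,
            new S ,
            λ j l y ne h → other S (ty f) _ _ _ (differs false ne) (rest-kept (ty f) F h))
            (store-ok (ty f) (var {suc d} zero) (lit 0) (trans (loops F (ℕₚ.n<1+n d)) at) h))
        index-≟

      module Copy = Filling {d} {f} (λ i → move (ty f) (user f i) (var {suc d} zero) (shadow f i) (var {suc d} zero))
        (λ _ → 6) (name true f) (λ e → proj₂ (same-index e)) val Shadowed
        (λ {σ} x (V , h , h′) → (λ y → trans (loops (frame-loop {d} {0} {σ} x) (level< y)) (V y)) ,
            (λ g i v ne → rest-kept (ty g) (frame-loop {d} {0} x) (h g i v ne)) ,
            λ i v → rest-kept (ty f) (frame-loop {d} {0} x) (h′ i v))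
        (λ i v {σ} (V , h , h′) at → runs-mono ℕₚ.≤-refl (λ S →
            other S num 1 d _ (inj₁ λ ()) at ,
            ((λ x → other S num 1 _ _ (inj₁ λ ()) (V x)) ,
             (λ g j u ne → other S (ty g) _ _ _ (inj₁ (3+≢ (fam≢ ne))) (h g j u ne)) ,
             (λ j u → other S (ty f) _ _ _ (inj₁ (3+≢ λ p → tags (sym p))) (h′ j u))) ,
            new S ,
            λ j l y ne → other S (ty f) _ _ _ (differs true ne))
            (store-ok (ty f) (var {suc d} zero) (var {suc d} zero) at
              (subst (λ l → Holds (ty f) σ (shadow f i) l (val i v)) (sym at) (h′ i v))))
        index-≟

      done : ∀ {τ} → Shadowed τ × (∀ i v → Holds (ty f) τ (user f i) (toℕ v) (val i v)) →
             Models ρ (set s f val) τ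
      done {τ} ((V , h , _) , h′) = record { vars = V ; holds = by }
        where
        by : ∀ g i v → Holds (ty g) τ (user g i) (toℕ v) (set s f val g i v)
        by g i v with f ≟ᵃ g
        ... | yes refl = h′ i v
        ... | no ne    = h g i v (ne ∘ sym)

-- Booleans, colour sets and sums

true≢false : {A : Set} {b : Bool} → b ≡ true → b ≡ false → A
true≢false refl ()

∧-true⁻ : ∀ {a b} → a ∧ b ≡ true → a ≡ true × b ≡ true
∧-true⁻ {true} {true} _ = refl , refl

∧-true⁺ : ∀ {a b} → a ≡ true → b ≡ true → a ∧ b ≡ true
∧-true⁺ refl refl = refl

not-true⁻ : ∀ {a} → not a ≡ true → a ≡ false
not-true⁻ {false} _ = refl

not-false⁺ : ∀ {a} → a ≡ false → not a ≡ true
not-false⁺ refl = refl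

∨-true⁻ : ∀ {a b} → a ∨ b ≡ true → a ≡ true ⊎ b ≡ true
∨-true⁻ {true}  _ = inj₁ refl
∨-true⁻ {false} p = inj₂ p

∨-true⁺₁ : ∀ {a b} → a ≡ true → a ∨ b ≡ true
∨-true⁺₁ refl = refl

∨-true⁺₂ : ∀ {a b} → b ≡ true → a ∨ b ≡ true
∨-true⁺₂ {true}  refl = refl
∨-true⁺₂ {false} refl = refl

bool-cases : ∀ b → b ≡ true ⊎ b ≡ false
bool-cases true  = inj₁ refl
bool-cases false = inj₂ refl

if-true : ∀ {A : Set} {b} {x y : A} → b ≡ true → (if b then x else y) ≡ x
if-true refl = refl

if-false : ∀ {A : Set} {b} {x y : A} → b ≡ false → (if b then x else y) ≡ y
if-false refl = refl

infix 7 _≡ᶠ_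
_≡ᶠ_ : ∀ {n} → Fin n → Fin n → Bool
u ≡ᶠ v = does (u ≟ᶠ v)

≡ᶠ-refl : ∀ {n} (u : Fin n) → u ≡ᶠ u ≡ true
≡ᶠ-refl u = dec-true (u ≟ᶠ u) refl

≡ᶠ⇒≡ : ∀ {n} {u v : Fin n} → u ≡ᶠ v ≡ true → u ≡ v
≡ᶠ⇒≡ {u = u} {v} p with u ≟ᶠ v
... | yes e = e
... | no _ = true≢false p refl

≢⇒≡ᶠ : ∀ {n} {u v : Fin n} → u ≢ v → u ≡ᶠ v ≡ false
≢⇒≡ᶠ {u = u} {v} = dec-false (u ≟ᶠ v)

∈-tabulate⁺ : ∀ {k} (P : Fin k → Bool) {i} → P i ≡ true → i ∈ tabulate P
∈-tabulate⁺ P {i} p = lookup⇒[]= i _ (trans (lookup∘tabulate P i) p)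

∈-tabulate⁻ : ∀ {k} (P : Fin k → Bool) {i} → i ∈ tabulate P → P i ≡ true
∈-tabulate⁻ P {i} p = trans (sym (lookup∘tabulate P i)) ([]=⇒lookup p)

∈-─⁻ : ∀ {k} {p q : Subset k} {i} → i ∈ p ─ q → i ∉ q
∈-─⁻ {p = _ Data.Vec.Base.∷ p} {Sub.outside Data.Vec.Base.∷ q} {zero} a ()
∈-─⁻ {p = _ Data.Vec.Base.∷ p} {Sub.inside Data.Vec.Base.∷ q} {zero} () b
∈-─⁻ {p = _ Data.Vec.Base.∷ p} {_ Data.Vec.Base.∷ q} {suc i} (Data.Vec.Base.there a) (Data.Vec.Base.there b) = ∈-─⁻ {p = p} a b

sum-mono : ∀ {n} {f g : Fin n → ℚ} → (∀ v → f v ≤ℚ g v) → sum f ≤ℚ sum g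
sum-mono {zero}  h = ℚₚ.≤-refl
sum-mono {suc n} h = ℚₚ.+-mono-≤ (h zero) (sum-mono (h ∘ suc))

sum-extract : ∀ {n} (f : Fin n → ℚ) u → sum f ≡ f u +ℚ sum (λ v → if v ≡ᶠ u then 0ℚ else f v)
sum-extract {suc n} f zero = cong (f zero +ℚ_) (sym (ℚₚ.+-identityˡ _))
sum-extract {suc n} f (suc u) = begin
  f zero +ℚ sum (f ∘ suc)            ≡⟨ cong (f zero +ℚ_) (sum-extract (f ∘ suc) u) ⟩
  f zero +ℚ (f (suc u) +ℚ rest)      ≡⟨ sym (ℚₚ.+-assoc (f zero) (f (suc u)) rest) ⟩
  (f zero +ℚ f (suc u)) +ℚ rest      ≡⟨ cong (_+ℚ rest) (ℚₚ.+-comm (f zero) (f (suc u))) ⟩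
  (f (suc u) +ℚ f zero) +ℚ rest      ≡⟨ ℚₚ.+-assoc (f (suc u)) (f zero) rest ⟩
  f (suc u) +ℚ (f zero +ℚ rest)      ∎
  where
  open ≡-Reasoning
  rest = sum (λ v → if v ≡ᶠ u then 0ℚ else f (suc v))

-- Assignments of colour sets and their optimal values

module Assignments {n k : ℕ} (adj′ : Fin n → Fin n → Bool)
  (adj′-sym : ∀ u v → adj′ u v ≡ adj′ v u) (adj′-irrefl : ∀ v → adj′ v v ≡ false) where

  -- A vertex standing for a contracted module receives a set of colours; a `Weight` tells what that
  -- set earns there.
  VSet Weight Assignment : Set
  VSet       = Fin n → Bool
  Weight     = Subset k → Fin n → ℚ
  Assignment = Fin n → Subset k

  Within : Subset k → VSet → Assignment → Set
  Within K A D = ∀ {v} → A v ≡ true → D v ⊆ K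

  Compatible : VSet → Assignment → Set
  Compatible A D = ∀ {u v} → A u ≡ true → A v ≡ true → adj′ u v ≡ true → ∀ {i} → i ∈ D u → i ∉ D v

  record Monotone (r : Weight) : Set where
    field
      mono     : ∀ {D D′} v → D ⊆ D′ → r D v ≤ℚ r D′ v
      nonneg   : ∀ D v → 0ℚ ≤ℚ r D v

  infixl 6 _∖_
  abstract
    _∖_ : VSet → Fin n → VSet
    (A ∖ u) v = A v ∧ not (v ≡ᶠ u)

    ∖-⊆ : ∀ {A u v} → (A ∖ u) v ≡ true → A v ≡ true × v ≢ u
    ∖-⊆ {A} {u} {v} p with ∧-true⁻ {A v} p
    ... | a , b = a , λ { refl → true≢false (≡ᶠ-refl u) (not-true⁻ b) }

    ∖-⊇ : ∀ {A u v} → A v ≡ true → v ≢ u → (A ∖ u) v ≡ true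
    ∖-⊇ a ne = ∧-true⁺ a (not-false⁺ (≢⇒≡ᶠ ne))

    ∖-def : ∀ A u v → (A ∖ u) v ≡ A v ∧ not (v ≡ᶠ u)
    ∖-def A u v = refl

    value : VSet → Weight → Assignment → ℚ
    value A r D = sum (λ v → if A v then r (D v) v else 0ℚ)

    value-sum : ∀ A r D → value A r D ≡ sum (λ v → if A v then r (D v) v else 0ℚ)
    value-sum A r D = refl

    value-cong : ∀ {A A′ r r′ D D′} → (∀ v → A v ≡ A′ v) → (∀ v → A v ≡ true → r (D v) v ≡ r′ (D′ v) v) →
      value A r D ≡ value A′ r′ D′
    value-cong {A} {A′} {r} {r′} {D} {D′} e h = sum-cong-≗ λ v → by v (A v) (A′ v) refl (e v)
      where
      by : ∀ v a a′ → A v ≡ a → a ≡ a′ → (if a then r (D v) v else 0ℚ) ≡ (if a′ then r′ (D′ v) v else 0ℚ)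
      by v true  .true  p refl = h v p
      by v false .false p refl = refl

    value-mono : ∀ {A r r′ D D′} → (∀ v → A v ≡ true → r (D v) v ≤ℚ r′ (D′ v) v) → value A r D ≤ℚ value A r′ D′
    value-mono {A} {r} {r′} {D} {D′} h = sum-mono λ v → by v (A v) refl
      where
      by : ∀ v a → A v ≡ a → (if a then r (D v) v else 0ℚ) ≤ℚ (if a then r′ (D′ v) v else 0ℚ)
      by v true  p = h v p
      by v false p = ℚₚ.≤-refl

    value-nonneg : ∀ {A r D} → Monotone r → 0ℚ ≤ℚ value A r D
    value-nonneg {A} {r} {D} mr = ℚₚ.≤-trans (ℚₚ.≤-reflexive (sym (zeros n))) (sum-mono by)
      where
      zeros : ∀ m → sum {m} (λ _ → 0ℚ) ≡ 0ℚ
      zeros zero    = refl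
      zeros (suc m) = trans (ℚₚ.+-identityˡ _) (zeros m)
      by : ∀ v → 0ℚ ≤ℚ (if A v then r (D v) v else 0ℚ)
      by v with A v
      ... | true  = Monotone.nonneg mr _ v
      ... | false = ℚₚ.≤-refl

    value-empty : ∀ {A r D} → (∀ v → A v ≡ false) → value A r D ≡ 0ℚ
    value-empty {A} {r} {D} e = trans (sum-cong-≗ λ v → if-false {x = r (D v) v} (e v)) (zeros n)
      where
      zeros : ∀ m → sum {m} (λ _ → 0ℚ) ≡ 0ℚ
      zeros zero    = refl
      zeros (suc m) = trans (ℚₚ.+-identityˡ _) (zeros m)

    value-split : ∀ A (P : VSet) r D →
      value A r D ≡ value (λ v → A v ∧ P v) r D +ℚ value (λ v → A v ∧ not (P v)) r D
    value-split A P r D = trans (sum-cong-≗ by) (∑-distrib-+ {n} _ _)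
      where
      by : ∀ v → (if A v then r (D v) v else 0ℚ) ≡
        (if A v ∧ P v then r (D v) v else 0ℚ) +ℚ (if A v ∧ not (P v) then r (D v) v else 0ℚ)
      by v with A v | P v
      ... | true  | true  = sym (ℚₚ.+-identityʳ _)
      ... | true  | false = sym (ℚₚ.+-identityˡ _)
      ... | false | _     = sym (ℚₚ.+-identityˡ _)

    value-extract : ∀ {A} r D {u} → A u ≡ true → value A r D ≡ r (D u) u +ℚ value (A ∖ u) r D
    value-extract {A} r D {u} p = trans (sum-extract _ u)
        (cong₂ _+ℚ_ (if-true p) (sum-cong-≗ by))
      where
      by : ∀ v → (if v ≡ᶠ u then 0ℚ else (if A v then r (D v) v else 0ℚ)) ≡
                 (if A v ∧ not (v ≡ᶠ u) then r (D v) v else 0ℚ)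
      by v with v ≡ᶠ u | A v
      ... | true  | true  = refl
      ... | true  | false = refl
      ... | false | true  = refl
      ... | false | false = refl


  -- `x` is the best value of an assignment within `K`, plus the amount `c` already earned.
  -- `attained` and `bound` together make `D` reach it exactly.
  record Opt (A : VSet) (r : Weight) (K : Subset k) (c x : ℚ) : Set where
    field
      D        : Assignment
      within   : Within K A D
      compat   : Compatible A D
      attained : x ≤ℚ c +ℚ value A r D
      bound    : ∀ D → Within K A D → Compatible A D → c +ℚ value A r D ≤ℚ x

  override : VSet → Assignment → Assignment → Assignment
  override M D D′ v = if M v then D v else D′ v

  module Contraction {A M : VSet} {r : Weight} {z : Fin n} {g : Subset k → ℚ}
    (M⊆A : ∀ {v} → M v ≡ true → A v ≡ true)
    (z∈M : M z ≡ true)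
    (module′ : ∀ {x s s′} → A x ≡ true → M x ≡ false → M s ≡ true → M s′ ≡ true → adj′ x s ≡ adj′ x s′)
    (opt : ∀ K → Opt M r K 0ℚ (g K))
    {A′ : VSet} {r′ : Weight}
    (A′-out : ∀ {v} → M v ≡ false → A′ v ≡ A v)
    (A′-in  : ∀ {v} → M v ≡ true → A′ v ≡ v ≡ᶠ z)
    (r′-out : ∀ {v} D → M v ≡ false → r′ D v ≡ r D v)
    (r′-z   : ∀ D → r′ D z ≡ g D) where

    rest : VSet
    rest v = A v ∧ not (M v)

    A′z : A′ z ≡ true
    A′z = trans (A′-in z∈M) (≡ᶠ-refl z)

    rest-out : ∀ {v} → rest v ≡ true → A v ≡ true × M v ≡ false
    rest-out {v} p = proj₁ (∧-true⁻ {A v} p) , not-true⁻ (proj₂ (∧-true⁻ {A v} p))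

    value′ : ∀ D → value A′ r′ D ≡ g (D z) +ℚ value rest r D
    value′ D = trans (value-extract r′ D A′z) (cong₂ _+ℚ_ (r′-z (D z))
        (value-cong {D = D} {D} same λ v p → r′-out (D v) (out v (trans (sym (same v)) p))))
      where
      same : ∀ v → (A′ ∖ z) v ≡ rest v
      same v with bool-cases (M v)
      ... | inj₁ m = trans (trans (∖-def A′ z v) (cong (_∧ not (v ≡ᶠ z)) (A′-in m)))
                       (trans (𝔹ₚ.∧-inverseʳ (v ≡ᶠ z)) (sym (trans (cong (λ b → A v ∧ not b) m) (𝔹ₚ.∧-zeroʳ (A v)))))
      ... | inj₂ m = trans (∖-def A′ z v) (cong₂ _∧_ (A′-out m) (trans (cong not (≢⇒≡ᶠ {u = v} {z} λ { refl → true≢false z∈M m })) (sym (cong not m))))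
      out : ∀ v → rest v ≡ true → M v ≡ false
      out v p = proj₂ (rest-out p)

    value-whole : ∀ D → value A r D ≡ value M r D +ℚ value rest r D
    value-whole D = trans (value-split A M r D) (cong (_+ℚ value rest r D)
        (value-cong {D = D} {D} same λ v _ → refl))
      where
      same : ∀ v → A v ∧ M v ≡ M v
      same v with bool-cases (M v)
      ... | inj₁ m = cong (_∧ M v) (M⊆A m)
      ... | inj₂ m = trans (cong (A v ∧_) m) (trans (𝔹ₚ.∧-zeroʳ (A v)) (sym m))

    -- An optimal assignment of the contracted graph is completed inside `M` by the optimum for the
    -- set that `z` received. Conversely an assignment of `A` contracts by giving `z` all colours
    -- used in `M`. Since `M` is a module, both directions preserve compatibility.
    expand : ∀ {K x} → Opt A′ r′ K 0ℚ x → Opt A r K 0ℚ x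
    expand {K} {x} O = record
      { D = D̂ ; within = within ; compat = compat ; attained = attained ; bound = bound }
      where
      module O = Opt O
      module I = Opt (opt (O.D z))
      D̂ : Assignment
      D̂ = override M I.D O.D
      in-A′ : ∀ {v} → A v ≡ true → M v ≡ false → A′ v ≡ true
      in-A′ a m = trans (A′-out m) a
      within : Within K A D̂
      within {v} a p with bool-cases (M v)
      ... | inj₁ m = O.within A′z (I.within m (subst (_ ∈_) (if-true m) p))
      ... | inj₂ m = O.within (in-A′ a m) (subst (_ ∈_) (if-false m) p)
      compat : Compatible A D̂
      compat {u} {v} a b e {i} p q with bool-cases (M u) | bool-cases (M v)
      ... | inj₁ mu | inj₁ mv = I.compat mu mv e (subst (i ∈_) (if-true mu) p) (subst (i ∈_) (if-true mv) q)
      ... | inj₂ mu | inj₂ mv = O.compat (in-A′ a mu) (in-A′ b mv) e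
              (subst (i ∈_) (if-false mu) p) (subst (i ∈_) (if-false mv) q)
      ... | inj₂ mu | inj₁ mv = O.compat (in-A′ a mu) A′z (trans (module′ a mu z∈M mv) e)
              (subst (i ∈_) (if-false mu) p) (I.within mv (subst (i ∈_) (if-true mv) q))
      ... | inj₁ mu | inj₂ mv = O.compat A′z (in-A′ b mv)
              (trans (adj′-sym z v) (trans (module′ b mv z∈M mu) (trans (adj′-sym v u) e)))
              (I.within mu (subst (i ∈_) (if-true mu) p)) (subst (i ∈_) (if-false mv) q)
      attained : x ≤ℚ 0ℚ +ℚ value A r D̂
      attained = begin
        x                                               ≤⟨ O.attained ⟩
        0ℚ +ℚ value A′ r′ O.D                           ≡⟨ cong (0ℚ +ℚ_) (value′ O.D) ⟩
        0ℚ +ℚ (g (O.D z) +ℚ value rest r O.D)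
          ≤⟨ ℚₚ.+-monoʳ-≤ 0ℚ (ℚₚ.+-monoˡ-≤ (value rest r O.D)
               (ℚₚ.≤-trans I.attained (ℚₚ.≤-reflexive (ℚₚ.+-identityˡ (value M r I.D))))) ⟩
        0ℚ +ℚ (value M r I.D +ℚ value rest r O.D)
          ≡⟨ cong (0ℚ +ℚ_) (cong₂ _+ℚ_
               (value-cong {A = M} {r = r} {D = I.D} {D̂} (λ _ → refl) λ v p → cong (λ d → r d v) (sym (if-true p)))
               (value-cong {A = rest} {r = r} {D = O.D} {D̂} (λ _ → refl) λ v p →
                  cong (λ d → r d v) (sym (if-false (proj₂ (rest-out p)))))) ⟩
        0ℚ +ℚ (value M r D̂ +ℚ value rest r D̂)           ≡⟨ cong (0ℚ +ℚ_) (sym (value-whole D̂)) ⟩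
        0ℚ +ℚ value A r D̂                               ∎
        where open ℚₚ.≤-Reasoning
      bound : ∀ D → Within K A D → Compatible A D → 0ℚ +ℚ value A r D ≤ℚ x
      bound D w c = begin
        0ℚ +ℚ value A r D                               ≡⟨ cong (0ℚ +ℚ_) (value-whole D) ⟩
        0ℚ +ℚ (value M r D +ℚ value rest r D)
          ≤⟨ ℚₚ.+-monoʳ-≤ 0ℚ (ℚₚ.+-monoˡ-≤ (value rest r D)
               (ℚₚ.≤-trans (ℚₚ.≤-reflexive (sym (ℚₚ.+-identityˡ (value M r D))))
                 (Opt.bound (opt E) D (λ m p → ∈-E⁺ m p) λ m m′ → c (M⊆A m) (M⊆A m′)))) ⟩
        0ℚ +ℚ (g E +ℚ value rest r D)
          ≡⟨ cong (0ℚ +ℚ_) (cong₂ _+ℚ_ (cong g (sym Dz))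
               (value-cong {A = rest} {r = r} {D = D} {Ď} (λ _ → refl) λ v p →
                  cong (λ d → r d v) (sym (Dout (proj₂ (rest-out p)))))) ⟩
        0ℚ +ℚ (g (Ď z) +ℚ value rest r Ď)               ≡⟨ cong (0ℚ +ℚ_) (sym (value′ Ď)) ⟩
        0ℚ +ℚ value A′ r′ Ď                             ≤⟨ O.bound Ď within′ compat′ ⟩
        x                                               ∎
        where
        open ℚₚ.≤-Reasoning
        used : ∀ i → Dec (∃[ v ] (M v ≡ true × i ∈ D v))
        used i = any? λ v → (M v 𝔹ₚ.≟ true) ×-dec (i ∈? D v)
        E : Subset k
        E = tabulate (λ i → does (used i))
        ∈-E⁺ : ∀ {v i} → M v ≡ true → i ∈ D v → i ∈ E
        ∈-E⁺ {v} {i} m p = ∈-tabulate⁺ _ (dec-true (used i) (v , m , p))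
        ∈-E⁻ : ∀ {i} → i ∈ E → ∃[ v ] (M v ≡ true × i ∈ D v)
        ∈-E⁻ {i} p with used i | ∈-tabulate⁻ (λ i → does (used i)) p
        ... | yes q | _ = q
        Ď : Assignment
        Ď v = if v ≡ᶠ z then E else D v
        Dz : Ď z ≡ E
        Dz = if-true (≡ᶠ-refl z)
        Dout : ∀ {v} → M v ≡ false → Ď v ≡ D v
        Dout {v} m = if-false (≢⇒≡ᶠ {u = v} {z} λ { refl → true≢false z∈M m })
        A′-cases : ∀ {v} → A′ v ≡ true → v ≡ z ⊎ (A v ≡ true × M v ≡ false)
        A′-cases {v} p with bool-cases (M v)
        ... | inj₁ m = inj₁ (≡ᶠ⇒≡ (trans (sym (A′-in m)) p))
        ... | inj₂ m = inj₂ (trans (sym (A′-out m)) p , m)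
        within′ : Within K A′ Ď
        within′ {v} p q with A′-cases p
        ... | inj₁ refl = let (u , m , d) = ∈-E⁻ (subst (_ ∈_) Dz q) in w (M⊆A m) d
        ... | inj₂ (a , m) = w a (subst (_ ∈_) (Dout m) q)
        compat′ : Compatible A′ Ď
        compat′ {u} {v} p q e {i} du dv with A′-cases p | A′-cases q
        ... | inj₁ refl | inj₁ refl = true≢false e (adj′-irrefl z)
        ... | inj₂ (a , m) | inj₂ (b , m′) = c a b e (subst (i ∈_) (Dout m) du) (subst (i ∈_) (Dout m′) dv)
        ... | inj₁ refl | inj₂ (b , m′) = let (y , my , d) = ∈-E⁻ (subst (i ∈_) Dz du) in
                c (M⊆A my) b (trans (adj′-sym y v) (trans (module′ b m′ my z∈M) (trans (adj′-sym v z) e)))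
                  d (subst (i ∈_) (Dout m′) dv)
        ... | inj₂ (a , m) | inj₁ refl = let (y , my , d) = ∈-E⁻ (subst (i ∈_) Dz dv) in
                c a (M⊆A my) (trans (module′ a m my z∈M) e) (subst (i ∈_) (Dout m) du) d

  abstract
    set-at : Fin n → Subset k → Assignment → Assignment
    set-at u E D v = if v ≡ᶠ u then E else D v

    set-at-same : ∀ u {E} D → set-at u E D u ≡ E
    set-at-same u D = if-true (≡ᶠ-refl u)

    set-at-other : ∀ {u v E} D → v ≢ u → set-at u E D v ≡ D v
    set-at-other {u} {v} D ne = if-false (≢⇒≡ᶠ {u = v} {u} ne)

  value-set-at : ∀ {A} r {u E} D → A u ≡ true →
    value A r (set-at u E D) ≡ r E u +ℚ value (A ∖ u) r D
  value-set-at {A} r {u} {E} D p = trans (value-extract r (set-at u E D) p) (cong₂ _+ℚ_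
    (cong (λ d → r d u) (set-at-same u D))
    (value-cong (λ _ → refl) λ v q → cong (λ d → r d v) (set-at-other D (proj₂ (∖-⊆ q)))))

  compat-restrict : ∀ {A u D} → Compatible A D → Compatible (A ∖ u) D
  compat-restrict c p q = c (proj₁ (∖-⊆ p)) (proj₁ (∖-⊆ q))

  opt-empty : ∀ {A r K c} → (∀ v → A v ≡ false) → Opt A r K c c
  opt-empty {A} {r} {K} {c} e = record
    { D = λ _ → Sub.⊥ ; within = λ {v} p → true≢false p (e v) ; compat = λ {u} p → true≢false p (e u)
    ; attained = ℚₚ.≤-reflexive (sym (none _)) ; bound = λ D _ _ → ℚₚ.≤-reflexive (none D) }
    where
    none : ∀ D → c +ℚ value A r D ≡ c
    none D = trans (cong (c +ℚ_) (value-empty e)) (ℚₚ.+-identityʳ c)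

  module _ {S : VSet} {r : Weight} {K : Subset k} {c : ℚ} {u : Fin n} (u∈S : S u ≡ true) (mr : Monotone r) where

    open Monotone mr

    -- Weights are monotone, so a vertex without neighbours takes all of `K`.
    eliminate-isolated : (∀ {a} → S a ≡ true → adj′ u a ≡ true → ⊥) → ∀ {x} →
      Opt (S ∖ u) r K (c +ℚ r K u) x → Opt S r K c x
    eliminate-isolated iso {x} O = record
      { D = D̂ ; within = within ; compat = compat ; attained = attained ; bound = bound }
      where
      module O = Opt O
      D̂ : Assignment
      D̂ = set-at u K O.D
      within : Within K S D̂
      within {v} p q with v ≟ᶠ u
      ... | yes refl = subst (_ ∈_) (set-at-same u O.D) q
      ... | no ne = O.within (∖-⊇ p ne) (subst (_ ∈_) (set-at-other O.D ne) q)
      compat : Compatible S D̂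
      compat {v} {w} p q e {i} i∈v i∈w with v ≟ᶠ u | w ≟ᶠ u
      ... | yes refl | _ = iso q e
      ... | no _ | yes refl = iso p (trans (adj′-sym u v) e)
      ... | no ne | no ne′ = O.compat (∖-⊇ p ne) (∖-⊇ q ne′) e
              (subst (i ∈_) (set-at-other O.D ne) i∈v) (subst (i ∈_) (set-at-other O.D ne′) i∈w)
      attained : x ≤ℚ c +ℚ value S r D̂
      attained = ℚₚ.≤-trans O.attained (ℚₚ.≤-reflexive (trans (ℚₚ.+-assoc c (r K u) _)
        (cong (c +ℚ_) (sym (value-set-at r O.D u∈S)))))
      bound : ∀ D → Within K S D → Compatible S D → c +ℚ value S r D ≤ℚ x
      bound D w cp = begin
        c +ℚ value S r D                              ≡⟨ cong (c +ℚ_) (value-extract r D u∈S) ⟩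
        c +ℚ (r (D u) u +ℚ value (S ∖ u) r D)
          ≤⟨ ℚₚ.+-monoʳ-≤ c (ℚₚ.+-monoˡ-≤ (value (S ∖ u) r D) (mono u (w u∈S))) ⟩
        c +ℚ (r K u +ℚ value (S ∖ u) r D)             ≡⟨ sym (ℚₚ.+-assoc c (r K u) _) ⟩
        (c +ℚ r K u) +ℚ value (S ∖ u) r D
          ≤⟨ O.bound D (λ p → w (proj₁ (∖-⊆ p))) (compat-restrict cp) ⟩
        x                                             ∎
        where open ℚₚ.≤-Reasoning

    -- Once `v`, the only neighbour of `u`, uses `F`, the best set for `u` is the rest of `K`. The
    -- new weight of `v` is the maximum of this joint gain over all `F` inside the set granted to
    -- `v`, characterised by two inequalities.
    eliminate-leaf : ∀ {v r′} → S v ≡ true → adj′ u v ≡ true →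
      (∀ {a} → S a ≡ true → adj′ u a ≡ true → a ≡ v) →
      (∀ {y} D → S y ≡ true → y ≢ v → r′ D y ≡ r D y) →
      (∀ D → ∃[ F ] (F ⊆ D × r′ D v ≤ℚ r F v +ℚ r (K ─ F) u)) →
      (∀ {D F} → F ⊆ D → r F v +ℚ r (K ─ F) u ≤ℚ r′ D v) → ∀ {x} →
      Opt (S ∖ u) r′ K c x → Opt S r K c x
    eliminate-leaf {v} {r′} v∈S u~v only same lower upper {x} O = record
      { D = D̂ ; within = within ; compat = compat ; attained = attained ; bound = bound }
      where
      module O = Opt O
      v≢u : v ≢ u
      v≢u refl = true≢false u~v (adj′-irrefl u)
      F : Subset k
      F = proj₁ (lower (O.D v))
      D̂ : Assignment
      D̂ = set-at u (K ─ F) (set-at v F O.D)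
      shrunk : ∀ {w i} → S w ≡ true → w ≢ u → i ∈ D̂ w → i ∈ O.D w
      shrunk {w} {i} p ne q = by (w ≟ᶠ v)
        where
        by : Dec (w ≡ v) → i ∈ O.D w
        by (yes refl) = proj₁ (proj₂ (lower (O.D v)))
          (subst (i ∈_) (trans (set-at-other _ ne) (set-at-same v O.D)) q)
        by (no ne′) = subst (i ∈_) (trans (set-at-other _ ne) (set-at-other O.D ne′)) q
      at-u : ∀ {i} → i ∈ D̂ u → i ∈ K ─ F
      at-u {i} = subst (i ∈_) (set-at-same u _)
      at-v : ∀ {i} → i ∈ D̂ v → i ∈ F
      at-v {i} p = subst (i ∈_) (trans (set-at-other _ v≢u) (set-at-same v _)) p
      within : Within K S D̂
      within {w} p q = by (w ≟ᶠ u)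
        where
        by : Dec (w ≡ u) → _ ∈ K
        by (yes refl) = p─q⊆p K F (at-u q)
        by (no ne) = O.within (∖-⊇ p ne) (shrunk p ne q)
      compat : Compatible S D̂
      compat {w} {y} p q e {i} i∈w i∈y = by (w ≟ᶠ u) (y ≟ᶠ u)
        where
        by : Dec (w ≡ u) → Dec (y ≡ u) → ⊥
        by (yes refl) _ with only q e
        ... | refl = ∈-─⁻ {p = K} {F} (at-u i∈w) (at-v i∈y)
        by (no _) (yes refl) with only p (trans (adj′-sym u w) e)
        ... | refl = ∈-─⁻ {p = K} {F} (at-u i∈y) (at-v i∈w)
        by (no ne) (no ne′) = O.compat (∖-⊇ p ne) (∖-⊇ q ne′) e (shrunk p ne i∈w) (shrunk q ne′ i∈y)
      v∈S∖u : (S ∖ u) v ≡ true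
      v∈S∖u = ∖-⊇ v∈S v≢u
      rest : VSet
      rest = S ∖ u ∖ v
      rearranged : ∀ D → value S r D ≡ (r (D v) v +ℚ r (D u) u) +ℚ value rest r D
      rearranged D = trans (value-extract r D u∈S) (trans (cong (r (D u) u +ℚ_) (value-extract r D v∈S∖u))
        (trans (sym (ℚₚ.+-assoc (r (D u) u) (r (D v) v) _))
               (cong (_+ℚ value rest r D) (ℚₚ.+-comm (r (D u) u) (r (D v) v)))))
      reduced : ∀ D → value (S ∖ u) r′ D ≡ r′ (D v) v +ℚ value rest r D
      reduced D = trans (value-extract r′ D v∈S∖u) (cong (r′ (D v) v +ℚ_)
        (value-cong (λ _ → refl) λ y p → same (D y) (proj₁ (∖-⊆ (proj₁ (∖-⊆ p)))) (proj₂ (∖-⊆ p))))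
      attained : x ≤ℚ c +ℚ value S r D̂
      attained = begin
        x                                             ≤⟨ O.attained ⟩
        c +ℚ value (S ∖ u) r′ O.D                     ≡⟨ cong (c +ℚ_) (reduced O.D) ⟩
        c +ℚ (r′ (O.D v) v +ℚ value rest r O.D)
          ≤⟨ ℚₚ.+-monoʳ-≤ c (ℚₚ.+-monoˡ-≤ (value rest r O.D) (proj₂ (proj₂ (lower (O.D v))))) ⟩
        c +ℚ ((r F v +ℚ r (K ─ F) u) +ℚ value rest r O.D)
          ≡⟨ cong (c +ℚ_) (cong₂ _+ℚ_ (cong₂ _+ℚ_
               (cong (λ d → r d v) (sym (trans (set-at-other _ v≢u) (set-at-same v O.D))))
               (cong (λ d → r d u) (sym (set-at-same u _))))
               (value-cong (λ _ → refl) λ y p → cong (λ d → r d y)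
                 (sym (trans (set-at-other _ (proj₂ (∖-⊆ (proj₁ (∖-⊆ p))))) (set-at-other _ (proj₂ (∖-⊆ p))))))) ⟩
        c +ℚ ((r (D̂ v) v +ℚ r (D̂ u) u) +ℚ value rest r D̂) ≡⟨ cong (c +ℚ_) (sym (rearranged D̂)) ⟩
        c +ℚ value S r D̂                              ∎
        where open ℚₚ.≤-Reasoning
      bound : ∀ D → Within K S D → Compatible S D → c +ℚ value S r D ≤ℚ x
      bound D w cp = begin
        c +ℚ value S r D                              ≡⟨ cong (c +ℚ_) (rearranged D) ⟩
        c +ℚ ((r (D v) v +ℚ r (D u) u) +ℚ value rest r D)
          ≤⟨ ℚₚ.+-monoʳ-≤ c (ℚₚ.+-monoˡ-≤ (value rest r D) (ℚₚ.≤-trans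
               (ℚₚ.+-monoʳ-≤ (r (D v) v) (mono u λ i∈u → x∈p∧x∉q⇒x∈p─q (w u∈S i∈u) (cp u∈S v∈S u~v i∈u)))
               (upper id))) ⟩
        c +ℚ (r′ (D v) v +ℚ value rest r D)           ≡⟨ cong (c +ℚ_) (sym (reduced D)) ⟩
        c +ℚ value (S ∖ u) r′ D
          ≤⟨ O.bound D (λ p → w (proj₁ (∖-⊆ p))) (compat-restrict cp) ⟩
        x                                             ∎
        where open ℚₚ.≤-Reasoning

  -- Programmed maxima start from the default 0. A result of at most 0 is attained by the empty
  -- assignment.
  opt-from : ∀ {A r K x} → Monotone r →
    (x ≤ℚ 0ℚ ⊎ ∃[ D ] (Within K A D × Compatible A D × x ≤ℚ value A r D)) →
    (∀ D → Within K A D → Compatible A D → value A r D ≤ℚ x) → Opt A r K 0ℚ x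
  opt-from {A} {r} {K} {x} mr (inj₁ x≤0) b = record
    { D = λ _ → Sub.⊥ ; within = λ _ → ⊥⊆ ; compat = λ _ _ _ p → ⊥-elim (∉⊥ p)
    ; attained = ℚₚ.≤-trans x≤0 (ℚₚ.≤-trans (value-nonneg mr)
        (ℚₚ.≤-reflexive (sym (ℚₚ.+-identityˡ (value A r (λ _ → Sub.⊥))))))
    ; bound = λ D w c → ℚₚ.≤-trans (ℚₚ.≤-reflexive (ℚₚ.+-identityˡ (value A r D))) (b D w c) }
  opt-from {A} {r} mr (inj₂ (D , w , c , le)) b = record
    { D = D ; within = w ; compat = c
    ; attained = ℚₚ.≤-trans le (ℚₚ.≤-reflexive (sym (ℚₚ.+-identityˡ (value A r D))))
    ; bound = λ D w c → ℚₚ.≤-trans (ℚₚ.≤-reflexive (ℚₚ.+-identityˡ (value A r D))) (b D w c) }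

  -- Fixing the colour set Z of z turns the remaining vertices into an independent instance.
  guess : ∀ {A r K z x} {r₀ : Subset k → Weight} {y : Subset k → ℚ} → Monotone r → A z ≡ true →
    (∀ {Z v} D → adj′ v z ≡ true → r₀ Z D v ≡ r (D ─ Z) v) →
    (∀ {Z v} D → adj′ v z ≡ false → r₀ Z D v ≡ r D v) →
    (∀ {Z} → Z ⊆ K → Opt (A ∖ z) (r₀ Z) K (r Z z) (y Z)) →
    (x ≤ℚ 0ℚ ⊎ ∃[ Z ] (Z ⊆ K × x ≤ℚ y Z)) → (∀ {Z} → Z ⊆ K → y Z ≤ℚ x) → Opt A r K 0ℚ x
  guess {A} {r} {K} {z} {x} {r₀} {y} mr z∈A near far opt low up = opt-from mr (lower low) upper
    where
    lower : (x ≤ℚ 0ℚ ⊎ ∃[ Z ] (Z ⊆ K × x ≤ℚ y Z)) →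
      x ≤ℚ 0ℚ ⊎ ∃[ D ] (Within K A D × Compatible A D × x ≤ℚ value A r D)
    lower (inj₁ p) = inj₁ p
    lower (inj₂ (Z , Z⊆K , le)) = inj₂ (D̂ , within , compat , attained)
      where
      module O = Opt (opt Z⊆K)
      D₁ D̂ : Assignment
      -- At neighbours of `z` the colours of `Z` earn nothing under `r₀ Z`, so dropping them
      -- restores compatibility without loss.
      D₁ v = if adj′ v z then O.D v ─ Z else O.D v
      D̂ = set-at z Z D₁
      D₁⊆ : ∀ {v i} → i ∈ D₁ v → i ∈ O.D v
      D₁⊆ {v} {i} p with adj′ v z
      ... | true  = p─q⊆p (O.D v) Z p
      ... | false = p
      at-z : ∀ {i} → i ∈ D̂ z → i ∈ Z
      at-z {i} = subst (i ∈_) (set-at-same z D₁)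
      at-v : ∀ {v i} → v ≢ z → i ∈ D̂ v → i ∈ D₁ v
      at-v {v} {i} ne = subst (i ∈_) (set-at-other D₁ ne)
      avoid : ∀ {v i} → v ≢ z → adj′ v z ≡ true → i ∈ D̂ v → i ∉ Z
      avoid {v} {i} ne e p = ∈-─⁻ {p = O.D v} {Z} (subst (i ∈_) (if-true e) (at-v ne p))
      within : Within K A D̂
      within {v} p q = by (v ≟ᶠ z)
        where
        by : Dec (v ≡ z) → _ ∈ K
        by (yes refl) = Z⊆K (at-z q)
        by (no ne) = O.within (∖-⊇ p ne) (D₁⊆ (at-v ne q))
      compat : Compatible A D̂
      compat {v} {w} p q e {i} i∈v i∈w = by (v ≟ᶠ z) (w ≟ᶠ z)
        where
        by : Dec (v ≡ z) → Dec (w ≡ z) → ⊥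
        by (yes refl) (yes refl) = true≢false e (adj′-irrefl z)
        by (yes refl) (no ne) = avoid ne (trans (adj′-sym w z) e) i∈w (at-z i∈v)
        by (no ne) (yes refl) = avoid ne e i∈v (at-z i∈w)
        by (no ne) (no ne′) = O.compat (∖-⊇ p ne) (∖-⊇ q ne′) e (D₁⊆ (at-v ne i∈v)) (D₁⊆ (at-v ne′ i∈w))
      weigh : ∀ v → r₀ Z (O.D v) v ≡ r (D₁ v) v
      weigh v with bool-cases (adj′ v z)
      ... | inj₁ e = trans (near (O.D v) e) (cong (λ d → r d v) (sym (if-true e)))
      ... | inj₂ e = trans (far (O.D v) e) (cong (λ d → r d v) (sym (if-false e)))
      attained : x ≤ℚ value A r D̂
      attained = ℚₚ.≤-trans le (ℚₚ.≤-trans O.attained (ℚₚ.≤-reflexive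
        (trans (cong (r Z z +ℚ_) (value-cong (λ _ → refl) λ v _ → weigh v))
               (sym (value-set-at r D₁ z∈A)))))
    upper : ∀ D → Within K A D → Compatible A D → value A r D ≤ℚ x
    upper D w c = begin
      value A r D                              ≡⟨ value-extract r D z∈A ⟩
      r (D z) z +ℚ value (A ∖ z) r D
        ≤⟨ ℚₚ.+-monoʳ-≤ (r (D z) z) (value-mono λ v p → weigh v (proj₁ (∖-⊆ p))) ⟩
      r (D z) z +ℚ value (A ∖ z) (r₀ (D z)) D
        ≤⟨ Opt.bound (opt (w z∈A)) D (λ p → w (proj₁ (∖-⊆ p))) (compat-restrict c) ⟩
      y (D z)                                  ≤⟨ up (w z∈A) ⟩
      x                                        ∎
      where
      open ℚₚ.≤-Reasoning
      weigh : ∀ v → A v ≡ true → r (D v) v ≤ℚ r₀ (D z) (D v) v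
      weigh v p with bool-cases (adj′ v z)
      ... | inj₁ e = ℚₚ.≤-trans (Monotone.mono mr v λ i∈v → x∈p∧x∉q⇒x∈p─q i∈v (c p z∈A e i∈v))
                       (ℚₚ.≤-reflexive (sym (near (D v) e)))
      ... | inj₂ e = ℚₚ.≤-reflexive (sym (far (D v) e))

-- Enumeration of colour sets and numbering of arrays

subsets : ∀ k → List (Subset k)
subsets zero    = [] ∷ []
subsets (suc k) = map (true ∷_) (subsets k) ++ map (false ∷_) (subsets k)

∈-subsets : ∀ {k} (D : Subset k) → D ∈ᴸ subsets k
∈-subsets []          = here refl
∈-subsets (true  ∷ D) = ∈-++⁺ˡ (∈-map⁺ (true ∷_) (∈-subsets D))
∈-subsets (false ∷ D) = ∈-++⁺ʳ (map (true ∷_) (subsets _)) (∈-map⁺ (false ∷_) (∈-subsets D))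

-- Bijective binary numeration with the digits 1 and 2, hence injective without regard to leading
-- zeros.
encode : List Bool → ℕ
encode []          = 0
encode (false ∷ l) = suc (encode l + encode l)
encode (true  ∷ l) = suc (suc (encode l + encode l))

double-injective : ∀ a b → a + a ≡ b + b → a ≡ b
double-injective zero    zero    e = refl
double-injective (suc a) (suc b) e = cong suc (double-injective a b
  (ℕₚ.suc-injective (trans (sym (ℕₚ.+-suc a a)) (trans (ℕₚ.suc-injective e) (ℕₚ.+-suc b b)))))

odd≢even : ∀ a b → suc (a + a) ≢ b + b
odd≢even zero    (suc b) e with trans (ℕₚ.suc-injective e) (ℕₚ.+-suc b b)
... | ()
odd≢even (suc a) (suc b) e = odd≢even a b
  (trans (sym (ℕₚ.+-suc a a)) (ℕₚ.suc-injective (trans (ℕₚ.suc-injective e) (ℕₚ.+-suc b b))))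

encode-injective : ∀ l m → encode l ≡ encode m → l ≡ m
encode-injective []          []          e = refl
encode-injective (false ∷ l) (false ∷ m) e =
  cong (false ∷_) (encode-injective l m (double-injective _ _ (ℕₚ.suc-injective e)))
encode-injective (true ∷ l)  (true ∷ m)  e =
  cong (true ∷_) (encode-injective l m (double-injective _ _ (ℕₚ.suc-injective (ℕₚ.suc-injective e))))
encode-injective (false ∷ l) (true ∷ m)  e = ⊥-elim (odd≢even (encode m) (encode l) (sym (ℕₚ.suc-injective e)))
encode-injective (true ∷ l)  (false ∷ m) e = ⊥-elim (odd≢even (encode l) (encode m) (ℕₚ.suc-injective e))
encode-injective [] (false ∷ m) ()
encode-injective [] (true ∷ m) ()

-- A self-delimiting code: both the number and the bits after it can be recovered.
unary : ℕ → List Bool → List Bool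
unary zero    l = false ∷ l
unary (suc m) l = true ∷ unary m l

unary-injective : ∀ m m′ {l l′} → unary m l ≡ unary m′ l′ → m ≡ m′ × l ≡ l′
unary-injective zero    zero     refl = refl , refl
unary-injective (suc m) (suc m′) e with unary-injective m m′ (proj₂ (∷-injective e))
... | refl , e′ = refl , e′

-- `alive` marks the vertices left by contractions, `inM` the current module, `clo` the closure of a
-- pair, `vis` the vertices no longer considered in an elimination. `wt` holds the tables, `wt′` a
-- working copy, `gain` the new table of the module, `acc` the revenue collected under one guess.
-- `ban` holds forbidden options and `best` the optimum without prohibitions.
data Fam : Set where
  alive inM clo vis ban out wt wt′ gain acc best : Fam

fam→ℕ : Fam → ℕ
fam→ℕ alive = 0
fam→ℕ inM   = 1
fam→ℕ clo   = 2
fam→ℕ vis   = 3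
fam→ℕ ban   = 4
fam→ℕ out   = 5
fam→ℕ wt    = 6
fam→ℕ wt′   = 7
fam→ℕ gain  = 8
fam→ℕ acc   = 9
fam→ℕ best  = 10

ℕ→fam : ℕ → Maybe Fam
ℕ→fam 0  = just alive
ℕ→fam 1  = just inM
ℕ→fam 2  = just clo
ℕ→fam 3  = just vis
ℕ→fam 4  = just ban
ℕ→fam 5  = just out
ℕ→fam 6  = just wt
ℕ→fam 7  = just wt′
ℕ→fam 8  = just gain
ℕ→fam 9  = just acc
ℕ→fam 10 = just best
ℕ→fam _  = nothing

ℕ→fam→ℕ : ∀ f → ℕ→fam (fam→ℕ f) ≡ just f
ℕ→fam→ℕ alive = refl
ℕ→fam→ℕ inM   = refl
ℕ→fam→ℕ clo   = refl
ℕ→fam→ℕ vis   = refl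
ℕ→fam→ℕ ban   = refl
ℕ→fam→ℕ out   = refl
ℕ→fam→ℕ wt    = refl
ℕ→fam→ℕ wt′   = refl
ℕ→fam→ℕ gain  = refl
ℕ→fam→ℕ acc   = refl
ℕ→fam→ℕ best  = refl

fam→ℕ-injective : ∀ {f g} → fam→ℕ f ≡ fam→ℕ g → f ≡ g
fam→ℕ-injective {f} {g} e = just-injective (trans (sym (ℕ→fam→ℕ f)) (trans (cong ℕ→fam e) (ℕ→fam→ℕ g)))

ty : Fam → Ty
ty alive = bool
ty inM   = bool
ty clo   = bool
ty vis   = bool
ty ban   = bool
ty out   = num
ty wt    = rational
ty wt′   = rational
ty gain  = rational
ty acc   = rational
ty best  = rational

-- The algorithm

module Algo (k : ℕ) where

  Ix : Fam → Set
  Ix ban  = Fin k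
  Ix wt   = Subset k
  Ix wt′  = Subset k
  Ix gain = Subset k
  Ix _    = ⊤

  enum : ∀ f → List (Ix f)
  enum alive = tt ∷ []
  enum inM   = tt ∷ []
  enum clo   = tt ∷ []
  enum vis   = tt ∷ []
  enum ban   = allFin k
  enum out   = tt ∷ []
  enum wt    = subsets k
  enum wt′   = subsets k
  enum gain  = subsets k
  enum acc   = tt ∷ []
  enum best  = tt ∷ []

  enum-complete : ∀ f (i : Ix f) → i ∈ᴸ enum f
  enum-complete alive i = here refl
  enum-complete inM   i = here refl
  enum-complete clo   i = here refl
  enum-complete vis   i = here refl
  enum-complete ban   i = ∈-allFin i
  enum-complete out   i = here refl
  enum-complete wt    i = ∈-subsets i
  enum-complete wt′   i = ∈-subsets i
  enum-complete gain  i = ∈-subsets i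
  enum-complete acc   i = here refl
  enum-complete best  i = here refl

  ixBits : ∀ f → Ix f → List Bool
  ixBits ban  i = unary (toℕ i) []
  ixBits wt   D = toList D
  ixBits wt′  D = toList D
  ixBits gain D = toList D
  ixBits _    _ = []

  ixBits-injective : ∀ f {i j} → ixBits f i ≡ ixBits f j → i ≡ j
  ixBits-injective alive e = refl
  ixBits-injective inM   e = refl
  ixBits-injective clo   e = refl
  ixBits-injective vis   e = refl
  ixBits-injective ban   e = Fₚ.toℕ-injective (proj₁ (unary-injective _ _ e))
  ixBits-injective out   e = refl
  ixBits-injective wt    e = trans (sym (Vecₚ.cast-is-id refl _)) (Vecₚ.toList-injective refl _ _ e)
  ixBits-injective wt′   e = trans (sym (Vecₚ.cast-is-id refl _)) (Vecₚ.toList-injective refl _ _ e)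
  ixBits-injective gain  e = trans (sym (Vecₚ.cast-is-id refl _)) (Vecₚ.toList-injective refl _ _ e)
  ixBits-injective acc   e = refl
  ixBits-injective best  e = refl

  signature : Signature
  signature = record
    { Fam = Fam ; ty = ty ; Ix = Ix ; enum = enum ; enum-complete = enum-complete
    ; _≟ᵃ_ = λ f g → map′ fam→ℕ-injective (cong fam→ℕ) (fam→ℕ f ℕₚ.≟ fam→ℕ g)
    ; name = λ b f i → encode (b ∷ unary (fam→ℕ f) (ixBits f i))
    ; name-injective = injective }
    where
    injective : ∀ {b c f g} {i : Ix f} {j : Ix g} →
      encode (b ∷ unary (fam→ℕ f) (ixBits f i)) ≡ encode (c ∷ unary (fam→ℕ g) (ixBits g j)) →
      _≡_ {A = Bool × Σ Fam Ix} (b , f , i) (c , g , j)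
    injective {f = f} {g} e with ∷-injective (encode-injective _ _ e)
    ... | refl , e′ with unary-injective (fam→ℕ f) (fam→ℕ g) e′
    ...   | p , q with fam→ℕ-injective {f} {g} p
    ...     | refl = cong (λ i → _ , f , i) (ixBits-injective f q)

  open Language signature k

  pattern #0 = zero
  pattern #1 = suc zero
  pattern #2 = suc (suc zero)
  pattern #3 = suc (suc (suc zero))
  pattern #4 = suc (suc (suc (suc zero)))

  infixr 6 _∧ᵉ_
  infixr 5 _∨ᵉ_
  notᵉ : ∀ {d} → Exp bool d → Exp bool d
  notᵉ b = ifᵉ b (const false) (const true)

  _∧ᵉ_ _∨ᵉ_ : ∀ {d} → Exp bool d → Exp bool d → Exp bool d
  b ∧ᵉ c = ifᵉ b c (const false)
  b ∨ᵉ c = bin or b c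

  anyᵉ : ∀ {d} → Exp bool (suc d) → Exp bool d
  anyᵉ = big or

  eqᵉ : ∀ {d} → Fin d → Fin d → Exp bool d
  eqᵉ x y = leᵉ x y ∧ᵉ leᵉ y x

  alive? inM? clo? vis? unvisited? : ∀ {d} → Fin d → Exp bool d
  alive? x     = cell alive tt x
  inM? x       = cell inM tt x
  clo? x       = cell clo tt x
  vis? x       = cell vis tt x
  unvisited? x = notᵉ (vis? x)

  maxima : ∀ {A : Set} {d} → List A → (A → Exp rational d) → Exp rational d
  maxima []       e = const 0ℚ
  maxima (x ∷ xs) e = bin max (e x) (maxima xs e)

  allOf : ∀ {A : Set} {d} → List A → (A → Exp bool d) → Exp bool d
  allOf []       e = const true
  allOf (x ∷ xs) e = e x ∧ᵉ allOf xs e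

  -- The vertex #0 tells some element of clo apart from u, which is variable #3, behind a counter and v.
  mixed : ∀ {d} → Exp bool (4 + d)
  mixed = inM? #0 ∧ᵉ anyᵉ (clo? #0 ∧ᵉ
    ifᵉ (adjᵉ #1 #0) (notᵉ (adjᵉ #1 #4)) (adjᵉ #1 #4))

  -- A vertex of `inM` distinguishing two elements belongs to every module of `inM` that contains
  -- them. Adding such vertices `n` times reaches the module generated by `u` and `v`.
  close : ∀ {d} → Cmd (2 + d)
  close = assign clo (λ _ → eqᵉ #0 #2 ∨ᵉ eqᵉ #0 #1) ▸ for (assign clo (λ _ → clo? #0 ∨ᵉ mixed))

  shrink : ∀ {d} → Cmd (2 + d)
  shrink = close ▸ assign inM (λ _ →
    ifᵉ (inM? #2 ∧ᵉ inM? #1 ∧ᵉ notᵉ (eqᵉ #2 #1)) (clo? #0) (inM? #0))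

  -- One pass over the pairs suffices: a treated pair of distinct vertices that is still present
  -- generates the whole current set, and later shrinking preserves this.
  findModule : ∀ {d} → Cmd d
  findModule = assign inM (λ _ → alive? #0) ▸ for (for shrink)

  -- The least vertex of the module, a canonical choice that can be tested at each cell.
  rep : ∀ {d} → Fin d → Exp bool d
  rep x = inM? x ∧ᵉ notᵉ (anyᵉ (inM? #0 ∧ᵉ notᵉ (leᵉ (suc x) #0)))

  high : ∀ {d} → Exp bool d
  high = anyᵉ (inM? #0 ∧ᵉ anyᵉ (inM? #0 ∧ᵉ adjᵉ #1 #0 ∧ᵉ
    anyᵉ (inM? #0 ∧ᵉ adjᵉ #2 #0 ∧ᵉ notᵉ (eqᵉ #1 #0) ∧ᵉ
    anyᵉ (inM? #0 ∧ᵉ adjᵉ #3 #0 ∧ᵉ notᵉ (eqᵉ #2 #0) ∧ᵉ notᵉ (eqᵉ #1 #0)))))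

  bigs : ∀ m {d} → Exp rational (m + d) → Exp rational d
  bigs zero    e = e
  bigs (suc m) e = bigs m (big max e)

  -- The index of an array cannot be computed at run time, so the set of colours passing the tests
  -- is found by branching over all sets.
  decide : ∀ m {d} → (Fin m → Exp bool d) → (Subset m → Exp rational d) → Exp rational d
  decide zero    t e = e []
  decide (suc m) t e = ifᵉ (t zero) (decide m (t ∘ suc) (e ∘ (true ∷_))) (decide m (t ∘ suc) (e ∘ (false ∷_)))

  -- Colour i may use the vertices of the module not adjacent to any of the three vertices
  -- chosen for i.
  chosen : ∀ {d} → Fin k → Fin 3 → Fin (k * 3 + d)
  chosen {d} i c = combine i c ↑ˡ d

  free : ∀ {d} e → (Fin (k * 3 + d) → Fin e) → Fin e → Fin k → Exp bool e
  free e lift x i = notᵉ (adjᵉ x (lift (chosen i #0))) ∧ᵉ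
    notᵉ (adjᵉ x (lift (chosen i #1))) ∧ᵉ notᵉ (adjᵉ x (lift (chosen i #2)))

  valid : ∀ {d} → Exp bool (k * 3 + d)
  valid = allOf (allFin k) λ i → notᵉ (anyᵉ (inM? #0 ∧ᵉ free _ suc #0 i ∧ᵉ
    anyᵉ (inM? #0 ∧ᵉ free _ (λ y → suc (suc y)) #0 i ∧ᵉ adjᵉ #1 #0)))

  triples : ∀ {d} → Subset k → Exp rational d
  triples K = bigs (k * 3) (ifᵉ valid
    (big plus (ifᵉ (inM? #0) (decide k (free _ suc #0) (λ B → cell wt (B ∩ K) #0)) (const 0ℚ)))
    (const 0ℚ))

  -- The variables are z, the counter and u, the vertex to be eliminated (0).
  eligible : ∀ {d} → Fin d → Exp bool d
  eligible u = unvisited? u ∧ᵉ notᵉ (anyᵉ (unvisited? #0 ∧ᵉ adjᵉ (suc u) #0 ∧ᵉ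
    anyᵉ (unvisited? #0 ∧ᵉ adjᵉ (suc (suc u)) #0 ∧ᵉ notᵉ (eqᵉ #1 #0))))

  eliminate : ∀ {d} → Subset k → Cmd (suc d)
  eliminate K =
    assign acc (λ _ → ifᵉ (eligible #1 ∧ᵉ notᵉ (anyᵉ (unvisited? #0 ∧ᵉ adjᵉ #2 #0)))
      (bin plus (cell acc tt #0) (cell wt′ K #1)) (cell acc tt #0)) ▸
    assign wt′ (λ D → ifᵉ (eligible #1 ∧ᵉ unvisited? #0 ∧ᵉ adjᵉ #1 #0)
      (maxima (subsets k) λ F → bin plus (cell wt′ (F ∩ D) #0) (cell wt′ (K ─ (F ∩ D)) #1))
      (cell wt′ D #0)) ▸
    -- `vis` changes last, because the other two assignments must test eligibility before `u` is
    -- marked.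
    assign vis (λ _ → vis? #0 ∨ᵉ (eqᵉ #0 #1 ∧ᵉ eligible #1))

  _≟ˢ_ : (D E : Subset k) → Dec (D ≡ E)
  _≟ˢ_ = Vecₚ.≡-dec 𝔹ₚ._≟_

  -- K is the set of colours available to the module, Z the set that z receives.  In a prime graph of
  -- maximum degree two, deleting z leaves paths, which are eliminated from their ends.
  solveFrom : ∀ {d} → Subset k → Subset k → Cmd (suc d)
  solveFrom K Z =
    assign wt′ (λ D → ifᵉ (adjᵉ #0 #1) (cell wt (D ─ Z) #0) (cell wt D #0)) ▸
    assign vis (λ _ → eqᵉ #0 #1 ∨ᵉ notᵉ (inM? #0)) ▸
    assign acc (λ _ → cell wt Z #1) ▸
    for (for (eliminate K)) ▸
    assign gain (λ D → if does (D ≟ˢ K)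
      then ifᵉ (rep #1) (ifᵉ high (cell gain D #0) (bin max (cell gain D #0) (cell acc tt #0))) (cell gain D #0)
      else cell gain D #0)

  -- Every vertex is run as `z`, but `gain` accepts a result only from the representative and only
  -- if the degrees are low. The table of a module of high degree therefore stays as `triples` left
  -- it.
  solve : ∀ {d} → Cmd d
  solve = assign gain (λ K → ifᵉ high (triples K) (const 0ℚ)) ▸
    each (subsets k) λ K → each (subsets k) λ Z → for (solveFrom K (Z ∩ K))

  contract : ∀ {d} → Cmd d
  contract =
    assign wt (λ D → ifᵉ (rep #0) (cell gain D #0) (cell wt D #0)) ▸
    assign alive (λ _ → alive? #0 ∧ᵉ notᵉ (inM? #0 ∧ᵉ notᵉ (rep #0)))

  optimise : ∀ {d} → Cmd d
  optimise =
    assign wt (λ D → maxima (allFin k) λ i →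
      if does (i ∈? D) then ifᵉ (cell ban i #0) (const 0ℚ) (revᵉ #0 i) else const 0ℚ) ▸
    assign alive (λ _ → const true) ▸
    for (findModule ▸ solve ▸ contract)

  optimum : ∀ {d} → Exp rational d
  optimum = big plus (ifᵉ (alive? #0) (cell wt Sub.⊤ #0) (const 0ℚ))

  -- The option (v, i) stays banned unless that lowers the optimum.
  tryBan : ∀ {d} → Fin k → Cmd (suc d)
  tryBan i =
    assign ban (λ j → if does (j Fₚ.≟ i) then cell ban j #0 ∨ᵉ eqᵉ #0 #1 else cell ban j #0) ▸
    optimise ▸
    assign ban (λ j → if does (j Fₚ.≟ i)
      then cell ban j #0 ∧ᵉ notᵉ (eqᵉ #0 #1 ∧ᵉ notᵉ (cell best tt #1 ≤ᵉ optimum)) else cell ban j #0)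

  -- Takes the first option that is not banned; after the self-reduction each vertex has at most
  -- one.
  palette : ∀ {d} → List (Fin k) → Exp num (suc d)
  palette []       = const 0
  palette (i ∷ is) = ifᵉ (cell ban i zero) (palette is) (const (suc (toℕ i)))

  main : Cmd 0
  main = optimise ▸ assign best (λ _ → optimum) ▸
    for (each (allFin k) tryBan) ▸ assign out (λ _ → palette (allFin k))

  program : Program
  program = compile main ⨾ loopᵖ 0 (0 ⟦ var {1} zero ⟧≔ user out tt ⟦ var {1} zero ⟧)

-- Reading programmed tests, iterations and maxima

reflects-true : ∀ {P : Set} {b} → Reflects P b → P → b ≡ true
reflects-true (ofʸ _) p = refl
reflects-true (ofⁿ f) p = ⊥-elim (f p)

reflects-false : ∀ {P : Set} {b} → Reflects P b → ¬ P → b ≡ false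
reflects-false (ofʸ p) f = ⊥-elim (f p)
reflects-false (ofⁿ _) f = refl

true-reflects : ∀ {P : Set} {b} → Reflects P b → b ≡ true → P
true-reflects (ofʸ p) refl = p

false-reflects : ∀ {P : Set} {b} → Reflects P b → b ≡ false → ¬ P
false-reflects (ofⁿ f) refl = f

r-map : ∀ {P Q : Set} {b} → (P → Q) → (Q → P) → Reflects P b → Reflects Q b
r-map f g (ofʸ p) = ofʸ (f p)
r-map f g (ofⁿ n) = ofⁿ (n ∘ g)

r-bool : ∀ b → Reflects (b ≡ true) b
r-bool true  = ofʸ refl
r-bool false = ofⁿ λ ()

r-and : ∀ {P Q : Set} {a b} → Reflects P a → Reflects Q b → Reflects (P × Q) (if a then b else false)
r-and (ofʸ p) (ofʸ q) = ofʸ (p , q)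
r-and (ofʸ p) (ofⁿ n) = ofⁿ (n ∘ proj₂)
r-and (ofⁿ n) _       = ofⁿ (n ∘ proj₁)

r-not : ∀ {P : Set} {a} → Reflects P a → Reflects (¬ P) (if a then false else true)
r-not (ofʸ p) = ofⁿ λ n → n p
r-not (ofⁿ n) = ofʸ n

r-or : ∀ {P Q : Set} {a b} → Reflects P a → Reflects Q b → Reflects (P ⊎ Q) (a ∨ b)
r-or (ofʸ p) _       = ofʸ (inj₁ p)
r-or (ofⁿ n) (ofʸ q) = ofʸ (inj₂ q)
r-or (ofⁿ n) (ofⁿ m) = ofⁿ λ { (inj₁ p) → n p ; (inj₂ q) → m q }

r-differ : ∀ a b → Reflects (a ≢ b) (if a then (if b then false else true) else b)
r-differ true  true  = ofⁿ λ n → n refl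
r-differ true  false = ofʸ λ ()
r-differ false true  = ofʸ λ ()
r-differ false false = ofⁿ λ n → n refl

r-any : ∀ {n} {P : Fin n → Set} {f : Fin n → Bool} → (∀ v → Reflects (P v) (f v)) →
  Reflects (∃ P) (iter (λ v a → a ∨ f v) false)
r-any h = r-map (λ { (inj₁ ()) ; (inj₂ p) → p }) inj₂ (go {A = ⊥} (ofⁿ id) h)
  where
  go : ∀ {n} {A : Set} {P : Fin n → Set} {f : Fin n → Bool} {a} → Reflects A a →
    (∀ v → Reflects (P v) (f v)) → Reflects (A ⊎ ∃ P) (iter (λ v a → a ∨ f v) a)
  go {zero}  r h = r-map inj₁ (λ { (inj₁ p) → p }) r
  go {suc n} r h = r-map
    (λ { (inj₁ (inj₁ p)) → inj₁ p ; (inj₁ (inj₂ p)) → inj₂ (zero , p) ; (inj₂ (v , p)) → inj₂ (suc v , p) })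
    (λ { (inj₁ p) → inj₁ (inj₁ p) ; (inj₂ (zero , p)) → inj₁ (inj₂ p) ; (inj₂ (suc v , p)) → inj₂ (v , p) })
    (go (r-or r (h zero)) (h ∘ suc))

r-eq : ∀ {n} (x y : Fin n) →
  Reflects (x ≡ y) (if does (toℕ x ℕₚ.≤? toℕ y) then does (toℕ y ℕₚ.≤? toℕ x) else false)
r-eq x y = r-map (λ (p , q) → Fₚ.toℕ-injective (ℕₚ.≤-antisym p q)) (λ { refl → ℕₚ.≤-refl , ℕₚ.≤-refl })
  (r-and (proof (toℕ x ℕₚ.≤? toℕ y)) (proof (toℕ y ℕₚ.≤? toℕ x)))

iter-inv : ∀ {ℓ} {A : Set} {n} (f : Fin n → A → A) (Inv : ℕ → A → Set ℓ) →
  (∀ v a → Inv (toℕ v) a → Inv (suc (toℕ v)) (f v a)) → ∀ {a} → Inv 0 a → Inv n (iter f a)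
iter-inv {n = zero}  f Inv step i = i
iter-inv {n = suc n} f Inv step i =
  iter-inv (f ∘ suc) (Inv ∘ suc) (λ v → step (suc v)) (step zero _ i)

iter-keep : ∀ {ℓ} {A : Set} {n} (f : Fin n → A → A) (Inv : A → Set ℓ) →
  (∀ v a → Inv a → Inv (f v a)) → ∀ {a} → Inv a → Inv (iter f a)
iter-keep f Inv step = iter-inv f (λ _ → Inv) step

-- If every step either finds the goal reached or decreases μ, then μ steps suffice.
module _ {ℓ} {A B : Set} (f : B → A → A) (μ : A → ℕ) (Goal : A → Set) (Inv : A → Set ℓ)
  (goal-step : ∀ b a → Inv a → Goal a → Goal (f b a)) (inv-step : ∀ b a → Inv a → Inv (f b a))
  (split : ∀ b a → Inv a → Goal a ⊎ μ (f b a) < μ a) (b₀ : B) where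

  settles : ∀ m (h : Fin m → B) {a} → Inv a → μ a ≤ m → Goal (iter (f ∘ h) a)
  settles zero h {a} i le with split b₀ a i
  ... | inj₁ g = g
  ... | inj₂ l = ⊥-elim (ℕₚ.n≮0 (ℕₚ.≤-trans l le))
  settles (suc m) h {a} i le with split (h zero) a i
  ... | inj₂ l = settles m (h ∘ suc) (inv-step _ a i) (ℕₚ.≤-pred (ℕₚ.≤-trans l le))
  ... | inj₁ g = stay m (h ∘ suc) (inv-step _ a i) (goal-step _ a i g)
    where
    stay : ∀ m (h : Fin m → B) {a} → Inv a → Goal a → Goal (iter (f ∘ h) a)
    stay zero    h i g = g
    stay (suc m) h i g = stay m (h ∘ suc) (inv-step _ _ i) (goal-step _ _ i g)

count : ∀ {n} → (Fin n → Bool) → ℕ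
count {zero}  P = 0
count {suc n} P = (if P zero then 1 else 0) + count (P ∘ suc)

count≤ : ∀ {n} (P : Fin n → Bool) → count P ≤ n
count≤ {zero}  P = z≤n
count≤ {suc n} P = ℕₚ.+-mono-≤ {if P zero then 1 else 0} (bit≤ (P zero)) (count≤ (P ∘ suc))
  where
  bit≤ : ∀ b → (if b then 1 else 0) ≤ 1
  bit≤ true  = ℕₚ.≤-refl
  bit≤ false = z≤n

count-mono : ∀ {n} {P Q : Fin n → Bool} → (∀ x → P x ≡ true → Q x ≡ true) → count P ≤ count Q
count-mono {zero}  h = z≤n
count-mono {suc n} {P} {Q} h = ℕₚ.+-mono-≤ (bit≤ (P zero) (Q zero) (h zero)) (count-mono (h ∘ suc))
  where
  bit≤ : ∀ p q → (p ≡ true → q ≡ true) → (if p then 1 else 0) ≤ (if q then 1 else 0)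
  bit≤ true  q h rewrite h refl = ℕₚ.≤-refl
  bit≤ false q h = z≤n

count-strict : ∀ {n} {P Q : Fin n → Bool} → (∀ x → P x ≡ true → Q x ≡ true) →
  ∀ x → P x ≡ false → Q x ≡ true → count P < count Q
count-strict h zero p q rewrite p | q = s≤s (count-mono (h ∘ suc))
count-strict {P = P} {Q} h (suc x) p q with P zero | Q zero | h zero
... | false | false | _ = count-strict (h ∘ suc) x p q
... | false | true  | _ = ℕₚ.m<n⇒m<1+n (count-strict (h ∘ suc) x p q)
... | true  | true  | _ = s≤s (count-strict (h ∘ suc) x p q)
... | true  | false | e = true≢false (e refl) refl

⊔ᵠ-cases : ∀ p q → p ⊔ᵠ q ≡ p ⊎ p ⊔ᵠ q ≡ q
⊔ᵠ-cases p q with does (p ℚₚ.≤? q)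
... | true  = inj₂ refl
... | false = inj₁ refl

≤⊔ᵠˡ : ∀ p q → p ≤ℚ p ⊔ᵠ q
≤⊔ᵠˡ p q with bool-cases (does (p ℚₚ.≤? q))
... | inj₁ e = ℚₚ.≤-trans (true-reflects (proof (p ℚₚ.≤? q)) e) (ℚₚ.≤-reflexive (sym (if-true e)))
... | inj₂ e = ℚₚ.≤-reflexive (sym (if-false e))

≤⊔ᵠʳ : ∀ p q → q ≤ℚ p ⊔ᵠ q
≤⊔ᵠʳ p q with bool-cases (does (p ℚₚ.≤? q))
... | inj₁ e = ℚₚ.≤-reflexive (sym (if-true e))
... | inj₂ e = ℚₚ.≤-trans (ℚₚ.<⇒≤ (ℚₚ.≰⇒> (false-reflects (proof (p ℚₚ.≤? q)) e))) (ℚₚ.≤-reflexive (sym (if-false e)))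

iter-max-upper : ∀ {n} (f : Fin n → ℚ) a → a ≤ℚ iter (λ v x → x ⊔ᵠ f v) a × (∀ v → f v ≤ℚ iter (λ v x → x ⊔ᵠ f v) a)
iter-max-upper {zero}  f a = ℚₚ.≤-refl , λ ()
iter-max-upper {suc n} f a with iter-max-upper (f ∘ suc) (a ⊔ᵠ f zero)
... | p , q = ℚₚ.≤-trans (≤⊔ᵠˡ a (f zero)) p ,
              λ { zero → ℚₚ.≤-trans (≤⊔ᵠʳ a (f zero)) p ; (suc v) → q v }

iter-max-attained : ∀ {n} (f : Fin n → ℚ) a →
  iter (λ v x → x ⊔ᵠ f v) a ≡ a ⊎ ∃[ v ] iter (λ v x → x ⊔ᵠ f v) a ≡ f v
iter-max-attained {zero}  f a = inj₁ refl
iter-max-attained {suc n} f a with iter-max-attained (f ∘ suc) (a ⊔ᵠ f zero)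
... | inj₂ (v , e) = inj₂ (suc v , e)
... | inj₁ e with ⊔ᵠ-cases a (f zero)
...   | inj₁ e′ = inj₁ (trans e e′)
...   | inj₂ e′ = inj₂ (zero , trans e e′)

iter-sum : ∀ {n} (f : Fin n → ℚ) → iter (λ v x → x +ℚ f v) 0ℚ ≡ sum f
iter-sum f = trans (go f 0ℚ) (ℚₚ.+-identityˡ (sum f))
  where
  go : ∀ {n} (f : Fin n → ℚ) a → iter (λ v x → x +ℚ f v) a ≡ a +ℚ sum f
  go {zero}  f a = sym (ℚₚ.+-identityʳ a)
  go {suc n} f a = trans (go (f ∘ suc) (a +ℚ f zero)) (ℚₚ.+-assoc a (f zero) _)

among : List Fam → Fam → Bool
among []       g = false
among (f ∷ fs) g = (fam→ℕ f ≡ᵇ fam→ℕ g) ∨ among fs g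

-- Finding a minimal module

module Run {n k : ℕ} (G : Graph (Fin n)) (rev : Revenue n k) where

  open Algo k
  open Language signature k
  open Semantics G rev
  open Assignments {n} {k} (adj G) (adj-sym G) (adj-irrefl G)

  record Kept (fs : List Fam) (s s′ : Store) : Set where
    constructor kept
    field at : ∀ g → among fs g ≡ false → s′ g ≡ s g
  open Kept

  kept-refl : ∀ {fs s} → Kept fs s s
  kept-refl = kept λ g e → refl

  kept-trans : ∀ {fs s s′ s″} → Kept fs s s′ → Kept fs s′ s″ → Kept fs s s″
  kept-trans K K′ = kept λ g e → trans (at K′ g e) (at K g e)

  kept-set : ∀ {fs} s f {x} → among fs f ≡ true → Kept fs s (set s f x)
  kept-set {fs} s f {x} t = kept by
    where
    by : ∀ g → among fs g ≡ false → set s f x g ≡ s g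
    by g e with Signature._≟ᵃ_ signature f g
    ... | yes refl = true≢false t e
    ... | no _     = refl

  kept-iter : ∀ {fs m} (f : Fin m → Store → Store) → (∀ v s → Kept fs s (f v s)) → ∀ s → Kept fs s (iter f s)
  kept-iter {fs} f h s = iter-keep f (Kept fs s) (λ v s′ K → kept-trans K (h v s′)) kept-refl

  ModuleIn : VSet → (Fin n → Set) → Set
  ModuleIn C S = ∀ {x s s′} → C x ≡ true → ¬ S x → C s ≡ true → S s → C s′ ≡ true → S s′ →
    adj G x s ≡ adj G x s′

  _⊆ᵇ_ : VSet → VSet → Set
  A ⊆ᵇ B = ∀ x → A x ≡ true → B x ≡ true

  -- The quantification over all `C′` containing `C` lets the property pass from one growth step to
  -- the next; in the end it is used with `C′` equal to `C`.
  Generated : Fin n → Fin n → VSet → Set₁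
  Generated u v C = ∀ {C′} → C ⊆ᵇ C′ → (S : Fin n → Set) → ModuleIn C′ S → S u → S v →
    ∀ {x} → C x ≡ true → ¬ ¬ S x

  module _ {d} (u v : Fin n) (ρ : Vec (Fin n) d) where

    mixed-reflects : ∀ x c s → Reflects
      (s inM tt x ≡ true × ∃[ y ] (s clo tt y ≡ true × adj G x y ≢ adj G x u))
      (eval mixed (x ∷ c ∷ v ∷ u ∷ ρ) s)
    mixed-reflects x c s = r-and (r-bool _) (r-any λ y → r-and (r-bool _) (r-differ _ _))

    private
      grow : Store → Store
      grow s = set s clo (λ _ x → s clo tt x ∨ eval mixed (x ∷ u ∷ v ∷ u ∷ ρ) s)

      record Inv (M : VSet) (s : Store) : Set₁ where
        field
          inM≡  : s inM ≡ λ _ → M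
          ⊆M    : s clo tt ⊆ᵇ M
          has-u : s clo tt u ≡ true
          has-v : s clo tt v ≡ true
          least : Generated u v (s clo tt)
      open Inv

      Stable : Store → Set
      Stable s = ∀ x y → s inM tt x ≡ true → s clo tt x ≡ false → s clo tt y ≡ true →
        adj G x y ≡ adj G x u

      grow-⊇ : ∀ s → s clo tt ⊆ᵇ grow s clo tt
      grow-⊇ s x p = ∨-true⁺₁ p

      grow-inv : ∀ {M} s → Inv M s → Inv M (grow s)
      grow-inv {M} s I = record
        { inM≡ = inM≡ I
        ; ⊆M = sub
        ; has-u = grow-⊇ s u (has-u I) ; has-v = grow-⊇ s v (has-v I)
        ; least = λ {C′} ⊆C′ S mod Su Sv {x} p → next {C′} ⊆C′ S mod Su Sv (∨-true⁻ {s clo tt x} p) (⊆C′ x p) }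
        where
        sub : grow s clo tt ⊆ᵇ M
        sub x p with ∨-true⁻ {s clo tt x} p
        ... | inj₁ q = ⊆M I x q
        ... | inj₂ q = trans (cong (λ m → m tt x) (sym (inM≡ I))) (proj₁ (true-reflects (mixed-reflects x u s) q))
        next : ∀ {C′} → grow s clo tt ⊆ᵇ C′ → (S : Fin n → Set) → ModuleIn C′ S → S u → S v →
          ∀ {x} → s clo tt x ≡ true ⊎ eval mixed (x ∷ u ∷ v ∷ u ∷ ρ) s ≡ true → C′ x ≡ true → ¬ ¬ S x
        next {C′} ⊆C′ S mod Su Sv (inj₁ q) _ = least I (λ y → ⊆C′ y ∘ grow-⊇ s y) S mod Su Sv q
        next {C′} ⊆C′ S mod Su Sv {x} (inj₂ q) x∈ ¬Sx with true-reflects (mixed-reflects x u s) q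
        ... | _ , y , cy , ne = least I (λ y → ⊆C′ y ∘ grow-⊇ s y) S mod Su Sv cy λ Sy →
          ne (mod x∈ ¬Sx (⊆C′ y (grow-⊇ s y cy)) Sy (⊆C′ u (grow-⊇ s u (has-u I))) Su)

      missing : Store → ℕ
      missing s = count (λ x → not (s clo tt x))

      grow-split : ∀ {M} s → Inv M s → (Stable s × ∀ x → grow s clo tt x ≡ s clo tt x) ⊎ missing (grow s) < missing s
      grow-split s I with Fₚ.any? (λ x → (s clo tt x Data.Bool.Properties.≟ false) ×-dec
                                 (eval mixed (x ∷ u ∷ v ∷ u ∷ ρ) s Data.Bool.Properties.≟ true))
        where import Data.Bool.Properties
      ... | yes (x , p , q) = inj₂ (count-strict
              (λ y r → not-false⁺ (shrinks y (not-true⁻ r))) x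
              (trans (cong not (∨-true⁺₂ {s clo tt x} q)) refl) (not-false⁺ p))
        where
        shrinks : ∀ y → grow s clo tt y ≡ false → s clo tt y ≡ false
        shrinks y e with s clo tt y
        ... | false = refl
      ... | no none = inj₁ (stable , same)
        where
        same : ∀ x → grow s clo tt x ≡ s clo tt x
        same x with bool-cases (s clo tt x) | bool-cases (eval mixed (x ∷ u ∷ v ∷ u ∷ ρ) s)
        ... | inj₁ p | _ = trans (∨-true⁺₁ p) (sym p)
        ... | inj₂ p | inj₁ q = ⊥-elim (none (x , p , q))
        ... | inj₂ p | inj₂ q = trans (cong₂ _∨_ p q) (sym p)
        stable : Stable s
        stable x y m p q with adj G x y Data.Bool.Properties.≟ adj G x u
          where import Data.Bool.Properties
        ... | yes e = e
        ... | no ne = ⊥-elim (none (x , p , reflects-true (mixed-reflects x u s) (m , y , q , ne)))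

    close-kept : ∀ {fs} s → among fs clo ≡ true → Kept fs s (exec close (v ∷ u ∷ ρ) s)
    close-kept s t = kept-trans (kept-set s clo t)
      (kept-iter {m = n} (λ c → exec (assign clo (λ _ → clo? #0 ∨ᵉ mixed)) (c ∷ v ∷ u ∷ ρ)) (λ c s → kept-set s clo t) _)

    record Closure (M C : VSet) : Set₁ where
      field
        ⊆M     : C ⊆ᵇ M
        has-u  : C u ≡ true
        has-v  : C v ≡ true
        least  : Generated u v C
        stable : ∀ {x y} → M x ≡ true → C x ≡ false → C y ≡ true → adj G x y ≡ adj G x u

    close-closure : ∀ s → s inM tt u ≡ true → s inM tt v ≡ true →
      Closure (s inM tt) (exec close (v ∷ u ∷ ρ) s clo tt)
    close-closure s mu mv = record
      { ⊆M = ⊆M final ; has-u = has-u final ; has-v = has-v final ; least = least final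
      ; stable = λ m p q → stable _ _ (trans (cong (λ f → f tt _) (inM≡ final)) m) p q }
      where
      M : VSet
      M = s inM tt
      start : Store
      start = set s clo (λ _ x → eval (eqᵉ #0 #2 ∨ᵉ eqᵉ #0 #1) (x ∷ v ∷ u ∷ ρ) s)
      start-reflects : ∀ x → Reflects (x ≡ u ⊎ x ≡ v) (start clo tt x)
      start-reflects x = r-or (r-eq x u) (r-eq x v)
      init : Inv M start
      init = record
        { inM≡ = refl
        ; ⊆M = λ x p → by (true-reflects (start-reflects x) p)
        ; has-u = reflects-true (start-reflects u) (inj₁ refl)
        ; has-v = reflects-true (start-reflects v) (inj₂ refl)
        ; least = λ _ S _ Su Sv {x} p ¬Sx → case Su Sv ¬Sx (true-reflects (start-reflects x) p) }
        where
        by : ∀ {x} → x ≡ u ⊎ x ≡ v → M x ≡ true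
        by (inj₁ refl) = mu
        by (inj₂ refl) = mv
        case : ∀ {S : Fin n → Set} {x} → S u → S v → ¬ S x → x ≡ u ⊎ x ≡ v → ⊥
        case Su Sv ¬Sx (inj₁ refl) = ¬Sx Su
        case Su Sv ¬Sx (inj₂ refl) = ¬Sx Sv
      closed : Store
      closed = iter {n = n} (λ _ → grow) start
      final : Inv M closed
      final = lift-inv n start init
        where
        lift-inv : ∀ m s → Inv M s → Inv M (iter {n = m} (λ _ → grow) s)
        lift-inv zero    s i = i
        lift-inv (suc m) s i = lift-inv m (grow s) (grow-inv s i)
      stable-grow : ∀ s → Inv M s → Stable s → Stable (grow s)
      stable-grow s i g with grow-split s i
      ... | inj₁ (_ , same) = λ x y a b c → g x y a (trans (sym (same x)) b) (trans (sym (same y)) c)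
      ... | inj₂ l = ⊥-elim (ℕₚ.<-irrefl refl (ℕₚ.<-≤-trans l
              (count-mono λ x p → not-false⁺ (stuck x (not-true⁻ p)))))
        where
        stuck : ∀ x → s clo tt x ≡ false → grow s clo tt x ≡ false
        stuck x p with bool-cases (eval mixed (x ∷ u ∷ v ∷ u ∷ ρ) s)
        ... | inj₂ q = trans (cong₂ _∨_ p q) refl
        ... | inj₁ q with true-reflects (mixed-reflects x u s) q
        ...   | m , y , cy , ne = ⊥-elim (ne (g x y m p cy))
      stable : Stable closed
      stable = settles (λ (_ : Fin n) → grow) missing Stable (Inv M) (λ _ → stable-grow) (λ _ → grow-inv)
        (λ _ s i → weaken s (grow-split s i)) u n id init (count≤ _)
        where
        weaken : ∀ s → (Stable s × ∀ x → grow s clo tt x ≡ s clo tt x) ⊎ missing (grow s) < missing s →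
          Stable s ⊎ missing (grow s) < missing s
        weaken s (inj₁ (g , _)) = inj₁ g
        weaken s (inj₂ l) = inj₂ l

  Two : VSet → Set
  Two A = ∃[ a ] ∃[ b ] (A a ≡ true × A b ≡ true × a ≢ b)

  -- `P` collects the pairs already treated. By `gen` such a pair of distinct vertices, if still
  -- present, generates all of `M`; once all pairs are treated, this is primality of `M`.
  record Shrunk (A : VSet) (P : Fin n → Fin n → Set) (M : VSet) : Set₁ where
    field
      ⊆A  : M ⊆ᵇ A
      mod : ∀ {x y y′} → A x ≡ true → M x ≡ false → M y ≡ true → M y′ ≡ true → adj G x y ≡ adj G x y′
      -- Ensures that the later contraction loses a vertex.
      two : Two A → Two M
      some : ∃[ a ] A a ≡ true → ∃[ m ] M m ≡ true
      gen : ∀ {a b} → P a b → a ≢ b → M a ≡ true → M b ≡ true → (S : Fin n → Set) → ModuleIn M S →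
            S a → S b → ∀ {x} → M x ≡ true → ¬ ¬ S x

  shrunk-≗ : ∀ {A P M M′} → (∀ x → M x ≡ M′ x) → Shrunk A P M → Shrunk A P M′
  shrunk-≗ e H = record
    { ⊆A = λ x p → ⊆A x (trans (e x) p)
    ; mod = λ a p q r → mod a (trans (e _) p) (trans (e _) q) (trans (e _) r)
    ; some = λ h → let (a , p) = some h in a , trans (sym (e a)) p
    ; two = λ t → let (a , b , p , q , ne) = two t in a , b , trans (sym (e a)) p , trans (sym (e b)) q , ne
    ; gen = λ Pab ne p q S m Sa Sb r → gen Pab ne (trans (e _) p) (trans (e _) q) S
        (λ a b c d f g → m (trans (sym (e _)) a) b (trans (sym (e _)) c) d (trans (sym (e _)) f) g) Sa Sb (trans (e _) r) }
    where open Shrunk H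

  shrunk-P : ∀ {A P Q M} → (∀ {a b} → Q a b → P a b) → Shrunk A P M → Shrunk A Q M
  shrunk-P f H = record { ⊆A = ⊆A ; mod = mod ; two = two ; some = some ; gen = λ q → gen (f q) }
    where open Shrunk H

  module _ {d} (ρ : Vec (Fin n) d) (u v : Fin n) where

    shrink-kept : ∀ {fs} s → among fs clo ≡ true → among fs inM ≡ true → Kept fs s (exec shrink (v ∷ u ∷ ρ) s)
    shrink-kept s t t′ = kept-trans (close-kept u v ρ s t) (kept-set _ inM t′)

    shrink-step : ∀ {A P} s → Shrunk A P (s inM tt) →
      Shrunk A (λ a b → P a b ⊎ (a ≡ u × b ≡ v)) (exec shrink (v ∷ u ∷ ρ) s inM tt)
    shrink-step {A} {P} s H = by (bool-cases (eval cond (u ∷ v ∷ u ∷ ρ) s′))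
      where
      open Shrunk H
      M : VSet
      M = s inM tt
      s′ : Store
      s′ = exec close (v ∷ u ∷ ρ) s
      cond : Exp bool (3 + d)
      cond = inM? #2 ∧ᵉ inM? #1 ∧ᵉ notᵉ (eqᵉ #2 #1)
      M≡ : ∀ x → s′ inM tt x ≡ M x
      M≡ x = cong (λ f → f tt x) (Kept.at (close-kept {d} u v ρ {clo ∷ []} s refl) inM refl)
      cond-reflects : Reflects (M u ≡ true × M v ≡ true × ¬ (u ≡ v)) (eval cond (u ∷ v ∷ u ∷ ρ) s′)
      cond-reflects = r-and (r-map (trans (sym (M≡ u))) (trans (M≡ u)) (r-bool _))
        (r-and (r-map (trans (sym (M≡ v))) (trans (M≡ v)) (r-bool _)) (r-not (r-eq u v)))
      by : eval cond (u ∷ v ∷ u ∷ ρ) s′ ≡ true ⊎ eval cond (u ∷ v ∷ u ∷ ρ) s′ ≡ false →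
        Shrunk A (λ a b → P a b ⊎ (a ≡ u × b ≡ v)) (exec shrink (v ∷ u ∷ ρ) s inM tt)
      by (inj₂ e) = shrunk-≗ (λ x → sym (trans (if-false e) (M≡ x))) record
        { ⊆A = ⊆A ; mod = mod ; two = two ; some = some
        ; gen = λ { (inj₁ p) → gen p
                  ; (inj₂ (refl , refl)) ne p q → ⊥-elim (false-reflects cond-reflects e (p , q , ne)) } }
      by (inj₁ e) = shrunk-≗ (λ x → sym (if-true e)) record
        { ⊆A = λ x p → ⊆A x (C.⊆M x p)
        ; mod = λ a p q r → module-C a p q r
        ; some = λ _ → u , C.has-u
        ; two = λ _ → u , v , C.has-u , C.has-v , proj₂ (proj₂ holds)
        ; gen = λ { (inj₁ p) ne q r S m Sa Sb {x} c → persist p ne q r S m Sa Sb c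
                  ; (inj₂ (refl , refl)) ne q r S m Sa Sb {x} c → C.least (λ _ p → p) S m Sa Sb c } }
        where
        holds : M u ≡ true × M v ≡ true × ¬ (u ≡ v)
        holds = true-reflects cond-reflects e
        C : VSet
        C = s′ clo tt
        module C = Closure (close-closure u v ρ s (proj₁ holds) (proj₁ (proj₂ holds)))
        module-C : ∀ {x y y′} → A x ≡ true → C x ≡ false → C y ≡ true → C y′ ≡ true → adj G x y ≡ adj G x y′
        module-C {x} a p q r with bool-cases (M x)
        ... | inj₁ m = trans (C.stable m p q) (sym (C.stable m p r))
        ... | inj₂ m = mod a m (C.⊆M _ q) (C.⊆M _ r)
        -- `C` is a module of `M`, so a module of `C` is a module of `M`, and the old property of
        -- the pair applies.
        persist : ∀ {a b} → P a b → a ≢ b → C a ≡ true → C b ≡ true → (S : Fin n → Set) → ModuleIn C S →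
            S a → S b → ∀ {x} → C x ≡ true → ¬ ¬ S x
        persist p ne q r S m Sa Sb {x} c ¬Sx = gen p ne (C.⊆M _ q) (C.⊆M _ r) (λ y → C y ≡ true × S y)
          inside (q , Sa) (r , Sb) (C.⊆M x c) (¬Sx ∘ proj₂)
          where
          inside : ModuleIn M (λ y → C y ≡ true × S y)
          inside {y} My ¬Sy _ (c₁ , S₁) _ (c₂ , S₂) with bool-cases (C y)
          ... | inj₁ cy = m cy (λ Sy → ¬Sy (cy , Sy)) c₁ S₁ c₂ S₂
          ... | inj₂ cy = module-C (⊆A y My) cy c₁ c₂

  module _ {d} (ρ : Vec (Fin n) d) where

    findModule-kept : ∀ {fs} s → among fs clo ≡ true → among fs inM ≡ true → Kept fs s (exec findModule ρ s)
    findModule-kept s t t′ = kept-trans (kept-set s inM t′)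
      (kept-iter {m = n} (λ u → exec (for shrink) (u ∷ ρ)) (λ u s → kept-iter {m = n} (λ v → exec shrink (v ∷ u ∷ ρ))
        (λ v s → shrink-kept ρ u v s t t′) s) _)

    findModule-shrunk : ∀ s → Shrunk (s alive tt) (λ _ _ → ⊤) (exec findModule ρ s inM tt)
    findModule-shrunk s = shrunk-P (λ {a} _ → Fₚ.toℕ<n a) (iter-inv {n = n} (λ u → exec (for shrink) (u ∷ ρ))
        (λ i s → Shrunk A (λ a _ → toℕ a < i) (s inM tt)) outer
        {set s inM λ _ → A} start)
      where
      A : VSet
      A = s alive tt
      start : Shrunk A (λ a _ → toℕ a < 0) A
      start = record { ⊆A = λ _ p → p ; mod = λ p q → true≢false p q ; two = id ; some = id ; gen = λ () }
      outer : ∀ u s → Shrunk A (λ a _ → toℕ a < toℕ u) (s inM tt) →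
        Shrunk A (λ a _ → toℕ a < suc (toℕ u)) (exec (for shrink) (u ∷ ρ) s inM tt)
      outer u s H = shrunk-P split (iter-inv {n = n} (λ v → exec shrink (v ∷ u ∷ ρ))
          (λ j s → Shrunk A (λ a b → toℕ a < toℕ u ⊎ (a ≡ u × toℕ b < j)) (s inM tt))
          (λ v s H → shrunk-P (λ { (inj₁ p) → inj₁ (inj₁ p) ; (inj₂ (e , l)) → last v e (ℕₚ.m<1+n⇒m<n∨m≡n l) })
            (shrink-step ρ u v s H))
          (shrunk-P (λ { (inj₁ p) → p ; (inj₂ (_ , ())) }) H))
        where
        split : ∀ {a b : Fin n} → toℕ a < suc (toℕ u) → toℕ a < toℕ u ⊎ (a ≡ u × toℕ b < n)
        split {a} {b} l with ℕₚ.m<1+n⇒m<n∨m≡n l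
        ... | inj₁ p = inj₁ p
        ... | inj₂ e = inj₂ (Fₚ.toℕ-injective e , Fₚ.toℕ<n b)
        last : ∀ {a b : Fin n} v → a ≡ u → toℕ b < toℕ v ⊎ toℕ b ≡ toℕ v →
          (toℕ a < toℕ u ⊎ (a ≡ u × toℕ b < toℕ v)) ⊎ (a ≡ u × b ≡ v)
        last v e (inj₁ l)  = inj₁ (inj₂ (e , l))
        last v e (inj₂ e′) = inj₂ (e , Fₚ.toℕ-injective e′)

least : ∀ {n} (M : Fin n → Bool) x → M x ≡ true →
  ∃[ z ] (M z ≡ true × ∀ w → M w ≡ true → toℕ z ≤ toℕ w)
least {suc n} M x p with bool-cases (M zero)
... | inj₁ q = zero , q , λ _ _ → z≤n
least {suc n} M zero p    | inj₂ q = true≢false p q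
least {suc n} M (suc x) p | inj₂ q with least (M ∘ suc) x p
... | z , Mz , h = suc z , Mz , λ { zero r → true≢false r q ; (suc w) r → s≤s (h w r) }

-- Elimination from the ends of paths

module RunPath {n k : ℕ} (G : Graph (Fin n)) (rev : Revenue n k) where

  open Algo k
  open Language signature k
  open Semantics G rev
  open Assignments {n} {k} (adj G) (adj-sym G) (adj-irrefl G)
  open Run G rev

  opt-cong : ∀ {A A′ r r′ K c c′ x} → (∀ v → A v ≡ A′ v) → (∀ D v → A v ≡ true → r D v ≡ r′ D v) → c ≡ c′ →
    Opt A r K c x → Opt A′ r′ K c′ x
  opt-cong {A} {A′} {r} {r′} {c = c} e h refl O = record
    { D = O.D
    ; within = λ p → O.within (trans (e _) p)
    ; compat = λ p q → O.compat (trans (e _) p) (trans (e _) q)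
    ; attained = ℚₚ.≤-trans O.attained (ℚₚ.≤-reflexive (cong (c +ℚ_) (value-cong e (λ v → h (O.D v) v))))
    ; bound = λ D w cp → ℚₚ.≤-trans (ℚₚ.≤-reflexive (cong (c +ℚ_) (sym (value-cong e (λ v → h (D v) v)))))
        (O.bound D (λ p → w (trans (sym (e _)) p)) λ p q → cp (trans (sym (e _)) p) (trans (sym (e _)) q)) }
    where module O = Opt O

  opt-unique : ∀ {A r K c x y} → Opt A r K c x → Opt A r K c y → x ≤ℚ y
  opt-unique O O′ = ℚₚ.≤-trans (Opt.attained O) (Opt.bound O′ (Opt.D O) (Opt.within O) (Opt.compat O))

  maxima-upper : ∀ {A : Set} {d} (xs : List A) (e : A → Exp rational d) ρ s {x} → x ∈ᴸ xs →
    eval (e x) ρ s ≤ℚ eval (maxima xs e) ρ s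
  maxima-upper (x ∷ xs) e ρ s (here refl) = ≤⊔ᵠˡ _ _
  maxima-upper (x ∷ xs) e ρ s (there p) = ℚₚ.≤-trans (maxima-upper xs e ρ s p) (≤⊔ᵠʳ (eval (e x) ρ s) _)

  maxima-attained : ∀ {A : Set} {d} (xs : List A) (e : A → Exp rational d) ρ s →
    eval (maxima xs e) ρ s ≡ 0ℚ ⊎ ∃[ x ] (x ∈ᴸ xs × eval (maxima xs e) ρ s ≡ eval (e x) ρ s)
  maxima-attained [] e ρ s = inj₁ refl
  maxima-attained (x ∷ xs) e ρ s with ⊔ᵠ-cases (eval (e x) ρ s) (eval (maxima xs e) ρ s)
  ... | inj₁ p = inj₂ (x , here refl , p)
  ... | inj₂ p with maxima-attained xs e ρ s
  ...   | inj₁ q = inj₁ (trans p q)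
  ...   | inj₂ (y , m , q) = inj₂ (y , there m , trans p q)

  High : VSet → Set
  High M = ∃[ v ] (M v ≡ true × ∃[ a ] (M a ≡ true × adj G v a ≡ true ×
    ∃[ b ] (M b ≡ true × adj G v b ≡ true × ¬ (a ≡ b) ×
    ∃[ c ] (M c ≡ true × adj G v c ≡ true × ¬ (a ≡ c) × ¬ (b ≡ c)))))

  high-reflects : ∀ {d} (ρ : Vec (Fin n) d) s → Reflects (High (s inM tt)) (eval high ρ s)
  high-reflects ρ s = r-any λ v → r-and (r-bool _) (r-any λ a → r-and (r-bool _) (r-and (r-bool _)
    (r-any λ b → r-and (r-bool _) (r-and (r-bool _) (r-and (r-not (r-eq a b))
    (r-any λ c → r-and (r-bool _) (r-and (r-bool _) (r-and (r-not (r-eq a c)) (r-not (r-eq b c)))))))))) 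

  Rep : VSet → Fin n → Set
  Rep M z = M z ≡ true × ¬ (∃[ w ] (M w ≡ true × ¬ (toℕ z ≤ toℕ w)))

  rep-reflects : ∀ {d} (ρ : Vec (Fin n) d) s x → Reflects (Rep (s inM tt) (lookup ρ x)) (eval (rep x) ρ s)
  rep-reflects ρ s x = r-and (r-bool _) (r-not (r-any λ w → r-and (r-bool _) (r-not (proof (_ ℕₚ.≤? _)))))

  rep-unique : ∀ {M x y} → Rep M x → Rep M y → x ≡ y
  rep-unique {x = x} {y} (Mx , nx) (My , ny) = Fₚ.toℕ-injective (ℕₚ.≤-antisym
    (decidable-stable (_ ℕₚ.≤? _) λ n → nx (y , My , n)) (decidable-stable (_ ℕₚ.≤? _) λ n → ny (x , Mx , n)))

  rep-exists : ∀ {M} x → M x ≡ true → ∃ (Rep M)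
  rep-exists {M} x p with least M x p
  ... | z , Mz , h = z , Mz , λ { (w , Mw , n) → n (h w Mw) }

  IsPrimeIn : VSet → Set₁
  IsPrimeIn M = ∀ {a b} → a ≢ b → M a ≡ true → M b ≡ true → (S : Fin n → Set) → ModuleIn M S →
    S a → S b → ∀ {x} → M x ≡ true → ¬ ¬ S x

  U : Store → VSet
  U s x = not (s vis tt x)

  Eligible : VSet → Fin n → Set
  Eligible A u = A u ≡ true × ¬ (∃[ a ] (A a ≡ true × adj G u a ≡ true ×
    ∃[ b ] (A b ≡ true × adj G u b ≡ true × ¬ (a ≡ b))))

  r-unvisited : ∀ b → Reflects (not b ≡ true) (if b then false else true)
  r-unvisited true  = ofⁿ λ ()
  r-unvisited false = ofʸ refl

  eligible-reflects : ∀ {d} (ρ : Vec (Fin n) d) s u → Reflects (Eligible (U s) (lookup ρ u)) (eval (eligible u) ρ s)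
  eligible-reflects ρ s u = r-and (r-unvisited _) (r-not (r-any λ a → r-and (r-unvisited _) (r-and (r-bool _)
    (r-any λ b → r-and (r-unvisited _) (r-and (r-bool _) (r-not (r-eq a b)))))))

  -- Otherwise each vertex of `A` has two neighbours in `A`, hence no other neighbour in `M`, where
  -- degrees are at most two. Then `A` is a module of `M` with two elements and without `z`.
  eligible-exists : ∀ {M A z} → IsPrimeIn M → ¬ High M → M z ≡ true → A ⊆ᵇ (M ∖ z) →
    ∀ x → A x ≡ true → ¬ (∀ u → ¬ Eligible A u)
  eligible-exists {M} {A} {z} prime low Mz A⊆ x Ax none = busy Ax λ a Aa e b Ab e′ ne →
      prime (λ { refl → true≢false e (adj-irrefl G x) }) (in-M Ax) (in-M Aa) (λ y → A y ≡ true)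
        closed Ax Aa Mz λ Az → proj₂ (∖-⊆ (A⊆ z Az)) refl
    where
    in-M : ∀ {y} → A y ≡ true → M y ≡ true
    in-M p = proj₁ (∖-⊆ (A⊆ _ p))
    busy : ∀ {y} → A y ≡ true → (∀ a → A a ≡ true → adj G y a ≡ true → ∀ b → A b ≡ true → adj G y b ≡ true →
      ¬ (a ≡ b) → ⊥) → ⊥
    busy {y} p k = none y (p , λ { (a , Aa , e , b , Ab , e′ , ne) → k a Aa e b Ab e′ ne })
    away : ∀ {y s} → M y ≡ true → ¬ (A y ≡ true) → A s ≡ true → adj G y s ≡ false
    away {y} {s} My ¬Ay As with bool-cases (adj G y s)
    ... | inj₂ e = e
    ... | inj₁ e = ⊥-elim (busy As λ a Aa e₁ b Ab e₂ ne → low (s , in-M As , y , My , trans (adj-sym G s y) e ,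
      a , in-M Aa , e₁ , (λ { refl → ¬Ay Aa }) , b , in-M Ab , e₂ , (λ { refl → ¬Ay Ab }) , ne))
    closed : ModuleIn M (λ y → A y ≡ true)
    closed My ¬Ay _ As _ As′ = trans (away My ¬Ay As) (sym (away My ¬Ay As′))

  module Sweep {d} (ρ : Vec (Fin n) d) (z : Fin n) (K : Subset k) where

    step : Fin n → Fin n → Store → Store
    step c u = exec (eliminate K) (u ∷ c ∷ z ∷ ρ)

    -- Correctness is carried backwards: any value optimal for the vertices still present satisfies
    -- `Target`, the claim about the instance before the sweeps.
    record Inv (Target : ℚ → Set) (M : VSet) (s : Store) : Set where
      field
        mono  : Monotone (s wt′)
        back  : ∀ {x} → Opt (U s) (s wt′) K (s acc tt z) x → Target x
        ⊆M    : U s ⊆ᵇ (M ∖ z)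

    module Step (c u : Fin n) (s : Store) where

      s₁ s₂ s′ : Store
      s₁ = exec (assign acc (λ _ → ifᵉ (eligible #1 ∧ᵉ notᵉ (anyᵉ (unvisited? #0 ∧ᵉ adjᵉ #2 #0)))
        (bin plus (cell acc tt #0) (cell wt′ K #1)) (cell acc tt #0))) (u ∷ c ∷ z ∷ ρ) s
      s₂ = exec (assign wt′ (λ D → ifᵉ (eligible #1 ∧ᵉ unvisited? #0 ∧ᵉ adjᵉ #1 #0)
        (maxima (subsets k) λ F → bin plus (cell wt′ (F ∩ D) #0) (cell wt′ (K ─ (F ∩ D)) #1))
        (cell wt′ D #0))) (u ∷ c ∷ z ∷ ρ) s₁
      s′ = step c u s

      ρ′ : Fin n → Vec (Fin n) (4 + d)
      ρ′ x = x ∷ u ∷ c ∷ z ∷ ρ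

      isolated-reflects : Reflects (Eligible (U s) u × ¬ (∃[ a ] (U s a ≡ true × adj G u a ≡ true)))
        (eval (eligible #1 ∧ᵉ notᵉ (anyᵉ (unvisited? #0 ∧ᵉ adjᵉ #2 #0))) (ρ′ z) s)
      isolated-reflects = r-and (eligible-reflects (ρ′ z) s #1)
        (r-not (r-any λ a → r-and (r-unvisited _) (r-bool _)))

      update-reflects : ∀ x → Reflects (Eligible (U s) u × U s x ≡ true × adj G u x ≡ true)
        (eval (eligible #1 ∧ᵉ unvisited? #0 ∧ᵉ adjᵉ #1 #0) (ρ′ x) s₁)
      update-reflects x = r-and (eligible-reflects (ρ′ x) s₁ #1) (r-and (r-unvisited _) (r-bool _))

      vis-reflects : ∀ x → Reflects (s vis tt x ≡ true ⊎ (x ≡ u × Eligible (U s) u)) (s′ vis tt x)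
      vis-reflects x = r-or (r-bool _) (r-and (r-eq x u) (eligible-reflects (ρ′ x) s₂ #1))

      U-shrinks : U s′ ⊆ᵇ U s
      U-shrinks x p with bool-cases (s vis tt x)
      ... | inj₂ e = not-false⁺ e
      ... | inj₁ e = true≢false (reflects-true (vis-reflects x) (inj₁ e)) (not-true⁻ p)

      U-eligible : Eligible (U s) u → U s′ u ≡ false
      U-eligible el = cong not (reflects-true (vis-reflects u) (inj₂ (refl , el)))

      U-same : ¬ Eligible (U s) u → ∀ x → U s′ x ≡ U s x
      U-same ¬el x with bool-cases (s vis tt x)
      ... | inj₁ e = cong not (trans (reflects-true (vis-reflects x) (inj₁ e)) (sym e))
      ... | inj₂ e = cong not (trans (reflects-false (vis-reflects x)
              λ { (inj₁ p) → true≢false p e ; (inj₂ (_ , el)) → ¬el el }) (sym e))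

      U-drop : Eligible (U s) u → ∀ x → U s′ x ≡ (U s ∖ u) x
      U-drop el x with x Fₚ.≟ u
      ... | yes refl = trans (U-eligible el) (sym (trans (∖-def (U s) u u)
                         (trans (cong (λ b → U s u ∧ not b) (≡ᶠ-refl u)) (𝔹ₚ.∧-zeroʳ (U s u)))))
      ... | no ne = trans (cong not (same (bool-cases (s vis tt x))))
              (sym (trans (∖-def (U s) u x) (trans (cong (λ b → U s x ∧ not b) (≢⇒≡ᶠ ne)) (𝔹ₚ.∧-identityʳ (U s x)))))
        where
        same : s vis tt x ≡ true ⊎ s vis tt x ≡ false → s′ vis tt x ≡ s vis tt x
        same (inj₁ e) = trans (reflects-true (vis-reflects x) (inj₁ e)) (sym e)
        same (inj₂ e) = trans (reflects-false (vis-reflects x)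
          λ { (inj₁ p) → true≢false p e ; (inj₂ (e′ , _)) → ne e′ }) (sym e)

      wt-same : ∀ {x} D → ¬ (Eligible (U s) u × U s x ≡ true × adj G u x ≡ true) → s′ wt′ D x ≡ s wt′ D x
      wt-same {x} D h = if-false (reflects-false (update-reflects x) h)

      choice : Subset k → Fin n → Exp rational (4 + d)
      choice D x = maxima (subsets k) λ F → bin plus (cell wt′ (F ∩ D) #0) (cell wt′ (K ─ (F ∩ D)) #1)

      wt-new : ∀ {x} D → Eligible (U s) u × U s x ≡ true × adj G u x ≡ true →
        s′ wt′ D x ≡ eval (choice D x) (ρ′ x) s₁
      wt-new {x} D h = if-true (reflects-true (update-reflects x) h)

      acc-iso : Eligible (U s) u → ¬ (∃[ a ] (U s a ≡ true × adj G u a ≡ true)) →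
        s′ acc tt z ≡ s acc tt z +ℚ s wt′ K u
      acc-iso el iso = if-true (reflects-true isolated-reflects (el , iso))

      acc-same : ¬ (Eligible (U s) u × ¬ (∃[ a ] (U s a ≡ true × adj G u a ≡ true))) → s′ acc tt z ≡ s acc tt z
      acc-same h = if-false (reflects-false isolated-reflects h)

      wt-upper : ∀ {x D F} → Eligible (U s) u × U s x ≡ true × adj G u x ≡ true → F ⊆ D →
        s wt′ F x +ℚ s wt′ (K ─ F) u ≤ℚ s′ wt′ D x
      wt-upper {x} {D} {F} h F⊆D = ℚₚ.≤-trans
        (ℚₚ.≤-reflexive (cong (λ E → s wt′ E x +ℚ s wt′ (K ─ E) u)
          (⊆-antisym (λ p → x∈p∩q⁺ (p , F⊆D p)) (p∩q⊆p F D))))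
        (ℚₚ.≤-trans (maxima-upper (subsets k) (λ F → bin plus (cell wt′ (F ∩ D) #0) (cell wt′ (K ─ (F ∩ D)) #1))
            (ρ′ x) s₁ (∈-subsets F))
          (ℚₚ.≤-reflexive (sym (wt-new D h))))

      wt-lower : ∀ {x} → Monotone (s wt′) → ∀ D → Eligible (U s) u × U s x ≡ true × adj G u x ≡ true →
        ∃[ F ] (F ⊆ D × s′ wt′ D x ≤ℚ s wt′ F x +ℚ s wt′ (K ─ F) u)
      wt-lower {x} mr D h with maxima-attained (subsets k)
          (λ F → bin plus (cell wt′ (F ∩ D) #0) (cell wt′ (K ─ (F ∩ D)) #1)) (ρ′ x) s₁
      ... | inj₂ (F , _ , e) = F ∩ D , p∩q⊆q F D , ℚₚ.≤-reflexive (trans (wt-new D h) e)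
      ... | inj₁ e = D , id , ℚₚ.≤-trans (ℚₚ.≤-reflexive (trans (wt-new D h) e))
              (ℚₚ.+-mono-≤ (Monotone.nonneg mr D x) (Monotone.nonneg mr (K ─ D) u))

      mono′ : Monotone (s wt′) → Monotone (s′ wt′)
      mono′ mr = record { mono = λ {D} {D′} v sub → by v sub (bool-cases (eval (eligible #1 ∧ᵉ unvisited? #0 ∧ᵉ adjᵉ #1 #0) (ρ′ v) s₁))
                        ; nonneg = λ D v → pos D v (bool-cases (eval (eligible #1 ∧ᵉ unvisited? #0 ∧ᵉ adjᵉ #1 #0) (ρ′ v) s₁)) }
        where
        by : ∀ {D D′} v → D ⊆ D′ → _ → s′ wt′ D v ≤ℚ s′ wt′ D′ v
        by {D} {D′} v sub (inj₁ e) =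
          let h = true-reflects (update-reflects v) e
              (F , F⊆D , le) = wt-lower mr D h in
          ℚₚ.≤-trans le (wt-upper h (sub ∘ F⊆D))
        by {D} {D′} v sub (inj₂ e) =
          let h = false-reflects (update-reflects v) e in
          ℚₚ.≤-trans (ℚₚ.≤-reflexive (wt-same D h))
            (ℚₚ.≤-trans (Monotone.mono mr v sub) (ℚₚ.≤-reflexive (sym (wt-same D′ h))))
        pos : ∀ D v → _ → 0ℚ ≤ℚ s′ wt′ D v
        pos D v (inj₁ e) = ℚₚ.≤-trans (ℚₚ.+-mono-≤ (Monotone.nonneg mr D v) (Monotone.nonneg mr (K ─ D) u))
          (wt-upper (true-reflects (update-reflects v) e) id)
        pos D v (inj₂ e) = ℚₚ.≤-trans (Monotone.nonneg mr D v)
          (ℚₚ.≤-reflexive (sym (wt-same D (false-reflects (update-reflects v) e))))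

      pull : Monotone (s wt′) → ∀ {x} → Opt (U s′) (s′ wt′) K (s′ acc tt z) x → Opt (U s) (s wt′) K (s acc tt z) x
      pull mr {x} O = by (bool-cases (eval (eligible #1) (ρ′ z) s))
        where
        nbr? : Exp bool (4 + d)
        nbr? = anyᵉ (unvisited? #0 ∧ᵉ adjᵉ #2 #0)
        nbr-reflects : Reflects (∃[ a ] (U s a ≡ true × adj G u a ≡ true)) (eval nbr? (ρ′ z) s)
        nbr-reflects = r-any λ a → r-and (r-unvisited _) (r-bool _)
        by : eval (eligible #1) (ρ′ z) s ≡ true ⊎ eval (eligible #1) (ρ′ z) s ≡ false → Opt (U s) (s wt′) K (s acc tt z) x
        by (inj₂ e) = opt-cong (U-same ¬el) (λ D v _ → wt-same D (¬el ∘ proj₁)) (acc-same (¬el ∘ proj₁)) O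
          where ¬el = false-reflects (eligible-reflects (ρ′ z) s #1) e
        by (inj₁ e) = nbr (bool-cases (eval nbr? (ρ′ z) s))
          where
          el = true-reflects (eligible-reflects (ρ′ z) s #1) e
          nbr : eval nbr? (ρ′ z) s ≡ true ⊎ eval nbr? (ρ′ z) s ≡ false → Opt (U s) (s wt′) K (s acc tt z) x
          nbr (inj₂ e) = eliminate-isolated (proj₁ el) mr (λ p q → iso (_ , p , q))
            (opt-cong (U-drop el) (λ D v p → wt-same D λ (_ , q , r) → iso (v , q , r)) (acc-iso el iso) O)
            where iso = false-reflects nbr-reflects e
          nbr (inj₁ e) with true-reflects nbr-reflects e
          ... | v , Uv , u~v = eliminate-leaf (proj₁ el) mr {r′ = s′ wt′} Uv u~v only
              (λ D Uy ne → wt-same D λ (_ , q , r) → ne (only q r))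
              (λ D → wt-lower mr D (el , Uv , u~v)) (wt-upper (el , Uv , u~v))
              (opt-cong (U-drop el) (λ _ _ _ → refl) (acc-same λ (_ , iso) → iso (v , Uv , u~v)) O)
            where
            only : ∀ {a} → U s a ≡ true → adj G u a ≡ true → a ≡ v
            only {a} p q = decidable-stable (a Fₚ.≟ v) λ ne → proj₂ el (a , p , q , v , Uv , u~v , ne)

    step-inv : ∀ {T M} c u s → Inv T M s → Inv T M (step c u s)
    step-inv c u s I = record
      { mono = mono′ (Inv.mono I)
      ; back = λ O → Inv.back I (pull (Inv.mono I) O)
      ; ⊆M = λ x p → Inv.⊆M I x (U-shrinks x p) }
      where open Step c u s

    sweep : Fin n → Store → Store
    sweep c = iter (step c)

    sweep-inv : ∀ {T M} c s → Inv T M s → Inv T M (sweep c s)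
    sweep-inv {T} {M} c s = iter-keep (step c) (Inv T M) (step-inv c)

    sweep-shrinks : ∀ c s → U (sweep c s) ⊆ᵇ U s
    sweep-shrinks c s = iter-keep (step c) (λ s′ → U s′ ⊆ᵇ U s) (λ u s′ h x p → h x (Step.U-shrinks c u s′ x p)) (λ x p → p)

    eligible-⊆ : ∀ {A B u} → B ⊆ᵇ A → B u ≡ true → Eligible A u → Eligible B u
    eligible-⊆ sub Bu (_ , h) = Bu , λ { (a , p , e , b , q , e′ , ne) → h (a , sub a p , e , b , sub b q , e′ , ne) }

    -- Removing other vertices preserves eligibility, so `u` is gone at the latest when its turn
    -- comes.
    sweep-visits : ∀ c s u → Eligible (U s) u → U (sweep c s) u ≡ false
    sweep-visits c s u el = proj₂ (iter-inv (step c)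
        (λ i s′ → U s′ ⊆ᵇ U s × (toℕ u < i → U s′ u ≡ false)) advance ((λ x p → p) , λ ())) (Fₚ.toℕ<n u)
      where
      advance : ∀ v s′ → U s′ ⊆ᵇ U s × (toℕ u < toℕ v → U s′ u ≡ false) →
        U (step c v s′) ⊆ᵇ U s × (toℕ u < suc (toℕ v) → U (step c v s′) u ≡ false)
      advance v s′ (sub , done) = (λ x p → sub x (Step.U-shrinks c v s′ x p)) , λ l → go (ℕₚ.m<1+n⇒m<n∨m≡n l) (bool-cases (U s′ u))
        where
        stays : U s′ u ≡ false → U (step c v s′) u ≡ false
        stays e with bool-cases (U (step c v s′) u)
        ... | inj₂ p = p
        ... | inj₁ p = true≢false (Step.U-shrinks c v s′ u p) e
        go : toℕ u < toℕ v ⊎ toℕ u ≡ toℕ v → U s′ u ≡ true ⊎ U s′ u ≡ false → U (step c v s′) u ≡ false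
        go (inj₁ l) _ = stays (done l)
        go (inj₂ _) (inj₂ e) = stays e
        go (inj₂ e) (inj₁ p) with Fₚ.toℕ-injective e
        ... | refl = Step.U-eligible c u s′ (eligible-⊆ sub p el)

    module _ {T : ℚ → Set} {M : VSet} (prime : IsPrimeIn M) (low : ¬ High M) (Mz : M z ≡ true) where

      Finished : Store → Set
      Finished s = ∀ x → U s x ≡ false

      -- By `eligible-exists` each sweep removes a vertex while one is left, so `n` sweeps suffice.
      finishes : ∀ s → Inv T M s → Finished (iter {n = n} sweep s)
      finishes s I = settles sweep (count ∘ U) Finished (Inv T M)
          (λ c s _ fin x → still c s fin x) sweep-inv split z n id I (count≤ (U s))
        where
        still : ∀ c s → Finished s → ∀ x → U (sweep c s) x ≡ false
        still c s fin x with bool-cases (U (sweep c s) x)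
        ... | inj₂ e = e
        ... | inj₁ p = true≢false (sweep-shrinks c s x p) (fin x)
        split : ∀ c s → Inv T M s → Finished s ⊎ count (U (sweep c s)) < count (U s)
        split c s I with Fₚ.any? (λ x → U s x 𝔹ₚ.≟ true)
        ... | no none = inj₁ λ x → 𝔹ₚ.¬-not (λ e → none (x , e))
        ... | yes (x , p) with Fₚ.any? (λ u → eval (eligible {1} #0) (u ∷ []) s 𝔹ₚ.≟ true)
        ...   | yes (u , e) = inj₂ (count-strict (sweep-shrinks c s) u (sweep-visits c s u el) (proj₁ el))
                where el = true-reflects (eligible-reflects (u ∷ []) s #0) e
        ...   | no none = ⊥-elim (eligible-exists prime low Mz (Inv.⊆M I) x p λ u el →
                none (u , reflects-true (eligible-reflects (u ∷ []) s #0) el))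

      result : ∀ s → Inv T M s → T (iter {n = n} sweep s acc tt z)
      result s I = Inv.back last (opt-empty (finishes s I))
        where
        last : Inv T M (iter {n = n} sweep s)
        last = iter-keep {n = n} sweep (Inv T M) sweep-inv I

-- Modules of maximum degree two

module RunSolve {n k : ℕ} (G : Graph (Fin n)) (rev : Revenue n k) where

  open Algo k
  open Language signature k
  open Semantics G rev
  open Assignments {n} {k} (adj G) (adj-sym G) (adj-irrefl G)
  open Run G rev
  open RunPath G rev

  scratch : List Fam
  scratch = wt′ ∷ vis ∷ acc ∷ gain ∷ []

  eliminate-kept : ∀ {d} K (ρ : Vec (Fin n) (suc d)) s → Kept (wt′ ∷ vis ∷ acc ∷ []) s (exec (eliminate K) ρ s)
  eliminate-kept K ρ s = kept-trans (kept-set s acc refl) (kept-trans (kept-set _ wt′ refl) (kept-set _ vis refl))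

  ∩-⊆ : ∀ {Z K : Subset k} → Z ⊆ K → Z ∩ K ≡ Z
  ∩-⊆ {Z} {K} sub = ⊆-antisym (p∩q⊆p Z K) (λ p → x∈p∩q⁺ (p , sub p))

  -- Weights once z uses the colours in Z.
  reduced : Weight → Fin n → Subset k → Weight
  reduced r z Z D v = if adj G v z then r (D ─ Z) v else r D v

  reduced-mono : ∀ {r z Z} → Monotone r → Monotone (reduced r z Z)
  reduced-mono {r} {z} {Z} mr = record { mono = mono′ ; nonneg = pos }
    where
    mono′ : ∀ {D D′} v → D ⊆ D′ → reduced r z Z D v ≤ℚ reduced r z Z D′ v
    mono′ {D} {D′} v sub with adj G v z
    ... | true  = Monotone.mono mr v λ p → x∈p∧x∉q⇒x∈p─q (sub (p─q⊆p D Z p)) (∈-─⁻ {p = D} {Z} p)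
    ... | false = Monotone.mono mr v sub
    pos : ∀ D v → 0ℚ ≤ℚ reduced r z Z D v
    pos D v with adj G v z
    ... | true  = Monotone.nonneg mr _ v
    ... | false = Monotone.nonneg mr _ v

  module SolveFrom {d} (ρ : Vec (Fin n) d) (z : Fin n) (K Z : Subset k) (s : Store) where

    s₁ s₂ s₃ s₄ s′ : Store
    s₁ = exec (assign wt′ (λ D → ifᵉ (adjᵉ #0 #1) (cell wt (D ─ Z) #0) (cell wt D #0))) (z ∷ ρ) s
    s₂ = exec (assign vis (λ _ → eqᵉ #0 #1 ∨ᵉ notᵉ (inM? #0))) (z ∷ ρ) s₁
    s₃ = exec (assign acc (λ _ → cell wt Z #1)) (z ∷ ρ) s₂
    s₄ = iter {n = n} (Sweep.sweep ρ z K) s₃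
    s′ = exec (solveFrom K Z) (z ∷ ρ) s

    kept₄ : Kept (wt′ ∷ vis ∷ acc ∷ []) s s₄
    kept₄ = kept-trans (kept-set s wt′ refl) (kept-trans (kept-set s₁ vis refl) (kept-trans (kept-set s₂ acc refl)
      (kept-iter {m = n} (Sweep.sweep ρ z K) (λ c → kept-iter {m = n} (Sweep.step ρ z K c)
        (λ u → eliminate-kept K (u ∷ c ∷ z ∷ ρ))) s₃)))

    kept′ : Kept scratch s s′
    kept′ = kept λ
      { alive refl → K.at alive refl ; inM refl → K.at inM refl ; clo refl → K.at clo refl
      ; ban refl → K.at ban refl ; out refl → K.at out refl ; wt refl → K.at wt refl
      ; best refl → K.at best refl }
      where module K = Kept kept₄

    M : VSet
    M = s inM tt

    same-M : s₄ inM tt ≡ M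
    same-M = cong (λ f → f tt) (Kept.at kept₄ inM refl)

    vis-reflects : ∀ x → Reflects (x ≡ z ⊎ ¬ (M x ≡ true)) (s₃ vis tt x)
    vis-reflects x = r-or (r-eq x z) (r-not (r-bool _))

    U₃ : ∀ x → U s₃ x ≡ (M ∖ z) x
    U₃ x = trans (by (bool-cases (M x)) (x Fₚ.≟ z)) (sym (∖-def M z x))
      where
      by : M x ≡ true ⊎ M x ≡ false → Dec (x ≡ z) → U s₃ x ≡ M x ∧ not (x ≡ᶠ z)
      by _ (yes refl) = trans (cong not (reflects-true (vis-reflects x) (inj₁ refl)))
        (sym (trans (cong (λ b → M x ∧ not b) (≡ᶠ-refl x)) (𝔹ₚ.∧-zeroʳ (M x))))
      by (inj₁ p) (no ne) = trans (cong not (reflects-false (vis-reflects x)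
          λ { (inj₁ e) → ne e ; (inj₂ m) → m p })) (sym (trans (cong₂ _∧_ p (cong not (≢⇒≡ᶠ ne))) refl))
      by (inj₂ p) (no ne) = trans (cong not (reflects-true (vis-reflects x) (inj₂ λ q → true≢false q p)))
        (sym (cong (_∧ not (x ≡ᶠ z)) p))

    Target : ℚ → Set
    Target = Opt (M ∖ z) (reduced (s wt) z Z) K (s wt Z z)

    invariant : Monotone (s wt) → Sweep.Inv ρ z K Target M s₃
    invariant mr = record
      { mono = reduced-mono {z = z} {Z} mr
      ; back = opt-cong U₃ (λ _ _ _ → refl) refl
      ; ⊆M = λ x p → trans (sym (U₃ x)) p }

    outcome : Monotone (s wt) → IsPrimeIn M → ¬ High M → M z ≡ true → Target (s₄ acc tt z)
    outcome mr prime low Mz = Sweep.result ρ z K prime low Mz s₃ (invariant mr)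

    gain-other : ∀ {D} x → D ≢ K → s′ gain D x ≡ s gain D x
    gain-other {D} x ne rewrite dec-false (D ≟ˢ K) ne = cong (λ f → f D x) (Kept.at kept₄ gain refl)


    gain-unmoved : ∀ D x → (¬ Rep M z ⊎ High M) → s′ gain D x ≡ s gain D x
    gain-unmoved D x h with D ≟ˢ K
    ... | no _ = cong (λ f → f D x) (Kept.at kept₄ gain refl)
    ... | yes refl = trans (by h) (cong (λ f → f D x) (Kept.at kept₄ gain refl))
      where
      body : Exp rational (2 + d)
      body = ifᵉ (rep #1) (ifᵉ high (cell gain D #0) (bin max (cell gain D #0) (cell acc tt #0))) (cell gain D #0)
      by : ¬ Rep M z ⊎ High M → eval body (x ∷ z ∷ ρ) s₄ ≡ s₄ gain D x
      by (inj₁ nr) = if-false (reflects-false (rep-reflects (x ∷ z ∷ ρ) s₄ #1)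
        (subst (λ M → ¬ Rep M z) (sym same-M) nr))
      by (inj₂ hi) = trans (cong (λ y → if eval (rep #1) (x ∷ z ∷ ρ) s₄ then y else s₄ gain D x)
          (if-true {y = s₄ gain D x ⊔ᵠ s₄ acc tt x} (reflects-true (high-reflects (x ∷ z ∷ ρ) s₄)
            (subst High (sym same-M) hi))))
          (collapse (eval (rep #1) (x ∷ z ∷ ρ) s₄))
        where
        collapse : ∀ b → (if b then s₄ gain D x else s₄ gain D x) ≡ s₄ gain D x
        collapse true  = refl
        collapse false = refl

    gain-new : Rep M z → ¬ High M → s′ gain K z ≡ s gain K z ⊔ᵠ s₄ acc tt z
    gain-new r low rewrite dec-true (K ≟ˢ K) refl = trans
      (if-true (reflects-true (rep-reflects (z ∷ z ∷ ρ) s₄ #1) (subst (λ M → Rep M z) (sym same-M) r)))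
      (trans (if-false (reflects-false (high-reflects (z ∷ z ∷ ρ) s₄) (subst (λ M → ¬ High M) (sym same-M) low)))
        (cong (λ f → f K z ⊔ᵠ s₄ acc tt z) (Kept.at kept₄ gain refl)))

  exec-each : ∀ {A : Set} {d} (xs : List A) (c : A → Cmd d) {ρ} (Inv : (A → Set) → Store → Set) →
    (∀ {P Q s} → (∀ {a} → Q a → P a) → Inv P s → Inv Q s) →
    (∀ {P} x s → Inv P s → Inv (λ a → P a ⊎ a ≡ x) (exec (c x) ρ s)) →
    ∀ {P s} → Inv P s → Inv (λ a → P a ⊎ a ∈ᴸ xs) (exec (each xs c) ρ s)
  exec-each [] c Inv sub step i = sub (λ { (inj₁ p) → p }) i
  exec-each (x ∷ xs) c Inv sub step i = sub
    (λ { (inj₁ p) → inj₁ (inj₁ p) ; (inj₂ (here e)) → inj₁ (inj₂ e) ; (inj₂ (there m)) → inj₂ m })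
    (exec-each xs c Inv sub step (step x _ i))

  module Low {d} (ρ : Vec (Fin n) d) (s : Store) (z : Fin n) (r : Rep (s inM tt) z) (low : ¬ High (s inM tt))
    (prime : IsPrimeIn (s inM tt)) (mr : Monotone (s wt)) where

    M : VSet
    M = s inM tt

    Goal : Subset k → Subset k → ℚ → Set
    Goal K Z y = Opt (M ∖ z) (reduced (s wt) z (Z ∩ K)) K (s wt (Z ∩ K) z) y

    -- `P` holds of the pairs `K`, `Z` already tried. `gain` dominates the optimum of each of them
    -- and is at most 0 or bounded by the optimum of some pair, which is the input that `guess`
    -- expects.
    record Progress (P : Subset k → Subset k → Set) (s′ : Store) : Set where
      field
        keeps : Kept scratch s s′
        upper : ∀ {K Z} → P K Z → ∃[ y ] (Goal K Z y × y ≤ℚ s′ gain K z)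
        lower : ∀ K → s′ gain K z ≤ℚ 0ℚ ⊎ ∃[ Z ] ∃[ y ] (Goal K Z y × s′ gain K z ≤ℚ y)

    weaken : ∀ {P Q s′} → (∀ {K Z} → Q K Z → P K Z) → Progress P s′ → Progress Q s′
    weaken f H = record { keeps = keeps ; upper = upper ∘ f ; lower = lower }
      where open Progress H

    one : ∀ {P} K Z s′ → Progress P s′ → ∀ w →
      Progress (λ K′ Z′ → P K′ Z′ ⊎ (K′ ≡ K × Z′ ≡ Z × w ≡ z)) (exec (solveFrom K (Z ∩ K)) (w ∷ ρ) s′)
    one {P} K Z s′ H w = by (w Fₚ.≟ z)
      where
      open Progress H
      module F = SolveFrom ρ w K (Z ∩ K) s′
      same-M : s′ inM tt ≡ M
      same-M = cong (λ f → f tt) (Kept.at keeps inM refl)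
      same-wt : s′ wt ≡ s wt
      same-wt = Kept.at keeps wt refl
      by : Dec (w ≡ z) → Progress (λ K′ Z′ → P K′ Z′ ⊎ (K′ ≡ K × Z′ ≡ Z × w ≡ z)) F.s′
      by (no ne) = record
        { keeps = kept-trans keeps F.kept′
        ; upper = λ { (inj₁ p) → let (y , g , l) = upper p in y , g , ℚₚ.≤-trans l (ℚₚ.≤-reflexive (sym (unmoved _)))
                    ; (inj₂ (_ , _ , e)) → ⊥-elim (ne e) }
        ; lower = λ K′ → subst (λ q → q ≤ℚ 0ℚ ⊎ ∃[ Z ] ∃[ y ] (Goal K′ Z y × q ≤ℚ y)) (sym (unmoved K′)) (lower K′) }
        where
        unmoved : ∀ D → F.s′ gain D z ≡ s′ gain D z
        unmoved D = F.gain-unmoved D z (inj₁ λ r′ → ne (rep-unique (subst (λ M → Rep M w) same-M r′) r))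
      by (yes refl) = record
        { keeps = kept-trans keeps F.kept′
        ; upper = λ { (inj₁ p) → let (y , g , l) = upper p in y , g , ℚₚ.≤-trans l (grows _)
                    ; (inj₂ (refl , refl , _)) → y , goal , ℚₚ.≤-trans (≤⊔ᵠʳ (s′ gain K z) y) (ℚₚ.≤-reflexive (sym new)) }
        ; lower = lower′ }
        where
        y : ℚ
        y = F.s₄ acc tt z
        goal : Goal K Z y
        goal = subst (λ m → Opt (m ∖ z) (reduced (s wt) z (Z ∩ K)) K (s wt (Z ∩ K) z) y) same-M
          (subst (λ f → Opt (s′ inM tt ∖ z) (reduced f z (Z ∩ K)) K (f (Z ∩ K) z) y) same-wt
            (F.outcome (subst Monotone (sym same-wt) mr) (subst IsPrimeIn (sym same-M) prime)
              (subst (λ m → ¬ High m) (sym same-M) low) (trans (cong (λ m → m z) same-M) (proj₁ r))))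
        new : F.s′ gain K z ≡ s′ gain K z ⊔ᵠ y
        new = F.gain-new (subst (λ m → Rep m z) (sym same-M) r) (subst (λ m → ¬ High m) (sym same-M) low)
        grows : ∀ D → s′ gain D z ≤ℚ F.s′ gain D z
        grows D = at-D (D ≟ˢ K)
          where
          at-D : Dec (D ≡ K) → s′ gain D z ≤ℚ F.s′ gain D z
          at-D (yes refl) = ℚₚ.≤-trans (≤⊔ᵠˡ (s′ gain K z) y) (ℚₚ.≤-reflexive (sym new))
          at-D (no ne) = ℚₚ.≤-reflexive (sym (F.gain-other z ne))
        Low-bound : Subset k → ℚ → Set
        Low-bound D q = q ≤ℚ 0ℚ ⊎ ∃[ Z ] ∃[ y ] (Goal D Z y × q ≤ℚ y)
        lower′ : ∀ D → Low-bound D (F.s′ gain D z)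
        lower′ D = at-D (D ≟ˢ K)
          where
          at-D : Dec (D ≡ K) → Low-bound D (F.s′ gain D z)
          at-D (no ne) = subst (Low-bound D) (sym (F.gain-other z ne)) (lower D)
          at-D (yes refl) with ⊔ᵠ-cases (s′ gain K z) y
          ... | inj₂ e = inj₂ (Z , y , goal , ℚₚ.≤-reflexive (trans new e))
          ... | inj₁ e = subst (Low-bound K) (sym (trans new e)) (lower K)

    all-vertices : ∀ {P} K Z s′ → Progress P s′ →
      Progress (λ K′ Z′ → P K′ Z′ ⊎ (K′ ≡ K × Z′ ≡ Z)) (exec (for (solveFrom K (Z ∩ K))) ρ s′)
    all-vertices {P} K Z s′ H = weaken
      (λ { (inj₁ p) → inj₁ p ; (inj₂ (e , e′)) → inj₂ (e , e′ , Fₚ.toℕ<n z) })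
      (iter-inv {n = n} (λ w → exec (solveFrom K (Z ∩ K)) (w ∷ ρ))
        (λ i → Progress (λ K′ Z′ → P K′ Z′ ⊎ (K′ ≡ K × Z′ ≡ Z × toℕ z < i)))
        (λ w t H → weaken (λ { (inj₁ p) → inj₁ (inj₁ p) ; (inj₂ (e , e′ , l)) → late w e e′ (ℕₚ.m<1+n⇒m<n∨m≡n l) })
          (one K Z t H w))
        (weaken (λ { (inj₁ p) → p ; (inj₂ (_ , _ , ())) }) H))
      where
      late : ∀ w {K′ Z′} → K′ ≡ K → Z′ ≡ Z → toℕ z < toℕ w ⊎ toℕ z ≡ toℕ w →
        (P K′ Z′ ⊎ (K′ ≡ K × Z′ ≡ Z × toℕ z < toℕ w)) ⊎ (K′ ≡ K × Z′ ≡ Z × w ≡ z)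
      late w e e′ (inj₁ l) = inj₁ (inj₂ (e , e′ , l))
      late w e e′ (inj₂ p) = inj₂ (e , e′ , sym (Fₚ.toℕ-injective p))

    finish : ∀ s′ → Kept scratch s s′ → (∀ K → s′ gain K z ≡ 0ℚ) → ∀ K →
      Opt M (s wt) K 0ℚ (exec (each (subsets k) λ K → each (subsets k) λ Z → for (solveFrom K (Z ∩ K))) ρ s′ gain K z)
    finish s′ keeps zero-gain K = guess mr (proj₁ r)
        (λ D e → if-true e) (λ D e → if-false e) (λ {Z} sub → goal sub)
        low-side (λ {Z} sub → proj₂ (proj₂ (done Z)))
      where
      end : Store
      end = exec (each (subsets k) λ K → each (subsets k) λ Z → for (solveFrom K (Z ∩ K))) ρ s′
      progress : Progress (λ K Z → ⊥ ⊎ K ∈ᴸ subsets k) end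
      progress = exec-each (subsets k) _ (λ P → Progress (λ K _ → P K)) (λ f → weaken f)
        (λ {P} K t H → weaken (λ { (inj₁ p) → inj₁ p ; (inj₂ e) → inj₂ (e , ∈-subsets _) })
          (weaken {λ K′ Z → P K′ ⊎ (K′ ≡ K × (⊥ ⊎ Z ∈ᴸ subsets k))} (λ { (inj₁ p) → inj₁ p ; (inj₂ (e , m)) → inj₂ (e , inj₂ m) })
          (exec-each (subsets k) (λ Z → for (solveFrom K (Z ∩ K)))
            (λ Q → Progress (λ K′ Z → P K′ ⊎ (K′ ≡ K × Q Z)))
            (λ f → weaken λ { (inj₁ p) → inj₁ p ; (inj₂ (e , q)) → inj₂ (e , f q) })
            (λ Z t H → weaken (λ { (inj₁ p) → inj₁ (inj₁ p) ; (inj₂ (e , inj₁ q)) → inj₁ (inj₂ (e , q))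
                                 ; (inj₂ (e , inj₂ e′)) → inj₂ (e , e′) }) (all-vertices K Z t H))
            {λ _ → ⊥} (weaken (λ { (inj₁ p) → p ; (inj₂ (_ , ())) }) H))))
        {λ _ → ⊥} record { keeps = keeps ; upper = λ () ; lower = λ K → inj₁ (ℚₚ.≤-reflexive (zero-gain K)) }
      done : ∀ Z → ∃[ y ] (Goal K Z y × y ≤ℚ end gain K z)
      done Z = Progress.upper progress (inj₂ (∈-subsets K))
      goal : ∀ {Z} → Z ⊆ K → Opt (M ∖ z) (reduced (s wt) z Z) K (s wt Z z) (proj₁ (done Z))
      goal {Z} sub = subst (λ Z′ → Opt (M ∖ z) (reduced (s wt) z Z′) K (s wt Z′ z) (proj₁ (done Z)))
        (∩-⊆ sub) (proj₁ (proj₂ (done Z)))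
      low-side : end gain K z ≤ℚ 0ℚ ⊎ ∃[ Z ] (Z ⊆ K × end gain K z ≤ℚ proj₁ (done Z))
      low-side with Progress.lower progress K
      ... | inj₁ l = inj₁ l
      ... | inj₂ (Z , y , g , l) = inj₂ (Z ∩ K , p∩q⊆q Z K , ℚₚ.≤-trans l (opt-unique g
              (subst (λ Z′ → Opt (M ∖ z) (reduced (s wt) z Z′) K (s wt Z′ z) (proj₁ (done (Z ∩ K))))
                (∩-⊆ (p∩q⊆q Z K)) (proj₁ (proj₂ (done (Z ∩ K)))))))

-- Modules with a vertex of degree at least three

module Members {n : ℕ} (M : Fin n → Bool) where

  -- The structural theorem speaks of a whole vertex type, so the module becomes a type of its own.
  V : Set
  V = ∃[ v ] M v ≡ true

  V-≡ : ∀ {a b : V} → proj₁ a ≡ proj₁ b → a ≡ b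
  V-≡ {x , p} {_ , q} refl = cong (x ,_) (irrelevant p q)
    where
    irrelevant : ∀ {b} (p q : b ≡ true) → p ≡ q
    irrelevant refl refl = refl

  collect : List (Fin n) → List V
  collect [] = []
  collect (v ∷ vs) with bool-cases (M v)
  ... | inj₁ p = (v , p) ∷ collect vs
  ... | inj₂ _ = collect vs

  ∈-collect : ∀ vs (x : V) → proj₁ x ∈ᴸ vs → x ∈ᴸ collect vs
  ∈-collect (v ∷ vs) (x , p) m with bool-cases (M v) | m
  ... | inj₁ q | here refl = here (V-≡ refl)
  ... | inj₁ q | there m′ = there (∈-collect vs (x , p) m′)
  ... | inj₂ q | here refl = true≢false p q
  ... | inj₂ q | there m′ = ∈-collect vs (x , p) m′

module RunTriples {n k : ℕ} (G : Graph (Fin n)) (rev : Revenue n k) where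

  open Algo k
  open Language signature k
  open Semantics G rev
  open Assignments {n} {k} (adj G) (adj-sym G) (adj-irrefl G)
  open Run G rev
  open RunPath G rev

  bigs-upper : ∀ m {d} (e : Exp rational (m + d)) ρ s (T : Vec (Fin n) m) →
    eval e (T ++ᵛ ρ) s ≤ℚ eval (bigs m e) ρ s
  bigs-upper zero e ρ s [] = ℚₚ.≤-refl
  bigs-upper (suc m) e ρ s (v ∷ T) = ℚₚ.≤-trans
    (proj₂ (iter-max-upper (λ v → eval e (v ∷ (T ++ᵛ ρ)) s) 0ℚ) v) (bigs-upper m (big max e) ρ s T)

  bigs-attained : ∀ m {d} (e : Exp rational (m + d)) ρ s →
    eval (bigs m e) ρ s ≤ℚ 0ℚ ⊎ ∃[ T ] (eval (bigs m e) ρ s ≡ eval e (T ++ᵛ ρ) s)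
  bigs-attained zero e ρ s = inj₂ ([] , refl)
  bigs-attained (suc m) e ρ s with bigs-attained m (big max e) ρ s
  ... | inj₁ l = inj₁ l
  ... | inj₂ (T , p) with iter-max-attained (λ v → eval e (v ∷ (T ++ᵛ ρ)) s) 0ℚ
  ...   | inj₁ q = inj₁ (ℚₚ.≤-reflexive (trans p q))
  ...   | inj₂ (v , q) = inj₂ (v ∷ T , trans p q)

  decide-eval : ∀ m {d} (t : Fin m → Exp bool d) (e : Subset m → Exp rational d) ρ s →
    eval (decide m t e) ρ s ≡ eval (e (tabulate λ i → eval (t i) ρ s)) ρ s
  decide-eval zero t e ρ s = refl
  decide-eval (suc m) t e ρ s with eval (t zero) ρ s
  ... | true  = decide-eval m (t ∘ suc) (e ∘ (true ∷_)) ρ s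
  ... | false = decide-eval m (t ∘ suc) (e ∘ (false ∷_)) ρ s

  allOf-reflects : ∀ {A : Set} {d} (xs : List A) (e : A → Exp bool d) {ρ s} {P : A → Set} →
    (∀ x → Reflects (P x) (eval (e x) ρ s)) → Reflects (∀ x → x ∈ᴸ xs → P x) (eval (allOf xs e) ρ s)
  allOf-reflects [] e h = ofʸ λ _ ()
  allOf-reflects (x ∷ xs) e h = r-map (λ { (p , q) _ (here refl) → p ; (p , q) y (there m) → q y m })
    (λ f → f x (here refl) , λ y m → f y (there m)) (r-and (h x) (allOf-reflects xs e h))

  Free : (Fin 3 → Fin n) → Fin n → Set
  Free t v = ∀ c → ¬ (adj G v (t c) ≡ true)

  Valid : VSet → (Fin 3 → Fin n) → Set
  Valid M t = ¬ (∃[ v ] (M v ≡ true × Free t v × ∃[ w ] (M w ≡ true × Free t w × adj G v w ≡ true)))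

  chosenBy : Vec (Fin n) (k * 3) → Fin k → Fin 3 → Fin n
  chosenBy T i c = lookup T (combine i c)

  free-reflects : ∀ {d e} (lift : Fin (k * 3 + d) → Fin e) (x : Fin e) i (T : Vec (Fin n) (k * 3)) ρ s →
    (∀ c → lookup ρ (lift (chosen i c)) ≡ chosenBy T i c) →
    Reflects (Free (chosenBy T i) (lookup ρ x)) (eval (free e lift x i) ρ s)
  free-reflects lift x i T ρ s h = r-map
    (λ { (p , q , r) zero → p ; (p , q , r) (suc zero) → q ; (p , q , r) (suc (suc zero)) → r })
    (λ f → f zero , f (suc zero) , f (suc (suc zero)))
    (r-and (one zero) (r-and (one (suc zero)) (one (suc (suc zero)))))
    where
    one : ∀ c → Reflects (¬ (adj G (lookup ρ x) (chosenBy T i c) ≡ true))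
      (if adj G (lookup ρ x) (lookup ρ (lift (chosen i c))) then false else true)
    one c = subst (λ y → Reflects (¬ (adj G (lookup ρ x) (chosenBy T i c) ≡ true))
      (if adj G (lookup ρ x) y then false else true)) (sym (h c)) (r-not (r-bool _))

  at-chosen : ∀ {d} (T : Vec (Fin n) (k * 3)) (ρ : Vec (Fin n) d) i c →
    lookup (T ++ᵛ ρ) (chosen i c) ≡ chosenBy T i c
  at-chosen T ρ i c = lookup-++ˡ T ρ (combine i c)

  valid-reflects : ∀ {d} (T : Vec (Fin n) (k * 3)) (ρ : Vec (Fin n) d) s →
    Reflects (∀ i → Valid (s inM tt) (chosenBy T i)) (eval valid (T ++ᵛ ρ) s)
  valid-reflects T ρ s = r-map (λ f i → f i (∈-allFin i)) (λ f i _ → f i)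
    (allOf-reflects (allFin k) _ λ i → r-not (r-any λ v → r-and (r-bool _)
      (r-and (free-reflects suc #0 i T (v ∷ (T ++ᵛ ρ)) s (at-chosen T ρ i))
      (r-any λ w → r-and (r-bool _) (r-and (free-reflects (λ y → suc (suc y)) #0 i T (w ∷ v ∷ (T ++ᵛ ρ)) s (at-chosen T ρ i))
        (r-bool _))))))

  module _ (M : VSet) (hi : High M) (prime : IsPrimeIn M) (bcf : BullChairFree (adj G)) where

    open Members M

    adjⱽ : V → V → Bool
    adjⱽ u v = adj G (proj₁ u) (proj₁ v)

    bcfⱽ : BullChairFree adjⱽ
    bcfⱽ = record
      { ~-sym = λ u v → adj-sym G (proj₁ u) (proj₁ v) ; ~-irrefl = λ v → adj-irrefl G (proj₁ v)
      ; bull-free = B.bull-free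
      ; chair-free = λ a b c d e f g h i j ne → B.chair-free a b c d e f g h i j (λ q → ne (V-≡ q)) }
      where module B = BullChairFree bcf

    primeⱽ : IsPrime adjⱽ
    primeⱽ S closed {a} {b} Sa Sb a≢b x ¬Sx = prime (λ e → a≢b (V-≡ e)) (proj₂ a) (proj₂ b)
        (λ v → Σ (M v ≡ true) λ p → S (v , p)) inside (proj₂ a , Sa) (proj₂ b , Sb) (proj₂ x)
        λ { (p , Sp) → ¬Sx (subst S (V-≡ refl) Sp) }
      where
      inside : ModuleIn M (λ v → Σ (M v ≡ true) λ p → S (v , p))
      inside {x} {s} {s′} Mx ¬S _ (p , Sp) _ (q , Sq) with bool-cases (adj G x s) | bool-cases (adj G x s′)
      ... | inj₁ e | inj₁ f = trans e (sym f)
      ... | inj₂ e | inj₂ f = trans e (sym f)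
      ... | inj₁ e | inj₂ f = ⊥-elim (closed {x , Mx} {s , p} {s′ , q} (λ Sx → ¬S (Mx , Sx)) Sp Sq e f)
      ... | inj₂ e | inj₁ f = ⊥-elim (closed {x , Mx} {s′ , q} {s , p} (λ Sx → ¬S (Mx , Sx)) Sq Sp f e)

    not-low : ¬ MaxDegree≤2 adjⱽ
    not-low deg = let (v , Mv , a , Ma , va , b , Mb , vb , ab , c , Mc , vc , ac , bc) = hi in
      deg {v , Mv} {a , Ma} {b , Mb} {c , Mc} va vb vc (ab ∘ cong proj₁) (ac ∘ cong proj₁) (bc ∘ cong proj₁)

    Independent : VSet → Set
    Independent I = ∀ {v w} → I v ≡ true → I w ≡ true → adj G v w ≡ false

    module _ (I : VSet) (I⊆M : I ⊆ᵇ M) (ind : Independent I)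
      (max : ∀ {y} → M y ≡ true → I y ≡ false → ∃[ i ] (I i ≡ true × adj G y i ≡ true)) where

      Dominates : Fin n → Fin n → Fin n → Set
      Dominates x y z = ∀ w → M w ≡ true → I w ≡ false → ¬ (adj G w x ≡ false × adj G w y ≡ false × adj G w z ≡ false)

      dominates? : ∀ x y z → Dec (Dominates x y z)
      dominates? x y z = Fₚ.all? λ w → (M w 𝔹ₚ.≟ true) →-dec ((I w 𝔹ₚ.≟ false) →-dec ¬?
          ((adj G w x 𝔹ₚ.≟ false) ×-dec ((adj G w y 𝔹ₚ.≟ false) ×-dec (adj G w z 𝔹ₚ.≟ false))))

      no-triple-absurd : ¬ (∀ x y z → I x ≡ true → I y ≡ true → I z ≡ true → ¬ Dominates x y z)
      no-triple-absurd none = MI.dominating (collect (allFin n)) (λ x → ∈-collect (allFin n) x (∈-allFin _))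
          (proj₁ hi , proj₁ (proj₂ hi)) not-low
          λ {x} {y} {z} Ix Iy Iz h → none (proj₁ x) (proj₁ y) (proj₁ z) Ix Iy Iz λ w Mw Iw (p , q , r) →
            h {w , Mw} (λ Iw′ → true≢false Iw′ Iw) p q r
        where
        maximalⱽ : ∀ {y : V} → ¬ (I (proj₁ y) ≡ true) → ∃[ i ] (I (proj₁ i) ≡ true × adjⱽ y i ≡ true)
        maximalⱽ {y} ¬Iy = let (i , Ii , e) = max (proj₂ y) (𝔹ₚ.¬-not ¬Iy) in (i , I⊆M i Ii) , Ii , e
        module MI = MaximalIndependent adjⱽ bcfⱽ primeⱽ (λ v → I (proj₁ v) ≡ true) (λ v → I (proj₁ v) 𝔹ₚ.≟ true)
          ind (λ {y} → maximalⱽ {y})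

      -- Domination is decidable, so the search finds a triple or contradicts the structural
      -- theorem. The common non-neighbours of the triple within `M` are exactly `I`, which makes
      -- them independent.
      triple : ∃[ t ] (Valid M t × ∀ v → I v ≡ true → Free t v)
      triple with Fₚ.any? (λ x → Fₚ.any? λ y → Fₚ.any? λ z → (I x 𝔹ₚ.≟ true) ×-dec ((I y 𝔹ₚ.≟ true) ×-dec
                    ((I z 𝔹ₚ.≟ true) ×-dec dominates? x y z)))
      ... | no none = ⊥-elim (no-triple-absurd λ x y z p q r h → none (x , y , z , p , q , r , h))
      ... | yes (x , y , z , Ix , Iy , Iz , dom) = lookup t , valid′ , free′
        where
        t : Vec (Fin n) 3
        t = x ∷ y ∷ z ∷ []
        in-I : ∀ {v} → M v ≡ true → Free (lookup t) v → I v ≡ true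
        in-I {v} Mv f with bool-cases (I v)
        ... | inj₁ p = p
        ... | inj₂ p = ⊥-elim (dom v Mv p (𝔹ₚ.¬-not (f zero) , 𝔹ₚ.¬-not (f (suc zero)) , 𝔹ₚ.¬-not (f (suc (suc zero)))))
        valid′ : Valid M (lookup t)
        valid′ (v , Mv , fv , w , Mw , fw , e) = true≢false e (ind (in-I Mv fv) (in-I Mw fw))
        free′ : ∀ v → I v ≡ true → Free (lookup t) v
        free′ v Iv zero e = true≢false e (ind Iv Ix)
        free′ v Iv (suc zero) e = true≢false e (ind Iv Iy)
        free′ v Iv (suc (suc zero)) e = true≢false e (ind Iv Iz)

    addable? : (I : VSet) → ∀ v → Dec (M v ≡ true × ¬ (∃[ i ] (I i ≡ true × adj G v i ≡ true)))
    addable? I v = (M v 𝔹ₚ.≟ true) ×-dec ¬? (Fₚ.any? λ i → (I i 𝔹ₚ.≟ true) ×-dec (adj G v i 𝔹ₚ.≟ true))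

    grow : Fin n → VSet → VSet
    grow v I x = I x ∨ (x ≡ᶠ v ∧ does (addable? I v))

    record Growing (P : VSet) (i : ℕ) (I : VSet) : Set where
      field
        ⊆M  : I ⊆ᵇ M
        ind : Independent I
        P⊆  : P ⊆ᵇ I
        maximal : ∀ {y} → toℕ y < i → M y ≡ true → I y ≡ false → ∃[ j ] (I j ≡ true × adj G y j ≡ true)

    grow-cases : ∀ {v I x} → grow v I x ≡ true → I x ≡ true ⊎ (x ≡ v × M v ≡ true × ¬ (∃[ i ] (I i ≡ true × adj G v i ≡ true)))
    grow-cases {v} {I} {x} p with ∨-true⁻ {I x} p
    ... | inj₁ q = inj₁ q
    ... | inj₂ q with ∧-true⁻ {x ≡ᶠ v} q
    ...   | e , a = inj₂ (≡ᶠ⇒≡ e , true-reflects (proof (addable? I v)) a)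

    grow-step : ∀ {P} v I → Growing P (toℕ v) I → Growing P (suc (toℕ v)) (grow v I)
    grow-step {P} v I H = record { ⊆M = sub ; ind = ind′ ; P⊆ = λ x p → ∨-true⁺₁ (P⊆ x p) ; maximal = max′ }
      where
      open Growing H
      sub : grow v I ⊆ᵇ M
      sub x p with grow-cases {v} {I} p
      ... | inj₁ q = ⊆M x q
      ... | inj₂ (refl , m , _) = m
      ind′ : Independent (grow v I)
      ind′ {a} {b} p q with grow-cases {v} {I} p | grow-cases {v} {I} q
      ... | inj₁ x | inj₁ y = ind x y
      ... | inj₂ (refl , _ , h) | inj₁ y = 𝔹ₚ.¬-not λ e → h (b , y , e)
      ... | inj₁ x | inj₂ (refl , _ , h) = 𝔹ₚ.¬-not λ e → h (a , x , trans (adj-sym G b a) e)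
      ... | inj₂ (refl , _) | inj₂ (refl , _) = adj-irrefl G v
      max′ : ∀ {y} → toℕ y < suc (toℕ v) → M y ≡ true → grow v I y ≡ false → ∃[ j ] (grow v I j ≡ true × adj G y j ≡ true)
      max′ {y} l My Iy with ℕₚ.m<1+n⇒m<n∨m≡n l
      ... | inj₁ l′ = let (j , Ij , e) = maximal l′ My (was-out Iy) in j , ∨-true⁺₁ Ij , e
        where
        was-out : ∀ {y} → grow v I y ≡ false → I y ≡ false
        was-out {y} p with I y
        ... | false = refl
      ... | inj₂ e with Fₚ.toℕ-injective e
      ...   | refl = at-v (Fₚ.any? λ i → (I i 𝔹ₚ.≟ true) ×-dec (adj G v i 𝔹ₚ.≟ true))
        where
        at-v : Dec (∃[ i ] (I i ≡ true × adj G v i ≡ true)) → ∃[ j ] (grow v I j ≡ true × adj G v j ≡ true)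
        at-v (yes (j , Ij , e′)) = j , ∨-true⁺₁ Ij , e′
        at-v (no none) = true≢false (∨-true⁺₂ {I v} (∧-true⁺ (≡ᶠ-refl v)
          (reflects-true (proof (addable? I v)) (My , none)))) Iy

    -- The class is enlarged greedily to a maximal independent set; a triple describing the larger
    -- set leaves all vertices of the class free.
    colour-class : ∀ P → P ⊆ᵇ M → Independent P → ∃[ t ] (Valid M t × ∀ v → P v ≡ true → Free t v)
    colour-class P P⊆M indP = let (t , val , h) = triple I ⊆M ind (λ {y} → maximal (Fₚ.toℕ<n y)) in
        t , val , λ v p → h v (P⊆ v p)
      where
      I : VSet
      I = iter grow P
      grown : Growing P n I
      grown = iter-inv grow (Growing P) grow-step {P}
        record { ⊆M = P⊆M ; ind = indP ; P⊆ = λ _ p → p ; maximal = λ () }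
      open Growing grown

  module High′ {d} (ρ : Vec (Fin n) d) (s : Store) (hi : High (s inM tt)) (prime : IsPrimeIn (s inM tt))
    (bcf : BullChairFree (adj G)) (mr : Monotone (s wt)) where

    M : VSet
    M = s inM tt

    palette′ : Vec (Fin n) (k * 3) → Assignment
    palette′ T v = tabulate λ i → eval (free _ suc #0 i) (v ∷ (T ++ᵛ ρ)) s

    palette-reflects : ∀ T v i → Reflects (Free (chosenBy T i) v) (eval (free _ suc #0 i) (v ∷ (T ++ᵛ ρ)) s)
    palette-reflects T v i = free-reflects suc #0 i T (v ∷ (T ++ᵛ ρ)) s (at-chosen T ρ i)

    sum-value : ∀ K T → eval (big plus (ifᵉ (inM? #0) (decide k (free _ suc #0) (λ B → cell wt (B ∩ K) #0)) (const 0ℚ)))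
      (T ++ᵛ ρ) s ≡ value M (s wt) (λ v → palette′ T v ∩ K)
    sum-value K T = trans (iter-sum (λ v → if M v then eval (decide k (free _ suc #0) (λ B → cell wt (B ∩ K) #0)) (v ∷ (T ++ᵛ ρ)) s else 0ℚ)) (trans
      (sum-cong-≗ λ v → cong (λ q → if M v then q else 0ℚ)
        (decide-eval k (free _ suc #0) (λ B → cell wt (B ∩ K) #0) (v ∷ (T ++ᵛ ρ)) s))
      (sym (value-sum M (s wt) (λ v → palette′ T v ∩ K))))

    -- A valid choice of triples yields a compatible assignment. Conversely every assignment is
    -- contained, vertex by vertex, in the one obtained from triples for its colour classes, and
    -- weights are monotone.
    opt : ∀ K → Opt M (s wt) K 0ℚ (eval (triples K) ρ s)
    opt K = opt-from mr lower upper
      where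
      body : Exp rational (k * 3 + d)
      body = ifᵉ valid (big plus (ifᵉ (inM? #0) (decide k (free _ suc #0) (λ B → cell wt (B ∩ K) #0)) (const 0ℚ)))
        (const 0ℚ)
      lower : eval (triples K) ρ s ≤ℚ 0ℚ ⊎
        ∃[ D ] (Within K M D × Compatible M D × eval (triples K) ρ s ≤ℚ value M (s wt) D)
      lower with bigs-attained (k * 3) body ρ s
      ... | inj₁ l = inj₁ l
      ... | inj₂ (T , e) with bool-cases (eval valid (T ++ᵛ ρ) s)
      ...   | inj₂ f = inj₁ (ℚₚ.≤-reflexive (trans e (if-false f)))
      ...   | inj₁ v = inj₂ ((λ v → palette′ T v ∩ K) , (λ {v} _ → p∩q⊆q (palette′ T v) K) , compat ,
                ℚₚ.≤-reflexive (trans e (trans (if-true v) (sum-value K T))))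
        where
        compat : Compatible M (λ v → palette′ T v ∩ K)
        compat {u} {w} Mu Mw e {i} p q = true-reflects (valid-reflects T ρ s) v i
          (u , Mu , true-reflects (palette-reflects T u i) (∈-tabulate⁻ _ (p∩q⊆p (palette′ T u) K p)) ,
           w , Mw , true-reflects (palette-reflects T w i) (∈-tabulate⁻ _ (p∩q⊆p (palette′ T w) K q)) , e)
      upper : ∀ D → Within K M D → Compatible M D → value M (s wt) D ≤ℚ eval (triples K) ρ s
      upper D w c = ℚₚ.≤-trans (value-mono λ v Mv → Monotone.mono mr v (inside v Mv))
        (ℚₚ.≤-trans (ℚₚ.≤-reflexive (sym (trans (if-true ok) (sum-value K T)))) (bigs-upper (k * 3) body ρ s T))
        where
        class : Fin k → VSet
        class i v = M v ∧ does (i Data.Fin.Subset.Properties.∈? D v)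
          where import Data.Fin.Subset.Properties
        class-in : ∀ i {v} → class i v ≡ true → M v ≡ true × i ∈ D v
        class-in i {v} p = proj₁ (∧-true⁻ {M v} p) , true-reflects (proof (i Data.Fin.Subset.Properties.∈? D v)) (proj₂ (∧-true⁻ {M v} p))
          where import Data.Fin.Subset.Properties
        chosen-triple : ∀ i → ∃[ t ] (Valid M t × ∀ v → class i v ≡ true → Free t v)
        chosen-triple i = colour-class M hi prime bcf (class i) (λ v p → proj₁ (class-in i p))
          λ p q → 𝔹ₚ.¬-not λ e → c (proj₁ (class-in i p)) (proj₁ (class-in i q)) e
            (proj₂ (class-in i p)) (proj₂ (class-in i q))
        T : Vec (Fin n) (k * 3)
        T = tabulate λ j → let (i , c) = remQuot 3 j in proj₁ (chosen-triple i) c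
        T-spec : ∀ i c → chosenBy T i c ≡ proj₁ (chosen-triple i) c
        T-spec i c = trans (lookup∘tabulate _ (combine i c))
          (cong (λ (i , c) → proj₁ (chosen-triple i) c) (Fₚ.remQuot-combine {k} {3} i c))
        free-T : ∀ {i v} → Free (proj₁ (chosen-triple i)) v → Free (chosenBy T i) v
        free-T {i} {v} f c e = f c (trans (cong (adj G v) (sym (T-spec i c))) e)
        T-free : ∀ {i v} → Free (chosenBy T i) v → Free (proj₁ (chosen-triple i)) v
        T-free {i} {v} f c e = f c (trans (cong (adj G v) (T-spec i c)) e)
        ok : eval valid (T ++ᵛ ρ) s ≡ true
        ok = reflects-true (valid-reflects T ρ s) λ i (v , Mv , fv , w , Mw , fw , e) →
          proj₁ (proj₂ (chosen-triple i)) (v , Mv , T-free fv , w , Mw , T-free fw , e)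
        inside : ∀ v → M v ≡ true → D v ⊆ (palette′ T v ∩ K)
        inside v Mv {i} p = x∈p∩q⁺ (∈-tabulate⁺ _ (reflects-true (palette-reflects T v i)
            (free-T (proj₂ (proj₂ (chosen-triple i)) v
              (∧-true⁺ Mv (reflects-true (proof (i Data.Fin.Subset.Properties.∈? D v)) p))))) , w Mv p)
          where import Data.Fin.Subset.Properties

-- Induced bulls and chairs as embedded configurations

module _ {m n : ℕ} (F : Graph (Fin m)) (G : Graph (Fin n)) where

  induced : (f : Fin m → Fin n) → (∀ u v → adj F u v ≡ adj G (f u) (f v)) →
    (∀ {u v} → f u ≡ f v → u ≡ v) → F ≅InducedSubgraphOf G
  induced f e inj = Im , mk↔ₛ′ to from to-from from-to , e
    where
    hit : ∀ x → Dec (∃[ u ] f u ≡ x)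
    hit x = any? λ u → f u ≟ᶠ x
    Im : Subset n
    Im = tabulate λ x → does (hit x)
    preimage : ∀ {x} → x ∈ Im → ∃[ u ] f u ≡ x
    preimage {x} p with hit x | ∈-tabulate⁻ (λ x → does (hit x)) p
    ... | yes q | _ = q
    to : Fin m → ∃ (_∈ Im)
    to u = f u , ∈-tabulate⁺ _ (dec-true (hit (f u)) (u , refl))
    from : ∃ (_∈ Im) → Fin m
    from (x , p) = proj₁ (preimage p)
    ext : ∀ {x y} {p : x ∈ Im} {q : y ∈ Im} → x ≡ y → _≡_ {A = ∃ (_∈ Im)} (x , p) (y , q)
    ext {x} {p = p} {q} refl = cong (x ,_) ([]=-irrelevant p q)
    to-from : ∀ x → to (from x) ≡ x
    to-from (x , p) = ext (proj₂ (preimage p))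
    from-to : ∀ u → from (to u) ≡ u
    from-to u = inj (proj₂ (preimage (proj₂ (to u))))

module _ {n : ℕ} (G : Graph (Fin n)) where

  -- Checking the ten pairs of vertices is enough: the rest follows by symmetry.
  embed₅ : (F : Graph (Fin 5)) (a b c d e : Fin n) → let f = lookup (a ∷ b ∷ c ∷ d ∷ e ∷ []) in
    (∀ u v → u ≢ v → f u ≢ f v) →
    adj F zero (suc zero) ≡ adj G a b → adj F zero (suc (suc zero)) ≡ adj G a c →
    adj F zero (suc (suc (suc zero))) ≡ adj G a d → adj F zero (suc (suc (suc (suc zero)))) ≡ adj G a e →
    adj F (suc zero) (suc (suc zero)) ≡ adj G b c → adj F (suc zero) (suc (suc (suc zero))) ≡ adj G b d →
    adj F (suc zero) (suc (suc (suc (suc zero)))) ≡ adj G b e →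
    adj F (suc (suc zero)) (suc (suc (suc zero))) ≡ adj G c d →
    adj F (suc (suc zero)) (suc (suc (suc (suc zero)))) ≡ adj G c e →
    adj F (suc (suc (suc zero))) (suc (suc (suc (suc zero)))) ≡ adj G d e →
    F ≅InducedSubgraphOf G
  embed₅ F a b c d e ne ab ac ad ae bc bd be cd ce de = induced F G f pairs
      λ {u} {v} q → decidable-stable (u ≟ᶠ v) λ u≢v → ne u v u≢v q
    where
    import Relation.Nullary.Decidable
    f : Fin 5 → Fin n
    f = lookup (a ∷ b ∷ c ∷ d ∷ e ∷ [])
    flip : ∀ {u v} → adj F u v ≡ adj G (f u) (f v) → adj F v u ≡ adj G (f v) (f u)
    flip {u} {v} p = trans (adj-sym F v u) (trans p (adj-sym G (f u) (f v)))
    loop≡ : ∀ u → adj F u u ≡ adj G (f u) (f u)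
    loop≡ u = trans (adj-irrefl F u) (sym (adj-irrefl G (f u)))
    pattern #0 = zero
    pattern #1 = suc zero
    pattern #2 = suc (suc zero)
    pattern #3 = suc (suc (suc zero))
    pattern #4 = suc (suc (suc (suc zero)))
    pairs : ∀ u v → adj F u v ≡ adj G (f u) (f v)
    pairs #0 #0 = loop≡ #0
    pairs #0 #1 = ab
    pairs #0 #2 = ac
    pairs #0 #3 = ad
    pairs #0 #4 = ae
    pairs #1 #0 = flip {#0} {#1} ab
    pairs #1 #1 = loop≡ #1
    pairs #1 #2 = bc
    pairs #1 #3 = bd
    pairs #1 #4 = be
    pairs #2 #0 = flip {#0} {#2} ac
    pairs #2 #1 = flip {#1} {#2} bc
    pairs #2 #2 = loop≡ #2
    pairs #2 #3 = cd
    pairs #2 #4 = ce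
    pairs #3 #0 = flip {#0} {#3} ad
    pairs #3 #1 = flip {#1} {#3} bd
    pairs #3 #2 = flip {#2} {#3} cd
    pairs #3 #3 = loop≡ #3
    pairs #3 #4 = de
    pairs #4 #0 = flip {#0} {#4} ae
    pairs #4 #1 = flip {#1} {#4} be
    pairs #4 #2 = flip {#2} {#4} ce
    pairs #4 #3 = flip {#3} {#4} de
    pairs #4 #4 = loop≡ #4

  distinct₅ : (a b c d e : Fin n) → a ≢ b → a ≢ c → a ≢ d → a ≢ e → b ≢ c → b ≢ d → b ≢ e → c ≢ d → c ≢ e → d ≢ e →
    ∀ u v → u ≢ v → lookup (a ∷ b ∷ c ∷ d ∷ e ∷ []) u ≢ lookup (a ∷ b ∷ c ∷ d ∷ e ∷ []) v
  distinct₅ a b c d e ab ac ad ae bc bd be cd ce de = go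
    where
    pattern #0 = zero
    pattern #1 = suc zero
    pattern #2 = suc (suc zero)
    pattern #3 = suc (suc (suc zero))
    pattern #4 = suc (suc (suc (suc zero)))
    go : ∀ u v → u ≢ v → lookup (a ∷ b ∷ c ∷ d ∷ e ∷ []) u ≢ lookup (a ∷ b ∷ c ∷ d ∷ e ∷ []) v
    go #0 #0 n _ = n refl
    go #1 #1 n _ = n refl
    go #2 #2 n _ = n refl
    go #3 #3 n _ = n refl
    go #4 #4 n _ = n refl
    go #0 #1 n = ab
    go #0 #2 n = ac
    go #0 #3 n = ad
    go #0 #4 n = ae
    go #1 #2 n = bc
    go #1 #3 n = bd
    go #1 #4 n = be
    go #2 #3 n = cd
    go #2 #4 n = ce
    go #3 #4 n = de
    go #1 #0 n q = ab (sym q)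
    go #2 #0 n q = ac (sym q)
    go #3 #0 n q = ad (sym q)
    go #4 #0 n q = ae (sym q)
    go #2 #1 n q = bc (sym q)
    go #3 #1 n q = bd (sym q)
    go #4 #1 n q = be (sym q)
    go #3 #2 n q = cd (sym q)
    go #4 #2 n q = ce (sym q)
    go #4 #3 n q = de (sym q)

  bull-chair-free : ¬ (bull ≅InducedSubgraphOf G) → ¬ (chair ≅InducedSubgraphOf G) → BullChairFree (adj G)
  bull-chair-free ¬bull ¬chair = record
    { ~-sym = adj-sym G ; ~-irrefl = adj-irrefl G
    ; bull-free = λ {a} {b} {c} {d} {e} ab ac bc ad be ae bd cd ce de →
        ¬bull (embed₅ bull a b c d e
          (distinct₅ a b c d e (adjacent ab) (adjacent ac) (adjacent ad) (separates ad (sw de)) (adjacent bc)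
            (separates be de) (adjacent be) (separates (sw bc) (sw bd)) (separates (sw ac) (sw ae))
            (separates (sw ad) (sw ae)))
          (sym ab) (sym ac) (sym ad) (sym ae) (sym bc) (sym bd) (sym be) (sym cd) (sym ce) (sym de))
    ; chair-free = λ {c} {x} {y} {p} {q} cx cy cp pq xy xp yp qc qx qy x≢y →
        ¬chair (embed₅ chair c x y p q
          (distinct₅ c x y p q (adjacent cx) (adjacent cy) (adjacent cp) (separates cx qx) x≢y
            (λ e → separates pq (sw qx) (sym e)) (separates (sw cx) qc)
            (λ e → separates pq (sw qy) (sym e)) (separates (sw cy) qc) (adjacent pq))
          (sym cx) (sym cy) (sym cp) (sym (sw qc)) (sym xy) (sym xp) (sym (sw qx)) (sym yp) (sym (sw qy)) (sym pq)) }
    where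
    sw : ∀ {u v b} → adj G u v ≡ b → adj G v u ≡ b
    sw {u} {v} p = trans (adj-sym G v u) p
    adjacent : ∀ {u v} → adj G u v ≡ true → u ≢ v
    adjacent {u} p refl = true≢false p (adj-irrefl G u)
    separates : ∀ {u v w} → adj G u w ≡ true → adj G v w ≡ false → u ≢ v
    separates p q refl = true≢false p q

-- Rounds of contraction

module RunRounds {n k : ℕ} (G : Graph (Fin n)) (rev : Revenue n k) (bcf : BullChairFree (adj G)) where

  open Algo k
  open Language signature k
  open Semantics G rev
  open Assignments {n} {k} (adj G) (adj-sym G) (adj-irrefl G)
  open Run G rev
  open RunPath G rev
  open RunSolve G rev
  open RunTriples G rev

  each-kept : ∀ {A : Set} {d fs} (xs : List A) (c : A → Cmd d) {ρ} → (∀ x s → Kept fs s (exec (c x) ρ s)) →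
    ∀ s → Kept fs s (exec (each xs c) ρ s)
  each-kept [] c h s = kept-refl
  each-kept (x ∷ xs) c h s = kept-trans (h x s) (each-kept xs c h _)

  loops : ∀ {d} → Cmd d
  loops = each (subsets k) λ K → each (subsets k) λ Z → for (solveFrom K (Z ∩ K))

  loops-kept : ∀ {d} (ρ : Vec (Fin n) d) s → Kept scratch s (exec loops ρ s)
  loops-kept ρ = each-kept (subsets k) _ λ K → each-kept (subsets k) _ λ Z s →
    kept-iter {m = n} (λ w → exec (solveFrom K (Z ∩ K)) (w ∷ ρ)) (λ w t → SolveFrom.kept′ ρ w K (Z ∩ K) t) s

  module _ {d} (ρ : Vec (Fin n) d) (s : Store) where

    private
      s₁ : Store
      s₁ = exec (assign gain (λ K → ifᵉ high (triples K) (const 0ℚ))) ρ s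

    solve-kept : Kept scratch s (exec solve ρ s)
    solve-kept = kept-trans (kept-set s gain refl) (loops-kept ρ s₁)

    loops-high : High (s inM tt) → ∀ K x → exec loops ρ s₁ gain K x ≡ s₁ gain K x
    loops-high hi = proj₂ (exec-each (subsets k) _ (λ _ t → Inv t) (λ _ i → i)
        (λ K t i → exec-each (subsets k) _ (λ _ t → Inv t) (λ _ i → i) (λ Z t i →
          iter-keep {n = n} (λ w → exec (solveFrom K (Z ∩ K)) (w ∷ ρ)) Inv (λ w t i → one K Z w t i) i) {λ _ → ⊤} i)
        {λ _ → ⊤} (kept-set s gain refl , λ _ _ → refl))
      where
      Inv : Store → Set
      Inv t = Kept scratch s t × ∀ K x → t gain K x ≡ s₁ gain K x
      one : ∀ K Z w t → Inv t → Inv (exec (solveFrom K (Z ∩ K)) (w ∷ ρ) t)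
      one K Z w t (keeps , same) = kept-trans keeps F.kept′ , λ D x → trans
          (F.gain-unmoved D x (inj₂ (subst (λ f → High (f tt)) (sym (Kept.at keeps inM refl)) hi))) (same D x)
        where module F = SolveFrom ρ w K (Z ∩ K) t

    solve-opt : ∀ {z} → Rep (s inM tt) z → IsPrimeIn (s inM tt) → Monotone (s wt) →
      ∀ K → Opt (s inM tt) (s wt) K 0ℚ (exec solve ρ s gain K z)
    solve-opt {z} r prime mr K = by (bool-cases (eval high (z ∷ ρ) s))
      where
      by : eval high (z ∷ ρ) s ≡ true ⊎ eval high (z ∷ ρ) s ≡ false → Opt (s inM tt) (s wt) K 0ℚ (exec solve ρ s gain K z)
      by (inj₁ e) = subst (Opt (s inM tt) (s wt) K 0ℚ)
          (sym (trans (loops-high hi K z) (if-true e))) (High′.opt (z ∷ ρ) s hi prime bcf mr K)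
        where hi = true-reflects (high-reflects (z ∷ ρ) s) e
      by (inj₂ e) = Low.finish ρ s z r (false-reflects (high-reflects (z ∷ ρ) s) e) prime mr s₁
        (kept-set s gain refl) (λ K → if-false e) K

  opt-mono : ∀ {A r K K′ x y} → K ⊆ K′ → Opt A r K 0ℚ x → Opt A r K′ 0ℚ y → x ≤ℚ y
  opt-mono sub O O′ = ℚₚ.≤-trans (Opt.attained O) (Opt.bound O′ (Opt.D O) (λ p → sub ∘ Opt.within O p) (Opt.compat O))

  opt-nonneg : ∀ {A r K x} → Monotone r → Opt A r K 0ℚ x → 0ℚ ≤ℚ x
  opt-nonneg {A} {r} mr O = ℚₚ.≤-trans (value-nonneg mr) (ℚₚ.≤-trans
    (ℚₚ.≤-reflexive (sym (ℚₚ.+-identityˡ (value A r (λ _ → Sub.⊥)))))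
    (Opt.bound O (λ _ → Sub.⊥) (λ _ → ⊥⊆) (λ _ _ _ p → ⊥-elim (∉⊥ p))))

  module Contract {d} (ρ : Vec (Fin n) d) (s : Store) where

    s₁ s′ : Store
    s₁ = exec (assign wt (λ D → ifᵉ (rep #0) (cell gain D #0) (cell wt D #0))) ρ s
    s′ = exec contract ρ s

    M : VSet
    M = s inM tt

    alive-reflects : ∀ x → Reflects (s alive tt x ≡ true × ¬ (M x ≡ true × ¬ (Rep M x))) (s′ alive tt x)
    alive-reflects x = r-and (r-bool _) (r-not (r-and (r-bool _) (r-not (rep-reflects (x ∷ ρ) s₁ #0))))

    wt-rep : ∀ {x} D → Rep M x → s′ wt D x ≡ s gain D x
    wt-rep {x} D r = if-true (reflects-true (rep-reflects (x ∷ ρ) s #0) r)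

    wt-other : ∀ {x} D → ¬ Rep M x → s′ wt D x ≡ s wt D x
    wt-other {x} D r = if-false (reflects-false (rep-reflects (x ∷ ρ) s #0) r)

    rep? : ∀ x → Rep M x ⊎ ¬ Rep M x
    rep? x with bool-cases (eval (rep #0) (x ∷ ρ) s)
    ... | inj₁ e = inj₁ (true-reflects (rep-reflects (x ∷ ρ) s #0) e)
    ... | inj₂ e = inj₂ (false-reflects (rep-reflects (x ∷ ρ) s #0) e)

  roundBody : ∀ {d} → Cmd (suc d)
  roundBody = findModule ▸ solve ▸ contract

  touched : List Fam
  touched = alive ∷ inM ∷ clo ∷ wt ∷ wt′ ∷ vis ∷ acc ∷ gain ∷ []

  widen : ∀ {fs gs s s′} → (∀ g → among gs g ≡ false → among fs g ≡ false) → Kept fs s s′ → Kept gs s s′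
  widen h K = kept λ g e → Kept.at K g (h g e)

  roundBody-kept : ∀ {d} (ρ : Vec (Fin n) (suc d)) s → Kept touched s (exec roundBody ρ s)
  roundBody-kept ρ s = kept-trans (findModule-kept ρ s refl refl)
    (kept-trans (widen (λ { ban refl → refl ; out refl → refl ; best refl → refl }) (solve-kept ρ _))
      (kept-trans (kept-set _ wt refl) (kept-set _ alive refl)))

  module Round {d} (ρ : Vec (Fin n) (suc d)) (s : Store) (mr : Monotone (s wt)) (ne : ∃[ a ] s alive tt a ≡ true) where

    s₁ s₂ s′ : Store
    s₁ = exec findModule ρ s
    s₂ = exec solve ρ s₁
    s′ = exec contract ρ s₂

    M A : VSet
    M = s₁ inM tt
    A = s alive tt

    open Shrunk (findModule-shrunk ρ s)

    keep₁ : Kept (clo ∷ inM ∷ []) s s₁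
    keep₁ = findModule-kept ρ s refl refl

    keep₂ : Kept scratch s₁ s₂
    keep₂ = solve-kept ρ s₁

    wt≡ : s₂ wt ≡ s wt
    wt≡ = trans (Kept.at keep₂ wt refl) (Kept.at keep₁ wt refl)

    alive≡ : s₂ alive tt ≡ A
    alive≡ = cong (λ f → f tt) (trans (Kept.at keep₂ alive refl) (Kept.at keep₁ alive refl))

    M≡ : s₂ inM tt ≡ M
    M≡ = cong (λ f → f tt) (Kept.at keep₂ inM refl)

    representative : ∃ (Rep M)
    representative = let (m , p) = some ne in rep-exists m p

    z : Fin n
    z = proj₁ representative

    rep-z : Rep M z
    rep-z = proj₂ representative

    opt : ∀ K → Opt M (s wt) K 0ℚ (s₂ gain K z)
    opt K = subst (λ f → Opt M f K 0ℚ (s₂ gain K z)) (Kept.at keep₁ wt refl)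
      (solve-opt ρ s₁ rep-z (λ ne Ma Mb → gen tt ne Ma Mb) (subst Monotone (sym (Kept.at keep₁ wt refl)) mr) K)

    module C = Contract ρ s₂

    rep-z′ : Rep C.M z
    rep-z′ = subst (λ m → Rep m z) (sym M≡) rep-z

    at-M : ∀ {v b} → M v ≡ b → C.M v ≡ b
    at-M {v} m = trans (cong (λ f → f v) M≡) m

    at-A : ∀ {v b} → A v ≡ b → s₂ alive tt v ≡ b
    at-A {v} a = trans (cong (λ f → f v) alive≡) a

    alive-out : ∀ {v} → M v ≡ false → s′ alive tt v ≡ A v
    alive-out {v} m = by (bool-cases (A v))
      where
      by : A v ≡ true ⊎ A v ≡ false → s′ alive tt v ≡ A v
      by (inj₁ a) = trans (reflects-true (C.alive-reflects v) (at-A a , λ (p , _) → true≢false p (at-M m))) (sym a)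
      by (inj₂ a) = trans (reflects-false (C.alive-reflects v) λ (p , _) → true≢false p (at-A a)) (sym a)

    alive-in : ∀ {v} → M v ≡ true → s′ alive tt v ≡ v ≡ᶠ z
    alive-in {v} m = by (v Fₚ.≟ z)
      where
      by : Dec (v ≡ z) → s′ alive tt v ≡ v ≡ᶠ z
      by (yes e) = trans (reflects-true (C.alive-reflects v)
          (at-A (⊆A v m) , λ (_ , h) → h (subst (Rep C.M) (sym e) rep-z′))) (sym (dec-true (v Fₚ.≟ z) e))
      by (no ne) = trans (reflects-false (C.alive-reflects v) λ (_ , h) →
          h (at-M m , λ r → ne (rep-unique r rep-z′))) (sym (≢⇒≡ᶠ ne))

    wt-out : ∀ {v} D → M v ≡ false → s′ wt D v ≡ s wt D v
    wt-out {v} D m = trans (C.wt-other D λ r → true≢false (proj₁ r) (at-M m)) (cong (λ f → f D v) wt≡)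

    expanded : ∀ {K x} → Opt (s′ alive tt) (s′ wt) K 0ℚ x → Opt A (s wt) K 0ℚ x
    expanded = Contraction.expand {A} {M} {s wt} {z} {λ K → s₂ gain K z} (⊆A _) (proj₁ rep-z) mod opt
      {s′ alive tt} {s′ wt} alive-out alive-in (λ D → wt-out D) (λ D → C.wt-rep D rep-z′)

    wt-other : ∀ {v} D → ¬ Rep C.M v → s′ wt D v ≡ s wt D v
    wt-other {v} D nr = trans (C.wt-other D nr) (cong (λ f → f D v) wt≡)

    -- At the representative the new table consists of optima, which grow with the set of permitted
    -- colours.
    mono′ : Monotone (s′ wt)
    mono′ = record { mono = λ {D} {D′} v sub → by D D′ v sub (C.rep? v) ; nonneg = λ D v → pos D v (C.rep? v) }
      where
      wt-z : ∀ {v} D → Rep C.M v → s′ wt D v ≡ s₂ gain D z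
      wt-z D r = trans (C.wt-rep D r) (cong (s₂ gain D) (rep-unique r rep-z′))
      by : ∀ D D′ v → D ⊆ D′ → Rep C.M v ⊎ ¬ Rep C.M v → s′ wt D v ≤ℚ s′ wt D′ v
      by D D′ v sub (inj₂ nr) = ℚₚ.≤-trans (ℚₚ.≤-reflexive (wt-other D nr))
        (ℚₚ.≤-trans (Monotone.mono mr v sub) (ℚₚ.≤-reflexive (sym (wt-other D′ nr))))
      by D D′ v sub (inj₁ r) = ℚₚ.≤-trans (ℚₚ.≤-reflexive (wt-z D r))
        (ℚₚ.≤-trans (opt-mono sub (opt D) (opt D′)) (ℚₚ.≤-reflexive (sym (wt-z D′ r))))
      pos : ∀ D v → Rep C.M v ⊎ ¬ Rep C.M v → 0ℚ ≤ℚ s′ wt D v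
      pos D v (inj₂ nr) = ℚₚ.≤-trans (Monotone.nonneg mr D v) (ℚₚ.≤-reflexive (sym (wt-other D nr)))
      pos D v (inj₁ r) = ℚₚ.≤-trans (opt-nonneg mr (opt D)) (ℚₚ.≤-reflexive (sym (wt-z D r)))

    still-alive : s′ alive tt z ≡ true
    still-alive = trans (alive-in (proj₁ rep-z)) (≡ᶠ-refl z)

    alive-⊆ : s′ alive tt ⊆ᵇ A
    alive-⊆ v p = trans (cong (λ f → f v) (sym alive≡)) (proj₁ (true-reflects (C.alive-reflects v) p))

    fewer : Two A → count (s′ alive tt) < count A
    fewer t = let (a , b , Ma , Mb , ne) = two t in by a b Ma Mb ne (a Fₚ.≟ z)
      where
      drop : ∀ a → M a ≡ true → a ≢ z → count (s′ alive tt) < count A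
      drop a Ma ne = count-strict alive-⊆ a (trans (alive-in Ma) (≢⇒≡ᶠ ne)) (⊆A a Ma)
      by : ∀ a b → M a ≡ true → M b ≡ true → a ≢ b → Dec (a ≡ z) → count (s′ alive tt) < count A
      by a b Ma Mb ne (yes refl) = drop b Mb λ e → ne (sym e)
      by a b Ma Mb ne (no n) = drop a Ma n

  value-optimum : ∀ {d} (ρ : Vec (Fin n) d) s → eval optimum ρ s ≡ value (s alive tt) (s wt) (λ _ → Sub.⊤)
  value-optimum ρ s = trans (iter-sum (λ v → if s alive tt v then s wt Sub.⊤ v else 0ℚ))
    (sym (value-sum (s alive tt) (s wt) (λ _ → Sub.⊤)))

  -- With at most one vertex left no edge restricts the choice, and monotonicity grants it all
  -- colours.
  opt-single : ∀ {A r} → Monotone r → (∀ {a b} → A a ≡ true → A b ≡ true → a ≡ b) →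
    Opt A r Sub.⊤ 0ℚ (value A r (λ _ → Sub.⊤))
  opt-single {A} {r} mr single = opt-from mr
    (inj₂ ((λ _ → Sub.⊤) , (λ _ → id) , (λ {u} p q e → clash p q e (single p q)) , ℚₚ.≤-refl))
    (λ D _ _ → value-mono λ v _ → Monotone.mono mr v ⊆⊤)
    where
    clash : ∀ {u v} {B : Set} → A u ≡ true → A v ≡ true → adj G u v ≡ true → u ≡ v → B
    clash {u} _ _ e refl = true≢false e (adj-irrefl G u)

  -- The tables before any contraction, with the options in `b` forbidden; the value 0 stands for
  -- leaving the vertex uncoloured.
  record IsInitial (b : Fin k → VSet) (r : Weight) : Set where
    field
      above    : ∀ {D v i} → i ∈ D → b i v ≡ false → rev v i ≤ℚ r D v
      attained : ∀ D v → r D v ≡ 0ℚ ⊎ ∃[ i ] (i ∈ D × b i v ≡ false × r D v ≡ rev v i)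

  module Optimise (rev-nonneg : ∀ v i → 0ℚ ≤ℚ rev v i) where

    initial-nonneg : ∀ {b r} → IsInitial b r → ∀ D v → 0ℚ ≤ℚ r D v
    initial-nonneg H D v with IsInitial.attained H D v
    ... | inj₁ e = ℚₚ.≤-reflexive (sym e)
    ... | inj₂ (i , _ , _ , e) = ℚₚ.≤-trans (rev-nonneg v i) (ℚₚ.≤-reflexive (sym e))

    initial-mono : ∀ {b r} → IsInitial b r → Monotone r
    initial-mono {b} {r} H = record { mono = λ {D} {D′} v sub → by D D′ v sub (attained D v) ; nonneg = initial-nonneg H }
      where
      open IsInitial H
      by : ∀ D D′ v → D ⊆ D′ → r D v ≡ 0ℚ ⊎ ∃[ i ] (i ∈ D × b i v ≡ false × r D v ≡ rev v i) → r D v ≤ℚ r D′ v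
      by D D′ v sub (inj₁ e) = ℚₚ.≤-trans (ℚₚ.≤-reflexive e) (initial-nonneg H D′ v)
      by D D′ v sub (inj₂ (i , p , q , e)) = ℚₚ.≤-trans (ℚₚ.≤-reflexive e) (above (sub p) q)

    module _ {d} (ρ : Vec (Fin n) d) (s : Store) where

      private
        option : Subset k → Fin k → Exp rational (suc d)
        option D i = if does (i ∈? D) then ifᵉ (cell ban i #0) (const 0ℚ) (revᵉ #0 i) else const 0ℚ
        s₁ s₂ : Store
        s₁ = exec (assign wt (λ D → maxima (allFin k) (option D))) ρ s
        s₂ = exec (assign alive (λ _ → const true)) ρ s₁

      optimise-kept : Kept touched s (exec optimise ρ s)
      optimise-kept = kept-trans (kept-set s wt refl) (kept-trans (kept-set s₁ alive refl)
        (kept-iter {m = n} (λ c → exec roundBody (c ∷ ρ)) (λ c → roundBody-kept (c ∷ ρ)) s₂))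

      initial : IsInitial (s ban) (s₁ wt)
      initial = record { above = above ; attained = attained }
        where
        above : ∀ {D v i} → i ∈ D → s ban i v ≡ false → rev v i ≤ℚ s₁ wt D v
        above {D} {v} {i} p q = ℚₚ.≤-trans (ℚₚ.≤-reflexive (sym same))
            (maxima-upper (allFin k) (option D) (v ∷ ρ) s (∈-allFin i))
          where
          same : eval (option D i) (v ∷ ρ) s ≡ rev v i
          same rewrite dec-true (i ∈? D) p = if-false q
        attained : ∀ D v → s₁ wt D v ≡ 0ℚ ⊎ ∃[ i ] (i ∈ D × s ban i v ≡ false × s₁ wt D v ≡ rev v i)
        attained D v with maxima-attained (allFin k) (option D) (v ∷ ρ) s
        ... | inj₁ e = inj₁ e
        ... | inj₂ (i , _ , e) = by (i ∈? D) (bool-cases (s ban i v)) refl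
          where
          by : (p : Dec (i ∈ D)) → s ban i v ≡ true ⊎ s ban i v ≡ false → (i ∈? D) ≡ p →
            s₁ wt D v ≡ 0ℚ ⊎ ∃[ i ] (i ∈ D × s ban i v ≡ false × s₁ wt D v ≡ rev v i)
          by (no ¬p) _ eq = inj₁ (trans e (cong (λ o → eval o (v ∷ ρ) s)
            (cong (λ t → if does t then ifᵉ (cell ban i #0) (const 0ℚ) (revᵉ #0 i) else const 0ℚ) eq)))
          by (yes p) (inj₁ q) eq = inj₁ (trans e (trans (cong (λ o → eval o (v ∷ ρ) s)
            (cong (λ t → if does t then ifᵉ (cell ban i #0) (const 0ℚ) (revᵉ #0 i) else const 0ℚ) eq)) (if-true q)))
          by (yes p) (inj₂ q) eq = inj₂ (i , p , q , trans e (trans (cong (λ o → eval o (v ∷ ρ) s)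
            (cong (λ t → if does t then ifᵉ (cell ban i #0) (const 0ℚ) (revᵉ #0 i) else const 0ℚ) eq)) (if-false q)))

      record RoundInv (t : Store) : Set where
        field
          mono  : Monotone (t wt)
          lift  : ∀ {K x} → Opt (t alive tt) (t wt) K 0ℚ x → Opt (λ _ → true) (s₁ wt) K 0ℚ x
          some  : Fin n → ∃[ a ] t alive tt a ≡ true

      round-inv : ∀ c t → RoundInv t → RoundInv (exec roundBody (c ∷ ρ) t)
      round-inv c t I = record { mono = mono′ ; lift = lift ∘ expanded ; some = λ _ → z , still-alive }
        where
        open RoundInv I
        open Round (c ∷ ρ) t mono (some c)

      One : Store → Set
      One t = ∀ a b → t alive tt a ≡ true → t alive tt b ≡ true → a ≡ b

      one-step : ∀ c t → RoundInv t → One t → One (exec roundBody (c ∷ ρ) t)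
      one-step c t I o a b p q = o a b (alive-⊆ a p) (alive-⊆ b q)
        where open Round (c ∷ ρ) t (RoundInv.mono I) (RoundInv.some I c)

      split : ∀ c t → RoundInv t → One t ⊎ count (exec roundBody (c ∷ ρ) t alive tt) < count (t alive tt)
      split c t I = by (Fₚ.any? λ a → Fₚ.any? λ b → (t alive tt a 𝔹ₚ.≟ true) ×-dec ((t alive tt b 𝔹ₚ.≟ true) ×-dec ¬? (a Fₚ.≟ b)))
        where
        by : Dec (Two (t alive tt)) → One t ⊎ count (exec roundBody (c ∷ ρ) t alive tt) < count (t alive tt)
        by (yes two) = inj₂ (Round.fewer (c ∷ ρ) t (RoundInv.mono I) (RoundInv.some I c) two)
        by (no none) = inj₁ λ a b p q → decidable-stable (a Fₚ.≟ b) λ ne → none (a , b , p , q , ne)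

      start-inv : RoundInv s₂
      start-inv = record { mono = initial-mono initial ; lift = id ; some = λ v → v , refl }

      after-rounds : RoundInv (exec optimise ρ s) × One (exec optimise ρ s)
      after-rounds = iter-keep {n = n} (λ c → exec roundBody (c ∷ ρ)) RoundInv round-inv start-inv , one (any-vertex n refl)
        where
        any-vertex : ∀ m → n ≡ m → Fin n ⊎ n ≡ 0
        any-vertex zero    e = inj₂ e
        any-vertex (suc m) e = inj₁ (subst Fin (sym e) zero)
        one : Fin n ⊎ n ≡ 0 → One (exec optimise ρ s)
        -- Without vertices no round takes place, and the claim is vacuous.
        one (inj₂ e) a = ⊥-elim (absurd (subst Fin e a))
          where
          absurd : Fin 0 → ⊥
          absurd ()
        one (inj₁ v) = settles (λ c → exec roundBody (c ∷ ρ)) (λ t → count (t alive tt)) One RoundInv one-step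
          round-inv split v n id start-inv (count≤ (s₂ alive tt))

      private
        end : Store
        end = exec optimise ρ s

      optimise-opt : ∀ {d′} (ρ′ : Vec (Fin n) d′) → ∃[ r ] (IsInitial (s ban) r ×
        Opt (λ _ → true) r Sub.⊤ 0ℚ (eval optimum ρ′ (exec optimise ρ s)))
      optimise-opt ρ′ = s₁ wt , initial , subst (Opt (λ _ → true) (s₁ wt) Sub.⊤ 0ℚ) (sym (value-optimum ρ′ end)) final
        where
        final : Opt (λ _ → true) (s₁ wt) Sub.⊤ 0ℚ (value (end alive tt) (end wt) (λ _ → Sub.⊤))
        final = RoundInv.lift {end} (proj₁ after-rounds)
          (opt-single (RoundInv.mono {end} (proj₁ after-rounds)) λ {a} {b} → proj₂ after-rounds a b)

-- From the optimum to an optimal colouring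

module RunReduce {n k : ℕ} (G : Graph (Fin n)) (rev : Revenue n k) (bcf : BullChairFree (adj G))
  (rev-nonneg : ∀ v i → 0ℚ ≤ℚ rev v i) where

  open Algo k
  open Language signature k
  open Semantics G rev
  open Assignments {n} {k} (adj G) (adj-sym G) (adj-irrefl G)
  open Run G rev
  open RunPath G rev
  open RunSolve G rev using (exec-each)
  open RunRounds G rev bcf
  open Optimise rev-nonneg

  Colouring : Set
  Colouring = PartialColoring k G

  Bans : Set
  Bans = Fin k → VSet

  Uses : Colouring → Bans → Set
  Uses c b = ∀ v (p : v ∈ X c) → b (color c (v , p)) v ≡ false

  At : Colouring → Fin n → Fin k → Set
  At c v i = Σ (v ∈ X c) λ p → color c (v , p) ≡ i

  at? : ∀ c v i → Dec (At c v i)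
  at? c v i with v ∈? X c
  ... | no ¬p = no (¬p ∘ proj₁)
  ... | yes p with color c (v , p) Fₚ.≟ i
  ...   | yes e = yes (p , e)
  ...   | no ne = no λ (q , e) → ne (trans (cong (λ r → color c (v , r)) ([]=-irrelevant p q)) e)

  revenueAt-in : ∀ c {v} (p : v ∈ X c) → revenueAt {G = G} rev c v ≡ rev v (color c (v , p))
  revenueAt-in c {v} p with v ∈? X c
  ... | yes q = cong (λ r → rev v (color c (v , r))) ([]=-irrelevant q p)
  ... | no ¬p = ⊥-elim (¬p p)

  revenueAt-out : ∀ c {v} → v ∉ X c → revenueAt {G = G} rev c v ≡ 0ℚ
  revenueAt-out c {v} ¬p with v ∈? X c
  ... | yes p = ⊥-elim (¬p p)
  ... | no _  = refl

  module _ {b : Bans} {r : Weight} (init : IsInitial b r) {x : ℚ} (opt : Opt (λ _ → true) r Sub.⊤ 0ℚ x) where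

    open IsInitial init
    module O = Opt opt

    -- A colouring is read as an assignment of singletons, with the empty set off its domain.
    colouring-bound : ∀ c → Uses c b → revenue rev c ≤ℚ x
    colouring-bound c uses = ℚₚ.≤-trans (sum-mono λ v → below v (v ∈? X c) refl)
        (ℚₚ.≤-trans (ℚₚ.≤-reflexive (trans (sym (value-sum (λ _ → true) r D)) (sym (ℚₚ.+-identityˡ (value (λ _ → true) r D)))))
          (O.bound D (λ _ → ⊆⊤) compat))
      where
      single : ∀ {v} → Dec (v ∈ X c) → Subset k
      single {v} (yes p) = ⁅ color c (v , p) ⁆
      single     (no _)  = Sub.⊥
      D : Assignment
      D v = single (v ∈? X c)
      below : ∀ v (d : Dec (v ∈ X c)) → (v ∈? X c) ≡ d → revenueAt {G = G} rev c v ≤ℚ r (D v) v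
      below v (yes p) e = ℚₚ.≤-trans (ℚₚ.≤-reflexive (revenueAt-in c p))
        (above (subst (λ d → color c (v , p) ∈ single d) (sym e) (x∈⁅x⁆ _)) (uses v p))
      below v (no ¬p) e = ℚₚ.≤-trans (ℚₚ.≤-reflexive (revenueAt-out c ¬p)) (initial-nonneg init (D v) v)
      member : ∀ {v i} (d : Dec (v ∈ X c)) → i ∈ single d → At c v i
      member {v} (yes p) q = p , sym (x∈⁅y⁆⇒x≡y _ q)
      member (no _) q = ⊥-elim (∉⊥ q)
      compat : Compatible (λ _ → true) D
      compat {u} {v} _ _ e i∈u i∈v with member (u ∈? X c) i∈u | member (v ∈? X c) i∈v
      ... | p , eu | q , ev = proper c (u , p) (v , q) e (trans eu (sym ev))

    -- In an optimal assignment each vertex keeps one colour that earns its initial weight, or stays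
    -- uncoloured if that weight is 0. Disjointness on adjacent vertices makes the colouring proper.
    colouring-attains : ∃[ c ] (Uses c b × x ≤ℚ revenue rev c)
    colouring-attains = c , uses , ℚₚ.≤-trans O.attained (ℚₚ.≤-trans
        (ℚₚ.≤-reflexive (trans (ℚₚ.+-identityˡ (value (λ _ → true) r O.D)) (value-sum (λ _ → true) r O.D)))
        (ℚₚ.≤-reflexive (sum-cong-≗ λ v → same v)))
      where
      Choice : Fin n → Set
      Choice v = r (O.D v) v ≡ 0ℚ ⊎ ∃[ i ] (i ∈ O.D v × b i v ≡ false × r (O.D v) v ≡ rev v i)
      coloured : ∀ {v} → Choice v → Bool
      coloured (inj₁ _) = false
      coloured (inj₂ _) = true
      choice : ∀ v → Choice v
      choice v = attained (O.D v) v
      Xc : Subset n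
      Xc = tabulate λ v → coloured (choice v)
      get : ∀ {v} (a : Choice v) → coloured a ≡ true → ∃[ i ] (i ∈ O.D v × b i v ≡ false × r (O.D v) v ≡ rev v i)
      get (inj₂ a) _ = a
      chosenᶜ : (v : ∃ (_∈ Xc)) → ∃[ i ] (i ∈ O.D (proj₁ v) × b i (proj₁ v) ≡ false × r (O.D (proj₁ v)) (proj₁ v) ≡ rev (proj₁ v) i)
      chosenᶜ (v , p) = get (choice v) (∈-tabulate⁻ (λ v → coloured (choice v)) p)
      c : Colouring
      c = record
        { X = Xc ; color = λ v → proj₁ (chosenᶜ v)
        ; proper = λ u v e eq → O.compat refl refl e (proj₁ (proj₂ (chosenᶜ u)))
            (subst (_∈ O.D (proj₁ v)) (sym eq) (proj₁ (proj₂ (chosenᶜ v)))) }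
      uses : Uses c b
      uses v p = proj₁ (proj₂ (proj₂ (chosenᶜ (v , p))))
      same : ∀ v → r (O.D v) v ≡ revenueAt {G = G} rev c v
      same v = by (v ∈? Xc)
        where
        by : Dec (v ∈ Xc) → r (O.D v) v ≡ revenueAt {G = G} rev c v
        by (yes p) = trans (proj₂ (proj₂ (proj₂ (chosenᶜ (v , p))))) (sym (revenueAt-in c p))
        by (no ¬p) = trans (zero-at (choice v) λ q → ¬p (∈-tabulate⁺ (λ v → coloured (choice v)) q)) (sym (revenueAt-out c ¬p))
          where
          zero-at : (a : Choice v) → ¬ (coloured a ≡ true) → r (O.D v) v ≡ 0ℚ
          zero-at (inj₁ e) _ = e
          zero-at (inj₂ _) h = ⊥-elim (h refl)

  module _ (x₀ : ℚ) where

    -- `needed` makes each treated option that was not banned indispensable: every colouring that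
    -- respects the bans and earns at least `x₀` uses it.
    record Inv (P : Fin n → Fin k → Set) (s : Store) : Set where
      field
        stored   : ∀ v → s best tt v ≡ x₀
        feasible : ∃[ c ] (Uses c (s ban) × x₀ ≤ℚ revenue rev c)
        needed   : ∀ {v i} → P v i → s ban i v ≡ false → ∀ c → Uses c (s ban) → x₀ ≤ℚ revenue rev c → At c v i

    inv-P : ∀ {P Q s} → (∀ {v i} → Q v i → P v i) → Inv P s → Inv Q s
    inv-P f I = record { stored = stored ; feasible = feasible ; needed = needed ∘ f }
      where open Inv I

    module TryBan {d} (ρ : Vec (Fin n) d) (v : Fin n) (i : Fin k) (s : Store) where

      s₁ s₂ s′ : Store
      s₁ = exec (assign ban (λ j → if does (j Fₚ.≟ i) then cell ban j #0 ∨ᵉ eqᵉ #0 #1 else cell ban j #0)) (v ∷ ρ) s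
      s₂ = exec optimise (v ∷ ρ) s₁
      s′ = exec (tryBan i) (v ∷ ρ) s

      y : Fin n → ℚ
      y w = eval optimum (w ∷ v ∷ ρ) s₂

      y≡ : ∀ w → y w ≡ y v
      y≡ w = trans (value-optimum (w ∷ v ∷ ρ) s₂) (sym (value-optimum (v ∷ v ∷ ρ) s₂))

      ban₂ : s₂ ban ≡ s₁ ban
      ban₂ = Kept.at (optimise-kept (v ∷ ρ) s₁) ban refl

      best₂ : s₂ best ≡ s best
      best₂ = Kept.at (optimise-kept (v ∷ ρ) s₁) best refl

      best′ : s′ best ≡ s best
      best′ = best₂

      opt₁ : ∃[ r ] (IsInitial (s₁ ban) r × Opt (λ _ → true) r Sub.⊤ 0ℚ (y v))
      opt₁ = optimise-opt (v ∷ ρ) s₁ (v ∷ v ∷ ρ)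

      ban₁-other : ∀ {j} w → j ≢ i → s₁ ban j w ≡ s ban j w
      ban₁-other {j} w ne rewrite dec-false (j Fₚ.≟ i) ne = refl

      ban₁-reflects : ∀ w → Reflects (s ban i w ≡ true ⊎ w ≡ v) (s₁ ban i w)
      ban₁-reflects w rewrite dec-true (i Fₚ.≟ i) refl = r-or (r-bool _) (r-eq w v)

      revise : Fin k → Exp bool (2 + d)
      revise j = cell ban j #0 ∧ᵉ notᵉ (eqᵉ #0 #1 ∧ᵉ notᵉ (cell best tt #1 ≤ᵉ optimum))

      ban′-other : ∀ {j} w → j ≢ i → s′ ban j w ≡ s ban j w
      ban′-other {j} w ne = trans (cong (λ b → eval (if b then revise j else cell ban j #0) (w ∷ v ∷ ρ) s₂) (dec-false (j Fₚ.≟ i) ne))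
        (trans (cong (λ f → f j w) ban₂) (ban₁-other w ne))

      ban′-reflects : ∀ w → Reflects (s₁ ban i w ≡ true × ¬ (w ≡ v × ¬ (s best tt v ≤ℚ y v))) (s′ ban i w)
      ban′-reflects w = subst (Reflects _)
          (sym (cong (λ b → eval (if b then revise i else cell ban i #0) (w ∷ v ∷ ρ) s₂) (dec-true (i Fₚ.≟ i) refl)))
          (r-and (r-map (trans (cong (λ f → f i w) (sym ban₂))) (trans (cong (λ f → f i w) ban₂)) (r-bool _))
            (r-not (r-and (r-eq w v) (r-not (r-map to from (proof (s₂ best tt v ℚₚ.≤? y w)))))))
        where
        to : s₂ best tt v ≤ℚ y w → s best tt v ≤ℚ y v
        to l = subst₂′ (cong (λ f → f tt v) best₂) (y≡ w) l
          where
          subst₂′ : ∀ {a b c d} → a ≡ b → c ≡ d → a ≤ℚ c → b ≤ℚ d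
          subst₂′ refl refl l = l
        from : s best tt v ≤ℚ y v → s₂ best tt v ≤ℚ y w
        from l = ℚₚ.≤-trans (ℚₚ.≤-reflexive (cong (λ f → f tt v) best₂)) (ℚₚ.≤-trans l (ℚₚ.≤-reflexive (sym (y≡ w))))

      ban⊆ban₁ : ∀ {j w} → s₁ ban j w ≡ false → s ban j w ≡ false
      ban⊆ban₁ {j} {w} e = by (j Fₚ.≟ i)
        where
        by : Dec (j ≡ i) → s ban j w ≡ false
        by (no ne) = trans (sym (ban₁-other w ne)) e
        by (yes refl) = 𝔹ₚ.¬-not λ t → false-reflects (ban₁-reflects w) e (inj₁ t)

      uses₁ : ∀ c → Uses c (s ban) → ¬ At c v i → Uses c (s₁ ban)
      uses₁ c u ¬at w p = by (color c (w , p) Fₚ.≟ i)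
        where
        by : Dec (color c (w , p) ≡ i) → s₁ ban (color c (w , p)) w ≡ false
        by (no ne) = trans (ban₁-other w ne) (u w p)
        by (yes e) = subst (λ j → s₁ ban j w ≡ false) (sym e) (reflects-false (ban₁-reflects w)
          λ { (inj₁ t) → true≢false t (trans (cong (λ j → s ban j w) (sym e)) (u w p))
            ; (inj₂ refl) → ¬at (p , e) })

      module _ {P} (I : Inv P s) where

        open Inv I

        keep-ban : (∀ j w → s′ ban j w ≡ s₁ ban j w) → x₀ ≤ℚ y v → Inv (λ w j → P w j ⊎ (w ≡ v × j ≡ i)) s′
        keep-ban same le = record
          { stored = λ w → trans (cong (λ f → f tt w) best′) (stored w)
          ; feasible = let (r , init , opt) = opt₁ ; (c , u , l) = colouring-attains init opt in
              c , (λ w p → trans (same (color c (w , p)) w) (u w p)) , ℚₚ.≤-trans le l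
          ; needed = λ {w} {j} → λ where
              (inj₁ p) e c u l → needed p (ban⊆ban₁ {j} {w} (trans (sym (same j w)) e)) c
                (λ w q → ban⊆ban₁ {color c (w , q)} {w} (trans (sym (same (color c (w , q)) w)) (u w q))) l
              (inj₂ (refl , refl)) e → true≢false (reflects-true (ban₁-reflects v) (inj₂ refl)) (trans (sym (same i v)) e) }

        drop-ban : (∀ j w → s′ ban j w ≡ s ban j w) → ¬ (x₀ ≤ℚ y v) → Inv (λ w j → P w j ⊎ (w ≡ v × j ≡ i)) s′
        drop-ban same nle = record
          { stored = λ w → trans (cong (λ f → f tt w) best′) (stored w)
          ; feasible = let (c , u , l) = feasible in c , (λ w p → trans (same (color c (w , p)) w) (u w p)) , l
          ; needed = λ {w} {j} → λ where
              (inj₁ p) e c u l → needed p (trans (sym (same j w)) e) c (λ w q → trans (sym (same (color c (w , q)) w)) (u w q)) l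
              (inj₂ (refl , refl)) e c u l → must c (λ w q → trans (sym (same (color c (w , q)) w)) (u w q)) l (at? c v i) }
          where
          must : ∀ c → Uses c (s ban) → x₀ ≤ℚ revenue rev c → Dec (At c v i) → At c v i
          must c u l (yes a) = a
          must c u l (no na) = let (r , init , opt) = opt₁ in
            ⊥-elim (nle (ℚₚ.≤-trans l (colouring-bound init opt c (uses₁ c u na))))

        not-banned : ¬ (x₀ ≤ℚ y v) → s ban i v ≡ false
        not-banned nle = 𝔹ₚ.¬-not λ t → let (c , u , l) = feasible ; (r , init , opt) = opt₁ in
          nle (ℚₚ.≤-trans l (colouring-bound init opt c
            (uses₁ c u λ (p , e) → true≢false t (trans (cong (λ j → s ban j v) (sym e)) (u v p)))))

        step : Inv (λ w j → P w j ⊎ (w ≡ v × j ≡ i)) s′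
        step = by (x₀ ℚₚ.≤? y v)
          where
          below : s best tt v ≤ℚ y v → x₀ ≤ℚ y v
          below = ℚₚ.≤-trans (ℚₚ.≤-reflexive (sym (stored v)))
          by : Dec (x₀ ≤ℚ y v) → Inv (λ w j → P w j ⊎ (w ≡ v × j ≡ i)) s′
          by (yes le) = keep-ban (λ j w → same j w (j Fₚ.≟ i) (bool-cases (s₁ ban j w))) le
            where
            same : ∀ j w → Dec (j ≡ i) → s₁ ban j w ≡ true ⊎ s₁ ban j w ≡ false → s′ ban j w ≡ s₁ ban j w
            same j w (no ne) _ = trans (ban′-other w ne) (sym (ban₁-other w ne))
            same j w (yes refl) (inj₁ t) = trans (reflects-true (ban′-reflects w)
              (t , λ (_ , n) → n (ℚₚ.≤-trans (ℚₚ.≤-reflexive (stored v)) le))) (sym t)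
            same j w (yes refl) (inj₂ f) = trans (reflects-false (ban′-reflects w) λ (t , _) → true≢false t f) (sym f)
          by (no nle) = drop-ban (λ j w → same j w (j Fₚ.≟ i) (w Fₚ.≟ v) (bool-cases (s ban j w))) nle
            where
            same : ∀ j w → Dec (j ≡ i) → Dec (w ≡ v) → s ban j w ≡ true ⊎ s ban j w ≡ false → s′ ban j w ≡ s ban j w
            same j w (no ne) _ _ = ban′-other w ne
            same j w (yes refl) (yes refl) _ = trans (reflects-false (ban′-reflects v)
              λ (_ , h) → h (refl , nle ∘ below)) (sym (not-banned nle))
            same j w (yes refl) (no ne) (inj₁ t) = trans (reflects-true (ban′-reflects w)
              (reflects-true (ban₁-reflects w) (inj₁ t) , ne ∘ proj₁)) (sym t)
            same j w (yes refl) (no ne) (inj₂ f) = trans (reflects-false (ban′-reflects w)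
              λ (t , _) → by′ (true-reflects (ban₁-reflects w) t)) (sym f)
              where
              by′ : ¬ (s ban i w ≡ true ⊎ w ≡ v)
              by′ (inj₁ t) = true≢false t f
              by′ (inj₂ e) = ne e

    try-all : ∀ s → Inv (λ _ _ → ⊥) s → Inv (λ _ _ → ⊤) (exec (for (each (allFin k) tryBan)) [] s)
    try-all s I = inv-P (λ {v} _ → Fₚ.toℕ<n v) (iter-inv {n = n} (λ v → exec (each (allFin k) tryBan) (v ∷ []))
        (λ m → Inv (λ v _ → toℕ v < m)) outer (inv-P (λ ()) I))
      where
      outer : ∀ v s → Inv (λ w _ → toℕ w < toℕ v) s →
        Inv (λ w _ → toℕ w < suc (toℕ v)) (exec (each (allFin k) tryBan) (v ∷ []) s)
      outer v s I = inv-P (λ {w} {i} l → late w i (ℕₚ.m<1+n⇒m<n∨m≡n l))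
        (exec-each (allFin k) tryBan (λ Q → Inv (λ w i → toℕ w < toℕ v ⊎ (w ≡ v × Q i)))
          (λ f → inv-P λ { (inj₁ l) → inj₁ l ; (inj₂ (e , q)) → inj₂ (e , f q) })
          (λ i t H → inv-P (λ { (inj₁ l) → inj₁ (inj₁ l) ; (inj₂ (e , inj₁ q)) → inj₁ (inj₂ (e , q))
                              ; (inj₂ (e , inj₂ q)) → inj₂ (e , q) }) (TryBan.step [] v i t H))
          {λ _ → ⊥} (inv-P (λ { (inj₁ l) → l ; (inj₂ (_ , ())) }) I))
        where
        late : ∀ w i → toℕ w < toℕ v ⊎ toℕ w ≡ toℕ v → toℕ w < toℕ v ⊎ (w ≡ v × (⊥ ⊎ i ∈ᴸ allFin k))
        late w i (inj₁ l) = inj₁ l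
        late w i (inj₂ e) = inj₂ (Fₚ.toℕ-injective e , inj₂ (∈-allFin i))

  palette-cases : ∀ {d} (is : List (Fin k)) v (ρ : Vec (Fin n) d) s →
    (eval (palette is) (v ∷ ρ) s ≡ 0 × (∀ {i} → i ∈ᴸ is → s ban i v ≡ true)) ⊎
    ∃[ i ] (eval (palette is) (v ∷ ρ) s ≡ suc (toℕ i) × s ban i v ≡ false)
  palette-cases [] v ρ s = inj₁ (refl , λ ())
  palette-cases (i ∷ is) v ρ s with bool-cases (s ban i v)
  ... | inj₂ f = inj₂ (i , if-false f , f)
  ... | inj₁ t with palette-cases is v ρ s
  ...   | inj₁ (e , h) = inj₁ (trans (if-true t) e , λ { (here refl) → t ; (there m) → h m })
  ...   | inj₂ (j , e , f) = inj₂ (j , trans (if-true t) e , f)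

  -- The final feasible colouring uses only options that are not banned, and by `needed` it uses all
  -- of them. Hence a vertex has at most one such option, and `palette` reads off this very
  -- colouring.
  main-correct : ∀ s → (∀ i v → s ban i v ≡ false) → ∃[ c ]
    ((∀ v (p : v ∈ X c) → exec main [] s out tt v ≡ suc (toℕ (color c (v , p)))) ×
     (∀ v → v ∉ X c → exec main [] s out tt v ≡ 0) × IsOptimal rev c)
  main-correct s none = c , inside , outside , optimal
    where
    s₁ s₂ s₃ : Store
    s₁ = exec optimise [] s
    s₂ = exec (assign best (λ _ → optimum)) [] s₁
    s₃ = exec (for (each (allFin k) tryBan)) [] s₂
    x₀ : ℚ
    x₀ = eval optimum [] s₁
    opt₀ : ∃[ r ] (IsInitial (s ban) r × Opt (λ _ → true) r Sub.⊤ 0ℚ x₀)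
    opt₀ = optimise-opt [] s []
    ban₂ : s₂ ban ≡ s ban
    ban₂ = Kept.at (optimise-kept [] s) ban refl
    upper : ∀ c → revenue rev c ≤ℚ x₀
    upper c = let (r , init , opt) = opt₀ in colouring-bound init opt c λ v p → none _ v
    start : Inv x₀ (λ _ _ → ⊥) s₂
    start = record
      { stored = λ v → trans (value-optimum (v ∷ []) s₁) (sym (value-optimum [] s₁))
      ; feasible = let (r , init , opt) = opt₀ ; (c , u , l) = colouring-attains init opt in
          c , subst (Uses c) (sym ban₂) u , l
      ; needed = λ () }
    open Inv (try-all x₀ s₂ start)
    c : Colouring
    c = proj₁ feasible
    uses : Uses c (s₃ ban)
    uses = proj₁ (proj₂ feasible)
    must : ∀ {v i} → s₃ ban i v ≡ false → At c v i
    must e = needed tt e c uses (proj₂ (proj₂ feasible))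
    optimal : IsOptimal rev c
    optimal c′ = ℚₚ.≤-trans (upper c′) (proj₂ (proj₂ feasible))
    Cases : Fin n → Set
    Cases v = (eval (palette (allFin k)) (v ∷ []) s₃ ≡ 0 × (∀ {i} → i ∈ᴸ allFin k → s₃ ban i v ≡ true)) ⊎
      ∃[ i ] (eval (palette (allFin k)) (v ∷ []) s₃ ≡ suc (toℕ i) × s₃ ban i v ≡ false)
    inside : ∀ v (p : v ∈ X c) → eval (palette (allFin k)) (v ∷ []) s₃ ≡ suc (toℕ (color c (v , p)))
    inside v p = by (palette-cases (allFin k) v [] s₃)
      where
      by : Cases v → eval (palette (allFin k)) (v ∷ []) s₃ ≡ suc (toℕ (color c (v , p)))
      by (inj₁ (_ , h)) = true≢false (h (∈-allFin _)) (uses v p)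
      by (inj₂ (i , e , f)) = let (q , e′) = must f in
        trans e (cong (suc ∘ toℕ) (trans (sym e′) (cong (λ r → color c (v , r)) ([]=-irrelevant q p))))
    outside : ∀ v → v ∉ X c → eval (palette (allFin k)) (v ∷ []) s₃ ≡ 0
    outside v ¬p = by (palette-cases (allFin k) v [] s₃)
      where
      by : Cases v → eval (palette (allFin k)) (v ∷ []) s₃ ≡ 0
      by (inj₁ (e , _)) = e
      by (inj₂ (i , e , f)) = ⊥-elim (¬p (proj₁ (must f)))

-- Running time

open +-*-Solver using (_:+_; _:*_; _:=_; con) renaming (solve to semiring)

length-subsets : ∀ k → length (subsets k) ≡ 2 ^ k
length-subsets zero    = refl
length-subsets (suc k) = trans (length-++ (map (true ∷_) (subsets k)))
  (cong₂ _+_ (trans (length-map (true ∷_) (subsets k)) (length-subsets k))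
    (trans (length-map (false ∷_) (subsets k)) (trans (length-subsets k) (sym (ℕₚ.+-identityʳ _)))))

1≤2^ : ∀ k → 1 ≤ 2 ^ k
1≤2^ k = ℕₚ.m^n>0 2 k

suc≤2^ : ∀ k → suc k ≤ 2 ^ k
suc≤2^ zero    = ℕₚ.≤-refl
suc≤2^ (suc k) = ℕₚ.≤-trans (ℕₚ.+-mono-≤ (1≤2^ k) (suc≤2^ k))
  (ℕₚ.+-monoʳ-≤ (2 ^ k) (ℕₚ.≤-reflexive (sym (ℕₚ.+-identityʳ (2 ^ k)))))

module RunCost {n k : ℕ} (G : Graph (Fin n)) (rev : Revenue n k) where

  open Algo k
  open Language signature k
  open Semantics G rev

  N u : ℕ
  N = 2 ⊔ n
  u = suc k

  2≤N : 2 ≤ N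
  2≤N = ℕₚ.m≤m⊔n 2 n

  instance
    N≢0 : NonZero N
    N≢0 = >-nonZero (ℕₚ.≤-trans (s≤s z≤n) 2≤N)

  -- Costs are measured by an exponent in units of `suc k`. Products add exponents, a sum takes one
  -- unit more, and a factor `2 ^ k` from unrolled lists takes one unit, since `N` is at least 2.
  record W (m c : ℕ) : Set where
    constructor w
    field bound : c ≤ N ^ (m * u)
  open W

  W-≤ : ∀ {m l c} → m ≤ l → W m c → W l c
  W-≤ m≤l (w h) = w (ℕₚ.≤-trans h (ℕₚ.^-monoʳ-≤ N (ℕₚ.*-monoˡ-≤ u m≤l)))

  W-up : ∀ {m c} l → {IsTrue (m ≤ᵇ l)} → W m c → W l c
  W-up {m} l {p} = W-≤ (ℕₚ.≤ᵇ⇒≤ m l p)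

  W-down : ∀ {m c c′} → c ≤ c′ → W m c′ → W m c
  W-down c≤c′ (w h) = w (ℕₚ.≤-trans c≤c′ h)

  W-const : ∀ m {c} → {IsTrue (c ≤ᵇ 2 ^ m)} → W m c
  W-const m {c} {p} = w (ℕₚ.≤-trans (ℕₚ.≤ᵇ⇒≤ c (2 ^ m) p)
    (ℕₚ.≤-trans (ℕₚ.^-monoˡ-≤ m 2≤N) (ℕₚ.^-monoʳ-≤ N (ℕₚ.m≤m*n m u))))

  W-n : W 1 n
  W-n = w (ℕₚ.≤-trans (ℕₚ.m≤n⊔m 2 n) (ℕₚ.≤-trans (ℕₚ.≤-reflexive (sym (ℕₚ.^-identityʳ N)))
    (ℕₚ.^-monoʳ-≤ N {1} {1 * u} (s≤s z≤n))))

  W-2^ : W 1 (2 ^ u)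
  W-2^ = w (ℕₚ.≤-trans (ℕₚ.^-monoˡ-≤ u 2≤N) (ℕₚ.^-monoʳ-≤ N (ℕₚ.≤-reflexive (sym (ℕₚ.+-identityʳ u)))))

  W-refl : ∀ {m} → W m (N ^ (m * u))
  W-refl = w ℕₚ.≤-refl

  W-* : ∀ {m l x y} → W m x → W l y → W (m + l) (x * y)
  W-* {m} {l} (w h) (w h′) = w (ℕₚ.≤-trans (ℕₚ.*-mono-≤ h h′) (ℕₚ.≤-reflexive
    (trans (sym (ℕₚ.^-distribˡ-+-* N (m * u) (l * u))) (cong (N ^_) (sym (ℕₚ.*-distribʳ-+ u m l))))))

  W-+ : ∀ {m l x y} → W m x → W l y → W (m + l + 1) (x + y)
  W-+ {m} {l} h h′ = W-down (ℕₚ.+-mono-≤ (bound (W-≤ (ℕₚ.m≤m+n m l) h)) (bound (W-≤ (ℕₚ.m≤n+m l m) h′)))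
    (W-down (ℕₚ.≤-reflexive (trans (cong (B +_) (sym (ℕₚ.+-identityʳ B))) (ℕₚ.*-comm 2 B)))
      (W-* W-refl (W-const 1)))
    where
    B = N ^ ((m + l) * u)

  W-1 : ∀ {m} → 1 ≤ N ^ (m * u)
  W-1 {m} = ℕₚ.m^n>0 N (m * u)

  -- Exponents read off the syntax along `costᴱ`. On macros over lists indexed by colours they would
  -- grow with `k`, so those macros are bounded by separate lemmas.
  wE : ∀ {τ d} → Exp τ d → ℕ
  wE (const x)    = 2
  wE (cell f i x) = 3
  wE (adjᵉ x y)   = 4
  wE (leᵉ x y)    = 4
  wE (revᵉ x i)   = 3
  wE (p ≤ᵉ q)     = wE p + (wE q + 4 + 1) + 1
  wE (ifᵉ b p q)  = wE b + (3 + (wE p + wE q + 1) + 1) + 1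
  wE (bin o p q)  = wE p + (wE q + 4 + 1) + 1
  wE (big o e)    = 2 + (4 + (1 + (4 + (wE e + 4 + 1) + 1)) + 1) + 1

  big-W : ∀ {m c} → W m c → W (2 + (4 + (1 + (4 + (m + 4 + 1) + 1)) + 1) + 1) (3 + (10 + n * (13 + (c + 10))))
  big-W h = W-+ (W-const 2 {3}) (W-+ (W-const 4 {10}) (W-* W-n (W-+ (W-const 4 {13}) (W-+ h (W-const 4 {10})))))

  if-W : ∀ {m l q a b c} → W m a → W l b → W q c → W (m + (3 + (l + q + 1) + 1) + 1) (a + (5 + (b + c)))
  if-W h h′ h″ = W-+ h (W-+ (W-const 3 {5}) (W-+ h′ h″))

  bin-W : ∀ {m l a b} → W m a → W l b → W (m + (l + 4 + 1) + 1) (a + (b + 10))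
  bin-W h h′ = W-+ h (W-+ h′ (W-const 4 {10}))

  struct : ∀ {τ d} (e : Exp τ d) → W (wE e) (costᴱ e)
  struct (const x)    = W-const 2
  struct (cell f i x) = W-const 3
  struct (adjᵉ x y)   = W-const 4
  struct (leᵉ x y)    = W-const 4
  struct (revᵉ x i)   = W-const 3
  struct (p ≤ᵉ q)     = W-+ (struct p) (W-+ (struct q) (W-const 4 {9}))
  struct (ifᵉ b p q)  = if-W (struct b) (struct p) (struct q)
  struct (bin o p q)  = bin-W (struct p) (struct q)
  struct (big o e)    = big-W (struct e)

  cost≥1 : ∀ {τ d} (e : Exp τ d) → 1 ≤ costᴱ e
  cost≥1 (const x)    = s≤s z≤n
  cost≥1 (cell f i x) = s≤s z≤n
  cost≥1 (adjᵉ x y)   = s≤s z≤n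
  cost≥1 (leᵉ x y)    = s≤s z≤n
  cost≥1 (revᵉ x i)   = s≤s z≤n
  cost≥1 (p ≤ᵉ q)     = ℕₚ.≤-trans (cost≥1 p) (ℕₚ.m≤m+n _ _)
  cost≥1 (ifᵉ b p q)  = ℕₚ.≤-trans (cost≥1 b) (ℕₚ.m≤m+n _ _)
  cost≥1 (bin o p q)  = ℕₚ.≤-trans (cost≥1 p) (ℕₚ.m≤m+n _ _)
  cost≥1 (big o e)    = s≤s z≤n

  -- Macro-expanded lists are short enough for their length to be absorbed by N ^ u.
  Short : ∀ {A : Set} → List A → Set
  Short xs = suc (length xs) ≤ 2 ^ u

  short-subsets : Short (subsets k)
  short-subsets rewrite length-subsets k = ℕₚ.≤-trans (ℕₚ.+-monoˡ-≤ (2 ^ k) (1≤2^ k))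
    (ℕₚ.+-monoʳ-≤ (2 ^ k) (ℕₚ.≤-reflexive (sym (ℕₚ.+-identityʳ (2 ^ k)))))

  short-colours : Short (allFin k)
  short-colours rewrite length-tabulate {n = k} id = ℕₚ.≤-trans (suc≤2^ k) (ℕₚ.^-monoʳ-≤ 2 (ℕₚ.n≤1+n k))

  short-one : Short (tt ∷ [])
  short-one = ℕₚ.^-monoʳ-≤ 2 {1} {u} (s≤s z≤n)

  short-enum : ∀ f → Short (enum f)
  short-enum alive = short-one
  short-enum inM   = short-one
  short-enum clo   = short-one
  short-enum vis   = short-one
  short-enum ban   = short-colours
  short-enum out   = short-one
  short-enum wt    = short-subsets
  short-enum wt′   = short-subsets
  short-enum gain  = short-subsets
  short-enum acc   = short-one
  short-enum best  = short-one

  list-W : ∀ {A : Set} {m} (xs : List A) {c : ℕ} → Short xs → c ≤ suc (length xs) * N ^ (m * u) → W (1 + m) c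
  list-W {m = m} xs short le = W-down le (W-* {1} {m} (W-down short W-2^) W-refl)

  total-W : ∀ {A : Set} {m} (xs : List A) (c : A → ℕ) → Short xs → (∀ x → W m (c x)) → W (1 + m) (total xs c)
  total-W {A} {m} xs c short h = list-W {m = m} xs short (go xs)
    where
    go : ∀ ys → total ys c ≤ suc (length ys) * N ^ (m * u)
    go []       = ℕₚ.≤-trans (W-1 {m}) (ℕₚ.m≤m+n _ 0)
    go (y ∷ ys) = ℕₚ.+-mono-≤ (bound (h y)) (go ys)

  each-W : ∀ {A : Set} {m d} (xs : List A) (c : A → Cmd d) → Short xs → (∀ x → W m (costᶜ (c x))) →
    W (1 + m) (costᶜ (each xs c))
  each-W {A} {m} xs c short h = list-W {m = m} xs short (go xs)
    where
    go : ∀ ys → costᶜ (each ys c) ≤ suc (length ys) * N ^ (m * u)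
    go []       = ℕₚ.≤-trans (W-1 {m}) (ℕₚ.m≤m+n _ 0)
    go (y ∷ ys) = ℕₚ.+-mono-≤ (bound (h y)) (go ys)

  foldr-W : ∀ {A : Set} {m τ d} (xs : List A) (f : List A → Exp τ d) → Short xs → W m (costᴱ (f [])) →
    (∀ x ys c → costᴱ (f ys) ≤ c → costᴱ (f (x ∷ ys)) ≤ N ^ (m * u) + c) → W (1 + m) (costᴱ (f xs))
  foldr-W {A} {m} xs f short h₀ step = list-W {m = m} xs short (go xs)
    where
    go : ∀ ys → costᴱ (f ys) ≤ suc (length ys) * N ^ (m * u)
    go []       = ℕₚ.≤-trans (bound h₀) (ℕₚ.m≤m+n _ 0)
    go (y ∷ ys) = step y ys _ (go ys)

  maxima-W : ∀ {A : Set} {m d} (xs : List A) (e : A → Exp rational d) → Short xs → (∀ x → W m (costᴱ (e x))) →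
    W (1 + (m + 4 + 1)) (costᴱ (maxima xs e))
  maxima-W {m = m} xs e short h = foldr-W xs (λ ys → maxima ys e) short
    (W-≤ (ℕₚ.≤-trans (ℕₚ.m≤n+m 4 m) (ℕₚ.m≤m+n _ 1)) (W-const 4))
    λ x ys c le → ℕₚ.≤-trans (ℕₚ.≤-reflexive (rearrange (costᴱ (e x)) (costᴱ (maxima ys e))))
      (ℕₚ.+-mono-≤ (bound (W-+ (h x) (W-const 4 {10}))) le)
    where
    rearrange : ∀ a b → a + (b + 10) ≡ (a + 10) + b
    rearrange = semiring 2 (λ a b → a :+ (b :+ con 10) := (a :+ con 10) :+ b) refl

  allOf-W : ∀ {A : Set} {m d} (xs : List A) (e : A → Exp bool d) → Short xs → (∀ x → W m (costᴱ (e x))) →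
    W (1 + (m + 3 + 1)) (costᴱ (allOf xs e))
  allOf-W {m = m} xs e short h = foldr-W xs (λ ys → allOf ys e) short
    (W-≤ (ℕₚ.≤-trans (ℕₚ.m≤n+m 3 m) (ℕₚ.m≤m+n _ 1)) (W-const 3))
    λ x ys c le → ℕₚ.≤-trans (ℕₚ.≤-reflexive (rearrange (costᴱ (e x)) (costᴱ (allOf ys e))))
      (ℕₚ.+-mono-≤ (bound (W-+ (h x) (W-const 3 {8}))) le)
    where
    rearrange : ∀ a b → a + (5 + (b + 3)) ≡ (a + 8) + b
    rearrange = semiring 2 (λ a b → a :+ (con 5 :+ (b :+ con 3)) := (a :+ con 8) :+ b) refl

  palette-W : ∀ {d} → W 6 (costᴱ (palette {d} (allFin k)))
  palette-W {d} = W-up 6 (foldr-W (allFin k) (palette {d}) short-colours (W-const 4 {3})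
    λ x ys c le → ℕₚ.≤-trans (ℕₚ.≤-reflexive (rearrange (costᴱ (palette {d} ys))))
      (ℕₚ.+-mono-≤ (bound (W-const 4 {13})) le))
    where
    rearrange : ∀ b → 5 + (5 + (b + 3)) ≡ 13 + b
    rearrange = semiring 1 (λ b → con 5 :+ (con 5 :+ (b :+ con 3)) := con 13 :+ b) refl

  decide-W : ∀ {m l d} (t : Fin k → Exp bool d) (e : Subset k → Exp rational d) →
    (∀ i → W m (costᴱ (t i))) → (∀ D → W l (costᴱ (e D))) → W (1 + (l + (m + 3 + 1) + 1)) (costᴱ (decide k t e))
  decide-W {m} {l} t e ht he = W-down (ℕₚ.≤-trans (ℕₚ.m≤m+n _ Tb) (go k t e ht he))
      (W-* (W-down (ℕₚ.^-monoʳ-≤ 2 (ℕₚ.n≤1+n k)) W-2^) (W-+ {l} {m + 3 + 1} W-refl W-refl))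
    where
    B Tb : ℕ
    B = N ^ (l * u)
    Tb = N ^ ((m + 3 + 1) * u)
    shuffle : ∀ a b c t → a + (5 + (b + c)) + t ≡ (b + (a + 5)) + (c + t)
    shuffle = semiring 4 (λ a b c t → a :+ (con 5 :+ (b :+ c)) :+ t := (b :+ (a :+ con 5)) :+ (c :+ t)) refl
    -- The spare summand `Tb` closes the induction: at each node the one from the first subtree pays
    -- for the test, the one from the second is passed on.
    go : ∀ j {d} (t : Fin j → Exp bool d) (e : Subset j → Exp rational d) →
      (∀ i → W m (costᴱ (t i))) → (∀ D → W l (costᴱ (e D))) → costᴱ (decide j t e) + Tb ≤ 2 ^ j * (B + Tb)
    go zero    t e ht he = ℕₚ.≤-trans (ℕₚ.+-monoˡ-≤ Tb (bound (he []))) (ℕₚ.m≤m+n _ 0)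
    go (suc j) t e ht he = ℕₚ.≤-trans (ℕₚ.≤-reflexive (shuffle (costᴱ (t zero)) c₁ c₂ Tb))
        (ℕₚ.≤-trans (ℕₚ.+-mono-≤
            (ℕₚ.≤-trans (ℕₚ.+-monoʳ-≤ c₁ (bound (W-+ (ht zero) (W-const 3)))) (go j (t ∘ suc) _ (ht ∘ suc) (λ D → he _)))
            (go j (t ∘ suc) _ (ht ∘ suc) (λ D → he _)))
          (ℕₚ.≤-reflexive (trans (cong (2 ^ j * (B + Tb) +_) (sym (ℕₚ.+-identityʳ _)))
            (sym (ℕₚ.*-assoc 2 (2 ^ j) (B + Tb))))))
      where
      c₁ c₂ : ℕ
      c₁ = costᴱ (decide j (t ∘ suc) (e ∘ (true ∷_)))
      c₂ = costᴱ (decide j (t ∘ suc) (e ∘ (false ∷_)))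

  -- Each of the `3k` nested maxima multiplies the cost by at most `N ^ 7`, because
  -- `13 + 24 n ≤ 37 N ≤ 64 N`. The total exponent `21 k` is within 21 units.
  bigs-W : ∀ {m d} (e : Exp rational (k * 3 + d)) → W m (costᴱ e) → W (21 + m) (costᴱ (bigs (k * 3) e))
  bigs-W e h = W-down (go (k * 3) e) (W-* (w (ℕₚ.^-monoʳ-≤ N small)) h)
    where
    small : 7 * (k * 3) ≤ 21 * u
    small = ℕₚ.≤-trans (ℕₚ.≤-reflexive (trans (cong (7 *_) (ℕₚ.*-comm k 3)) (sym (ℕₚ.*-assoc 7 3 k))))
      (ℕₚ.*-monoʳ-≤ 21 (ℕₚ.n≤1+n k))
    N^7 : 13 + 24 * n ≤ N ^ 7
    N^7 = ℕₚ.≤-trans (ℕₚ.+-mono-≤ (ℕₚ.m≤m*n 13 N) (ℕₚ.*-monoʳ-≤ 24 (ℕₚ.m≤n⊔m 2 n)))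
      (ℕₚ.≤-trans (ℕₚ.≤-reflexive (sym (ℕₚ.*-distribʳ-+ N 13 24)))
        (ℕₚ.≤-trans (ℕₚ.*-monoˡ-≤ N (ℕₚ.≤-trans (ℕₚ.≤ᵇ⇒≤ 37 (2 ^ 6) tt) (ℕₚ.^-monoˡ-≤ 6 2≤N)))
          (ℕₚ.≤-reflexive (ℕₚ.*-comm (N ^ 6) N))))
    expand : ∀ n c → 3 + (10 + n * (13 + (c + 10))) ≡ (13 + 23 * n) + n * c
    expand = semiring 2 (λ n c → con 3 :+ (con 10 :+ n :* (con 13 :+ (c :+ con 10))) :=
      (con 13 :+ con 23 :* n) :+ n :* c) refl
    collect : ∀ n c → (13 + 23 * n) * c + n * c ≡ (13 + 24 * n) * c
    collect = semiring 2 (λ n c → (con 13 :+ con 23 :* n) :* c :+ n :* c := (con 13 :+ con 24 :* n) :* c) refl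
    factor : ∀ c → 1 ≤ c → 3 + (10 + n * (13 + (c + 10))) ≤ N ^ 7 * c
    factor c 1≤c = ℕₚ.≤-trans (ℕₚ.≤-reflexive (expand n c)) (ℕₚ.≤-trans
        (ℕₚ.+-monoˡ-≤ (n * c) (ℕₚ.m≤m*n (13 + 23 * n) c {{>-nonZero 1≤c}}))
        (ℕₚ.≤-trans (ℕₚ.≤-reflexive (collect n c)) (ℕₚ.*-monoˡ-≤ c N^7)))
    go : ∀ j {d} (e : Exp rational (j + d)) → costᴱ (bigs j e) ≤ N ^ (7 * j) * costᴱ e
    go zero    e = ℕₚ.≤-reflexive (sym (ℕₚ.+-identityʳ _))
    go (suc j) e = ℕₚ.≤-trans (go j (big max e)) (ℕₚ.≤-trans (ℕₚ.*-monoʳ-≤ (N ^ (7 * j)) (factor (costᴱ e) (cost≥1 e)))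
      (ℕₚ.≤-reflexive (trans (sym (ℕₚ.*-assoc (N ^ (7 * j)) (N ^ 7) (costᴱ e))) (cong (_* costᴱ e)
        (trans (sym (ℕₚ.^-distribˡ-+-* N (7 * j) 7)) (cong (N ^_) (trans (ℕₚ.+-comm (7 * j) 7) (sym (ℕₚ.*-suc 7 j)))))))))

  assign-W : ∀ {m d} f {e : Ix f → Exp (ty f) (suc d)} → (∀ i → W m (costᴱ (e i))) →
    W (m + 32) (costᶜ (assign {d} f e))
  assign-W {m} f h = W-≤ (ℕₚ.≤-reflexive (shape m)) (W-+
    (total-W (enum f) _ (short-enum f) λ i →
      W-+ (W-const 4 {10}) (W-* W-n (W-+ (W-const 4 {13}) (W-+ (h i) (W-const 3 {5})))))
    (total-W (enum f) _ (short-enum f) λ i → W-+ (W-const 4 {10}) (W-* W-n (W-+ (W-const 4 {13}) (W-const 3 {6})))))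
    where
    shape : ∀ m → 1 + (4 + (1 + (4 + (m + 3 + 1) + 1)) + 1) + (1 + (4 + (1 + (4 + 3 + 1)) + 1)) + 1 ≡ m + 32
    shape = semiring 1 (λ m → con 1 :+ (con 4 :+ (con 1 :+ (con 4 :+ (m :+ con 3 :+ con 1) :+ con 1)) :+ con 1)
      :+ con 15 :+ con 1 := m :+ con 32) refl

  for-W : ∀ {m d} {c : Cmd (suc d)} → W m (costᶜ c) → W (4 + (1 + (4 + m + 1)) + 1) (costᶜ (for c))
  for-W h = W-+ (W-const 4 {10}) (W-* W-n (W-+ (W-const 4 {13}) h))

  record E {τ d} (m : ℕ) (e : Exp τ d) : Set where
    constructor ⟨_⟩
    field cost : W m (costᴱ e)
  open E

  record C {d} (m : ℕ) (c : Cmd d) : Set where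
    constructor ⟨_⟩
    field cost : W m (costᶜ c)
  open C

  E-up : ∀ {m τ d} {e : Exp τ d} l → {IsTrue (m ≤ᵇ l)} → E m e → E l e
  E-up l {p} ⟨ h ⟩ = ⟨ W-up l {p} h ⟩

  syn : ∀ {τ d} {e : Exp τ d} → E (wE e) e
  syn {e = e} = ⟨ struct e ⟩

  ifᴱ : ∀ {m l q τ d b} {x y : Exp τ d} → E m b → E l x → E q y → E (m + (3 + (l + q + 1) + 1) + 1) (ifᵉ b x y)
  ifᴱ ⟨ h ⟩ ⟨ h′ ⟩ ⟨ h″ ⟩ = ⟨ if-W h h′ h″ ⟩

  bigᴱ : ∀ {m τ d o} {e : Exp τ (suc d)} → E m e → E (2 + (4 + (1 + (4 + (m + 4 + 1) + 1)) + 1) + 1) (big o e)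
  bigᴱ ⟨ h ⟩ = ⟨ big-W h ⟩

  allᴱ : ∀ {m l d} {b c : Exp bool d} → E m b → E l c → E (m + (3 + (l + 2 + 1) + 1) + 1) (b ∧ᵉ c)
  allᴱ h h′ = ifᴱ h h′ syn

  notᴱ : ∀ {m d} {b : Exp bool d} → E m b → E (m + 9 + 1) (notᵉ b)
  notᴱ h = ifᴱ h syn syn

  pickᴱ : ∀ {m τ d} b {x y : Exp τ d} → E m x → E m y → E m (if b then x else y)
  pickᴱ true  hx hy = hx
  pickᴱ false hx hy = hy

  assignᶜ : ∀ {m d f} {e : Ix f → Exp (ty f) (suc d)} → (∀ i → E m (e i)) → C (m + 32) (assign {d} f e)
  assignᶜ {f = f} {e} h = ⟨ assign-W f {e} (λ i → cost (h i)) ⟩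

  forᶜ : ∀ {m d} {c : Cmd (suc d)} → C m c → C (4 + (1 + (4 + m + 1)) + 1) (for c)
  forᶜ {c = c} ⟨ h ⟩ = ⟨ for-W {c = c} h ⟩

  infixr 4 _▸ᶜ_
  _▸ᶜ_ : ∀ {m l d} {c c′ : Cmd d} → C m c → C l c′ → C (m + l + 1) (c ▸ c′)
  ⟨ h ⟩ ▸ᶜ ⟨ h′ ⟩ = ⟨ W-+ h h′ ⟩

  C-up : ∀ {m d} {c : Cmd d} l → {IsTrue (m ≤ᵇ l)} → C m c → C l c
  C-up l {p} ⟨ h ⟩ = ⟨ W-up l {p} h ⟩

  eachᶜ : ∀ {A : Set} {m d} {xs : List A} {c : A → Cmd d} → Short xs → (∀ x → C m (c x)) → C (1 + m) (each xs c)
  eachᶜ {xs = xs} {c} short h = ⟨ each-W xs c short (λ x → C.cost (h x)) ⟩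

  maximaᴱ : ∀ {A : Set} {m d} {xs : List A} {e : A → Exp rational d} → Short xs → (∀ x → E m (e x)) →
    E (1 + (m + 4 + 1)) (maxima xs e)
  maximaᴱ {xs = xs} {e} short h = ⟨ maxima-W xs e short (λ x → cost (h x)) ⟩

  allOfᴱ : ∀ {A : Set} {m d} {xs : List A} {e : A → Exp bool d} → Short xs → (∀ x → E m (e x)) →
    E (1 + (m + 3 + 1)) (allOf xs e)
  allOfᴱ {xs = xs} {e} short h = ⟨ allOf-W xs e short (λ x → cost (h x)) ⟩

  decideᴱ : ∀ {m l d} {t : Fin k → Exp bool d} {e : Subset k → Exp rational d} →
    (∀ i → E m (t i)) → (∀ D → E l (e D)) → E (1 + (l + (m + 3 + 1) + 1)) (decide k t e)
  decideᴱ {t = t} {e} ht he = ⟨ decide-W t e (λ i → cost (ht i)) (λ D → cost (he D)) ⟩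

  bigsᴱ : ∀ {m d} {e : Exp rational (k * 3 + d)} → E m e → E (21 + m) (bigs (k * 3) e)
  bigsᴱ {e = e} ⟨ h ⟩ = ⟨ bigs-W e h ⟩

  -- The numerals from here on are exponents rounded up generously; `E-up` and `C-up` verify them by
  -- computation.
  freeᴱ : ∀ {d e} (lift : Fin (k * 3 + d) → Fin e) (x : Fin e) i → E 60 (free {d} e lift x i)
  freeᴱ {d} {e} lift x i = E-up 60 syn

  validᴱ : ∀ {d} → E 250 (valid {d})
  validᴱ {d} = E-up 250 (allOfᴱ {xs = allFin k} short-colours (λ i → notᴱ (bigᴱ (allᴱ syn (allᴱ (freeᴱ {d} suc #0 i)
    (bigᴱ (allᴱ syn (allᴱ (freeᴱ {d} (λ y → suc (suc y)) #0 i) syn))))))))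

  triplesᴱ : ∀ {d} K → E 500 (triples {d} K)
  triplesᴱ {d} K = E-up 500 (bigsᴱ (ifᴱ (validᴱ {d}) (bigᴱ (ifᴱ syn (decideᴱ (freeᴱ {d} suc #0) (λ B → syn)) syn)) syn))

  findModuleᶜ : ∀ {d} → C 700 (findModule {d})
  findModuleᶜ = C-up 700 (assignᶜ (λ _ → syn) ▸ᶜ forᶜ (forᶜ
    ((assignᶜ (λ _ → syn) ▸ᶜ forᶜ (assignᶜ (λ _ → syn))) ▸ᶜ assignᶜ (λ _ → syn))))

  solveFromᶜ : ∀ {d} K Z → C 2000 (solveFrom {d} K Z)
  solveFromᶜ K Z = C-up 2000 (assignᶜ (λ _ → syn) ▸ᶜ assignᶜ (λ _ → syn) ▸ᶜ assignᶜ (λ _ → syn) ▸ᶜ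
    forᶜ (forᶜ (assignᶜ (λ _ → syn) ▸ᶜ
      assignᶜ (λ D → ifᴱ syn (maximaᴱ {xs = subsets k} short-subsets (λ F → syn)) syn) ▸ᶜ
      assignᶜ (λ _ → syn))) ▸ᶜ
    assignᶜ (λ D → pickᴱ (does (D ≟ˢ K)) (E-up 500 syn) (E-up 500 syn)))

  solveᶜ : ∀ {d} → C 3000 (solve {d})
  solveᶜ = C-up 3000 (assignᶜ (λ K → ifᴱ syn (triplesᴱ K) syn) ▸ᶜ
    eachᶜ short-subsets λ K → eachᶜ short-subsets λ Z → forᶜ (solveFromᶜ K (Z ∩ K)))

  optimiseᶜ : ∀ {d} → C 5000 (optimise {d})
  optimiseᶜ = C-up 5000
    (assignᶜ (λ D → maximaᴱ short-colours λ i → pickᴱ (does (i ∈? D)) (E-up 50 syn) (E-up 50 syn)) ▸ᶜ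
     assignᶜ (λ _ → syn) ▸ᶜ
     forᶜ (findModuleᶜ ▸ᶜ solveᶜ ▸ᶜ assignᶜ (λ _ → syn) ▸ᶜ assignᶜ (λ _ → syn)))

  tryBanᶜ : ∀ {d} i → C 8000 (tryBan {d} i)
  tryBanᶜ i = C-up 8000
    (assignᶜ (λ j → pickᴱ (does (j Fₚ.≟ i)) (E-up 100 syn) (E-up 100 syn)) ▸ᶜ
     optimiseᶜ ▸ᶜ
     assignᶜ (λ j → pickᴱ (does (j Fₚ.≟ i)) (E-up 200 syn) (E-up 200 syn)))

  mainᶜ : C 15000 main
  mainᶜ = C-up 15000 (optimiseᶜ ▸ᶜ assignᶜ (λ _ → syn) ▸ᶜ forᶜ (eachᶜ short-colours tryBanᶜ) ▸ᶜ
    assignᶜ (λ _ → ⟨ palette-W ⟩))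

-- The compiled program meets the specification

module RunProgram {n k : ℕ} (G : Graph (Fin n)) (rev : Revenue n k) where

  open Algo k
  open Language signature k
  open Semantics G rev
  open RunCost G rev

  start : Store
  start f _ _ = initial (ty f)
    where
    initial : ∀ τ → ⟦ τ ⟧ᵀ
    initial bool     = false
    initial num      = 0
    initial rational = 0ℚ

  start-models : Models [] start blank
  start-models = record { vars = λ () ; holds = λ f i v → blank-holds f i v }
    where
    blank-holds : ∀ f i v → Holds (ty f) blank (user f i) (toℕ v) (start f i v)
    blank-holds alive i v = refl
    blank-holds inM   i v = refl
    blank-holds clo   i v = refl
    blank-holds vis   i v = refl
    blank-holds ban   i v = refl
    blank-holds out   i v = refl
    blank-holds wt    i v = refl
    blank-holds wt′   i v = refl
    blank-holds gain  i v = refl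
    blank-holds acc   i v = refl
    blank-holds best  i v = refl

  copy-out : ∀ s {σ} → Models [] s σ →
    Runs (loopᵖ 0 (0 ⟦ var {1} zero ⟧≔ user out tt ⟦ var {1} zero ⟧)) σ (10 + n * (13 + 6))
      (λ τ → ∀ v → nat τ 0 (toℕ v) ≡ s out tt v)
  copy-out s M = runs-mono ℕₚ.≤-refl (λ (_ , copied) v → copied v (toℕ<n v))
    (runs-loop 0 _ 6 Copied (λ x (src , dst) → src , dst) step (Models.holds M out tt , λ v ()))
    where
    Copied : ℕ → Memory → Set
    Copied m σ = (∀ v → nat σ (user out tt) (toℕ v) ≡ s out tt v) ×
                 (∀ v → toℕ v < m → nat σ 0 (toℕ v) ≡ s out tt v)
    step : ∀ v {σ} → Copied (toℕ v) σ → nat σ 1 0 ≡ toℕ v →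
      Runs (0 ⟦ var {1} zero ⟧≔ user out tt ⟦ var {1} zero ⟧) σ 6
        (λ τ → nat τ 1 0 ≡ toℕ v × Copied (suc (toℕ v)) τ)
    step v {σ} (src , dst) at = runs-mono ℕₚ.≤-refl
        (λ {τ} S → Stored.other S num 1 0 _ (inj₁ λ ()) at ,
          (λ u → Stored.other S num _ _ _ (inj₁ λ ()) (src u)) ,
          λ u l → written S u (ℕₚ.m<1+n⇒m<n∨m≡n l))
        (store-ok num (var {1} zero) (var {1} zero) at (trans (cong (nat σ (user out tt)) at) (src v)))
      where
      written : ∀ {τ} → Stored num 0 (toℕ v) (s out tt v) σ τ → ∀ u → toℕ u < toℕ v ⊎ toℕ u ≡ toℕ v →
        nat τ 0 (toℕ u) ≡ s out tt u
      written S u (inj₁ l) = Stored.other S num _ _ _ (inj₂ (ℕₚ.<⇒≢ l)) (dst u l)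
      written {τ} S u (inj₂ e) = subst (λ w → nat τ 0 (toℕ w) ≡ s out tt w) (sym (toℕ-injective e)) (Stored.new S)

  program-ok : Runs program blank (costᶜ main + (10 + n * (13 + 6)))
    (λ τ → ∀ v → nat τ 0 (toℕ v) ≡ exec main [] start out tt v)
  program-ok = runs-seq (compile-ok main start-models) (copy-out (exec main [] start))

  program-cost : W 15050 (costᶜ main + (10 + n * (13 + 6)))
  program-cost = W-up 15050 (W-+ (C.cost mainᶜ) (W-+ (W-const 4 {10}) (W-* W-n (W-const 5 {19}))))

  -- 15050 counts units of `suc k`, and `suc k ≤ 2 * k` for `k ≥ 1`; this is the origin of 30100.
  within : ∀ ω → 1 ≤ k → costᶜ main + (10 + n * (13 + 6)) ≤ timeBound 30100 k n ω
  within ω 1≤k = ℕₚ.≤-trans (W.bound program-cost) (ℕₚ.^-monoʳ-≤ N (ℕₚ.≤-trans (ℕₚ.*-monoʳ-≤ 15050 u≤2k)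
    (ℕₚ.≤-trans (ℕₚ.≤-reflexive (sym (ℕₚ.*-assoc 15050 2 k)))
      (ℕₚ.*-monoʳ-≤ 30100 (ℕₚ.≤-trans (ℕₚ.≤-reflexive (sym (ℕₚ.*-identityʳ k))) (ℕₚ.*-monoʳ-≤ k (ℕₚ.m≤m⊔n 1 ω)))))))
    where
    u≤2k : suc k ≤ 2 * k
    u≤2k = ℕₚ.+-mono-≤ 1≤k (ℕₚ.≤-reflexive (sym (ℕₚ.+-identityʳ k)))

  solves : ∀ ω → 1 ≤ k → ¬ (bull ≅InducedSubgraphOf G) → ¬ (chair ≅InducedSubgraphOf G) →
    (∀ v i → 0ℚ ≤ℚ rev v i) → SolvesWithin program G rev (timeBound 30100 k n ω)
  solves ω 1≤k ¬bull ¬chair nonneg = finish program-ok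
      (RunReduce.main-correct G rev (bull-chair-free G ¬bull ¬chair) nonneg start (λ _ _ → refl))
    where
    finish : Runs program blank _ (λ τ → ∀ v → nat τ 0 (toℕ v) ≡ exec main [] start out tt v) →
      ∃[ c ] ((∀ v (p : v ∈ X c) → exec main [] start out tt v ≡ suc (toℕ (color c (v , p)))) ×
        (∀ v → v ∉ X c → exec main [] start out tt v ≡ 0) × IsOptimal rev c) →
      SolvesWithin program G rev (timeBound 30100 k n ω)
    finish (runs l h q) (c , coloured , uncoloured , optimal) =
      _ , _ , h , ℕₚ.≤-trans l (within ω 1≤k) , c ,
      ((λ v p → trans (q v) (coloured v p)) , λ v p → trans (q v) (uncoloured v p)) , optimal

theorem1p1 : ∃[ a ] ((k : ℕ) → 1 ≤ k →
    ∃[ P ] ((n : ℕ) (G : Graph (Fin n)) (ω : ℕ) →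
    ¬ (bull ≅InducedSubgraphOf G) →
    ¬ (chair ≅InducedSubgraphOf G) →
    IsCliqueNumber G ω →
    (rev : Revenue n k) →
    (∀ v i → 0ℚ ≤ℚ rev v i) →
    SolvesWithin P G rev (timeBound a k n ω)))
theorem1p1 = 30100 , λ k 1≤k → Algo.program k , λ n G ω ¬bull ¬chair _ rev nonneg →
  RunProgram.solves G rev ω 1≤k ¬bull ¬chair nonneg
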